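{- Let $q\ge5$ be a prime power with $q\not\equiv0\pmod3$. If $q\equiv1\pmod3$: $\Lambda_{\mathrm{E}\Gamma,3_{\mathcal C}}=q-4$, $\Lambda_{\mathrm{E}\Gamma,\overline{1_{\mathcal C}}}=q$, $\Lambda_{\mathrm{E}\Gamma,0_{\mathcal C}}=q-1$; $\Pi_{3_{\mathcal C},\mathrm{E}\Gamma}=(q-4)/6$, $\Pi_{\overline{1_{\mathcal C}},\mathrm{E}\Gamma}=q/2$, $\Pi_{0_{\mathcal C},\mathrm{E}\Gamma}=(q-1)/3$; $\Lambda_{\mathrm{En}\Gamma,3_{\mathcal C}}=q^2-3q+4$, $\Lambda_{\mathrm{En}\Gamma,\overline{1_{\mathcal C}}}=q^2-q-2$, $\Lambda_{\mathrm{En}\Gamma,0_{\mathcal C}}=q^2+1$; $\Pi_{3_{\mathcal C},\mathrm{En}\Gamma}=\frac{q^2-3q+4}{6(q-1)}$, $\Pi_{\overline{1_{\mathcal C}},\mathrm{En}\Gamma}=\frac{q^2-q-2}{2(q-1)}$, $\Pi_{0_{\mathcal C},\mathrm{En}\Gamma}=\frac{q^2+1}{3(q-1)}$. If $q\equiv-1\pmod3$: $\Lambda_{\mathrm{E}\Gamma,3_{\mathcal C}}=\Lambda_{\mathrm{E}\Gamma,\overline{1_{\mathcal C}}}=q-2$, $\Lambda_{\mathrm{E}\Gamma,0_{\mathcal C}}=q+1$; $\Pi_{3_{\mathcal C},\mathrm{E}\Gamma}=(q-2)/6$, $\Pi_{\overline{1_{\mathcal C}},\mathrm{E}\Gamma}=(q-2)/2$,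 $\Pi_{0_{\mathcal C},\mathrm{E}\Gamma}=(q+1)/3$; $\Lambda_{\mathrm{En}\Gamma,3_{\mathcal C}}=(q-1)(q-2)$, $\Lambda_{\mathrm{En}\Gamma,\overline{1_{\mathcal C}}}=q^2-q$, $\Lambda_{\mathrm{En}\Gamma,0_{\mathcal C}}=q^2-1$; $\Pi_{3_{\mathcal C},\mathrm{En}\Gamma}=(q-2)/6$, $\Pi_{\overline{1_{\mathcal C}},\mathrm{En}\Gamma}=q/2$, $\Pi_{0_{\mathcal C},\mathrm{En}\Gamma}=(q+1)/3$.
   Context: Let $\mathrm{PG}(3,q)$ have points $\mathbf{P}(x_0,x_1,x_2,x_3)$; put $P(t)=\mathbf{P}(t^3,t^2,t,1)$ ($t\in\mathbb{F}_q$), $P(\infty)=\mathbf{P}(1,0,0,0)$, $\mathcal{C}=\{P(t):t\in\mathbb{F}_q\cup\{\infty\}\}$ the twisted cubic, $G_q$ the group of projectivities fixing $\mathcal C$. Write $\boldsymbol{\pi}(c_0,c_1,c_2,c_3)$ for the plane $c_0x_0+c_1x_1+c_2x_2+c_3x_3=0$. $\Gamma$-planes: the osculating planes $\boldsymbol{\pi}(1,-3t,3t^2,-t^3)$ ($t\in\mathbb{F}_q$) and $\boldsymbol{\pi}(0,0,0,1)$. A $d_{\mathcal C}$-plane ($d\in\{0,3\}$) contains exactly $d$ points of $\mathcal C$; a $\overline{1_{\mathcal C}}$-plane is a non-$\Gamma$-plane containing exactly one point of $\mathcal C$ (each type is a $G_q$-orbit for $q\ge5$). An external line contains no point of $\mathcal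 C$. A real axis is the intersection of two distinct $\Gamma$-planes; an imaginary axis is the line of $\mathrm{PG}(3,q)$ which is the intersection of $\boldsymbol{\pi}(1,-3s,3s^2,-s^3)$ and $\boldsymbol{\pi}(1,-3s^q,3s^{2q},-s^{3q})$, $s\in\mathbb{F}_{q^2}\setminus\mathbb{F}_q$; an imaginary chord is the line joining $P(s),P(s^q)$, $s\in\mathbb{F}_{q^2}\setminus\mathbb{F}_q$. An E$\Gamma$-line is an external line lying in a $\Gamma$-plane which is not a real axis; an En$\Gamma$-line is an external line lying in no $\Gamma$-plane which is neither an imaginary chord nor an imaginary axis. Notation: $\Lambda_{\lambda,\pi}$ is the number of $\lambda$-lines in a $\pi$-plane; $\Pi_{\pi,\lambda}$ is the average, over all $\lambda$-lines, of the number of $\pi$-planes through the line. -}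

module Defs where

open import Level using (0ℓ)
open import Data.Nat as ℕ using (ℕ; zero; suc)
open import Data.Fin as Fin using (Fin)
open import Data.Maybe using (Maybe; just; nothing)
open import Data.Vec using (Vec; []; _∷_; lookup; map)
open import Data.List as List using (List; []; _∷_; length)
open import Data.Nat.ListAction using (sum)
open import Data.List.Membership.Propositional using (_∈_)
open import Data.List.Relation.Unary.Unique.Propositional using (Unique)
open import Data.List.Relation.Binary.Pointwise using (Pointwise)
open import Data.Product using (Σ; ∃; ∃-syntax; _×_; _,_)
open import Data.Integer using (+_)
open import Data.Rational as ℚ using (ℚ; 0ℚ; _/_)
open import Relation.Nullary using (¬_)
open import Relation.Binary.PropositionalEquality using (_≡_; _≢_)
open import Relation.Binary.Definitions using (DecidableEquality)
open import Algebra.Structures using (IsCommutativeRing)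

record Field : Set₁ where
  infixl 6 _+_
  infixl 7 _*_
  infix  8 -_
  field
    Carrier           : Set
    _+_ _*_           : Carrier → Carrier → Carrier
    -_                : Carrier → Carrier
    0# 1#             : Carrier
    isCommutativeRing : IsCommutativeRing _≡_ _+_ _*_ -_ 0# 1#
    0≢1               : 0# ≢ 1#
    inverse           : ∀ x → x ≢ 0# → ∃[ y ] (x * y ≡ 1#)
    _≟_               : DecidableEquality Carrier
    elements          : List Carrier
    elements-unique   : Unique elements
    elements-complete : ∀ x → x ∈ elements

  size : ℕ
  size = length elements

  pow : Carrier → ℕ → Carrier
  pow x zero    = 1#
  pow x (suc n) = x * pow x n

  three : Carrier
  three = 1# + 1# + 1#

  Vec4 : Set
  Vec4 = Vec Carrier 4

  dot : Vec4 → Vec4 → Carrier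
  dot (a ∷ b ∷ c ∷ d ∷ []) (x ∷ y ∷ z ∷ w ∷ []) = a * x + b * y + c * z + d * w

  scale : Carrier → Vec4 → Vec4
  scale k v = map (λ x → k * x) v

  add : Vec4 → Vec4 → Vec4
  add (a ∷ b ∷ c ∷ d ∷ []) (x ∷ y ∷ z ∷ w ∷ []) = (a + x) ∷ (b + y) ∷ (c + z) ∷ (d + w) ∷ []

  -- P(t) = (t^3, t^2, t, 1), P(∞) = (1,0,0,0)   (nothing = ∞)
  curvePt : Maybe Carrier → Vec4
  curvePt (just t) = pow t 3 ∷ pow t 2 ∷ t ∷ 1# ∷ []
  curvePt nothing  = 1# ∷ 0# ∷ 0# ∷ 0# ∷ []

  -- osculating plane at P(t): π(1, -3t, 3t^2, -t^3);  at P(∞): π(0,0,0,1)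
  osc : Maybe Carrier → Vec4
  osc (just t) = 1# ∷ - (three * t) ∷ three * pow t 2 ∷ - pow t 3 ∷ []
  osc nothing  = 0# ∷ 0# ∷ 0# ∷ 1# ∷ []

record Embedding (F K : Field) : Set where
  private
    module F = Field F
    module K = Field K
  field
    ι     : F.Carrier → K.Carrier
    ι-+   : ∀ x y → ι (x F.+ y) ≡ ι x K.+ ι y
    ι-*   : ∀ x y → ι (x F.* y) ≡ ι x K.* ι y
    ι-1   : ι F.1# ≡ K.1#

Enumerates : {A : Set} → (A → Set) → List A → Set
Enumerates P xs = Unique xs × (∀ x → x ∈ xs → P x) × (∀ x → P x → x ∈ xs)

Card : {A : Set} → (A → Set) → ℕ → Set
Card {A} P n = Σ (List A) λ xs → Enumerates P xs × length xs ≡ n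

average : List ℕ → ℚ
average []       = 0ℚ
average (x ∷ xs) = (+ sum (x ∷ xs)) / suc (length xs)

-- the rational n / d (with the convention n / 0 = 0, never used)
frac : ℕ → ℕ → ℚ
frac n zero    = 0ℚ
frac n (suc d) = (+ n) / suc d

data PlaneType : Set where
  threeC oneBarC zeroC : PlaneType

data LineType : Set where
  EΓ EnΓ : LineType

-- Geometry of PG(3,q), q = |F|; K plays the role of F_{q^2} (|K| = q^2
-- is assumed in the statement), with embedding e : F → K.

module PG3 (F K : Field) (e : Embedding F K) where
  open Field F
  module K = Field K
  open Embedding e

  q : ℕ
  q = size

  -- normalized homogeneous coordinates: first nonzero entry is 1.
  -- Points and planes of PG(3,q) are exactly the normalized nonzero
  -- vectors of F^4.
  Normalized : Vec4 → Set
  Normalized v = ∃[ i ] ((∀ (k : Fin 4) → k Fin.< i → lookup v k ≡ 0#) × lookup v i ≡ 1#)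

  Proportional : Vec4 → Vec4 → Set
  Proportional u v = ∃[ k ] (k ≢ 0# × u ≡ scale k v)

  -- Lines of PG(3,q): 2-dimensional subspaces of F^4, represented
  -- canonically by their basis in reduced row echelon form.
  Line : Set
  Line = Vec4 × Vec4

  IsLine : Line → Set
  IsLine (r₁ , r₂) = Σ (Fin 4) λ i → Σ (Fin 4) λ j →
      i Fin.< j
    × (∀ (k : Fin 4) → k Fin.< i → lookup r₁ k ≡ 0#)
    × lookup r₁ i ≡ 1#
    × lookup r₁ j ≡ 0#
    × (∀ (k : Fin 4) → k Fin.< j → lookup r₂ k ≡ 0#)
    × lookup r₂ j ≡ 1#

  OnLine : Vec4 → Line → Set
  OnLine v (r₁ , r₂) = ∃[ a ] ∃[ b ] (v ≡ add (scale a r₁) (scale b r₂))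

  Contains : Vec4 → Line → Set
  Contains c (r₁ , r₂) = dot c r₁ ≡ 0# × dot c r₂ ≡ 0#

  GammaPlane : Vec4 → Set
  GammaPlane c = ∃[ t ] Proportional c (osc t)

  CurvePointsIn : Vec4 → ℕ → Set
  CurvePointsIn c n = Card (λ (t : Maybe Carrier) → dot c (curvePt t) ≡ 0#) n

  HasPlaneType : PlaneType → Vec4 → Set
  HasPlaneType threeC  c = CurvePointsIn c 3
  HasPlaneType zeroC   c = CurvePointsIn c 0
  HasPlaneType oneBarC c = ¬ GammaPlane c × CurvePointsIn c 1

  External : Line → Set
  External L = ∀ t → ¬ OnLine (curvePt t) L

  RealAxis : Line → Set
  RealAxis L = ∃[ s ] ∃[ t ] (s ≢ t × Contains (osc s) L × Contains (osc t) L)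

  InGammaPlane : Line → Set
  InGammaPlane L = ∃[ t ] Contains (osc t) L

  NotInF : K.Carrier → Set
  NotInF s = ∀ a → ι a ≢ s

  frob : K.Carrier → K.Carrier
  frob s = K.pow s q

  ιv : Vec4 → K.Vec4
  ιv = map ι

  OnLineK : K.Vec4 → Line → Set
  OnLineK v (r₁ , r₂) = ∃[ a ] ∃[ b ] (v ≡ K.add (K.scale a (ιv r₁)) (K.scale b (ιv r₂)))

  ContainsK : K.Vec4 → Line → Set
  ContainsK c (r₁ , r₂) = K.dot c (ιv r₁) ≡ K.0# × K.dot c (ιv r₂) ≡ K.0#

  ImaginaryChord : Line → Set
  ImaginaryChord L = ∃[ s ] (NotInF s × OnLineK (K.curvePt (just s)) L
                                      × OnLineK (K.curvePt (just (frob s))) L)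

  ImaginaryAxis : Line → Set
  ImaginaryAxis L = ∃[ s ] (NotInF s × ContainsK (K.osc (just s)) L
                                     × ContainsK (K.osc (just (frob s))) L)

  HasLineType : LineType → Line → Set
  HasLineType EΓ  L = External L × InGammaPlane L × ¬ RealAxis L
  HasLineType EnΓ L = External L × ¬ InGammaPlane L
                      × ¬ ImaginaryChord L × ¬ ImaginaryAxis L

  LambdaIs : LineType → PlaneType → ℕ → Set
  LambdaIs λt πt n = ∀ c → Normalized c → HasPlaneType πt c →
    Card (λ L → IsLine L × HasLineType λt L × Contains c L) n

  PiIs : PlaneType → LineType → ℚ → Set
  PiIs πt λt v = Σ (List Line) λ ls → Enumerates (λ L → IsLine L × HasLineType λt L) ls
    × Σ (List ℕ) λ ns →
        Pointwise (λ L n → Card (λ c → Normalized c × HasPlaneType πt c × Contains c L) n) ls ns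
      × average ns ≡ v

{-# OPTIONS --safe #-}
module Submission where

-- A plane of PG(3,q) is a binary cubic form, whose zeros on the projective line are the points of the
-- cubic in the plane; the osculating planes are the cubes of linear forms, and a line is a pencil of forms.
-- The number of external lines in a plane depends only on its number d of points of the cubic.
--
-- A plane c which is not osculating and has d ≠ 2 lies on exactly one (real or imaginary) axis.
-- It lies on at most one, since four osculating planes are independent over F_{q²}; that it lies on one
-- follows by comparing the totals over all planes, which avoids the Hessian and the discriminant.
-- On an axis the form of c is a U³ + b V³, and its zeros correspond to the solutions y = V/U of
-- a + b y³ = 0 in a group of order q - 1 (real axis) or q + 1 (imaginary axis); hence d = 1 if 3 is
-- prime to this order, and d is 0 or 3 otherwise. So q modulo 3 and d decide which kind of axis occurs.
-- In the same way an imaginary chord lies in c, and then only one, exactly when c is a 1-bar plane.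
-- Subtracting axes and chords from the external lines gives Λ, and double counting gives Π.

open import Defs
open import Algebra.Bundles using (CommutativeRing; CommutativeMonoid)
import Algebra.Solver.Ring
import Algebra.Solver.Ring.AlmostCommutativeRing as ACR
open import Data.Bool using (true; false; if_then_else_)
open import Data.Empty using (⊥; ⊥-elim)
open import Data.Fin using (Fin; zero; suc)
import Data.Fin as Fin
import Data.Fin.Properties as Finₚ
open import Data.Integer using (ℤ; -[1+_]; 0ℤ; 1ℤ)
import Data.Integer as ℤ
import Data.Integer.Properties as ℤₚ
open import Data.List using (List; []; _∷_; length; filter; map; _++_; cartesianProductWith; cartesianProduct)
open import Data.List.Membership.Propositional using (_∈_; find; lose)
open import Data.List.Membership.Propositional.Properties
  using (∈-filter⁺; ∈-filter⁻; ∈-map⁺; ∈-map⁻; ∈-cartesianProductWith⁺; ∈-cartesianProduct⁺; ∈-cartesianProduct⁻)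
open import Data.List.Membership.Propositional.Properties.WithK using (unique∧set⇒bag)
import Data.List.Properties as Listₚ
open import Data.List.Relation.Binary.BagAndSetEquality using (∼bag⇒↭)
open import Data.List.Relation.Binary.Permutation.Propositional using (↭⇒↭ₛ)
open import Data.List.Relation.Binary.Permutation.Setoid.Properties using (foldr-commMonoid)
open import Data.List.Relation.Binary.Pointwise using (Pointwise; []; _∷_)
import Data.List.Relation.Unary.All as All
open import Data.List.Relation.Unary.AllPairs using ([]; _∷_)
open import Data.List.Relation.Unary.Any using (here; there)
import Data.List.Relation.Unary.Any as Any
open import Data.List.Relation.Unary.Unique.Propositional using (Unique)
import Data.List.Relation.Unary.Unique.Propositional.Properties as Uniqueₚ
open import Data.Maybe using (Maybe; just; nothing)
import Data.Maybe.Properties as Maybeₚ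
open import Data.Nat as ℕ using (ℕ; zero; suc; _+_; _*_; _∸_; _^_; _≤_; _<_; _%_; z≤n; s≤s)
open import Data.Nat.DivMod using (m≡m%n+[m/n]*n; _/_; m%n<n; %-distribˡ-*)
open import Data.Nat.ListAction using (sum)
import Data.Nat.Properties as ℕₚ
open import Data.Nat.Solver using (module +-*-Solver)
open import Data.Product using (Σ; ∃-syntax; _×_; _,_; proj₁; proj₂)
import Data.Rational.Properties as ℚₚ
import Data.Rational.Unnormalised as ℚᵘ
open import Data.Sum as Sum using (_⊎_; inj₁; inj₂)
open import Data.Unit using (⊤; tt)
open import Data.Vec using (Vec; []; _∷_; lookup)
import Data.Vec as Vec
import Data.Vec.Properties as Vecₚ
open import Function using (_∘_; id; _$_; mk⇔)
open import Relation.Binary.Definitions using (DecidableEquality; tri<; tri≈; tri>)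
open import Relation.Binary.PropositionalEquality
  using (_≡_; _≢_; refl; sym; trans; cong; cong₂; subst; subst₂; module ≡-Reasoning)
open import Relation.Nullary using (¬_; Dec; yes; no; does)
open import Relation.Nullary.Decidable using (map′; _×-dec_; _→-dec_; _⊎-dec_; ¬?)
open import Relation.Unary using (Decidable)

-- Finite sums and counting

-- Everything is a comparison of cardinalities: ranks, meets of planes and the additivity of x ↦ x^q
-- all come from counting fibres or roots. The totals of planes are factorial moments of d: up to
-- three points of the cubic impose independent conditions, so the planes with d = 0, the 1-bar
-- planes and the planes with d = 3 make up 1/3, 1/2 and 1/6 of q³ - q, the order of PGL(2, q). On
-- the other side each of the q(q+1)/2 real axes lies in q - 1 planes that are not osculating, and
-- each of the q(q-1)/2 imaginary axes in q + 1. Each product is half of q³ - q, and 1/3 + 1/2 + 1/6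
-- = 1/2 + 1/2; this coincidence makes the bound of one axis per plane sharp. The meet of planes c
-- and x is external when the two forms have no common zero over F, so external lines in c are
-- counted by the forms x that do not vanish at the d zeros of c. For EΓ-lines x runs over the
-- osculating planes only, and a real axis is then met twice. Characteristic 3 must stay out because
-- the middle coefficients of the cube of a linear form carry a factor 3.

∑ : ∀ {A : Set} → List A → (A → ℕ) → ℕ
∑ []       f = 0
∑ (x ∷ xs) f = f x + ∑ xs f

𝟙 : ∀ {P : Set} → Dec P → ℕ
𝟙 d = if does d then 1 else 0

𝟙-yes : ∀ {P : Set} → (d : Dec P) → P → 𝟙 d ≡ 1
𝟙-yes (yes _) _ = refl
𝟙-yes (no ¬p) p = ⊥-elim (¬p p)

𝟙-no : ∀ {P : Set} → (d : Dec P) → ¬ P → 𝟙 d ≡ 0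
𝟙-no (yes p) ¬p = ⊥-elim (¬p p)
𝟙-no (no _)  _  = refl

𝟙-cong : ∀ {P Q : Set} → (d : Dec P) (e : Dec Q) → (P → Q) → (Q → P) → 𝟙 d ≡ 𝟙 e
𝟙-cong (yes p) e f g = sym (𝟙-yes e (f p))
𝟙-cong (no ¬p) e f g = sym (𝟙-no e (¬p ∘ g))

𝟙-× : ∀ {P Q : Set} → (d : Dec P) (e : Dec Q) → 𝟙 (d ×-dec e) ≡ 𝟙 d * 𝟙 e
𝟙-× (yes _) (yes _) = refl
𝟙-× (yes _) (no _)  = refl
𝟙-× (no _)  _       = refl

𝟙-and : ∀ {P Q R : Set} → (r : Dec R) (d : Dec P) (e : Dec Q) → (R → P × Q) → (P → Q → R) → 𝟙 r ≡ 𝟙 d * 𝟙 e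
𝟙-and r d e f g = trans (𝟙-cong r (d ×-dec e) f (λ (p , q) → g p q)) (𝟙-× d e)

𝟙-¬ : ∀ {P : Set} → (d : Dec P) → 𝟙 d + 𝟙 (¬? d) ≡ 1
𝟙-¬ (yes _) = refl
𝟙-¬ (no _)  = refl

𝟙-mono : ∀ {P Q : Set} → (d : Dec P) (e : Dec Q) → (P → Q) → 𝟙 d ≤ 𝟙 e
𝟙-mono (yes p) e f = ℕₚ.≤-reflexive (sym (𝟙-yes e (f p)))
𝟙-mono (no _)  e f = z≤n

𝟙-upper : ∀ {P : Set} → (d : Dec P) {n : ℕ} → (P → n ≤ 1) → (¬ P → n ≡ 0) → n ≤ 𝟙 d
𝟙-upper (yes p) f g = f p
𝟙-upper (no ¬p) f g = ℕₚ.≤-reflexive (g ¬p)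

𝟙-lower : ∀ {P : Set} → (d : Dec P) {n : ℕ} → (P → n ≢ 0) → 𝟙 d ≤ n
𝟙-lower (yes p) f = ℕₚ.n≢0⇒n>0 (f p)
𝟙-lower (no _)  f = z≤n

𝟙*-cong : ∀ {P : Set} → (d : Dec P) {m n : ℕ} → (P → m ≡ n) → 𝟙 d * m ≡ 𝟙 d * n
𝟙*-cong (yes p) f = cong (1 *_) (f p)
𝟙*-cong (no _)  f = refl

𝟙*-zero : ∀ {P : Set} → (d : Dec P) {m : ℕ} → (P → m ≡ 0) → 𝟙 d * m ≡ 0
𝟙*-zero (yes p) f = trans (ℕₚ.*-identityˡ _) (f p)
𝟙*-zero (no _)  f = refl

𝟙-difference : ∀ {P Q : Set} → (d : Dec P) (e : Dec Q) → (P → Q) → 𝟙 (¬? d) * 𝟙 e + 𝟙 d ≡ 𝟙 e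
𝟙-difference (yes p) e f = sym (𝟙-yes e (f p))
𝟙-difference (no _)  e f = trans (ℕₚ.+-identityʳ _) (ℕₚ.*-identityˡ _)

𝟙≢0 : ∀ {P : Set} → (d : Dec P) → 𝟙 d ≢ 0 → P
𝟙≢0 (yes p) _ = p
𝟙≢0 (no _)  h = ⊥-elim (h refl)

𝟙≡1 : ∀ {P : Set} → (d : Dec P) → 𝟙 d ≡ 1 → P
𝟙≡1 d h = 𝟙≢0 d (λ z → ℕₚ.1+n≢0 (trans (sym h) z))

∑-cong : ∀ {A : Set} xs {f g : A → ℕ} → (∀ x → x ∈ xs → f x ≡ g x) → ∑ xs f ≡ ∑ xs g
∑-cong []       h = refl
∑-cong (x ∷ xs) h = cong₂ _+_ (h x (here refl)) (∑-cong xs (λ y m → h y (there m)))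

∑-ext : ∀ {A : Set} xs {f g : A → ℕ} → (∀ x → f x ≡ g x) → ∑ xs f ≡ ∑ xs g
∑-ext xs h = ∑-cong xs (λ x _ → h x)

∑-mono : ∀ {A : Set} xs {f g : A → ℕ} → (∀ x → x ∈ xs → f x ≤ g x) → ∑ xs f ≤ ∑ xs g
∑-mono []       h = z≤n
∑-mono (x ∷ xs) h = ℕₚ.+-mono-≤ (h x (here refl)) (∑-mono xs (λ y m → h y (there m)))

∑-+ : ∀ {A : Set} xs (f g : A → ℕ) → ∑ xs (λ x → f x + g x) ≡ ∑ xs f + ∑ xs g
∑-+ []       f g = refl
∑-+ (x ∷ xs) f g rewrite ∑-+ xs f g = interchange (f x) (g x) (∑ xs f) (∑ xs g)
  where
  open import Algebra.Properties.CommutativeSemigroup ℕₚ.+-commutativeSemigroup using (interchange)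

∑-*ˡ : ∀ {A : Set} xs k (f : A → ℕ) → ∑ xs (λ x → k * f x) ≡ k * ∑ xs f
∑-*ˡ []       k f = sym (ℕₚ.*-zeroʳ k)
∑-*ˡ (x ∷ xs) k f rewrite ∑-*ˡ xs k f = sym (ℕₚ.*-distribˡ-+ k (f x) (∑ xs f))

∑-*ʳ : ∀ {A : Set} xs k (f : A → ℕ) → ∑ xs (λ x → f x * k) ≡ ∑ xs f * k
∑-*ʳ []       k f = refl
∑-*ʳ (x ∷ xs) k f rewrite ∑-*ʳ xs k f = sym (ℕₚ.*-distribʳ-+ k (f x) (∑ xs f))

∑-const : ∀ {A : Set} (xs : List A) k → ∑ xs (λ _ → k) ≡ length xs * k
∑-const []       k = refl
∑-const (x ∷ xs) k = cong (k +_) (∑-const xs k)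

∑-one : ∀ {A : Set} (xs : List A) → ∑ xs (λ _ → 1) ≡ length xs
∑-one xs = trans (∑-const xs 1) (ℕₚ.*-identityʳ (length xs))

∑-zero : ∀ {A : Set} xs {f : A → ℕ} → (∀ x → x ∈ xs → f x ≡ 0) → ∑ xs f ≡ 0
∑-zero xs h = trans (∑-cong xs h) (trans (∑-const xs 0) (ℕₚ.*-zeroʳ (length xs)))

∑-swap : ∀ {A B : Set} (xs : List A) (ys : List B) (f : A → B → ℕ) →
         ∑ xs (λ x → ∑ ys (f x)) ≡ ∑ ys (λ y → ∑ xs (λ x → f x y))
∑-swap []       ys f = sym (∑-zero ys (λ _ _ → refl))
∑-swap (x ∷ xs) ys f rewrite ∑-swap xs ys f = sym (∑-+ ys (f x) (λ y → ∑ xs (λ x → f x y)))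

-- The engine of every comparison of totals: a bound at each `x`, together with the opposite bound
-- for the sums alone, gives exact values at each `x`. Existence statements are obtained from it
-- without constructing a witness.
∑-tight : ∀ {A : Set} xs {f g : A → ℕ} → (∀ x → x ∈ xs → f x ≤ g x) → ∑ xs g ≤ ∑ xs f →
          ∀ x → x ∈ xs → f x ≡ g x
∑-tight (y ∷ ys) {f} {g} f≤g le x m = go m
  where
  tail≤ : ∑ ys f ≤ ∑ ys g
  tail≤ = ∑-mono ys (λ x m → f≤g x (there m))
  head≡ : f y ≡ g y
  head≡ = ℕₚ.≤-antisym (f≤g y (here refl))
    (ℕₚ.+-cancelʳ-≤ (∑ ys f) (g y) (f y) (ℕₚ.≤-trans (ℕₚ.+-monoʳ-≤ (g y) tail≤) le))
  go : x ∈ y ∷ ys → f x ≡ g x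
  go (here refl) = head≡
  go (there m)   = ∑-tight ys (λ x m → f≤g x (there m))
    (ℕₚ.+-cancelˡ-≤ (g y) (∑ ys g) (∑ ys f) (subst (λ z → g y + ∑ ys g ≤ z + ∑ ys f) head≡ le)) x m

∑-≢0 : ∀ {A : Set} xs {f : A → ℕ} → ∑ xs f ≢ 0 → ∃[ x ] (x ∈ xs × f x ≢ 0)
∑-≢0 []           h = ⊥-elim (h refl)
∑-≢0 (x ∷ xs) {f} h with f x in eq
... | suc n = x , here refl , λ z → ℕₚ.1+n≢0 (trans (sym eq) z)
... | zero with ∑-≢0 xs h
...   | y , m , p = y , there m , p

∑-≡0 : ∀ {A : Set} xs {f : A → ℕ} → ∑ xs f ≡ 0 → ∀ x → x ∈ xs → f x ≡ 0
∑-≡0 (y ∷ ys) {f} h x (here refl) = ℕₚ.m+n≡0⇒m≡0 (f y) h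
∑-≡0 (y ∷ ys) {f} h x (there m)   = ∑-≡0 ys (ℕₚ.m+n≡0⇒n≡0 (f y) h) x m

∑-single : ∀ {A : Set} {xs} {f : A → ℕ} → Unique xs → ∀ a → a ∈ xs →
           (∀ x → x ∈ xs → x ≢ a → f x ≡ 0) → ∑ xs f ≡ f a
∑-single {xs = x ∷ xs} {f} (x∉ ∷ u) a (here refl) h =
  trans (cong (f x +_) (∑-zero xs λ y m → h y (there m) λ y≡x → All.lookup x∉ m (sym y≡x)))
        (ℕₚ.+-identityʳ (f x))
∑-single {xs = x ∷ xs} {f} (x∉ ∷ u) a (there m) h =
  cong₂ _+_ (h x (here refl) (All.lookup x∉ m)) (∑-single u a m (λ y m → h y (there m)))

∑-two : ∀ {A : Set} {xs} {f : A → ℕ} → Unique xs → ∀ a b → a ∈ xs → b ∈ xs → a ≢ b →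
        (∀ x → x ∈ xs → x ≢ a → x ≢ b → f x ≡ 0) → ∑ xs f ≡ f a + f b
∑-two _ a b (here refl) (here refl) a≢b h = ⊥-elim (a≢b refl)
∑-two {xs = x ∷ xs} {f} (x∉ ∷ u) a b (here refl) (there m) a≢b h =
  cong (f x +_) (∑-single u b m λ y m′ y≢b → h y (there m′) (λ y≡x → All.lookup x∉ m′ (sym y≡x)) y≢b)
∑-two {xs = x ∷ xs} {f} (x∉ ∷ u) a b (there m) (here refl) a≢b h =
  trans (cong (f x +_) (∑-single u a m λ y m′ y≢a → h y (there m′) y≢a (λ y≡x → All.lookup x∉ m′ (sym y≡x))))
        (ℕₚ.+-comm (f x) (f a))
∑-two {xs = x ∷ xs} {f} (x∉ ∷ u) a b (there m) (there n) a≢b h =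
  cong₂ _+_ (h x (here refl) (All.lookup x∉ m) (All.lookup x∉ n))
            (∑-two u a b m n a≢b (λ y m → h y (there m)))

∑-map : ∀ {A B : Set} (g : A → B) xs (f : B → ℕ) → ∑ (map g xs) f ≡ ∑ xs (f ∘ g)
∑-map g []       f = refl
∑-map g (x ∷ xs) f = cong (f (g x) +_) (∑-map g xs f)

∑-filter : ∀ {A : Set} {P : A → Set} (P? : Decidable P) xs (f : A → ℕ) →
           ∑ (filter P? xs) f ≡ ∑ xs (λ x → 𝟙 (P? x) * f x)
∑-filter P? []       f = refl
∑-filter P? (x ∷ xs) f with does (P? x)
... | true  = cong₂ _+_ (sym (ℕₚ.+-identityʳ (f x))) (∑-filter P? xs f)
... | false = ∑-filter P? xs f

length-filter : ∀ {A : Set} {P : A → Set} (P? : Decidable P) xs →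
                length (filter P? xs) ≡ ∑ xs (𝟙 ∘ P?)
length-filter P? []       = refl
length-filter P? (x ∷ xs) with does (P? x)
... | true  = cong suc (length-filter P? xs)
... | false = length-filter P? xs

module _ {A : Set} {P : A → Set} {xs : List A} (E : Enumerates P xs) where
  unique : Unique xs
  unique = proj₁ E

  sound : ∀ {x} → x ∈ xs → P x
  sound {x} = proj₁ (proj₂ E) x

  complete : ∀ {x} → P x → x ∈ xs
  complete {x} = proj₂ (proj₂ E) x

  ∑-congᴱ : ∀ {f g : A → ℕ} → (∀ x → P x → f x ≡ g x) → ∑ xs f ≡ ∑ xs g
  ∑-congᴱ h = ∑-cong xs (λ x m → h x (sound m))

  count-one : ∀ {Q : A → Set} (Q? : Decidable Q) a → P a → Q a → (∀ x → P x → Q x → x ≡ a) →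
              ∑ xs (𝟙 ∘ Q?) ≡ 1
  count-one Q? a pa qa h =
    trans (∑-single unique a (complete pa) (λ x m x≢a → 𝟙-no (Q? x) (λ q → x≢a (h x (sound m) q))))
          (𝟙-yes (Q? a) qa)

  count-two : ∀ {Q : A → Set} (Q? : Decidable Q) a b → P a → P b → Q a → Q b → a ≢ b →
              (∀ x → P x → Q x → x ≡ a ⊎ x ≡ b) → ∑ xs (𝟙 ∘ Q?) ≡ 2
  count-two Q? a b pa pb qa qb a≢b h =
    trans (∑-two unique a b (complete pa) (complete pb) a≢b other)
          (cong₂ _+_ (𝟙-yes (Q? a) qa) (𝟙-yes (Q? b) qb))
    where
    other : ∀ x → x ∈ xs → x ≢ a → x ≢ b → 𝟙 (Q? x) ≡ 0
    other x m x≢a x≢b = 𝟙-no (Q? x) λ q → excl (h x (sound m) q)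
      where
      excl : ¬ (x ≡ a ⊎ x ≡ b)
      excl (inj₁ e) = x≢a e
      excl (inj₂ e) = x≢b e

  count-zero : ∀ {Q : A → Set} (Q? : Decidable Q) → (∀ x → P x → ¬ Q x) → ∑ xs (𝟙 ∘ Q?) ≡ 0
  count-zero Q? h = ∑-zero xs (λ x m → 𝟙-no (Q? x) (h x (sound m)))

  count≤1 : ∀ {Q : A → Set} (Q? : Decidable Q) → (∀ x y → P x → P y → Q x → Q y → x ≡ y) →
            ∑ xs (𝟙 ∘ Q?) ≤ 1
  count≤1 Q? h with ∑ xs (𝟙 ∘ Q?) ℕₚ.≟ 0
  ... | yes eq rewrite eq = z≤n
  ... | no  ne with ∑-≢0 xs ne
  ...   | a , m , q = ℕₚ.≤-reflexive (count-one Q? a (sound m) (𝟙≢0 (Q? a) q)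
                        (λ x px qx → h x a px (sound m) qx (𝟙≢0 (Q? a) q)))

  count-witness : ∀ {Q : A → Set} (Q? : Decidable Q) → ∑ xs (𝟙 ∘ Q?) ≢ 0 → ∃[ x ] (P x × Q x)
  count-witness Q? ne with ∑-≢0 xs ne
  ... | a , m , q = a , sound m , 𝟙≢0 (Q? a) q

  -- Two distinct solutions would already contribute 2, since the indicator of the pair `x`, `y`
  -- bounds that of `Q` from below.
  count-unique : ∀ {Q : A → Set} (Q? : Decidable Q) → ∑ xs (𝟙 ∘ Q?) ≤ 1 →
                 ∀ {x y} → P x → P y → Q x → Q y → DecidableEquality A → x ≡ y
  count-unique Q? le {x} {y} px py qx qy _≟_ with x ≟ y
  ... | yes e = e
  ... | no ne = ⊥-elim (ℕₚ.<⇒≱ ≤two le)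
    where
    ≤two : 2 ≤ ∑ xs (𝟙 ∘ Q?)
    ≤two = subst₂ _≤_
      (count-two (λ z → both z) x y px py (inj₁ refl) (inj₂ refl) ne (λ _ _ → id)) refl
      (∑-mono xs (λ z _ → 𝟙-mono (both z) (Q? z) λ { (inj₁ refl) → qx ; (inj₂ refl) → qy }))
      where
      both : ∀ z → Dec (z ≡ x ⊎ z ≡ y)
      both z with z ≟ x | z ≟ y
      ... | yes e | _     = yes (inj₁ e)
      ... | no _  | yes e = yes (inj₂ e)
      ... | no h  | no h′ = no λ { (inj₁ e) → h e ; (inj₂ e) → h′ e }

  enum-filter : ∀ {Q : A → Set} (Q? : Decidable Q) → Enumerates (λ x → P x × Q x) (filter Q? xs)
  enum-filter Q? = Uniqueₚ.filter⁺ Q? unique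
    , (λ x m → let (m′ , q) = ∈-filter⁻ Q? m in sound m′ , q)
    , (λ x (p , q) → ∈-filter⁺ Q? (complete p) q)

  card-filter : ∀ {Q : A → Set} (Q? : Decidable Q) {n} → ∑ xs (𝟙 ∘ Q?) ≡ n →
                Card (λ x → P x × Q x) n
  card-filter Q? eq = filter Q? xs , enum-filter Q? , trans (length-filter Q? xs) eq

  any-enum : ∀ {Q : A → Set} → Decidable Q → Dec (∃[ x ] (P x × Q x))
  any-enum Q? = map′ (λ a → let (x , m , q) = find a in x , sound m , q)
    (λ (x , p , q) → lose (complete p) q) (Any.any? Q? xs)

-- Both sides are the double sum of `h y` over the pairs with `f x ≡ y`, so the two lists are
-- compared without permuting either of them.
∑-bij : ∀ {A B : Set} {P : A → Set} {Q : B → Set} {xs ys} → Enumerates P xs → Enumerates Q ys →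
        DecidableEquality B → (f : A → B) →
        (∀ x → P x → Q (f x)) → (∀ y → Q y → ∃[ x ] (P x × f x ≡ y)) →
        (∀ x x′ → P x → P x′ → f x ≡ f x′ → x ≡ x′) →
        (h : B → ℕ) → ∑ xs (h ∘ f) ≡ ∑ ys h
∑-bij {xs = xs} {ys} E E′ _≟_ f pq surj inj h = begin
  ∑ xs (λ x → h (f x)) ≡⟨ ∑-congᴱ E (λ x px → sym (step₁ x px)) ⟩
  ∑ xs (λ x → ∑ ys (λ y → 𝟙 (f x ≟ y) * h y)) ≡⟨ ∑-swap xs ys _ ⟩
  ∑ ys (λ y → ∑ xs (λ x → 𝟙 (f x ≟ y) * h y)) ≡⟨ ∑-congᴱ E′ step₂ ⟩
  ∑ ys h ∎
  where
  open ≡-Reasoning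
  step₁ : ∀ x → _ → ∑ ys (λ y → 𝟙 (f x ≟ y) * h y) ≡ h (f x)
  step₁ x px = trans
    (∑-single (unique E′) (f x) (complete E′ (pq x px))
      (λ y _ ne → cong (_* h y) (𝟙-no (f x ≟ y) (ne ∘ sym))))
    (trans (cong (_* h (f x)) (𝟙-yes (f x ≟ f x) refl)) (ℕₚ.*-identityˡ _))
  step₂ : ∀ y → _ → ∑ xs (λ x → 𝟙 (f x ≟ y) * h y) ≡ h y
  step₂ y qy with surj y qy
  ... | x₀ , px₀ , refl = trans (∑-*ʳ xs (h y) (λ x → 𝟙 (f x ≟ y)))
    (trans (cong (_* h y) (count-one E (λ x → f x ≟ y) x₀ px₀ refl (λ x px e → inj x x₀ px px₀ e)))
           (ℕₚ.*-identityˡ _))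

length-enum : ∀ {A : Set} {P Q : A → Set} {xs ys} → Enumerates P xs → Enumerates Q ys → DecidableEquality A →
              (∀ x → P x → Q x) → (∀ x → Q x → P x) → length xs ≡ length ys
length-enum {xs = xs} {ys} E E′ _≟_ pq qp = trans (sym (∑-one xs))
  (trans (∑-bij E E′ _≟_ id pq (λ y q → y , qp y q , refl) (λ _ _ _ _ → id) (λ _ → 1)) (∑-one ys))

card-count : ∀ {A : Set} {P Q R : A → Set} {xs n} → Enumerates P xs → DecidableEquality A →
             (Q? : Decidable Q) → (∀ x → R x → P x × Q x) → (∀ x → P x → Q x → R x) →
             Card R n → ∑ xs (𝟙 ∘ Q?) ≡ n
card-count {xs = xs} E _≟_ Q? to from (ys , E′ , refl) = trans (sym (length-filter Q? xs))
  (length-enum (enum-filter E Q?) E′ _≟_ (λ x (p , q) → from x p q) to)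

card-map : ∀ {A : Set} {P Q : A → Set} {n} → (∀ x → P x → Q x) → (∀ x → Q x → P x) → Card P n → Card Q n
card-map f g (xs , (u , s , c) , l) = xs , (u , (λ x m → f x (s x m)) , (λ x q → c x (g x q))) , l

∑-remove : ∀ {A : Set} {xs} → Unique xs → (_≟_ : DecidableEquality A) → ∀ (f : A → ℕ) a → a ∈ xs →
           ∑ xs (λ x → 𝟙 (¬? (x ≟ a)) * f x) + f a ≡ ∑ xs f
∑-remove {xs = xs} u _≟_ f a m = begin
  ∑ xs (λ x → 𝟙 (¬? (x ≟ a)) * f x) + f a
    ≡⟨ cong (∑ xs (λ x → 𝟙 (¬? (x ≟ a)) * f x) +_) (sym single) ⟩
  ∑ xs (λ x → 𝟙 (¬? (x ≟ a)) * f x) + ∑ xs (λ x → 𝟙 (x ≟ a) * f x)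
    ≡⟨ sym (∑-+ xs _ _) ⟩
  ∑ xs (λ x → 𝟙 (¬? (x ≟ a)) * f x + 𝟙 (x ≟ a) * f x)
    ≡⟨ ∑-ext xs (λ x → trans (sym (ℕₚ.*-distribʳ-+ (f x) (𝟙 (¬? (x ≟ a))) (𝟙 (x ≟ a))))
         (trans (cong (_* f x) (trans (ℕₚ.+-comm (𝟙 (¬? (x ≟ a))) _) (𝟙-¬ (x ≟ a)))) (ℕₚ.*-identityˡ (f x)))) ⟩
  ∑ xs f ∎
  where
  open ≡-Reasoning
  single : ∑ xs (λ x → 𝟙 (x ≟ a) * f x) ≡ f a
  single = trans (∑-single u a m (λ x _ ne → cong (_* f x) (𝟙-no (x ≟ a) ne)))
    (trans (cong (_* f a) (𝟙-yes (a ≟ a) refl)) (ℕₚ.*-identityˡ (f a)))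

enum-map : ∀ {A : Set} {P Q : A → Set} {xs} → (∀ x → P x → Q x) → (∀ x → Q x → P x) → Enumerates P xs → Enumerates Q xs
enum-map f g (u , s , c) = u , (λ x m → f x (s x m)) , (λ x q → c x (g x q))

enum-product : ∀ {A B : Set} {P : A → Set} {Q : B → Set} {xs ys} → Enumerates P xs → Enumerates Q ys →
               Enumerates (λ (x , y) → P x × Q y) (cartesianProduct xs ys)
enum-product {xs = xs} {ys} E E′ = Uniqueₚ.cartesianProduct⁺ (unique E) (unique E′)
  , (λ (x , y) m → let (mx , my) = ∈-cartesianProduct⁻ xs ys m in sound E mx , sound E′ my)
  , (λ (x , y) (px , qy) → ∈-cartesianProduct⁺ (complete E px) (complete E′ qy))

∑-product : ∀ {A B : Set} {C : Set} (g : A → B → C) xs ys f →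
            ∑ (cartesianProductWith g xs ys) f ≡ ∑ xs (λ x → ∑ ys (λ y → f (g x y)))
∑-product g []       ys f = refl
∑-product g (x ∷ xs) ys f = trans (∑-++ (map (g x) ys) (cartesianProductWith g xs ys))
  (cong₂ _+_ (∑-map (g x) ys f) (∑-product g xs ys f))
  where
  ∑-++ : ∀ zs ws → ∑ (zs ++ ws) f ≡ ∑ zs f + ∑ ws f
  ∑-++ []       ws = refl
  ∑-++ (z ∷ zs) ws = trans (cong (f z +_) (∑-++ zs ws)) (sym (ℕₚ.+-assoc (f z) _ _))

module _ {A : Set} {R : A → Set} {xs : List A} (u : Unique xs) (_≟_ : DecidableEquality A) (R? : Decidable R) where
  private
    r : A → ℕ
    r = 𝟙 ∘ R?
    D = ∑ xs r
    _≢?_ : ∀ x y → Dec (x ≢ y)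
    x ≢? y = ¬? (x ≟ y)

  -- The second factorial moment: ordered pairs of distinct elements satisfying `R`. The truncation
  -- in `D ∸ 1` is harmless, because the inner sum is weighted by `r t`, and a `t` satisfying `R`
  -- makes `D` positive.
  ∑-pairs : ∑ xs (λ t → r t * ∑ xs (λ s → 𝟙 (s ≢? t) * r s)) ≡ D * (D ∸ 1)
  ∑-pairs = trans (∑-cong xs λ t m → 𝟙*-cong (R? t) λ rt → ℕₚ.+-cancelʳ-≡ 1 _ _ (trans
      (cong (∑ xs (λ s → 𝟙 (s ≢? t) * r s) +_) (sym (𝟙-yes (R? t) rt)))
      (trans (∑-remove u _≟_ r t m) (sym (ℕₚ.m∸n+n≡m (positive rt m))))))
    (∑-*ʳ xs (D ∸ 1) r)
    where
    positive : ∀ {t} → R t → t ∈ xs → 1 ≤ D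
    positive {t} rt m = ℕₚ.n≢0⇒n>0 λ z → ℕₚ.1+n≢0 (trans (sym (𝟙-yes (R? t) rt)) (∑-≡0 xs z t m))

  ∑-triples : ∑ xs (λ t → r t * ∑ xs (λ s → 𝟙 (s ≢? t) * (r s * ∑ xs (λ w → 𝟙 (w ≢? t) * (𝟙 (w ≢? s) * r w)))))
              ≡ D * (D ∸ 1) * (D ∸ 2)
  ∑-triples = trans (∑-cong xs λ t mt → 𝟙*-cong (R? t) λ rt → ∑-cong xs λ s ms → 𝟙*-cong (s ≢? t) λ s≢t → 𝟙*-cong (R? s) λ rs →
      inner t s mt ms rt rs s≢t)
    (trans (∑-ext xs λ t → trans (cong (r t *_) (trans (∑-ext xs λ s → sym (ℕₚ.*-assoc (𝟙 (s ≢? t)) (r s) (D ∸ 2)))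
      (∑-*ʳ xs (D ∸ 2) _))) (sym (ℕₚ.*-assoc (r t) _ (D ∸ 2))))
    (trans (∑-*ʳ xs (D ∸ 2) _) (cong (_* (D ∸ 2)) ∑-pairs)))
    where
    inner : ∀ t s → t ∈ xs → s ∈ xs → R t → R s → s ≢ t → ∑ xs (λ w → 𝟙 (w ≢? t) * (𝟙 (w ≢? s) * r w)) ≡ D ∸ 2
    inner t s mt ms rt rs s≢t = trans (sym (ℕₚ.m+n∸n≡m _ 2)) (cong (_∸ 2) (begin
      W + 2 ≡⟨ sym (ℕₚ.+-assoc W 1 1) ⟩
      W + 1 + 1 ≡⟨ cong (λ z → W + z + 1) (sym (trans (cong₂ _*_ (𝟙-yes (t ≢? s) (s≢t ∘ sym)) (𝟙-yes (R? t) rt)) refl)) ⟩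
      W + 𝟙 (t ≢? s) * r t + 1 ≡⟨ cong (_+ 1) (∑-remove u _≟_ (λ w → 𝟙 (w ≢? s) * r w) t mt) ⟩
      ∑ xs (λ w → 𝟙 (w ≢? s) * r w) + 1 ≡⟨ cong (∑ xs (λ w → 𝟙 (w ≢? s) * r w) +_) (sym (𝟙-yes (R? s) rs)) ⟩
      ∑ xs (λ w → 𝟙 (w ≢? s) * r w) + r s ≡⟨ ∑-remove u _≟_ r s ms ⟩
      D ∎))
      where
      open ≡-Reasoning
      W = ∑ xs (λ w → 𝟙 (w ≢? t) * (𝟙 (w ≢? s) * r w))

-- Arithmetic, powers and polynomials over a finite field

module FieldTheory (F : Field) where
  open Field F public
    using (Carrier; 0#; 1#; isCommutativeRing; 0≢1; inverse; _≟_; elements; pow; three)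
    renaming (_+_ to _⊕_; _*_ to _⊗_; -_ to ⊝_; size to order)

  infixl 6 _⊖_
  _⊖_ : Carrier → Carrier → Carrier
  x ⊖ y = x ⊕ ⊝ y

  ring : CommutativeRing _ _
  ring = record { isCommutativeRing = isCommutativeRing }

  open CommutativeRing ring public
    using (*-comm; *-identityˡ; *-identityʳ; zeroˡ; zeroʳ; +-identityˡ; +-identityʳ; -‿inverseʳ; *-assoc; *-isCommutativeMonoid; +-comm)
  private module R = CommutativeRing ring

  private
    module Solver where
      open import Algebra.Properties.Semiring.Mult.TCOptimised R.semiring
        using (1+×; ×-homo-+; ×1-homo-*) renaming (_×_ to infixl 8 _·_)
      open import Algebra.Properties.Ring R.ring
        using (-‿distribˡ-*; -‿distribʳ-*; -‿involutive; -0#≈0#; ⁻¹-anti-homo‿-)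
      open import Algebra.Properties.AbelianGroup R.+-abelianGroup using (⁻¹-∙-comm)

      -- The solver takes its coefficients from ℤ, where equality computes. With the optimised
      -- multiple `_·_` the integers 0, 1 and 3 evaluate definitionally to `0#`, `1#` and `three`,
      -- so `solve` applies directly to goals that mention these.
      ⟦_⟧ : ℤ → Carrier
      ⟦ ℤ.+ n ⟧      = n · 1#
      ⟦ -[1+ n ] ⟧ = ⊝ (suc n · 1#)

      ⊖-homo : ∀ m n → ⟦ m ℤ.⊖ n ⟧ ≡ m · 1# ⊖ n · 1#
      ⊖-homo m zero = sym (trans (cong (m · 1# ⊕_) -0#≈0#) (+-identityʳ _))
      ⊖-homo zero (suc n) = sym (+-identityˡ _)
      ⊖-homo (suc m) (suc n) = begin
        ⟦ suc m ℤ.⊖ suc n ⟧ ≡⟨ cong ⟦_⟧ (ℤₚ.[1+m]⊖[1+n]≡m⊖n m n) ⟩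
        ⟦ m ℤ.⊖ n ⟧ ≡⟨ ⊖-homo m n ⟩
        m · 1# ⊖ n · 1# ≡⟨ cong (_⊖ n · 1#) (sym (+-identityˡ _)) ⟩
        0# ⊕ m · 1# ⊖ n · 1# ≡⟨ cong (λ z → z ⊕ m · 1# ⊖ n · 1#) (sym (-‿inverseʳ 1#)) ⟩
        1# ⊖ 1# ⊕ m · 1# ⊖ n · 1# ≡⟨ cong (_⊖ n · 1#) (trans (R.+-assoc _ _ _) (trans (cong (1# ⊕_) (+-comm _ _)) (sym (R.+-assoc _ _ _)))) ⟩
        1# ⊕ m · 1# ⊖ 1# ⊖ n · 1# ≡⟨ R.+-assoc _ _ _ ⟩
        1# ⊕ m · 1# ⊕ (⊝ 1# ⊖ n · 1#) ≡⟨ cong (1# ⊕ m · 1# ⊕_) (⁻¹-∙-comm 1# (n · 1#)) ⟩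
        1# ⊕ m · 1# ⊖ (1# ⊕ n · 1#) ≡⟨ cong₂ _⊖_ (sym (1+× m 1#)) (sym (1+× n 1#)) ⟩
        suc m · 1# ⊖ suc n · 1# ∎
        where open ≡-Reasoning

      neg-homo : ∀ i → ⟦ ℤ.- i ⟧ ≡ ⊝ ⟦ i ⟧
      neg-homo (ℤ.+ zero)  = sym -0#≈0#
      neg-homo (ℤ.+ suc n) = refl
      neg-homo -[1+ n ]  = sym (-‿involutive _)

      +-homo : ∀ i j → ⟦ i ℤ.+ j ⟧ ≡ ⟦ i ⟧ ⊕ ⟦ j ⟧
      +-homo (ℤ.+ m) (ℤ.+ n) = ×-homo-+ 1# m n
      +-homo (ℤ.+ m) -[1+ n ] = ⊖-homo m (suc n)
      +-homo -[1+ m ] (ℤ.+ n) = trans (⊖-homo n (suc m)) (+-comm _ _)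
      +-homo -[1+ m ] -[1+ n ] = trans
        (cong ⊝_ (trans (cong (λ z → suc z · 1#) (sym (ℕₚ.+-suc m n))) (×-homo-+ 1# (suc m) (suc n))))
        (sym (⁻¹-∙-comm _ _))

      *-homo⁺ : ∀ m j → ⟦ ℤ.+ m ℤ.* j ⟧ ≡ ⟦ ℤ.+ m ⟧ ⊗ ⟦ j ⟧
      *-homo⁺ m (ℤ.+ n) = trans (cong ⟦_⟧ (sym (ℤₚ.pos-* m n))) (×1-homo-* m n)
      *-homo⁺ m -[1+ n ] = begin
        ⟦ ℤ.+ m ℤ.* -[1+ n ] ⟧ ≡⟨ cong ⟦_⟧ (sym (ℤₚ.neg-distribʳ-* (ℤ.+ m) (ℤ.+ suc n))) ⟩
        ⟦ ℤ.- (ℤ.+ m ℤ.* ℤ.+ suc n) ⟧ ≡⟨ neg-homo (ℤ.+ m ℤ.* ℤ.+ suc n) ⟩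
        ⊝ ⟦ ℤ.+ m ℤ.* ℤ.+ suc n ⟧ ≡⟨ cong ⊝_ (*-homo⁺ m (ℤ.+ suc n)) ⟩
        ⊝ (⟦ ℤ.+ m ⟧ ⊗ ⟦ ℤ.+ suc n ⟧) ≡⟨ -‿distribʳ-* _ _ ⟩
        ⟦ ℤ.+ m ⟧ ⊗ ⟦ -[1+ n ] ⟧ ∎
        where open ≡-Reasoning

      *-homo : ∀ i j → ⟦ i ℤ.* j ⟧ ≡ ⟦ i ⟧ ⊗ ⟦ j ⟧
      *-homo (ℤ.+ m) j = *-homo⁺ m j
      *-homo -[1+ m ] j = begin
        ⟦ -[1+ m ] ℤ.* j ⟧ ≡⟨ cong ⟦_⟧ (sym (ℤₚ.neg-distribˡ-* (ℤ.+ suc m) j)) ⟩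
        ⟦ ℤ.- (ℤ.+ suc m ℤ.* j) ⟧ ≡⟨ neg-homo (ℤ.+ suc m ℤ.* j) ⟩
        ⊝ ⟦ ℤ.+ suc m ℤ.* j ⟧ ≡⟨ cong ⊝_ (*-homo⁺ (suc m) j) ⟩
        ⊝ (⟦ ℤ.+ suc m ⟧ ⊗ ⟦ j ⟧) ≡⟨ -‿distribˡ-* _ _ ⟩
        ⟦ -[1+ m ] ⟧ ⊗ ⟦ j ⟧ ∎
        where open ≡-Reasoning

      morphism : CommutativeRing.rawRing ℤₚ.+-*-commutativeRing ACR.-Raw-AlmostCommutative⟶ ACR.fromCommutativeRing ring
      morphism = record
        { ⟦_⟧ = ⟦_⟧ ; +-homo = +-homo ; *-homo = *-homo ; -‿homo = neg-homo ; 0-homo = refl ; 1-homo = refl }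

      coeff≟ : ∀ i j → Maybe (⟦ i ⟧ ≡ ⟦ j ⟧)
      coeff≟ i j with i ℤₚ.≟ j
      ... | yes i≡j = just (cong ⟦_⟧ i≡j)
      ... | no  _   = nothing

  open Algebra.Solver.Ring (CommutativeRing.rawRing ℤₚ.+-*-commutativeRing) (ACR.fromCommutativeRing ring)
    Solver.morphism Solver.coeff≟ public
    using (solve; _:=_; _:+_; _:*_; _:-_; :-_; con; Polynomial)

  :0 :1 : ∀ {n} → Polynomial n
  :0 = con 0ℤ
  :1 = con 1ℤ

  :3 : ∀ {n} → Polynomial n
  :3 = con (ℤ.+ 3)

  recip : ∀ {x} → x ≢ 0# → Carrier
  recip {x} h = proj₁ (inverse x h)

  recipʳ : ∀ {x} (h : x ≢ 0#) → x ⊗ recip h ≡ 1#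
  recipʳ {x} h = proj₂ (inverse x h)

  recipˡ : ∀ {x} (h : x ≢ 0#) → recip h ⊗ x ≡ 1#
  recipˡ h = trans (*-comm _ _) (recipʳ h)

  x-y≡0⇒x≡y : ∀ {x y} → x ⊖ y ≡ 0# → x ≡ y
  x-y≡0⇒x≡y {x} {y} h = begin
    x ≡⟨ solve 2 (λ x y → x := (x :- y) :+ y) refl x y ⟩
    x ⊖ y ⊕ y ≡⟨ cong (_⊕ y) h ⟩
    0# ⊕ y ≡⟨ +-identityˡ y ⟩
    y ∎
    where open ≡-Reasoning

  x≡y⇒x-y≡0 : ∀ {x y} → x ≡ y → x ⊖ y ≡ 0#
  x≡y⇒x-y≡0 {x} refl = -‿inverseʳ x

  cancelˡ : ∀ {x y z} → x ≢ 0# → x ⊗ y ≡ x ⊗ z → y ≡ z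
  cancelˡ {x} {y} {z} h e = begin
    y ≡⟨ undo y ⟩
    recip h ⊗ (x ⊗ y) ≡⟨ cong (recip h ⊗_) e ⟩
    recip h ⊗ (x ⊗ z) ≡⟨ sym (undo z) ⟩
    z ∎
    where
    open ≡-Reasoning
    undo : ∀ y → y ≡ recip h ⊗ (x ⊗ y)
    undo y = trans (sym (*-identityˡ y)) (trans (cong (_⊗ y) (sym (recipˡ h))) (*-assoc _ _ _))

  xy≡0⇒y≡0 : ∀ {x y} → x ≢ 0# → x ⊗ y ≡ 0# → y ≡ 0#
  xy≡0⇒y≡0 {x} h e = cancelˡ h (trans e (sym (zeroʳ x)))

  ⊗-≢0 : ∀ {x y} → x ≢ 0# → y ≢ 0# → x ⊗ y ≢ 0#
  ⊗-≢0 hx hy e = hy (xy≡0⇒y≡0 hx e)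

  recip≢0 : ∀ {x} (h : x ≢ 0#) → recip h ≢ 0#
  recip≢0 {x} h e = 0≢1 (trans (sym (zeroʳ x)) (trans (cong (x ⊗_) (sym e)) (recipʳ h)))

  1≢0 : 1# ≢ 0#
  1≢0 = 0≢1 ∘ sym

  ⊝-≢0 : ∀ {x} → x ≢ 0# → ⊝ x ≢ 0#
  ⊝-≢0 {x} h e = h (trans (solve 1 (λ x → x := :- (:- x)) refl x)
    (trans (cong ⊝_ e) (solve 0 (:- :0 := :0) refl)))

  pow-+ : ∀ x m n → pow x (m + n) ≡ pow x m ⊗ pow x n
  pow-+ x zero    n = sym (*-identityˡ _)
  pow-+ x (suc m) n = trans (cong (x ⊗_) (pow-+ x m n)) (sym (*-assoc _ _ _))

  pow-⊗ : ∀ x y n → pow (x ⊗ y) n ≡ pow x n ⊗ pow y n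
  pow-⊗ x y zero    = sym (*-identityˡ _)
  pow-⊗ x y (suc n) = trans (cong (x ⊗ y ⊗_) (pow-⊗ x y n))
    (solve 4 (λ x y a b → x :* y :* (a :* b) := x :* a :* (y :* b)) refl x y (pow x n) (pow y n))

  pow-* : ∀ x m n → pow x (m * n) ≡ pow (pow x n) m
  pow-* x zero    n = refl
  pow-* x (suc m) n = trans (pow-+ x n (m * n)) (cong (pow x n ⊗_) (pow-* x m n))

  pow-1 : ∀ n → pow 1# n ≡ 1#
  pow-1 zero    = refl
  pow-1 (suc n) = trans (*-identityˡ _) (pow-1 n)

  cube : Carrier → Carrier
  cube x = x ⊗ x ⊗ x

  pow-3 : ∀ x → pow x 3 ≡ cube x
  pow-3 x = solve 1 (λ x → x :* (x :* (x :* :1)) := x :* x :* x) refl x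

  cube-⊗ : ∀ x y → cube (x ⊗ y) ≡ cube x ⊗ cube y
  cube-⊗ x y = solve 2 (λ x y → (x :* y) :* (x :* y) :* (x :* y) := x :* x :* x :* (y :* y :* y)) refl x y

  cube-≢0 : ∀ {x} → x ≢ 0# → cube x ≢ 0#
  cube-≢0 h = ⊗-≢0 (⊗-≢0 h h) h

  cube≡0 : ∀ {x} → cube x ≡ 0# → x ≡ 0#
  cube≡0 {x} e with x ≟ 0#
  ... | yes x≡0 = x≡0
  ... | no  x≢0 = ⊥-elim (cube-≢0 x≢0 e)

  elementsᴱ : Enumerates (λ _ → ⊤) elements
  elementsᴱ = Field.elements-unique F , (λ _ _ → tt) , (λ x _ → Field.elements-complete F x)

  units : List Carrier
  units = filter (λ x → ¬? (x ≟ 0#)) elements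

  unitsᴱ : Enumerates (λ x → ⊤ × x ≢ 0#) units
  unitsᴱ = enum-filter elementsᴱ (λ x → ¬? (x ≟ 0#))

  length-units : length units + 1 ≡ order
  length-units = begin
    length units + 1
      ≡⟨ cong₂ _+_ (trans (length-filter (λ x → ¬? (x ≟ 0#)) elements) (∑-ext elements λ x → sym (ℕₚ.*-identityʳ _))) refl ⟩
    ∑ elements (λ x → 𝟙 (¬? (x ≟ 0#)) * 1) + 1
      ≡⟨ ∑-remove (unique elementsᴱ) _≟_ (λ _ → 1) 0# (complete elementsᴱ tt) ⟩
    ∑ elements (λ _ → 1)
      ≡⟨ ∑-one elements ⟩
    order ∎
    where open ≡-Reasoning

  private
    ∏ : List Carrier → Carrier
    ∏ = Data.List.foldr _⊗_ 1#

    ∏-map : ∀ a xs → ∏ (map (a ⊗_) xs) ≡ pow a (length xs) ⊗ ∏ xs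
    ∏-map a []       = sym (*-identityˡ _)
    ∏-map a (x ∷ xs) = trans (cong (a ⊗ x ⊗_) (∏-map a xs))
      (solve 4 (λ a x p q → a :* x :* (p :* q) := a :* p :* (x :* q)) refl a x (pow a (length xs)) (∏ xs))

    ∏-≢0 : ∀ xs → (∀ x → x ∈ xs → x ≢ 0#) → ∏ xs ≢ 0#
    ∏-≢0 []       h = 1≢0
    ∏-≢0 (x ∷ xs) h = ⊗-≢0 (h x (here refl)) (∏-≢0 xs (λ y m → h y (there m)))

  -- Multiplication by a permutes the units.
  fermat : ∀ {a} → a ≢ 0# → pow a (length units) ≡ 1#
  fermat {a} a≢0 = cancelˡ ∏units≢0 (trans (*-comm _ _) (trans (sym (∏-map a units)) (trans ∏≡ (sym (*-identityʳ _)))))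
    where
    ∏units≢0 : ∏ units ≢ 0#
    ∏units≢0 = ∏-≢0 units (λ x m → proj₂ (sound unitsᴱ m))
    to : ∀ {x} → x ∈ map (a ⊗_) units → x ∈ units
    to m with ∈-map⁻ (a ⊗_) m
    ... | y , m′ , refl = complete unitsᴱ (tt , ⊗-≢0 a≢0 (proj₂ (sound unitsᴱ m′)))
    from : ∀ {x} → x ∈ units → x ∈ map (a ⊗_) units
    from {x} m = subst (_∈ map (a ⊗_) units)
      (trans (sym (*-assoc _ _ _)) (trans (cong (_⊗ x) (recipʳ a≢0)) (*-identityˡ x)))
      (∈-map⁺ (a ⊗_) (complete unitsᴱ (tt , ⊗-≢0 (recip≢0 a≢0) (proj₂ (sound unitsᴱ m)))))
    commutativeMonoid : CommutativeMonoid _ _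
    commutativeMonoid = record { isCommutativeMonoid = *-isCommutativeMonoid }
    ∏≡ : ∏ (map (a ⊗_) units) ≡ ∏ units
    ∏≡ = foldr-commMonoid (CommutativeMonoid.setoid commutativeMonoid) *-isCommutativeMonoid
      (↭⇒↭ₛ (∼bag⇒↭ (unique∧set⇒bag (Uniqueₚ.map⁺ (cancelˡ a≢0) (unique unitsᴱ)) (unique unitsᴱ) (mk⇔ to from))))

  pow-order : ∀ a → pow a order ≡ a
  pow-order a rewrite sym length-units | ℕₚ.+-comm (length units) 1 with a ≟ 0#
  ... | yes refl = zeroˡ _
  ... | no  a≢0  = trans (cong (a ⊗_) (fermat a≢0)) (*-identityʳ a)

  -- Polynomials, as coefficient vectors with the constant term first

  eval : ∀ {n} → Vec Carrier n → Carrier → Carrier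
  eval []      x = 0#
  eval (a ∷ p) x = a ⊕ x ⊗ eval p x

  -- Synthetic division: the coefficients of (p(X) - p(r)) / (X - r), which by Horner's scheme are
  -- the values at `r` of the successive tails of `p`.
  quotient : ∀ {n} → Vec Carrier (suc n) → Carrier → Vec Carrier n
  quotient (a ∷ [])    r = []
  quotient (a ∷ b ∷ p) r = eval (b ∷ p) r ∷ quotient (b ∷ p) r

  factor : ∀ {n} (p : Vec Carrier (suc n)) r x → eval p x ⊖ eval p r ≡ (x ⊖ r) ⊗ eval (quotient p r) x
  factor (a ∷ []) r x = solve 3 (λ a r x → (a :+ x :* :0) :- (a :+ r :* :0) := (x :- r) :* :0) refl a r x
  factor (a ∷ b ∷ p) r x = begin
    a ⊕ x ⊗ e x ⊖ (a ⊕ r ⊗ e r)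
      ≡⟨ solve 5 (λ a x r ex er → (a :+ x :* ex) :- (a :+ r :* er) := x :* (ex :- er) :+ (x :- r) :* er) refl a x r (e x) (e r) ⟩
    x ⊗ (e x ⊖ e r) ⊕ (x ⊖ r) ⊗ e r
      ≡⟨ cong (λ z → x ⊗ z ⊕ (x ⊖ r) ⊗ e r) (factor (b ∷ p) r x) ⟩
    x ⊗ ((x ⊖ r) ⊗ eval (quotient (b ∷ p) r) x) ⊕ (x ⊖ r) ⊗ e r
      ≡⟨ solve 4 (λ x r q er → x :* ((x :- r) :* q) :+ (x :- r) :* er := (x :- r) :* (er :+ x :* q)) refl x r (eval (quotient (b ∷ p) r) x) (e r) ⟩
    (x ⊖ r) ⊗ (e r ⊕ x ⊗ eval (quotient (b ∷ p) r) x) ∎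
    where
    open ≡-Reasoning
    e = eval (b ∷ p)

  -- Each root is divided out at the cost of one coefficient. The conclusion is about values rather
  -- than coefficients; where a contradiction is wanted, the value at 0 exposes the constant term.
  vanishes : ∀ {n} (p : Vec Carrier n) rs → Unique rs → n ≤ length rs →
             (∀ r → r ∈ rs → eval p r ≡ 0#) → ∀ x → eval p x ≡ 0#
  vanishes []      rs       u le h x = refl
  vanishes (a ∷ p) (r ∷ rs) (r∉ ∷ u) (s≤s le) h x = begin
    eval (a ∷ p) x ≡⟨ solve 2 (λ p z → p := (p :- z) :+ z) refl (eval (a ∷ p) x) (eval (a ∷ p) r) ⟩
    eval (a ∷ p) x ⊖ eval (a ∷ p) r ⊕ eval (a ∷ p) r
                                          ≡⟨ cong₂ _⊕_ (factor (a ∷ p) r x) (h r (here refl)) ⟩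
    (x ⊖ r) ⊗ eval (quotient (a ∷ p) r) x ⊕ 0#
                                          ≡⟨ cong (λ z → (x ⊖ r) ⊗ z ⊕ 0#) (vanishes (quotient (a ∷ p) r) rs u le root x) ⟩
    (x ⊖ r) ⊗ 0# ⊕ 0# ≡⟨ solve 2 (λ x r → (x :- r) :* :0 :+ :0 := :0) refl x r ⟩
    0# ∎
    where
    open ≡-Reasoning
    root : ∀ s → s ∈ rs → eval (quotient (a ∷ p) r) s ≡ 0#
    root s m = xy≡0⇒y≡0 (λ e → All.lookup r∉ m (sym (x-y≡0⇒x≡y e)))
      (trans (sym (factor (a ∷ p) r s)) (trans (cong₂ _⊖_ (h s (there m)) (h r (here refl))) (-‿inverseʳ 0#)))

  monomial : ∀ n → Vec Carrier (suc n)
  monomial zero    = 1# ∷ []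
  monomial (suc n) = 0# ∷ monomial n

  eval-monomial : ∀ n x → eval (monomial n) x ≡ pow x n
  eval-monomial zero    x = solve 1 (λ x → :1 :+ x :* :0 := :1) refl x
  eval-monomial (suc n) x = trans (+-identityˡ _) (cong (x ⊗_) (eval-monomial n x))

  -- If x ^ ((q - 1) / 3) = 1 for all units x, then X ^ ((q - 1) / 3) - 1 has too many roots.
  primitive-cube-root : order % 3 ≡ 1 → ∃[ ω ] (ω ≢ 1# × cube ω ≡ 1#)
  primitive-cube-root h = go (order / 3) (m≡m%n+[m/n]*n order 3)
    where
    go : ∀ n → order ≡ order % 3 + n * 3 → ∃[ ω ] (ω ≢ 1# × cube ω ≡ 1#)
    go n eq rewrite h = root n length≡
      where
      length≡ : length units ≡ n * 3
      length≡ = ℕₚ.suc-injective (trans (ℕₚ.+-comm 1 _) (trans length-units eq))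
      root : ∀ n → length units ≡ n * 3 → ∃[ ω ] (ω ≢ 1# × cube ω ≡ 1#)
      root zero leq = ⊥-elim (no-unit (complete unitsᴱ (tt , 1≢0)) leq)
        where
        no-unit : ∀ {x xs} → x ∈ xs → ¬ (length {A = Carrier} xs ≡ 0)
        no-unit (here _)  ()
        no-unit (there _) ()
      root (suc n) leq with any-enum unitsᴱ (λ x → ¬? (pow x (suc n) ≟ 1#))
      ... | yes (x , (_ , x≢0) , ne) = pow x (suc n) , ne , trans (sym (pow-3 _))
            (trans (sym (pow-* x 3 (suc n))) (trans (cong (pow x) (trans (ℕₚ.*-comm 3 (suc n)) (sym leq))) (fermat x≢0)))
      -- At 0 the vanishing polynomial takes the value of its constant term, -1.
      ... | no none = ⊥-elim (⊝-≢0 1≢0 (trans (solve 1 (λ e → :- :1 := :- :1 :+ :0 :* e) refl (eval (monomial n) 0#))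
              (vanishes p units (unique unitsᴱ) len roots 0#)))
        where
        p : Vec Carrier (suc (suc n))
        p = ⊝ 1# ∷ monomial n
        -- There are n + 2 coefficients against 3(n + 1) units.
        len : suc (suc n) ≤ length units
        len rewrite leq = s≤s (s≤s (ℕₚ.≤-trans (ℕₚ.m≤m*n n 3) (ℕₚ.n≤1+n _)))
        roots : ∀ r → r ∈ units → eval p r ≡ 0#
        roots r m with pow r (suc n) ≟ 1#
        ... | yes e = trans (cong (λ z → ⊝ 1# ⊕ r ⊗ z) (eval-monomial n r)) (trans (cong (⊝ 1# ⊕_) e) (trans (+-comm _ _) (-‿inverseʳ 1#)))
        ... | no ne = ⊥-elim (none (r , sound unitsᴱ m , ne))

-- Vectors and systems of linear equations over a finite field

module _ {A : Set} where
  allVecs : List A → ∀ n → List (Vec A n)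
  allVecs xs zero    = [] ∷ []
  allVecs xs (suc n) = cartesianProductWith _∷_ xs (allVecs xs n)

  length-allVecs : ∀ xs n → length (allVecs xs n) ≡ length xs ^ n
  length-allVecs xs zero    = refl
  length-allVecs xs (suc n) = begin
    length (allVecs xs (suc n)) ≡⟨ sym (∑-one (allVecs xs (suc n))) ⟩
    ∑ (allVecs xs (suc n)) (λ _ → 1) ≡⟨ ∑-product _∷_ xs (allVecs xs n) (λ _ → 1) ⟩
    ∑ xs (λ _ → ∑ (allVecs xs n) (λ _ → 1)) ≡⟨ ∑-const xs _ ⟩
    length xs * ∑ (allVecs xs n) (λ _ → 1) ≡⟨ cong (length xs *_) (trans (∑-one (allVecs xs n)) (length-allVecs xs n)) ⟩
    length xs ^ suc n ∎
    where open ≡-Reasoning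

  allVecsᴱ : ∀ {xs} → Enumerates (λ _ → ⊤) xs → ∀ n → Enumerates (λ _ → ⊤) (allVecs xs n)
  allVecsᴱ E zero    = (All.[] ∷ []) , (λ _ _ → tt) , λ { [] _ → here refl }
  allVecsᴱ E (suc n) = Uniqueₚ.cartesianProductWith⁺ _∷_ Vecₚ.∷-injective (unique E) (unique (allVecsᴱ E n))
    , (λ _ _ → tt)
    , λ { (x ∷ v) _ → ∈-cartesianProductWith⁺ _∷_ (complete E tt) (complete (allVecsᴱ E n) tt) }

module Vectors (F : Field) where
  open FieldTheory F public
  open Field F public using (Vec4; dot; scale; add)

  infix 4 _≟ᵛ_
  _≟ᵛ_ : ∀ {n} → DecidableEquality (Vec Carrier n)
  _≟ᵛ_ = Vecₚ.≡-dec _≟_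

  𝟎 : Vec4
  𝟎 = 0# ∷ 0# ∷ 0# ∷ 0# ∷ []

  lin : Carrier → Vec4 → Carrier → Vec4 → Vec4
  lin a u b v = add (scale a u) (scale b v)

  unit : Fin 4 → Vec4
  unit zero                   = 1# ∷ 0# ∷ 0# ∷ 0# ∷ []
  unit (suc zero)             = 0# ∷ 1# ∷ 0# ∷ 0# ∷ []
  unit (suc (suc zero))       = 0# ∷ 0# ∷ 1# ∷ 0# ∷ []
  unit (suc (suc (suc zero))) = 0# ∷ 0# ∷ 0# ∷ 1# ∷ []

  vec-ext : ∀ {u v : Vec4} → (∀ k → lookup u k ≡ lookup v k) → u ≡ v
  vec-ext {u} {v} h = trans (sym (Vecₚ.tabulate∘lookup u)) (trans (Vecₚ.tabulate-cong h) (Vecₚ.tabulate∘lookup v))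

  lookup-scale : ∀ a v k → lookup (scale a v) k ≡ a ⊗ lookup v k
  lookup-scale a v k = Vecₚ.lookup-map k (a ⊗_) v

  lookup-add : ∀ u v k → lookup (add u v) k ≡ lookup u k ⊕ lookup v k
  lookup-add (_ ∷ _ ∷ _ ∷ _ ∷ []) (_ ∷ _ ∷ _ ∷ _ ∷ []) zero                   = refl
  lookup-add (_ ∷ _ ∷ _ ∷ _ ∷ []) (_ ∷ _ ∷ _ ∷ _ ∷ []) (suc zero)             = refl
  lookup-add (_ ∷ _ ∷ _ ∷ _ ∷ []) (_ ∷ _ ∷ _ ∷ _ ∷ []) (suc (suc zero))       = refl
  lookup-add (_ ∷ _ ∷ _ ∷ _ ∷ []) (_ ∷ _ ∷ _ ∷ _ ∷ []) (suc (suc (suc zero))) = refl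

  lookup-lin : ∀ a u b v k → lookup (lin a u b v) k ≡ a ⊗ lookup u k ⊕ b ⊗ lookup v k
  lookup-lin a u b v k = trans (lookup-add (scale a u) (scale b v) k) (cong₂ _⊕_ (lookup-scale a u k) (lookup-scale b v k))

  lookup-𝟎 : ∀ k → lookup 𝟎 k ≡ 0#
  lookup-𝟎 k = Vecₚ.lookup-replicate k 0#

  dot-unit : ∀ k v → dot (unit k) v ≡ lookup v k
  dot-unit zero (a ∷ b ∷ c ∷ d ∷ []) =
    solve 4 (λ a b c d → :1 :* a :+ :0 :* b :+ :0 :* c :+ :0 :* d := a) refl a b c d
  dot-unit (suc zero) (a ∷ b ∷ c ∷ d ∷ []) =
    solve 4 (λ a b c d → :0 :* a :+ :1 :* b :+ :0 :* c :+ :0 :* d := b) refl a b c d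
  dot-unit (suc (suc zero)) (a ∷ b ∷ c ∷ d ∷ []) =
    solve 4 (λ a b c d → :0 :* a :+ :0 :* b :+ :1 :* c :+ :0 :* d := c) refl a b c d
  dot-unit (suc (suc (suc zero))) (a ∷ b ∷ c ∷ d ∷ []) =
    solve 4 (λ a b c d → :0 :* a :+ :0 :* b :+ :0 :* c :+ :1 :* d := d) refl a b c d

  dot-comm : ∀ u v → dot u v ≡ dot v u
  dot-comm (a ∷ b ∷ c ∷ d ∷ []) (x ∷ y ∷ z ∷ w ∷ []) =
    cong₂ _⊕_ (cong₂ _⊕_ (cong₂ _⊕_ (*-comm a x) (*-comm b y)) (*-comm c z)) (*-comm d w)

  dot-addˡ : ∀ u v w → dot (add u v) w ≡ dot u w ⊕ dot v w
  dot-addˡ (a ∷ b ∷ c ∷ d ∷ []) (a′ ∷ b′ ∷ c′ ∷ d′ ∷ []) (x ∷ y ∷ z ∷ w ∷ []) =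
    solve 12 (λ a b c d a′ b′ c′ d′ x y z w →
      (a :+ a′) :* x :+ (b :+ b′) :* y :+ (c :+ c′) :* z :+ (d :+ d′) :* w :=
      (a :* x :+ b :* y :+ c :* z :+ d :* w) :+ (a′ :* x :+ b′ :* y :+ c′ :* z :+ d′ :* w)) refl a b c d a′ b′ c′ d′ x y z w

  dot-scaleˡ : ∀ k u w → dot (scale k u) w ≡ k ⊗ dot u w
  dot-scaleˡ k (a ∷ b ∷ c ∷ d ∷ []) (x ∷ y ∷ z ∷ w ∷ []) =
    solve 9 (λ k a b c d x y z w →
      k :* a :* x :+ k :* b :* y :+ k :* c :* z :+ k :* d :* w := k :* (a :* x :+ b :* y :+ c :* z :+ d :* w))
      refl k a b c d x y z w

  dot-linˡ : ∀ a u b v w → dot (lin a u b v) w ≡ a ⊗ dot u w ⊕ b ⊗ dot v w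
  dot-linˡ a u b v w = trans (dot-addˡ (scale a u) (scale b v) w) (cong₂ _⊕_ (dot-scaleˡ a u w) (dot-scaleˡ b v w))

  dot-linʳ : ∀ a u b v w → dot w (lin a u b v) ≡ a ⊗ dot w u ⊕ b ⊗ dot w v
  dot-linʳ a u b v w = trans (dot-comm w (lin a u b v))
    (trans (dot-linˡ a u b v w) (cong₂ (λ p q → a ⊗ p ⊕ b ⊗ q) (dot-comm u w) (dot-comm v w)))

  dot-𝟎ˡ : ∀ w → dot 𝟎 w ≡ 0#
  dot-𝟎ˡ (x ∷ y ∷ z ∷ w ∷ []) = solve 4 (λ x y z w →
    :0 :* x :+ :0 :* y :+ :0 :* z :+ :0 :* w := :0) refl x y z w

  0⊕0 : ∀ a b {x y} → x ≡ 0# → y ≡ 0# → a ⊗ x ⊕ b ⊗ y ≡ 0#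
  0⊕0 a b refl refl = solve 2 (λ a b → a :* :0 :+ b :* :0 := :0) refl a b

  lin-kills : ∀ a u b v w → dot u w ≡ 0# → dot v w ≡ 0# → dot (lin a u b v) w ≡ 0#
  lin-kills a u b v w hu hv = trans (dot-linˡ a u b v w) (0⊕0 a b hu hv)

  scale-scale : ∀ a b v → scale a (scale b v) ≡ scale (a ⊗ b) v
  scale-scale a b v = trans (sym (Vecₚ.map-∘ (a ⊗_) (b ⊗_) v)) (Vecₚ.map-cong (λ x → sym (*-assoc a b x)) v)

  scale-1 : ∀ v → scale 1# v ≡ v
  scale-1 v = trans (Vecₚ.map-cong *-identityˡ v) (Vecₚ.map-id v)

  scale-recip : ∀ {a} (h : a ≢ 0#) v → scale a (scale (recip h) v) ≡ v
  scale-recip h v = trans (scale-scale _ _ v) (trans (cong (λ z → scale z v) (recipʳ h)) (scale-1 v))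

  scale-0 : ∀ v → scale 0# v ≡ 𝟎
  scale-0 v = vec-ext λ k → trans (lookup-scale 0# v k) (trans (zeroˡ _) (sym (lookup-𝟎 k)))

  scale-≢𝟎 : ∀ {a v} → a ≢ 0# → v ≢ 𝟎 → scale a v ≢ 𝟎
  scale-≢𝟎 {a} {v} ha hv e = hv (vec-ext λ k → trans (xy≡0⇒y≡0 ha
    (trans (sym (lookup-scale a v k)) (trans (cong (λ z → lookup z k) e) (lookup-𝟎 k)))) (sym (lookup-𝟎 k)))

  Independent : Vec4 → Vec4 → Set
  Independent u v = ∀ a b → lin a u b v ≡ 𝟎 → a ≡ 0# × b ≡ 0#

  LeadingAt : ∀ {n} → Vec Carrier n → Fin n → Set
  LeadingAt v i = (∀ k → k Fin.< i → lookup v k ≡ 0#) × lookup v i ≢ 0#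

  leading : ∀ {n} (v : Vec Carrier n) → (∀ k → lookup v k ≡ 0#) ⊎ ∃[ i ] LeadingAt v i
  leading []      = inj₁ λ ()
  leading (x ∷ v) with x ≟ 0#
  ... | no x≢0 = inj₂ (zero , (λ _ ()) , x≢0)
  ... | yes x≡0 with leading v
  ...   | inj₁ h = inj₁ λ { zero → x≡0 ; (suc k) → h k }
  ...   | inj₂ (i , h , ne) = inj₂ (suc i , (λ { zero _ → x≡0 ; (suc k) (s≤s lt) → h k lt }) , ne)

  leading-≢𝟎 : ∀ {v} → v ≢ 𝟎 → ∃[ i ] LeadingAt v i
  leading-≢𝟎 {v} h with leading v
  ... | inj₁ z = ⊥-elim (h (vec-ext λ k → trans (z k) (sym (lookup-𝟎 k))))
  ... | inj₂ l = l

  vectors : List Vec4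
  vectors = allVecs elements 4

  vectorsᴱ : Enumerates (λ _ → ⊤) vectors
  vectorsᴱ = allVecsᴱ elementsᴱ 4

  nonzero? : ∀ (v : Vec4) → Dec (v ≢ 𝟎)
  nonzero? v = ¬? (v ≟ᵛ 𝟎)

  values : ∀ {k} → Vec Vec4 k → Vec4 → Vec Carrier k
  values ps x = Vec.map (dot x) ps

  fibre : ∀ {k} → Vec Vec4 k → Vec Carrier k → ℕ
  fibre ps w = ∑ vectors (λ x → 𝟙 (values ps x ≟ᵛ w))

  zeros : ∀ k → Vec Carrier k
  zeros k = Vec.replicate k 0#

  values-add-kernel : ∀ {k} (ps : Vec Vec4 k) x y a → values ps y ≡ zeros k → values ps (lin 1# x a y) ≡ values ps x
  values-add-kernel []       x y a h = refl
  values-add-kernel (p ∷ ps) x y a h = cong₂ _∷_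
    (trans (dot-linˡ 1# x a y p) (trans (cong (λ z → 1# ⊗ dot x p ⊕ a ⊗ z) (Vecₚ.∷-injectiveˡ h))
      (solve 2 (λ d a → :1 :* d :+ a :* :0 := d) refl (dot x p) a)))
    (values-add-kernel ps x y a (Vecₚ.∷-injectiveʳ h))

  private
    values-sub : ∀ {k} (ps : Vec Vec4 k) x y → values ps x ≡ values ps y → values ps (lin 1# x (⊝ 1#) y) ≡ zeros k
    values-sub []       x y h = refl
    values-sub (p ∷ ps) x y h = cong₂ _∷_
      (trans (dot-linˡ 1# x (⊝ 1#) y p) (trans (cong (λ z → 1# ⊗ z ⊕ ⊝ 1# ⊗ dot y p) (Vecₚ.∷-injectiveˡ h))
        (solve 1 (λ d → :1 :* d :+ :- :1 :* d := :0) refl (dot y p))))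
      (values-sub ps x y (Vecₚ.∷-injectiveʳ h))

    sub-add : ∀ x y → lin 1# (lin 1# x (⊝ 1#) y) 1# y ≡ x
    sub-add x y = vec-ext λ k → trans (lookup-lin 1# (lin 1# x (⊝ 1#) y) 1# y k)
      (trans (cong (λ z → 1# ⊗ z ⊕ 1# ⊗ lookup y k) (lookup-lin 1# x (⊝ 1#) y k))
        (solve 2 (λ x y → :1 :* (:1 :* x :+ :- :1 :* y) :+ :1 :* y := x) refl (lookup x k) (lookup y k)))

    add-sub : ∀ x y → lin 1# (lin 1# x 1# y) (⊝ 1#) y ≡ x
    add-sub x y = vec-ext λ k → trans (lookup-lin 1# (lin 1# x 1# y) (⊝ 1#) y k)
      (trans (cong (λ z → 1# ⊗ z ⊕ ⊝ 1# ⊗ lookup y k) (lookup-lin 1# x 1# y k))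
        (solve 2 (λ x y → :1 :* (:1 :* x :+ :1 :* y) :+ :- :1 :* y := x) refl (lookup x k) (lookup y k)))

    values-translate : ∀ {k} (ps : Vec Vec4 k) x y → values ps x ≡ zeros k → values ps (lin 1# x 1# y) ≡ values ps y
    values-translate []       x y h = refl
    values-translate (p ∷ ps) x y h = cong₂ _∷_
      (trans (dot-linˡ 1# x 1# y p) (trans (cong (λ z → 1# ⊗ z ⊕ 1# ⊗ dot y p) (Vecₚ.∷-injectiveˡ h))
        (solve 1 (λ d → :1 :* :0 :+ :1 :* d := d) refl (dot y p))))
      (values-translate ps x y (Vecₚ.∷-injectiveʳ h))

  -- Adding the particular solution `y` is a bijection from the kernel onto the fibre.
  fibre-translate : ∀ {k} (ps : Vec Vec4 k) w y → values ps y ≡ w → fibre ps w ≡ fibre ps (zeros k)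
  fibre-translate {k} ps w y h = sym (trans
    (∑-ext vectors λ x → 𝟙-cong (values ps x ≟ᵛ zeros k) (values ps (lin 1# x 1# y) ≟ᵛ w)
      (λ e → trans (values-translate ps x y e) h)
      (λ e → trans (cong (values ps) (sym (add-sub x y))) (values-sub ps (lin 1# x 1# y) y (trans e (sym h)))))
    (∑-bij vectorsᴱ vectorsᴱ _≟ᵛ_ (λ x → lin 1# x 1# y)
      (λ _ _ → tt) (λ x _ → lin 1# x (⊝ 1#) y , tt , sub-add x y)
      (λ x x′ _ _ e → trans (sym (add-sub x y)) (trans (cong (λ z → lin 1# z (⊝ 1#) y) e) (add-sub x′ y))) (λ x → 𝟙 (values ps x ≟ᵛ w))))

  ∑-fibre : ∀ {k} (ps : Vec Vec4 k) → ∑ (allVecs elements k) (fibre ps) ≡ order ^ 4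
  ∑-fibre {k} ps = begin
    ∑ (allVecs elements k) (fibre ps)
      ≡⟨ ∑-swap (allVecs elements k) vectors _ ⟩
    ∑ vectors (λ x → ∑ (allVecs elements k) (λ w → 𝟙 (values ps x ≟ᵛ w)))
      ≡⟨ ∑-ext vectors (λ x → count-one (allVecsᴱ elementsᴱ k) (values ps x ≟ᵛ_) (values ps x) tt refl (λ _ _ → sym)) ⟩
    ∑ vectors (λ _ → 1)
      ≡⟨ ∑-one vectors ⟩
    length vectors
      ≡⟨ length-allVecs elements 4 ⟩
    order ^ 4 ∎
    where open ≡-Reasoning

  -- The rank inequality as a count: the fibres over the q^k possible values partition the q⁴
  -- vectors, and each of them is empty or a translate of the kernel.
  kernel-≥ : ∀ {k} (ps : Vec Vec4 k) → order ^ 4 ≤ order ^ k * fibre ps (zeros k)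
  kernel-≥ {k} ps = subst₂ _≤_ (∑-fibre ps)
    (trans (∑-const (allVecs elements k) _) (cong (_* fibre ps (zeros k)) (length-allVecs elements k)))
    (∑-mono (allVecs elements k) λ w _ → le w)
    where
    le : ∀ w → fibre ps w ≤ fibre ps (zeros k)
    le w with fibre ps w ℕₚ.≟ 0
    ... | yes e rewrite e = z≤n
    ... | no ne with count-witness vectorsᴱ (λ x → values ps x ≟ᵛ w) ne
    ...   | y , _ , e = ℕₚ.≤-reflexive (fibre-translate ps w y e)

  -- When every value is attained, all q^k fibres are translates of the kernel and share the q⁴
  -- vectors equally. Independence of conditions enters the later counts only in this form.
  fibre-surjective : ∀ {k} (ps : Vec Vec4 k) → (∀ w → ∃[ x ] values ps x ≡ w) → ∀ w →
                     order ^ k * fibre ps w ≡ order ^ 4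
  fibre-surjective {k} ps surj w = begin
    order ^ k * fibre ps w
      ≡⟨ cong (_* fibre ps w) (sym (length-allVecs elements k)) ⟩
    length (allVecs elements k) * fibre ps w
      ≡⟨ sym (∑-const (allVecs elements k) _) ⟩
    ∑ (allVecs elements k) (λ _ → fibre ps w)
      ≡⟨ ∑-ext (allVecs elements k) (λ w′ → trans (const w) (sym (const w′))) ⟩
    ∑ (allVecs elements k) (fibre ps)
      ≡⟨ ∑-fibre ps ⟩
    order ^ 4 ∎
    where
    open ≡-Reasoning
    const : ∀ w → fibre ps w ≡ fibre ps (zeros k)
    const w = fibre-translate ps w (proj₁ (surj w)) (proj₂ (surj w))

-- Points, planes and lines of PG(3,q)

module Lines (F : Field) where
  open Vectors F public

  private
    -- The notions opened from `PG3` below involve the base field alone, so any extension serves to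
    -- instantiate them, and they unfold to the same types for the given `K` and `e`. Choosing `F`
    -- itself allows the whole theory to be applied a second time with `K` as base field.
    identity : Embedding F F
    identity = record { ι = id ; ι-+ = λ _ _ → refl ; ι-* = λ _ _ → refl ; ι-1 = refl }

  open PG3 F F identity public
    using (Line; IsLine; OnLine; Contains; Normalized; Proportional; External; InGammaPlane; RealAxis; GammaPlane; CurvePointsIn)

  order≡ : order ≡ suc (length units)
  order≡ = trans (sym length-units) (ℕₚ.+-comm _ 1)

  instance
    order-nonZero : ℕ.NonZero order
    order-nonZero = ℕ.≢-nonZero (λ e → ℕₚ.1+n≢0 (trans (sym order≡) e))

  -- Planes, as normalized vectors

  Normalized? : Decidable Normalized
  Normalized? v = Finₚ.any? λ i → Finₚ.all? (λ k → (k Finₚ.<? i) →-dec (lookup v k ≟ 0#)) ×-dec (lookup v i ≟ 1#)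

  planes : List Vec4
  planes = filter Normalized? vectors

  planesᴱ : Enumerates Normalized planes
  planesᴱ = enum-map (λ _ → proj₂) (λ _ n → tt , n) (enum-filter vectorsᴱ Normalized?)

  nonzeros : List Vec4
  nonzeros = filter nonzero? vectors

  nonzerosᴱ : Enumerates (_≢ 𝟎) nonzeros
  nonzerosᴱ = enum-map (λ _ → proj₂) (λ _ n → tt , n) (enum-filter vectorsᴱ nonzero?)

  normalized-≢𝟎 : ∀ {v} → Normalized v → v ≢ 𝟎
  normalized-≢𝟎 (i , _ , e) refl = 0≢1 (trans (sym (lookup-𝟎 i)) e)

  normalize : ∀ {v} → v ≢ 𝟎 → ∃[ k ] ∃[ u ] (k ≢ 0# × Normalized u × scale k u ≡ v)
  normalize {v} h with leading-≢𝟎 h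
  ... | i , z , ne = lookup v i , scale (recip ne) v , ne
      , (i , (λ k lt → trans (lookup-scale _ v k) (trans (cong (recip ne ⊗_) (z k lt)) (zeroʳ _)))
           , trans (lookup-scale _ v i) (recipˡ ne))
      , scale-recip ne v

  private
    leading-unique : ∀ {k k′ u u′} ((i , _) : Normalized u) ((i′ , _) : Normalized u′) → k ≢ 0# →
                     scale k u ≡ scale k′ u′ → ¬ (i Fin.< i′)
    leading-unique {k} {k′} {u} {u′} (i , z , e) (i′ , z′ , e′) hk eq lt = hk (begin
      k ≡⟨ sym (*-identityʳ k) ⟩
      k ⊗ 1# ≡⟨ cong (k ⊗_) (sym e) ⟩
      k ⊗ lookup u i ≡⟨ sym (lookup-scale k u i) ⟩
      lookup (scale k u) i ≡⟨ cong (λ w → lookup w i) eq ⟩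
      lookup (scale k′ u′) i ≡⟨ lookup-scale k′ u′ i ⟩
      k′ ⊗ lookup u′ i ≡⟨ cong (k′ ⊗_) (z′ i lt) ⟩
      k′ ⊗ 0# ≡⟨ zeroʳ k′ ⟩
      0# ∎)
      where open ≡-Reasoning

  normalize-unique : ∀ {k k′ u u′} → Normalized u → Normalized u′ → k ≢ 0# → k′ ≢ 0# →
                     scale k u ≡ scale k′ u′ → k ≡ k′ × u ≡ u′
  normalize-unique {k} {k′} {u} {u′} n@(i , z , e) n′@(i′ , z′ , e′) hk hk′ eq with Finₚ.<-cmp i i′
  ... | tri< lt _ _ = ⊥-elim (leading-unique n n′ hk eq lt)
  ... | tri> _ _ gt = ⊥-elim (leading-unique n′ n hk′ (sym eq) gt)
  ... | tri≈ _ refl _ = k≡k′ , vec-ext λ j → cancelˡ hk (trans (at j) (cong (_⊗ lookup u′ j) (sym k≡k′)))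
    where
    at : ∀ j → k ⊗ lookup u j ≡ k′ ⊗ lookup u′ j
    at j = trans (sym (lookup-scale k u j)) (trans (cong (λ w → lookup w j) eq) (lookup-scale k′ u′ j))
    k≡k′ : k ≡ k′
    k≡k′ = trans (sym (*-identityʳ k)) (trans (cong (k ⊗_) (sym e)) (trans (at i) (trans (cong (k′ ⊗_) e′) (*-identityʳ k′))))

  -- A nonzero vector is a unit multiple of exactly one normalized vector, so a quantity that
  -- ignores scaling is met q - 1 times for each plane.
  ∑-projective : ∀ (h : Vec4 → ℕ) → (∀ k v → k ≢ 0# → h (scale k v) ≡ h v) →
                 ∑ nonzeros h ≡ length units * ∑ planes h
  ∑-projective h inv = begin
    ∑ nonzeros h
      ≡⟨ sym (∑-bij (enum-product unitsᴱ planesᴱ) nonzerosᴱ _≟ᵛ_ (λ (k , u) → scale k u)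
           (λ (k , u) ((_ , hk) , n) → scale-≢𝟎 hk (normalized-≢𝟎 n))
           (λ v hv → let (k , u , hk , n , e) = normalize hv in (k , u) , ((tt , hk) , n) , e)
           (λ (k , u) (k′ , u′) ((_ , hk) , n) ((_ , hk′) , n′) e →
             let (p , p′) = normalize-unique n n′ hk hk′ e in cong₂ _,_ p p′) h) ⟩
    ∑ (cartesianProduct units planes) (λ (k , u) → h (scale k u))
      ≡⟨ ∑-product _,_ units planes _ ⟩
    ∑ units (λ k → ∑ planes (λ u → h (scale k u)))
      ≡⟨ ∑-congᴱ unitsᴱ (λ k (_ , hk) → ∑-ext planes (λ u → inv k u hk)) ⟩
    ∑ units (λ _ → ∑ planes h)
      ≡⟨ ∑-const units _ ⟩
    length units * ∑ planes h ∎
    where open ≡-Reasoning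

  ∑-vectors : ∀ (h : Vec4 → ℕ) → ∑ vectors h ≡ ∑ nonzeros h + h 𝟎
  ∑-vectors h = sym (trans (cong (_+ h 𝟎) (∑-filter nonzero? vectors h))
    (∑-remove (unique vectorsᴱ) _≟ᵛ_ h 𝟎 (complete vectorsᴱ tt)))

  -- The final 1 is the zero vector, which solves every homogeneous system but is no plane.
  count-planes : ∀ {Q : Vec4 → Set} (Q? : Decidable Q) → (∀ k v → k ≢ 0# → Q (scale k v) → Q v) →
                 (∀ k v → k ≢ 0# → Q v → Q (scale k v)) → Q 𝟎 →
                 ∑ vectors (𝟙 ∘ Q?) ≡ length units * ∑ planes (𝟙 ∘ Q?) + 1
  count-planes Q? f g q0 = trans (∑-vectors (𝟙 ∘ Q?))
    (cong₂ _+_ (∑-projective (𝟙 ∘ Q?) (λ k v hk → 𝟙-cong (Q? (scale k v)) (Q? v) (f k v hk) (g k v hk))) (𝟙-yes (Q? 𝟎) q0))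

  -- Lines and their pencils of planes

  IsLine? : Decidable IsLine
  IsLine? (r₁ , r₂) = Finₚ.any? λ i → Finₚ.any? λ j →
      (i Finₚ.<? j)
    ×-dec Finₚ.all? (λ k → (k Finₚ.<? i) →-dec (lookup r₁ k ≟ 0#))
    ×-dec (lookup r₁ i ≟ 1#)
    ×-dec (lookup r₁ j ≟ 0#)
    ×-dec Finₚ.all? (λ k → (k Finₚ.<? j) →-dec (lookup r₂ k ≟ 0#))
    ×-dec (lookup r₂ j ≟ 1#)

  lines : List Line
  lines = filter IsLine? (cartesianProduct vectors vectors)

  linesᴱ : Enumerates IsLine lines
  linesᴱ = enum-map (λ _ → proj₂) (λ _ l → (tt , tt) , l) (enum-filter (enum-product vectorsᴱ vectorsᴱ) IsLine?)

  Contains? : ∀ c L → Dec (Contains c L)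
  Contains? c (r₁ , r₂) = (dot c r₁ ≟ 0#) ×-dec (dot c r₂ ≟ 0#)

  OnLine? : ∀ v L → Dec (OnLine v L)
  OnLine? v (r₁ , r₂) = map′ (λ (a , _ , b , _ , e) → a , b , e) (λ (a , b , e) → a , tt , b , tt , e)
    (any-enum elementsᴱ λ a → any-enum elementsᴱ λ b → v ≟ᵛ lin a r₁ b r₂)

  Contains-lin : ∀ a c b d L → Contains c L → Contains d L → Contains (lin a c b d) L
  Contains-lin a c b d (r₁ , r₂) (c₁ , c₂) (d₁ , d₂) = lin-kills a c b d r₁ c₁ d₁ , lin-kills a c b d r₂ c₂ d₂

  Contains-scale : ∀ k c L → Contains c L → Contains (scale k c) L
  Contains-scale k c (r₁ , r₂) (e₁ , e₂) = at r₁ e₁ , at r₂ e₂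
    where
    at : ∀ r → dot c r ≡ 0# → dot (scale k c) r ≡ 0#
    at r e = trans (dot-scaleˡ k c r) (trans (cong (k ⊗_) e) (zeroʳ k))

  Contains-unscale : ∀ k c L → k ≢ 0# → Contains (scale k c) L → Contains c L
  Contains-unscale k c (r₁ , r₂) hk (e₁ , e₂) = at r₁ e₁ , at r₂ e₂
    where
    at : ∀ r → dot (scale k c) r ≡ 0# → dot c r ≡ 0#
    at r e = xy≡0⇒y≡0 hk (trans (sym (dot-scaleˡ k c r)) e)

  Contains-𝟎 : ∀ L → Contains 𝟎 L
  Contains-𝟎 (r₁ , r₂) = dot-𝟎ˡ r₁ , dot-𝟎ˡ r₂

  OnLine⇒killed : ∀ {v} L → OnLine v L → ∀ c → Contains c L → dot c v ≡ 0#
  OnLine⇒killed (r₁ , r₂) (a , b , refl) c (e₁ , e₂) = trans (dot-linʳ a r₁ b r₂ c) (0⊕0 a b e₁ e₂)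

  module Pivots (r₁ r₂ : Vec4) (isLine : IsLine (r₁ , r₂)) where
    i j : Fin 4
    i = proj₁ isLine
    j = proj₁ (proj₂ isLine)
    i<j : i Fin.< j
    i<j = proj₁ (proj₂ (proj₂ isLine))
    zero₁ : ∀ k → k Fin.< i → lookup r₁ k ≡ 0#
    zero₁ = proj₁ (proj₂ (proj₂ (proj₂ isLine)))
    one₁ : lookup r₁ i ≡ 1#
    one₁ = proj₁ (proj₂ (proj₂ (proj₂ (proj₂ isLine))))
    zero₁ⱼ : lookup r₁ j ≡ 0#
    zero₁ⱼ = proj₁ (proj₂ (proj₂ (proj₂ (proj₂ (proj₂ isLine)))))
    zero₂ : ∀ k → k Fin.< j → lookup r₂ k ≡ 0#
    zero₂ = proj₁ (proj₂ (proj₂ (proj₂ (proj₂ (proj₂ (proj₂ isLine))))))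
    one₂ : lookup r₂ j ≡ 1#
    one₂ = proj₂ (proj₂ (proj₂ (proj₂ (proj₂ (proj₂ (proj₂ isLine))))))
    zero₂ᵢ : lookup r₂ i ≡ 0#
    zero₂ᵢ = zero₂ i i<j

  -- For each k, the plane e_k - (r₁)_k e_i - (r₂)_k e_j contains the line with pivots i and j.
  killed⇒OnLine : ∀ {L} → IsLine L → ∀ {v} → (∀ c → Contains c L → dot c v ≡ 0#) → OnLine v L
  killed⇒OnLine {r₁ , r₂} isLine {v} h = lookup v i , lookup v j , vec-ext λ k →
    trans (coordinate k) (sym (lookup-lin (lookup v i) r₁ (lookup v j) r₂ k))
    where
    open Pivots r₁ r₂ isLine
    plane : Fin 4 → Vec4
    plane k = lin 1# (unit k) (⊝ 1#) (lin (lookup r₁ k) (unit i) (lookup r₂ k) (unit j))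
    dot-plane : ∀ k w → dot (plane k) w ≡ lookup w k ⊖ (lookup r₁ k ⊗ lookup w i ⊕ lookup r₂ k ⊗ lookup w j)
    dot-plane k w = begin
      dot (plane k) w
        ≡⟨ dot-linˡ 1# (unit k) (⊝ 1#) (lin (lookup r₁ k) (unit i) (lookup r₂ k) (unit j)) w ⟩
      1# ⊗ dot (unit k) w ⊕ ⊝ 1# ⊗ dot (lin (lookup r₁ k) (unit i) (lookup r₂ k) (unit j)) w
        ≡⟨ cong₂ (λ x y → 1# ⊗ x ⊕ ⊝ 1# ⊗ y) (dot-unit k w)
             (trans (dot-linˡ (lookup r₁ k) (unit i) (lookup r₂ k) (unit j) w)
               (cong₂ (λ x y → lookup r₁ k ⊗ x ⊕ lookup r₂ k ⊗ y) (dot-unit i w) (dot-unit j w))) ⟩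
      1# ⊗ lookup w k ⊕ ⊝ 1# ⊗ (lookup r₁ k ⊗ lookup w i ⊕ lookup r₂ k ⊗ lookup w j)
        ≡⟨ solve 2 (λ x y → :1 :* x :+ :- :1 :* y := x :- y) refl (lookup w k) _ ⟩
      lookup w k ⊖ (lookup r₁ k ⊗ lookup w i ⊕ lookup r₂ k ⊗ lookup w j) ∎
      where open ≡-Reasoning
    contains : ∀ k → Contains (plane k) (r₁ , r₂)
    contains k =
        trans (dot-plane k r₁) (trans (cong₂ (λ x y → lookup r₁ k ⊖ (lookup r₁ k ⊗ x ⊕ lookup r₂ k ⊗ y)) one₁ zero₁ⱼ)
          (solve 2 (λ x y → x :- (x :* :1 :+ y :* :0) := :0) refl (lookup r₁ k) (lookup r₂ k)))
      , trans (dot-plane k r₂) (trans (cong₂ (λ x y → lookup r₂ k ⊖ (lookup r₁ k ⊗ x ⊕ lookup r₂ k ⊗ y)) zero₂ᵢ one₂)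
          (solve 2 (λ x y → y :- (x :* :0 :+ y :* :1) := :0) refl (lookup r₁ k) (lookup r₂ k)))
    coordinate : ∀ k → lookup v k ≡ lookup v i ⊗ lookup r₁ k ⊕ lookup v j ⊗ lookup r₂ k
    coordinate k = trans (x-y≡0⇒x≡y (trans (sym (dot-plane k v)) (h (plane k) (contains k))))
      (cong₂ _⊕_ (*-comm _ _) (*-comm _ _))

  -- Vectors supported on the two pivots realise every pair of values on the two rows, so the two
  -- equations are independent. The zero vector is included in this count of the pencil.
  perp-count : ∀ {L} → IsLine L → ∑ vectors (λ c → 𝟙 (Contains? c L)) ≡ order * order
  perp-count {r₁ , r₂} isLine = ℕₚ.*-cancelˡ-≡ _ _ (order ^ 2) {{ℕₚ.m^n≢0 order 2}} (begin
    order ^ 2 * ∑ vectors (λ c → 𝟙 (Contains? c (r₁ , r₂)))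
      ≡⟨ cong (order ^ 2 *_) (∑-ext vectors λ c → 𝟙-cong (Contains? c (r₁ , r₂)) (values (r₁ ∷ r₂ ∷ []) c ≟ᵛ zeros 2)
           (λ (e₁ , e₂) → cong₂ _∷_ e₁ (cong (_∷ []) e₂))
           (λ e → Vecₚ.∷-injectiveˡ e , Vecₚ.∷-injectiveˡ (Vecₚ.∷-injectiveʳ e))) ⟩
    order ^ 2 * fibre (r₁ ∷ r₂ ∷ []) (zeros 2)
      ≡⟨ fibre-surjective (r₁ ∷ r₂ ∷ []) surj (zeros 2) ⟩
    order ^ 4
      ≡⟨ ℕₚ.^-distribˡ-+-* order 2 2 ⟩
    order ^ 2 * order ^ 2
      ≡⟨ cong (λ z → order ^ 2 * (order * z)) (ℕₚ.*-identityʳ order) ⟩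
    order ^ 2 * (order * order) ∎)
    where
    open ≡-Reasoning
    open Pivots r₁ r₂ isLine
    surj : ∀ w → ∃[ x ] values (r₁ ∷ r₂ ∷ []) x ≡ w
    surj (x ∷ y ∷ []) = lin x (unit i) y (unit j) , cong₂ _∷_ (at one₁ zero₁ⱼ (solve 2 (λ x y → x :* :1 :+ y :* :0 := x) refl x y))
      (cong (_∷ []) (at zero₂ᵢ one₂ (solve 2 (λ x y → x :* :0 :+ y :* :1 := y) refl x y)))
      where
      at : ∀ {r p p′ z} → lookup r i ≡ p → lookup r j ≡ p′ → x ⊗ p ⊕ y ⊗ p′ ≡ z → dot (lin x (unit i) y (unit j)) r ≡ z
      at {r} refl refl e = trans (dot-linˡ x (unit i) y (unit j) r) (trans (cong₂ (λ p q → x ⊗ p ⊕ y ⊗ q) (dot-unit i r) (dot-unit j r)) e)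

module ℕ-Solver where
  open +-*-Solver public using () renaming (solve to solveℕ; _:=_ to _:≡_; _:+_ to _:⊕_; _:*_ to _:⊗_; con to conℕ)

-- Pencils of planes, and the meet of two planes

module Incidence (F : Field) where
  open Lines F public
  open ℕ-Solver

  1<order : 1 < order
  1<order = subst (1 <_) (sym order≡) (s≤s (nonempty (complete unitsᴱ (tt , 1≢0))))
    where
    nonempty : ∀ {x : Carrier} {xs} → x ∈ xs → 1 ≤ length xs
    nonempty (here _)  = s≤s z≤n
    nonempty (there _) = s≤s z≤n

  -- Passes from the q² vectors of a pencil to its planes: (q² - 1) / (q - 1) = q + 1 for q = u + 1.
  square-pred : ∀ {u n} → suc u * suc u ≡ u * n + 1 → ℕ.NonZero u → n ≡ suc u + 1
  square-pred {u@(suc _)} {n} e _ = sym (ℕₚ.*-cancelˡ-≡ (suc u + 1) n u (ℕₚ.+-cancelʳ-≡ 1 _ _ (trans (expand u) e)))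
    where
    expand : ∀ u → u * (suc u + 1) + 1 ≡ suc u * suc u
    expand = solveℕ 1 (λ u → u :⊗ ((conℕ 1 :⊕ u) :⊕ conℕ 1) :⊕ conℕ 1 :≡ (conℕ 1 :⊕ u) :⊗ (conℕ 1 :⊕ u)) refl

  units-nonZero : ℕ.NonZero (length units)
  units-nonZero = ℕ.>-nonZero (ℕₚ.≤-pred (subst (1 <_) order≡ 1<order))

  perp-planes : ∀ {L} → IsLine L → ∑ planes (λ c → 𝟙 (Contains? c L)) ≡ order + 1
  perp-planes {L} isLine = trans (square-pred
    (trans (sym (cong₂ _*_ order≡ order≡)) (trans (sym (perp-count isLine))
      (count-planes (λ c → Contains? c L) (λ k v hk → Contains-unscale k v L hk) (λ k v _ → Contains-scale k v L) (Contains-𝟎 L))))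
    units-nonZero) (cong (_+ 1) (sym order≡))

  independent-injective : ∀ {c d} → Independent c d → ∀ {a b a′ b′} → lin a c b d ≡ lin a′ c b′ d → a ≡ a′ × b ≡ b′
  independent-injective {c} {d} ind {a} {b} {a′} {b′} e =
    let (p , q) = ind (a ⊖ a′) (b ⊖ b′) (vec-ext λ k → trans (lookup-lin _ c _ d k)
                    (trans (solve 6 (λ a a′ b b′ c d → (a :- a′) :* c :+ (b :- b′) :* d := (a :* c :+ b :* d) :- (a′ :* c :+ b′ :* d))
                              refl a a′ b b′ (lookup c k) (lookup d k))
                      (trans (x≡y⇒x-y≡0 (trans (sym (lookup-lin a c b d k)) (trans (cong (λ v → lookup v k) e) (lookup-lin a′ c b′ d k))))
                             (sym (lookup-𝟎 k)))))
    in x-y≡0⇒x≡y p , x-y≡0⇒x≡y q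
  scalarPairs : List (Carrier × Carrier)
  scalarPairs = cartesianProduct elements elements

  scalarPairsᴱ : Enumerates (λ _ → ⊤ × ⊤) scalarPairs
  scalarPairsᴱ = enum-product elementsᴱ elementsᴱ

  -- The span of two independent planes through a line has as many elements as its pencil.
  perp-span : ∀ {L} → IsLine L → ∀ {c d} → Independent c d → Contains c L → Contains d L →
              ∀ x → Contains x L → ∃[ a ] ∃[ b ] lin a c b d ≡ x
  perp-span {L} isLine {c} {d} ind hc hd x hx =
    let ((a , b) , _ , e) = count-witness scalarPairsᴱ {Q = λ (a , b) → lin a c b d ≡ x} (λ (a , b) → lin a c b d ≟ᵛ x)
          (λ z → ℕₚ.1+n≢0 (trans (sym (𝟙-yes (Contains? x L) hx)) (trans (sym tight) z)))
    in a , b , e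
    where
    f : Vec4 → ℕ
    f x = ∑ scalarPairs (λ (a , b) → 𝟙 (lin a c b d ≟ᵛ x))
    f≤ : ∀ x → f x ≤ 𝟙 (Contains? x L)
    f≤ x = 𝟙-upper (Contains? x L)
      (λ _ → count≤1 scalarPairsᴱ {Q = λ (a , b) → lin a c b d ≡ x} (λ (a , b) → lin a c b d ≟ᵛ x)
        λ (a , b) (a′ , b′) _ _ e e′ → let (p , q) = independent-injective ind (trans e (sym e′)) in cong₂ _,_ p q)
      (λ ¬h → count-zero scalarPairsᴱ {Q = λ (a , b) → lin a c b d ≡ x} (λ (a , b) → lin a c b d ≟ᵛ x)
        λ (a , b) _ e → ¬h (subst (λ x → Contains x L) e (Contains-lin a c b d L hc hd)))
    total : ∑ vectors f ≡ order * order
    total = begin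
      ∑ vectors f
        ≡⟨ ∑-swap vectors scalarPairs _ ⟩
      ∑ scalarPairs (λ (a , b) → ∑ vectors (λ x → 𝟙 (lin a c b d ≟ᵛ x)))
        ≡⟨ ∑-ext scalarPairs (λ (a , b) → count-one vectorsᴱ (lin a c b d ≟ᵛ_) (lin a c b d) tt refl (λ _ _ → sym)) ⟩
      ∑ scalarPairs (λ _ → 1)
        ≡⟨ ∑-product _,_ elements elements _ ⟩
      ∑ elements (λ _ → ∑ elements (λ _ → 1))
        ≡⟨ trans (∑-const elements _) (cong (order *_) (∑-one elements)) ⟩
      order * order ∎
      where open ≡-Reasoning
    tight : f x ≡ 𝟙 (Contains? x L)
    tight = ∑-tight vectors (λ x _ → f≤ x) (ℕₚ.≤-reflexive (trans (perp-count isLine) (sym total))) x (complete vectorsᴱ tt)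

  private
    pivot-≮ : ∀ r₁ r₂ s₁ s₂ (l : IsLine (r₁ , r₂)) (m : IsLine (s₁ , s₂)) → OnLine r₁ (s₁ , s₂) →
              ¬ (Pivots.i r₁ r₂ l Fin.< Pivots.i s₁ s₂ m)
    pivot-≮ r₁ r₂ s₁ s₂ l m (a , b , refl) lt = 1≢0 (trans (sym L.one₁) (trans (lookup-lin a s₁ b s₂ L.i)
      (0⊕0 a b (M.zero₁ L.i lt) (M.zero₂ L.i (Finₚ.<-trans lt M.i<j)))))
      where
      module L = Pivots r₁ r₂ l
      module M = Pivots s₁ s₂ m

  -- Mutual membership forces the leading positions to agree, since a combination of rows vanishes
  -- before the first pivot. The coefficients are then read off at the pivots, where reduced rows
  -- have entries 0 and 1.
  echelon-unique : ∀ {L M} → IsLine L → IsLine M → OnLine (proj₁ L) M → OnLine (proj₂ L) M →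
                   OnLine (proj₁ M) L → OnLine (proj₂ M) L → L ≡ M
  echelon-unique {r₁ , r₂} {s₁ , s₂} l m or₁@(a , b , er₁) (a₂ , b₂ , er₂) os₁ (c₂ , d₂ , es₂)
    with Finₚ.<-cmp (Pivots.i r₁ r₂ l) (Pivots.i s₁ s₂ m)
  ... | tri< lt _ _ = ⊥-elim (pivot-≮ r₁ r₂ s₁ s₂ l m or₁ lt)
  ... | tri> _ _ gt = ⊥-elim (pivot-≮ s₁ s₂ r₁ r₂ m l os₁ gt)
  ... | tri≈ _ i≡i′ _ = cong₂ _,_ r₁≡s₁ r₂≡s₂
    where
    module L = Pivots r₁ r₂ l
    module M = Pivots s₁ s₂ m
    sOne : lookup s₁ L.i ≡ 1#
    sOne = subst (λ i → lookup s₁ i ≡ 1#) (sym i≡i′) M.one₁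
    sZero : lookup s₂ L.i ≡ 0#
    sZero = subst (λ i → lookup s₂ i ≡ 0#) (sym i≡i′) M.zero₂ᵢ
    first : ∀ a b {x y z} → x ≡ 1# → y ≡ 0# → z ≡ a ⊗ x ⊕ b ⊗ y → a ≡ z
    first a b refl refl refl = solve 2 (λ a b → a := a :* :1 :+ b :* :0) refl a b
    second : ∀ a b {x y z} → x ≡ 0# → y ≡ 1# → z ≡ a ⊗ x ⊕ b ⊗ y → b ≡ z
    second a b refl refl refl = solve 2 (λ a b → b := a :* :0 :+ b :* :1) refl a b
    at : ∀ {v} a u b w → v ≡ lin a u b w → ∀ k → lookup v k ≡ a ⊗ lookup u k ⊕ b ⊗ lookup w k
    at a u b w e k = trans (cong (λ v → lookup v k) e) (lookup-lin a u b w k)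
    a₂≡0 : a₂ ≡ 0#
    a₂≡0 = trans (first a₂ b₂ sOne sZero (at a₂ s₁ b₂ s₂ er₂ L.i)) L.zero₂ᵢ
    c₂≡0 : c₂ ≡ 0#
    c₂≡0 = trans (first c₂ d₂ L.one₁ L.zero₂ᵢ (at c₂ r₁ d₂ r₂ es₂ L.i)) sZero
    tail₂ : ∀ k → lookup r₂ k ≡ b₂ ⊗ lookup s₂ k
    tail₂ k = trans (at a₂ s₁ b₂ s₂ er₂ k) (trans (cong (λ z → z ⊗ lookup s₁ k ⊕ b₂ ⊗ lookup s₂ k) a₂≡0)
      (solve 2 (λ x y → :0 :* x :+ y := y) refl (lookup s₁ k) (b₂ ⊗ lookup s₂ k)))
    tail₂′ : ∀ k → lookup s₂ k ≡ d₂ ⊗ lookup r₂ k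
    tail₂′ k = trans (at c₂ r₁ d₂ r₂ es₂ k) (trans (cong (λ z → z ⊗ lookup r₁ k ⊕ d₂ ⊗ lookup r₂ k) c₂≡0)
      (solve 2 (λ x y → :0 :* x :+ y := y) refl (lookup r₁ k) (d₂ ⊗ lookup r₂ k)))
    j≡j′ : L.j ≡ M.j
    j≡j′ with Finₚ.<-cmp L.j M.j
    ... | tri≈ _ e _ = e
    ... | tri< lt _ _ = ⊥-elim (1≢0 (trans (sym L.one₂) (trans (tail₂ L.j) (trans (cong (b₂ ⊗_) (M.zero₂ L.j lt)) (zeroʳ b₂)))))
    ... | tri> _ _ gt = ⊥-elim (1≢0 (trans (sym M.one₂) (trans (tail₂′ M.j) (trans (cong (d₂ ⊗_) (L.zero₂ M.j gt)) (zeroʳ d₂)))))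
    b₂≡1 : b₂ ≡ 1#
    b₂≡1 = trans (sym (*-identityʳ b₂)) (trans (cong (b₂ ⊗_) (sym M.one₂))
      (trans (sym (tail₂ M.j)) (subst (λ j → lookup r₂ j ≡ 1#) j≡j′ L.one₂)))
    r₂≡s₂ : r₂ ≡ s₂
    r₂≡s₂ = vec-ext λ k → trans (tail₂ k) (trans (cong (_⊗ lookup s₂ k) b₂≡1) (*-identityˡ _))
    a≡1 : a ≡ 1#
    a≡1 = trans (first a b sOne sZero (at a s₁ b s₂ er₁ L.i)) L.one₁
    b≡0 : b ≡ 0#
    b≡0 = trans (second a b (subst (λ j → lookup s₁ j ≡ 0#) (sym j≡j′) M.zero₁ⱼ)
      (subst (λ j → lookup s₂ j ≡ 1#) (sym j≡j′) M.one₂) (at a s₁ b s₂ er₁ L.j)) L.zero₁ⱼ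
    r₁≡s₁ : r₁ ≡ s₁
    r₁≡s₁ = vec-ext λ k → trans (at a s₁ b s₂ er₁ k) (trans (cong₂ (λ x y → x ⊗ lookup s₁ k ⊕ y ⊗ lookup s₂ k) a≡1 b≡0)
      (solve 2 (λ x y → :1 :* x :+ :0 :* y := x) refl (lookup s₁ k) (lookup s₂ k)))

  -- All pencils have the same size, so an inclusion is an equality. The rows of each line then lie
  -- on the other one, and reduced bases are unique.
  perp-⊆⇒≡ : ∀ {L M} → IsLine L → IsLine M → (∀ c → Contains c L → Contains c M) → L ≡ M
  perp-⊆⇒≡ {L} {M} l m L⊆M = echelon-unique l m
    (killed⇒OnLine m λ c h → proj₁ (M⊆L c h)) (killed⇒OnLine m λ c h → proj₂ (M⊆L c h))
    (killed⇒OnLine l λ c h → proj₁ (L⊆M c h)) (killed⇒OnLine l λ c h → proj₂ (L⊆M c h))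
    where
    M⊆L : ∀ c → Contains c M → Contains c L
    M⊆L c h = 𝟙≡1 (Contains? c L) (trans
      (∑-tight vectors (λ x _ → 𝟙-mono (Contains? x L) (Contains? x M) (L⊆M x))
        (ℕₚ.≤-reflexive (trans (perp-count m) (sym (perp-count l)))) c (complete vectorsᴱ tt))
      (𝟙-yes (Contains? c M) h))

  line-unique : ∀ {c d L M} → Independent c d → IsLine L → IsLine M → Contains c L → Contains d L →
                Contains c M → Contains d M → L ≡ M
  line-unique {c} {d} {L} {M} ind l m cL dL cM dM = perp-⊆⇒≡ l m λ x h →
    let (a , b , e) = perp-span l ind cL dL x h in subst (λ x → Contains x M) e (Contains-lin a c b d M cM dM)

  -- Gaussian elimination inside a subspace `S`, applied to the common points of two planes. Only
  -- the membership of the resulting rows in `S` is recorded, which is what it means for both planes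
  -- to contain the line.
  module Echelon (S : Vec4 → Set) (closed : ∀ a u b v → S u → S v → S (lin a u b v)) where
    ZeroBefore : Fin 4 → Vec4 → Set
    ZeroBefore i v = ∀ k → k Fin.< i → lookup v k ≡ 0#

    monic : ∀ v i → S v → ZeroBefore i v → (h : lookup v i ≢ 0#) →
            ∃[ u ] (S u × ZeroBefore i u × lookup u i ≡ 1# × (∀ k → lookup u k ≡ recip h ⊗ lookup v k))
    -- `closed` speaks of combinations of two vectors, so scaling is written with a zero second
    -- term.
    monic v i Sv z h = lin (recip h) v 0# v , closed (recip h) v 0# v Sv Sv
      , (λ k lt → trans (at k) (trans (cong (recip h ⊗_) (z k lt)) (zeroʳ (recip h)))) , trans (at i) (recipˡ h) , at
      where
      at : ∀ k → lookup (lin (recip h) v 0# v) k ≡ recip h ⊗ lookup v k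
      at k = trans (lookup-lin (recip h) v 0# v k) (solve 2 (λ x y → x :+ :0 :* y := x) refl (recip h ⊗ lookup v k) (lookup v k))

    clear : ∀ u w i → S u → S w → ZeroBefore i u → ZeroBefore i w → lookup u i ≡ 1# → (∀ a → w ≢ scale a u) →
            ∃[ w′ ] (S w′ × ZeroBefore i w′ × lookup w′ i ≡ 0# × w′ ≢ 𝟎)
    clear u w i Su Sw zu zw one w∉u = lin 1# w (⊝ m) u , closed 1# w (⊝ m) u Sw Su
      , (λ k lt → trans (at k) (0⊕0 1# (⊝ m) (zw k lt) (zu k lt)))
      , trans (at i) (trans (cong (λ z → 1# ⊗ m ⊕ ⊝ m ⊗ z) one) (solve 1 (λ m → :1 :* m :+ :- m :* :1 := :0) refl m))
      , λ e → w∉u m (vec-ext λ k → trans (x-y≡0⇒x≡y (trans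
          (solve 3 (λ x m y → x :- m :* y := :1 :* x :+ (:- m) :* y) refl (lookup w k) m (lookup u k))
          (trans (sym (at k)) (trans (cong (λ z → lookup z k) e) (lookup-𝟎 k))))) (sym (lookup-scale m u k)))
      where
      m = lookup w i
      at : ∀ k → lookup (lin 1# w (⊝ m) u) k ≡ 1# ⊗ lookup w k ⊕ ⊝ m ⊗ lookup u k
      at = lookup-lin 1# w (⊝ m) u

    reduced : ∀ u r i j → i Fin.< j → S u → S r → ZeroBefore i u → lookup u i ≡ 1# → ZeroBefore j r → lookup r j ≡ 1# →
              ∃[ L ] (IsLine L × S (proj₁ L) × S (proj₂ L))
    reduced u r i j lt Su Sr zu oneᵢ zr oneⱼ = (lin 1# u (⊝ m) r , r)
      , (i , j , lt
          , (λ k lt′ → trans (at k) (0⊕0 1# (⊝ m) (zu k lt′) (zr k (Finₚ.<-trans lt′ lt))))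
          , trans (at i) (trans (cong₂ (λ x y → 1# ⊗ x ⊕ ⊝ m ⊗ y) oneᵢ (zr i lt)) (solve 1 (λ x → :1 :* :1 :+ x :* :0 := :1) refl (⊝ m)))
          , trans (at j) (trans (cong (λ y → 1# ⊗ m ⊕ ⊝ m ⊗ y) oneⱼ) (solve 1 (λ x → :1 :* x :+ (:- x) :* :1 := :0) refl m))
          , zr , oneⱼ)
      , closed 1# u (⊝ m) r Su Sr , Sr
      where
      m = lookup u j
      at : ∀ k → lookup (lin 1# u (⊝ m) r) k ≡ 1# ⊗ lookup u k ⊕ ⊝ m ⊗ lookup r k
      at = lookup-lin 1# u (⊝ m) r

    eliminate : ∀ v w i → S v → S w → ZeroBefore i v → lookup v i ≢ 0# → ZeroBefore i w → (∀ a → w ≢ scale a v) →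
                ∃[ L ] (IsLine L × S (proj₁ L) × S (proj₂ L))
    eliminate v w i Sv Sw zv nv zw w∉v with monic v i Sv zv nv
    ... | u , Su , zu , oneᵢ , u-at = finish (clear u w i Su Sw zu zw oneᵢ w∉u)
      where
      w∉u : ∀ a → w ≢ scale a u
      w∉u a e = w∉v (a ⊗ recip nv) (vec-ext λ k → trans (cong (λ z → lookup z k) e) (trans (lookup-scale a u k)
        (trans (cong (a ⊗_) (u-at k)) (trans (sym (*-assoc a (recip nv) (lookup v k))) (sym (lookup-scale (a ⊗ recip nv) v k))))))
      finish : ∃[ w′ ] (S w′ × ZeroBefore i w′ × lookup w′ i ≡ 0# × w′ ≢ 𝟎) → ∃[ L ] (IsLine L × S (proj₁ L) × S (proj₂ L))
      finish (w′ , Sw′ , zw′ , w′ᵢ , w′≢𝟎) with leading-≢𝟎 w′≢𝟎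
      ... | j , z , nj with Finₚ.<-cmp i j
      ...   | tri≈ _ refl _ = ⊥-elim (nj w′ᵢ)
      ...   | tri> _ _ gt   = ⊥-elim (nj (zw′ j gt))
      ...   | tri< lt _ _ with monic w′ j Sw′ z nj
      ...     | r , Sr , zr , oneⱼ , _ = reduced u r i j lt Su Sr zu oneᵢ zr oneⱼ

    echelon : ∀ v w → S v → S w → v ≢ 𝟎 → (∀ a → w ≢ scale a v) → ∃[ L ] (IsLine L × S (proj₁ L) × S (proj₂ L))
    echelon v w Sv Sw v≢𝟎 w∉v with leading-≢𝟎 v≢𝟎 | leading-≢𝟎 {w} (λ e → w∉v 0# (trans e (sym (scale-0 v))))
    ... | iv , zv , nv | iw , zw , nw with Finₚ.<-cmp iv iw
    ...   | tri< lt _ _   = eliminate v w iv Sv Sw zv nv (λ k lt′ → zw k (Finₚ.<-trans lt′ lt)) w∉v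
    ...   | tri≈ _ refl _ = eliminate v w iv Sv Sw zv nv zw w∉v
    ...   | tri> _ _ gt   = eliminate w v iw Sw Sv zw nw (λ k lt′ → zv k (Finₚ.<-trans lt′ gt)) v∉w
      where
      v∉w : ∀ a → v ≢ scale a w
      v∉w a e with a ≟ 0#
      ... | yes refl = v≢𝟎 (trans e (scale-0 w))
      ... | no a≢0 = w∉v (recip a≢0) (trans (sym (scale-1 w)) (trans (cong (λ z → scale z w) (sym (recipˡ a≢0)))
            (trans (sym (scale-scale (recip a≢0) a w)) (cong (scale (recip a≢0)) (sym e)))))

  multiple? : ∀ v x → Dec (∃[ a ] x ≡ scale a v)
  multiple? v x = map′ (λ (a , _ , e) → a , e) (λ (a , e) → a , tt , e) (any-enum elementsᴱ λ a → x ≟ᵛ scale a v)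

  -- The common solutions of two equations number at least q², whereas a vector has at most q
  -- multiples and q > 1. So there is a solution outside the multiples of 𝟎, and then another one
  -- outside the multiples of the first. Nothing is assumed about `c` and `d`.
  line-exists : ∀ c d → ∃[ L ] (IsLine L × Contains c L × Contains d L)
  line-exists c d = first-point (spanning 𝟎)
    where
    T : Vec4 → Set
    T x = dot x c ≡ 0# × dot x d ≡ 0#
    closed : ∀ a u b v → T u → T v → T (lin a u b v)
    closed a u b v (uc , ud) (vc , vd) = lin-kills a u b v c uc vc , lin-kills a u b v d ud vd
    ps = c ∷ d ∷ []
    S : Vec4 → Set
    S x = values ps x ≡ zeros 2
    S⇒T : ∀ x → S x → T x
    S⇒T x e = Vecₚ.∷-injectiveˡ e , Vecₚ.∷-injectiveˡ (Vecₚ.∷-injectiveʳ e)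
    S? : Decidable S
    S? x = values ps x ≟ᵛ zeros 2
    q²≤ : order * order ≤ fibre ps (zeros 2)
    q²≤ = ℕₚ.*-cancelˡ-≤ (order ^ 2) {{ℕₚ.m^n≢0 order 2}} (subst (_≤ order ^ 2 * fibre ps (zeros 2))
      (trans (ℕₚ.^-distribˡ-+-* order 2 2) (cong (λ z → order ^ 2 * (order * z)) (ℕₚ.*-identityʳ order)))
      (kernel-≥ ps))
    spanning : ∀ v → ∃[ w ] (S w × ∀ a → w ≢ scale a v)
    spanning v with any-enum vectorsᴱ (λ w → S? w ×-dec ¬? (multiple? v w))
    ... | yes (w , _ , Sw , h) = w , Sw , λ a e → h (a , e)
    ... | no none = ⊥-elim (ℕₚ.<⇒≱ 1<order (ℕₚ.*-cancelˡ-≤ order (subst (order * order ≤_) (sym (ℕₚ.*-identityʳ order)) (ℕₚ.≤-trans q²≤ few))))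
      where
      few : fibre ps (zeros 2) ≤ order
      few = ℕₚ.≤-trans (∑-mono vectors λ x _ → le x) (ℕₚ.≤-reflexive (begin
        ∑ vectors (λ x → ∑ elements (λ a → 𝟙 (x ≟ᵛ scale a v)))
          ≡⟨ ∑-swap vectors elements _ ⟩
        ∑ elements (λ a → ∑ vectors (λ x → 𝟙 (x ≟ᵛ scale a v)))
          ≡⟨ ∑-ext elements (λ a → count-one vectorsᴱ (_≟ᵛ scale a v) (scale a v) tt refl (λ _ _ e → e)) ⟩
        ∑ elements (λ _ → 1)
          ≡⟨ ∑-one elements ⟩
        order ∎))
        where
        open ≡-Reasoning
        le : ∀ x → 𝟙 (S? x) ≤ ∑ elements (λ a → 𝟙 (x ≟ᵛ scale a v))
        le x = 𝟙-lower (S? x) found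
          where
          found : S x → ∑ elements (λ a → 𝟙 (x ≟ᵛ scale a v)) ≢ 0
          found Sx z with multiple? v x
          ... | no h = none (x , tt , Sx , h)
          ... | yes (a , e) = ℕₚ.1+n≢0 (trans (sym (𝟙-yes (x ≟ᵛ scale a v) e)) (∑-≡0 elements z a (complete elementsᴱ tt)))
    transposed : ∃[ L ] (IsLine L × T (proj₁ L) × T (proj₂ L)) → ∃[ L ] (IsLine L × Contains c L × Contains d L)
    transposed ((r₁ , r₂) , l , (c₁ , d₁) , (c₂ , d₂)) = (r₁ , r₂) , l
      , (trans (dot-comm c r₁) c₁ , trans (dot-comm c r₂) c₂) , (trans (dot-comm d r₁) d₁ , trans (dot-comm d r₂) d₂)
    second-point : ∀ v → S v → v ≢ 𝟎 → ∃[ w ] (S w × ∀ a → w ≢ scale a v) → ∃[ L ] (IsLine L × Contains c L × Contains d L)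
    second-point v Sv v≢𝟎 (w , Sw , w∉v) = transposed (Echelon.echelon T closed v w (S⇒T v Sv) (S⇒T w Sw) v≢𝟎 w∉v)
    first-point : ∃[ v ] (S v × ∀ a → v ≢ scale a 𝟎) → ∃[ L ] (IsLine L × Contains c L × Contains d L)
    first-point (v , Sv , v∉𝟎) = second-point v Sv (λ e → v∉𝟎 0# (trans e (sym (scale-0 𝟎)))) (spanning v)

  scale-injective : ∀ {a b v} → v ≢ 𝟎 → scale a v ≡ scale b v → a ≡ b
  scale-injective {a} {b} {v} hv e with leading-≢𝟎 hv
  ... | i , _ , ne = cancelˡ ne (trans (*-comm _ a) (trans (sym (lookup-scale a v i))
        (trans (cong (λ z → lookup z i) e) (trans (lookup-scale b v i) (*-comm b _)))))

  multiples-count : ∀ {v} → v ≢ 𝟎 → ∑ vectors (λ x → 𝟙 (multiple? v x)) ≡ order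
  multiples-count {v} hv = begin
    ∑ vectors (λ x → 𝟙 (multiple? v x))
      ≡⟨ ∑-ext vectors (λ x → ℕₚ.≤-antisym
           (𝟙-lower (multiple? v x) λ (a , e) z → ℕₚ.1+n≢0 (trans (sym (𝟙-yes (x ≟ᵛ scale a v) e)) (∑-≡0 elements z a (complete elementsᴱ tt))))
           (𝟙-upper (multiple? v x)
             (λ _ → count≤1 elementsᴱ (λ a → x ≟ᵛ scale a v) λ a b _ _ e e′ → scale-injective hv (trans (sym e) e′))
             (λ h → count-zero elementsᴱ (λ a → x ≟ᵛ scale a v) λ a _ e → h (a , e)))) ⟩
    ∑ vectors (λ x → ∑ elements (λ a → 𝟙 (x ≟ᵛ scale a v)))
      ≡⟨ ∑-swap vectors elements _ ⟩
    ∑ elements (λ a → ∑ vectors (λ x → 𝟙 (x ≟ᵛ scale a v)))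
      ≡⟨ ∑-ext elements (λ a → count-one vectorsᴱ (_≟ᵛ scale a v) (scale a v) tt refl (λ _ _ e → e)) ⟩
    ∑ elements (λ _ → 1)
      ≡⟨ ∑-one elements ⟩
    order ∎
    where open ≡-Reasoning

  non-multiple⇒independent : ∀ {c x} → c ≢ 𝟎 → ¬ (∃[ a ] x ≡ scale a c) → Independent c x
  non-multiple⇒independent {c} {x} hc hx a b e with b ≟ 0#
  ... | yes refl = scale-injective hc (trans (vec-ext λ k → trans (lookup-scale a c k)
          (trans (solve 2 (λ p y → p := p :+ :0 :* y) refl (a ⊗ lookup c k) (lookup x k))
            (trans (sym (lookup-lin a c 0# x k)) (cong (λ z → lookup z k) e)))) (sym (scale-0 c))) , refl
  ... | no hb = ⊥-elim (hx (⊝ (recip hb ⊗ a) , vec-ext λ k → trans (x-y≡0⇒x≡y (begin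
        lookup x k ⊖ ⊝ (recip hb ⊗ a) ⊗ lookup c k
          ≡⟨ cong (λ z → z ⊖ ⊝ (recip hb ⊗ a) ⊗ lookup c k) (sym (trans (cong (_⊗ lookup x k) (recipˡ hb)) (*-identityˡ _))) ⟩
        recip hb ⊗ b ⊗ lookup x k ⊖ ⊝ (recip hb ⊗ a) ⊗ lookup c k
          ≡⟨ solve 5 (λ r b x a c → r :* b :* x :- (:- (r :* a)) :* c := r :* (a :* c :+ b :* x)) refl (recip hb) b (lookup x k) a (lookup c k) ⟩
        recip hb ⊗ (a ⊗ lookup c k ⊕ b ⊗ lookup x k)
          ≡⟨ cong (recip hb ⊗_) (trans (sym (lookup-lin a c b x k)) (trans (cong (λ z → lookup z k) e) (lookup-𝟎 k))) ⟩
        recip hb ⊗ 0#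
          ≡⟨ zeroʳ _ ⟩
        0# ∎)) (sym (lookup-scale (⊝ (recip hb ⊗ a)) c k))))
    where open ≡-Reasoning

  -- Collapses a sum over lines once two planes are fixed: only their meet survives. It is the inner
  -- step of every double count over pairs of planes.
  meet-sum : ∀ {c d M} (g : Line → ℕ) → Independent c d → IsLine M → Contains c M → Contains d M →
             ∑ lines (λ L → 𝟙 (Contains? c L) * (𝟙 (Contains? d L) * g L)) ≡ g M
  meet-sum {c} {d} {M} g ind m cM dM = trans
    (∑-single (unique linesᴱ) M (complete linesᴱ m) (λ L mem ne → other L (sound linesᴱ mem) ne))
    (trans (cong₂ (λ x y → x * (y * g M)) (𝟙-yes (Contains? c M) cM) (𝟙-yes (Contains? d M) dM))
      (trans (ℕₚ.*-identityˡ _) (ℕₚ.*-identityˡ _)))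
    where
    other : ∀ L → IsLine L → L ≢ M → 𝟙 (Contains? c L) * (𝟙 (Contains? d L) * g L) ≡ 0
    other L l ne = 𝟙*-zero (Contains? c L) λ cL → 𝟙*-zero (Contains? d L) λ dL → ⊥-elim (ne (line-unique ind l m cL dL cM dM))

  -- Double counting of the pairs (x, L), where L is the line in which the plane x meets the plane c.
  lines-in-plane : ∀ {c} → c ≢ 𝟎 → (g : Line → ℕ) →
    ∑ vectors (λ x → 𝟙 (¬? (multiple? c x)) * ∑ lines (λ L → 𝟙 (Contains? c L) * (𝟙 (Contains? x L) * g L)))
      + order * ∑ lines (λ L → 𝟙 (Contains? c L) * g L)
      ≡ order * order * ∑ lines (λ L → 𝟙 (Contains? c L) * g L)
  lines-in-plane {c} hc g = begin
    ∑ vectors (λ x → 𝟙 (¬? (multiple? c x)) * ∑ lines (λ L → w L x)) + order * S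
      ≡⟨ cong₂ _+_ swapped (sym (∑-*ˡ lines order h)) ⟩
    ∑ lines (λ L → h L * P L) + ∑ lines (λ L → order * h L)
      ≡⟨ sym (∑-+ lines _ _) ⟩
    ∑ lines (λ L → h L * P L + order * h L)
      ≡⟨ ∑-congᴱ linesᴱ each ⟩
    ∑ lines (λ L → order * order * h L)
      ≡⟨ ∑-*ˡ lines (order * order) h ⟩
    order * order * S ∎
    where
    open ≡-Reasoning
    h : Line → ℕ
    h L = 𝟙 (Contains? c L) * g L
    w : Line → Vec4 → ℕ
    w L x = 𝟙 (Contains? c L) * (𝟙 (Contains? x L) * g L)
    S = ∑ lines h
    P : Line → ℕ
    P L = ∑ vectors (λ x → 𝟙 (¬? (multiple? c x)) * 𝟙 (Contains? x L))
    swapped : ∑ vectors (λ x → 𝟙 (¬? (multiple? c x)) * ∑ lines (λ L → w L x)) ≡ ∑ lines (λ L → h L * P L)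
    swapped = begin
      ∑ vectors (λ x → 𝟙 (¬? (multiple? c x)) * ∑ lines (λ L → w L x))
        ≡⟨ ∑-ext vectors (λ x → sym (∑-*ˡ lines (𝟙 (¬? (multiple? c x))) (λ L → w L x))) ⟩
      ∑ vectors (λ x → ∑ lines (λ L → 𝟙 (¬? (multiple? c x)) * w L x))
        ≡⟨ ∑-swap vectors lines _ ⟩
      ∑ lines (λ L → ∑ vectors (λ x → 𝟙 (¬? (multiple? c x)) * w L x))
        ≡⟨ ∑-ext lines (λ L → trans
             (∑-ext vectors λ x → solveℕ 4 (λ m a b g → m :⊗ (a :⊗ (b :⊗ g)) :≡ (a :⊗ g) :⊗ (m :⊗ b)) refl
               (𝟙 (¬? (multiple? c x))) (𝟙 (Contains? c L)) (𝟙 (Contains? x L)) (g L))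
             (∑-*ˡ vectors (h L) (λ x → 𝟙 (¬? (multiple? c x)) * 𝟙 (Contains? x L)))) ⟩
      ∑ lines (λ L → h L * P L) ∎
    -- The pencil of a line in `c` has q² vectors, q of which are multiples of `c` and cut out no
    -- line. These q account for the second summand on the left of the identity.
    complement : ∀ L → IsLine L → Contains c L → P L + order ≡ order * order
    complement L l cL = begin
      P L + order
        ≡⟨ cong (P L +_) (sym (multiples-count hc)) ⟩
      P L + ∑ vectors (λ x → 𝟙 (multiple? c x))
        ≡⟨ sym (∑-+ vectors _ _) ⟩
      ∑ vectors (λ x → 𝟙 (¬? (multiple? c x)) * 𝟙 (Contains? x L) + 𝟙 (multiple? c x))
        ≡⟨ ∑-ext vectors split ⟩
      ∑ vectors (λ x → 𝟙 (Contains? x L))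
        ≡⟨ perp-count l ⟩
      order * order ∎
      where
      split : ∀ x → 𝟙 (¬? (multiple? c x)) * 𝟙 (Contains? x L) + 𝟙 (multiple? c x) ≡ 𝟙 (Contains? x L)
      split x = 𝟙-difference (multiple? c x) (Contains? x L) λ (a , e) → subst (λ x → Contains x L) (sym e) (Contains-scale a c L cL)
    each : ∀ L → IsLine L → h L * P L + order * h L ≡ order * order * h L
    each L l = trans
      (solveℕ 4 (λ k g p q → (k :⊗ g) :⊗ p :⊕ q :⊗ (k :⊗ g) :≡ k :⊗ ((p :⊕ q) :⊗ g)) refl (𝟙 (Contains? c L)) (g L) (P L) order)
      (trans (𝟙*-cong (Contains? c L) (λ cL → cong (_* g L) (complement L l cL)))
        (solveℕ 3 (λ k q g → k :⊗ (q :⊗ g) :≡ q :⊗ (k :⊗ g)) refl (𝟙 (Contains? c L)) (order * order) (g L)))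

-- The twisted cubic and its osculating planes as binary cubic forms

module TwistedCubic (F : Field) where
  open Incidence F public
  open Field F public using (curvePt; osc)

  Parameter : Set
  Parameter = Maybe Carrier

  _≟ᵖ_ : DecidableEquality Parameter
  _≟ᵖ_ = Maybeₚ.≡-dec _≟_

  abstract
    parameters : List Parameter
    parameters = nothing ∷ map just elements

    parametersᴱ : Enumerates (λ _ → ⊤) parameters
    parametersᴱ = All.tabulate nothing∉ ∷ Uniqueₚ.map⁺ Maybeₚ.just-injective (unique elementsᴱ)
      , (λ _ _ → tt)
      , λ { nothing _ → here refl ; (just x) _ → there (∈-map⁺ just (complete elementsᴱ tt)) }
      where
      nothing∉ : ∀ {t} → t ∈ map just elements → nothing ≢ t
      nothing∉ m refl with ∈-map⁻ just m
      ... | _ , _ , ()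

    length-parameters : length parameters ≡ suc order
    length-parameters = cong suc (Listₚ.length-map just elements)

  X Y : Parameter → Carrier
  X (just t) = t
  X nothing  = 1#
  Y (just t) = 1#
  Y nothing  = 0#

  -- The linear form α s x + β s y on the projective line vanishes at s.
  α β : Parameter → Carrier
  α (just s) = 1#
  α nothing  = 0#
  β (just s) = ⊝ s
  β nothing  = 1#

  -- Up to sign, the determinant of the homogeneous coordinates of `s` and `t`. It treats the point
  -- at infinity like the others.
  ℓ : Parameter → Parameter → Carrier
  ℓ s t = α s ⊗ X t ⊕ β s ⊗ Y t

  ℓ-self : ∀ s → ℓ s s ≡ 0#
  ℓ-self (just s) = solve 1 (λ s → :1 :* s :+ (:- s) :* :1 := :0) refl s
  ℓ-self nothing  = solve 0 (:0 :* :1 :+ :1 :* :0 := :0) refl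

  ℓ≡0 : ∀ s t → ℓ s t ≡ 0# → s ≡ t
  ℓ≡0 (just s) (just t) e = cong just (sym (x-y≡0⇒x≡y (trans (solve 2 (λ s t → t :- s := :1 :* t :+ (:- s) :* :1) refl s t) e)))
  ℓ≡0 (just s) nothing  e = ⊥-elim (1≢0 (trans (solve 1 (λ s → :1 := :1 :* :1 :+ (:- s) :* :0) refl s) e))
  ℓ≡0 nothing  (just t) e = ⊥-elim (1≢0 (trans (solve 1 (λ t → :1 := :0 :* t :+ :1 :* :1) refl t) e))
  ℓ≡0 nothing  nothing  e = refl

  ℓ≢0 : ∀ {s t} → s ≢ t → ℓ s t ≢ 0#
  ℓ≢0 {s} {t} h e = h (ℓ≡0 s t e)

  form-zero : ∀ a b → ∃[ t ] a ⊗ X t ⊕ b ⊗ Y t ≡ 0#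
  form-zero a b with a ≟ 0#
  ... | yes refl = nothing , solve 1 (λ b → :0 :* :1 :+ b :* :0 := :0) refl b
  ... | no h     = just (⊝ (recip h ⊗ b)) , trans
    (solve 3 (λ a r b → a :* :- (r :* b) :+ b :* :1 := b :- (a :* r) :* b) refl a (recip h) b)
    (x≡y⇒x-y≡0 (sym (trans (cong (_⊗ b) (recipʳ h)) (*-identityˡ b))))

  form-zero-unique : ∀ a b {s t} → s ≢ t → a ⊗ X s ⊕ b ⊗ Y s ≡ 0# → a ⊗ X t ⊕ b ⊗ Y t ≡ 0# → a ≡ 0# × b ≡ 0#
  form-zero-unique a b {just s} {just t} h es et = a≡0 , trans (solve 3 (λ a b s → b := (a :* s :+ b :* :1) :- a :* s) refl a b s)
      (trans (cong₂ (λ x y → x ⊖ y ⊗ s) es a≡0) (solve 1 (λ s → :0 :- :0 :* s := :0) refl s))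
    where
    a≡0 : a ≡ 0#
    a≡0 = xy≡0⇒y≡0 {s ⊖ t} (λ e → h (cong just (x-y≡0⇒x≡y e)))
      (trans (solve 4 (λ a b s t → (s :- t) :* a := (a :* s :+ b :* :1) :- (a :* t :+ b :* :1)) refl a b s t)
        (trans (cong₂ _⊖_ es et) (-‿inverseʳ 0#)))
  form-zero-unique a b {just s} {nothing} h es et = a≡0 , trans (solve 3 (λ a b s → b := (a :* s :+ b :* :1) :- a :* s) refl a b s)
      (trans (cong₂ (λ x y → x ⊖ y ⊗ s) es a≡0) (solve 1 (λ s → :0 :- :0 :* s := :0) refl s))
    where
    a≡0 : a ≡ 0#
    a≡0 = trans (solve 2 (λ a b → a := a :* :1 :+ b :* :0) refl a b) et
  form-zero-unique a b {nothing} {just t} h es et = form-zero-unique a b {just t} {nothing} (h ∘ sym) et es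
  form-zero-unique a b {nothing} {nothing} h es et = ⊥-elim (h refl)

  -- Cubic forms

  cubics : Carrier → Carrier → Vec4
  cubics x y = x ⊗ x ⊗ x ∷ x ⊗ x ⊗ y ∷ x ⊗ y ⊗ y ∷ y ⊗ y ⊗ y ∷ []

  vec4-≡ : ∀ {a a′ b b′ c c′ d d′ : Carrier} → a ≡ a′ → b ≡ b′ → c ≡ c′ → d ≡ d′ →
           _≡_ {A = Vec4} (a ∷ b ∷ c ∷ d ∷ []) (a′ ∷ b′ ∷ c′ ∷ d′ ∷ [])
  vec4-≡ refl refl refl refl = refl

  curvePt≡ : ∀ t → curvePt t ≡ cubics (X t) (Y t)
  curvePt≡ (just t) = vec4-≡
    (solve 1 (λ t → t :* (t :* (t :* :1)) := t :* t :* t) refl t)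
    (solve 1 (λ t → t :* (t :* :1) := t :* t :* :1) refl t)
    (solve 1 (λ t → t := t :* :1 :* :1) refl t)
    (solve 0 (:1 := :1 :* :1 :* :1) refl)
  curvePt≡ nothing = vec4-≡
    (solve 0 (:1 := :1 :* :1 :* :1) refl) (solve 0 (:0 := :1 :* :1 :* :0) refl)
    (solve 0 (:0 := :1 :* :0 :* :0) refl) (solve 0 (:0 := :0 :* :0 :* :0) refl)

  -- The coefficients of the product of three linear forms a x + b y, in the order of the monomials
  -- in `cubics`.
  triple : Carrier → Carrier → Carrier → Carrier → Carrier → Carrier → Vec4
  triple a b a′ b′ a″ b″ =
    a ⊗ a′ ⊗ a″ ∷ a ⊗ a′ ⊗ b″ ⊕ a ⊗ b′ ⊗ a″ ⊕ b ⊗ a′ ⊗ a″ ∷ a ⊗ b′ ⊗ b″ ⊕ b ⊗ a′ ⊗ b″ ⊕ b ⊗ b′ ⊗ a″ ∷ b ⊗ b′ ⊗ b″ ∷ []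

  dot-triple : ∀ a b a′ b′ a″ b″ x y → dot (triple a b a′ b′ a″ b″) (cubics x y) ≡ (a ⊗ x ⊕ b ⊗ y) ⊗ (a′ ⊗ x ⊕ b′ ⊗ y) ⊗ (a″ ⊗ x ⊕ b″ ⊗ y)
  dot-triple = solve 8 (λ a b a′ b′ a″ b″ x y →
    a :* a′ :* a″ :* (x :* x :* x) :+ (a :* a′ :* b″ :+ a :* b′ :* a″ :+ b :* a′ :* a″) :* (x :* x :* y)
      :+ (a :* b′ :* b″ :+ b :* a′ :* b″ :+ b :* b′ :* a″) :* (x :* y :* y) :+ b :* b′ :* b″ :* (y :* y :* y)
    := (a :* x :+ b :* y) :* (a′ :* x :+ b′ :* y) :* (a″ :* x :+ b″ :* y)) refl

  through : Parameter → Parameter → Parameter → Vec4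
  through r s t = triple (α r) (β r) (α s) (β s) (α t) (β t)

  dot-through : ∀ r s t v → dot (through r s t) (curvePt v) ≡ ℓ r v ⊗ ℓ s v ⊗ ℓ t v
  dot-through r s t v = trans (cong (dot (through r s t)) (curvePt≡ v)) (dot-triple _ _ _ _ _ _ _ _)

  -- Expanding (α x + β y)³ yields these coefficients, so the osculating plane is the cube of the
  -- linear form that vanishes at `s`, also for s = ∞.
  osc≡ : ∀ s → osc s ≡ α s ⊗ α s ⊗ α s ∷ three ⊗ (α s ⊗ α s ⊗ β s) ∷ three ⊗ (α s ⊗ β s ⊗ β s) ∷ β s ⊗ β s ⊗ β s ∷ []
  osc≡ (just s) = vec4-≡
    (solve 0 (:1 := :1 :* :1 :* :1) refl)
    (solve 1 (λ s → :- (:3 :* s) := :3 :* (:1 :* :1 :* (:- s))) refl s)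
    (solve 1 (λ s → :3 :* (s :* (s :* :1)) := :3 :* (:1 :* (:- s) :* (:- s))) refl s)
    (solve 1 (λ s → :- (s :* (s :* (s :* :1))) := (:- s) :* (:- s) :* (:- s)) refl s)
  osc≡ nothing = vec4-≡
    (solve 0 (:0 := :0 :* :0 :* :0) refl) (solve 0 (:0 := :3 :* (:0 :* :0 :* :1)) refl)
    (solve 0 (:0 := :3 :* (:0 :* :1 :* :1)) refl) (solve 0 (:1 := :1 :* :1 :* :1) refl)

  dot-osc : ∀ s v → dot (osc s) (curvePt v) ≡ cube (ℓ s v)
  dot-osc s v = trans (cong₂ dot (osc≡ s) (curvePt≡ v)) (solve 4 (λ a b x y →
    a :* a :* a :* (x :* x :* x) :+ :3 :* (a :* a :* b) :* (x :* x :* y) :+ :3 :* (a :* b :* b) :* (x :* y :* y) :+ b :* b :* b :* (y :* y :* y)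
    := (a :* x :+ b :* y) :* (a :* x :+ b :* y) :* (a :* x :+ b :* y)) refl (α s) (β s) (X v) (Y v))

  -- A point on the osculating planes at r, s and t.
  probe : Parameter → Parameter → Parameter → Vec4
  probe r s t =
      three ⊗ (x ⊗ x′ ⊗ x″) ∷ x ⊗ x′ ⊗ y″ ⊕ x ⊗ y′ ⊗ x″ ⊕ y ⊗ x′ ⊗ x″
    ∷ x ⊗ y′ ⊗ y″ ⊕ y ⊗ x′ ⊗ y″ ⊕ y ⊗ y′ ⊗ x″ ∷ three ⊗ (y ⊗ y′ ⊗ y″) ∷ []
    where
    x = X r
    y = Y r
    x′ = X s
    y′ = Y s
    x″ = X t
    y″ = Y t

  -- The apolarity pairing: a cube of a linear form is paired with three points through its values
  -- at them. The factor 3 clears the denominators of the middle coefficients, so probes tell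
  -- osculating planes apart only when `three` is nonzero.
  dot-probe : ∀ v r s t → dot (osc v) (probe r s t) ≡ three ⊗ (ℓ v r ⊗ ℓ v s ⊗ ℓ v t)
  dot-probe v r s t = trans (cong (λ o → dot o (probe r s t)) (osc≡ v)) (solve 8 (λ a b x y x′ y′ x″ y″ →
    a :* a :* a :* (:3 :* (x :* x′ :* x″)) :+ :3 :* (a :* a :* b) :* (x :* x′ :* y″ :+ x :* y′ :* x″ :+ y :* x′ :* x″)
      :+ :3 :* (a :* b :* b) :* (x :* y′ :* y″ :+ y :* x′ :* y″ :+ y :* y′ :* x″) :+ b :* b :* b :* (:3 :* (y :* y′ :* y″))
    := :3 :* ((a :* x :+ b :* y) :* (a :* x′ :+ b :* y′) :* (a :* x″ :+ b :* y″))) refl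
    (α v) (β v) (X r) (Y r) (X s) (Y s) (X t) (Y t))

  -- Planes with prescribed values at points of the cubic

  Surjective : ∀ {k} → Vec Vec4 k → Set
  Surjective ps = ∀ w → ∃[ x ] values ps x ≡ w

  -- Newton interpolation: a multiple of `e` corrects the value at the new point and leaves the
  -- earlier values alone.
  surjective-∷ : ∀ {k p} {ps : Vec Vec4 k} → Surjective ps → ∀ e → values ps e ≡ zeros k → dot e p ≢ 0# → Surjective (p ∷ ps)
  surjective-∷ {p = p} {ps} surj e kills h (w ∷ ws) with surj ws
  ... | x , refl = lin 1# x c e , cong₂ _∷_ (trans (dot-linˡ 1# x c e p) value) (values-add-kernel ps x e c kills)
    where
    c = (w ⊖ dot x p) ⊗ recip h
    value : 1# ⊗ dot x p ⊕ c ⊗ dot e p ≡ w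
    value = trans (solve 4 (λ w d r e → :1 :* d :+ (w :- d) :* r :* e := d :+ (w :- d) :* (r :* e)) refl w (dot x p) (recip h) (dot e p))
      (trans (cong (λ z → dot x p ⊕ (w ⊖ dot x p) ⊗ z) (recipˡ h))
        (solve 2 (λ w d → d :+ (w :- d) :* :1 := w) refl w (dot x p)))

  through-≢0 : ∀ {r s t v} → r ≢ v → s ≢ v → t ≢ v → dot (through r s t) (curvePt v) ≢ 0#
  through-≢0 {r} {s} {t} {v} hr hs ht e = ⊗-≢0 (⊗-≢0 (ℓ≢0 hr) (ℓ≢0 hs)) (ℓ≢0 ht) (trans (sym (dot-through r s t v)) e)

  through-₁ : ∀ r s t → dot (through r s t) (curvePt r) ≡ 0#
  through-₁ r s t = trans (dot-through r s t r) (trans (cong (λ z → z ⊗ ℓ s r ⊗ ℓ t r) (ℓ-self r))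
    (solve 2 (λ x y → :0 :* x :* y := :0) refl (ℓ s r) (ℓ t r)))

  through-₂ : ∀ r s t → dot (through r s t) (curvePt s) ≡ 0#
  through-₂ r s t = trans (dot-through r s t s) (trans (cong (λ z → ℓ r s ⊗ z ⊗ ℓ t s) (ℓ-self s))
    (solve 2 (λ x y → x :* :0 :* y := :0) refl (ℓ r s) (ℓ t s)))

  through-₃ : ∀ r s t → dot (through r s t) (curvePt t) ≡ 0#
  through-₃ r s t = trans (dot-through r s t t) (trans (cong (λ z → ℓ r t ⊗ ℓ s t ⊗ z) (ℓ-self t)) (zeroʳ _))

  another : ∀ (t : Parameter) → ∃[ s ] (s ≢ t)
  another (just t) = nothing , λ ()
  another nothing  = just 0# , λ ()

  -- Here and in the next three lemmas the correcting form is a product of linear forms at the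
  -- earlier points, with a repeated factor where there are fewer than three of them. For a first
  -- point, the cube at any other parameter does.
  surjective₁ : ∀ r → Surjective (curvePt r ∷ [])
  surjective₁ r = let (s , h) = another r in
    surjective-∷ (λ { [] → 𝟎 , refl }) (through s s s) refl (through-≢0 h h h)

  surjective₂ : ∀ r s → r ≢ s → Surjective (curvePt s ∷ curvePt r ∷ [])
  surjective₂ r s h = surjective-∷ (surjective₁ r) (through r r r) (cong₂ _∷_ (through-₁ r r r) refl) (through-≢0 h h h)

  surjective₃ : ∀ r s t → r ≢ s → r ≢ t → s ≢ t → Surjective (curvePt t ∷ curvePt s ∷ curvePt r ∷ [])
  surjective₃ r s t h rt st = surjective-∷ (surjective₂ r s h) (through r s s)
    (cong₂ _∷_ (through-₂ r s s) (cong₂ _∷_ (through-₁ r s s) refl)) (through-≢0 rt st st)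

  surjective₄ : ∀ r s t v → r ≢ s → r ≢ t → s ≢ t → r ≢ v → s ≢ v → t ≢ v → Surjective (curvePt v ∷ curvePt t ∷ curvePt s ∷ curvePt r ∷ [])
  surjective₄ r s t v h rt st rv sv tv = surjective-∷ (surjective₃ r s t h rt st) (through r s t)
    (cong₂ _∷_ (through-₃ r s t) (cong₂ _∷_ (through-₂ r s t) (cong₂ _∷_ (through-₁ r s t) refl))) (through-≢0 rv sv tv)

  Root : Vec4 → Parameter → Set
  Root c t = dot c (curvePt t) ≡ 0#

  Root? : ∀ c t → Dec (Root c t)
  Root? c t = dot c (curvePt t) ≟ 0#

  roots : Vec4 → ℕ
  roots c = ∑ parameters (λ t → 𝟙 (Root? c t))

  -- Four conditions are independent in a space with q⁴ vectors, so the kernel has a single element.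
  four-roots : ∀ {c r s t v} → r ≢ s → r ≢ t → s ≢ t → r ≢ v → s ≢ v → t ≢ v →
               Root c r → Root c s → Root c t → Root c v → c ≡ 𝟎
  four-roots {c} {r} {s} {t} {v} h rt st rv sv tv er es et ev = count-unique vectorsᴱ (λ x → values ps x ≟ᵛ zeros 4)
    (ℕₚ.≤-reflexive (ℕₚ.*-cancelˡ-≡ _ 1 (order ^ 4) {{ℕₚ.m^n≢0 order 4}}
      (trans (fibre-surjective ps (surjective₄ r s t v h rt st rv sv tv) (zeros 4)) (sym (ℕₚ.*-identityʳ _)))))
    tt tt (cong₂ _∷_ ev (cong₂ _∷_ et (cong₂ _∷_ es (cong₂ _∷_ er refl))))
    (cong₂ _∷_ (dot-𝟎ˡ (curvePt v)) (cong₂ _∷_ (dot-𝟎ˡ (curvePt t)) (cong₂ _∷_ (dot-𝟎ˡ (curvePt s)) (cong₂ _∷_ (dot-𝟎ˡ (curvePt r)) refl)))) _≟ᵛ_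
    where
    ps = curvePt v ∷ curvePt t ∷ curvePt s ∷ curvePt r ∷ []

  roots≤3 : ∀ {c} → c ≢ 𝟎 → roots c ≤ 3
  roots≤3 {c} hc = subst (_≤ 3) (length-filter (Root? c) parameters)
    (at-most (filter (Root? c) parameters) (unique E) (λ t m → proj₂ (sound E m)))
    where
    E = enum-filter parametersᴱ (Root? c)
    at-most : ∀ ts → Unique ts → (∀ t → t ∈ ts → Root c t) → length ts ≤ 3
    at-most []              _ _ = z≤n
    at-most (_ ∷ [])        _ _ = s≤s z≤n
    at-most (_ ∷ _ ∷ [])    _ _ = s≤s (s≤s z≤n)
    at-most (_ ∷ _ ∷ _ ∷ []) _ _ = s≤s (s≤s (s≤s z≤n))
    at-most (r ∷ s ∷ t ∷ v ∷ ts) ((rs All.∷ rt All.∷ rv All.∷ _) ∷ (st All.∷ sv All.∷ _) ∷ (tv All.∷ _) ∷ _) h =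
      ⊥-elim (hc (four-roots rs rt st rv sv tv (h r (here refl)) (h s (there (here refl)))
        (h t (there (there (here refl)))) (h v (there (there (there (here refl)))))))

-- Planes sorted by their number of points of the cubic

module PlaneCounts (F : Field) where
  open TwistedCubic F public
  open ℕ-Solver

  -- This is q - 1. Counts are written with `suc u` in place of q, so that identities between them
  -- contain no truncated subtraction and are within reach of the semiring solver.
  u : ℕ
  u = length units

  cancel-units : ∀ {m n} → u * m ≡ u * n → m ≡ n
  cancel-units {m} {n} = ℕₚ.*-cancelˡ-≡ m n u {{units-nonZero}}

  ∑-pull : ∀ {A B : Set} (xs : List A) (ys : List B) (a : B → ℕ) (f : A → B → ℕ) →
           ∑ xs (λ x → ∑ ys (λ y → a y * f x y)) ≡ ∑ ys (λ y → a y * ∑ xs (λ x → f x y))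
  ∑-pull xs ys a f = trans (∑-swap xs ys _) (∑-ext ys λ y → ∑-*ˡ xs (a y) (λ x → f x y))

  values-zero-scale : ∀ {k} (ps : Vec Vec4 k) a v → values ps v ≡ zeros k → values ps (scale a v) ≡ zeros k
  values-zero-scale []       a v e = refl
  values-zero-scale (p ∷ ps) a v e = cong₂ _∷_
    (trans (dot-scaleˡ a v p) (trans (cong (a ⊗_) (Vecₚ.∷-injectiveˡ e)) (zeroʳ a)))
    (values-zero-scale ps a v (Vecₚ.∷-injectiveʳ e))

  values-𝟎 : ∀ {k} (ps : Vec Vec4 k) → values ps 𝟎 ≡ zeros k
  values-𝟎 []       = refl
  values-𝟎 (p ∷ ps) = cong₂ _∷_ (dot-𝟎ˡ p) (values-𝟎 ps)

  -- Here `m` is the number q^(4-k) of solution vectors and `n` the number (m - 1) / (q - 1) of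
  -- planes; supplying both as witnesses avoids division.
  system-planes : ∀ {k} (ps : Vec Vec4 k) → Surjective ps → ∀ n m → order ^ k * m ≡ order ^ 4 → m ≡ u * n + 1 →
                  ∑ planes (λ c → 𝟙 (values ps c ≟ᵛ zeros k)) ≡ n
  system-planes {k} ps surj n m hm hn = cancel-units (ℕₚ.+-cancelʳ-≡ 1 _ _ (trans (sym projective)
    (trans (ℕₚ.*-cancelˡ-≡ _ m (order ^ k) {{ℕₚ.m^n≢0 order k}} (trans (fibre-surjective ps surj (zeros k)) (sym hm))) hn)))
    where
    projective : fibre ps (zeros k) ≡ u * ∑ planes (λ c → 𝟙 (values ps c ≟ᵛ zeros k)) + 1
    projective = count-planes (λ c → values ps c ≟ᵛ zeros k)
      (λ a v ha e → trans (cong (values ps) (sym (trans (scale-scale (recip ha) a v) (trans (cong (λ z → scale z v) (recipˡ ha)) (scale-1 v)))))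
        (values-zero-scale ps (recip ha) (scale a v) e))
      (λ a v _ → values-zero-scale ps a v) (values-𝟎 ps)

  planes-total : length planes ≡ suc u * (suc u * suc u) + suc u * suc u + suc u + 1
  planes-total = trans (sym (∑-one planes)) (trans
    (∑-ext planes λ c → sym (𝟙-yes (values [] c ≟ᵛ []) refl))
    (system-planes [] (λ { [] → 𝟎 , refl }) _ (order ^ 4) (ℕₚ.*-identityˡ _)
      (trans (cong (_^ 4) order≡) (solveℕ 1 (λ u → let q = conℕ 1 :⊕ u in
        q :⊗ (q :⊗ (q :⊗ (q :⊗ conℕ 1))) :≡ u :⊗ (q :⊗ (q :⊗ q) :⊕ q :⊗ q :⊕ q :⊕ conℕ 1) :⊕ conℕ 1) refl u))))

  planes₁ : ∀ t → ∑ planes (λ c → 𝟙 (Root? c t)) ≡ suc u * suc u + suc u + 1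
  planes₁ t = trans
    (∑-ext planes λ c → 𝟙-cong (Root? c t) (values (curvePt t ∷ []) c ≟ᵛ zeros 1) (λ e → cong (_∷ []) e) Vecₚ.∷-injectiveˡ)
    (system-planes (curvePt t ∷ []) (surjective₁ t) _ (order ^ 3) (sym (ℕₚ.^-distribˡ-+-* order 1 3))
      (trans (cong (_^ 3) order≡) (solveℕ 1 (λ u → let q = conℕ 1 :⊕ u in
        q :⊗ (q :⊗ (q :⊗ conℕ 1)) :≡ u :⊗ (q :⊗ q :⊕ q :⊕ conℕ 1) :⊕ conℕ 1) refl u)))

  planes₂ : ∀ t s → t ≢ s → ∑ planes (λ c → 𝟙 (Root? c t) * 𝟙 (Root? c s)) ≡ suc u + 1
  planes₂ t s h = trans
    (∑-ext planes λ c → sym (𝟙-and (values (curvePt s ∷ curvePt t ∷ []) c ≟ᵛ zeros 2) (Root? c t) (Root? c s)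
      (λ e → Vecₚ.∷-injectiveˡ (Vecₚ.∷-injectiveʳ e) , Vecₚ.∷-injectiveˡ e) (λ et es → cong₂ _∷_ es (cong (_∷ []) et))))
    (system-planes (curvePt s ∷ curvePt t ∷ []) (surjective₂ t s h) _ (order ^ 2) (sym (ℕₚ.^-distribˡ-+-* order 2 2))
      (trans (cong (_^ 2) order≡) (solveℕ 1 (λ u → let q = conℕ 1 :⊕ u in
        q :⊗ (q :⊗ conℕ 1) :≡ u :⊗ (q :⊕ conℕ 1) :⊕ conℕ 1) refl u)))

  planes₃ : ∀ t s w → t ≢ s → t ≢ w → s ≢ w → ∑ planes (λ c → 𝟙 (Root? c t) * (𝟙 (Root? c s) * 𝟙 (Root? c w))) ≡ 1
  planes₃ t s w ts tw sw = trans
    (∑-ext planes λ c → sym (trans (𝟙-and (values (curvePt w ∷ curvePt s ∷ curvePt t ∷ []) c ≟ᵛ zeros 3) (Root? c t) (Root? c s ×-dec Root? c w)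
      (λ e → Vecₚ.∷-injectiveˡ (Vecₚ.∷-injectiveʳ (Vecₚ.∷-injectiveʳ e)) , Vecₚ.∷-injectiveˡ (Vecₚ.∷-injectiveʳ e) , Vecₚ.∷-injectiveˡ e)
      (λ et (es , ew) → cong₂ _∷_ ew (cong₂ _∷_ es (cong (_∷ []) et))))
      (cong (𝟙 (Root? c t) *_) (𝟙-× (Root? c s) (Root? c w)))))
    (system-planes (curvePt w ∷ curvePt s ∷ curvePt t ∷ []) (surjective₃ t s w ts tw sw) _ (order ^ 1) (sym (ℕₚ.^-distribˡ-+-* order 3 1))
      (trans (cong (_^ 1) order≡) (solveℕ 1 (λ u → let q = conℕ 1 :⊕ u in q :⊗ conℕ 1 :≡ u :⊗ conℕ 1 :⊕ conℕ 1) refl u)))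

  -- Factorial moments of the number of roots

  private
    D = length parameters
    _≢?_ : ∀ (s t : Parameter) → Dec (s ≢ t)
    s ≢? t = ¬? (s ≟ᵖ t)
    U = unique parametersᴱ

  moment₁ : ∑ planes roots ≡ D * (suc u * suc u + suc u + 1)
  moment₁ = trans (∑-swap planes parameters _) (trans (∑-ext parameters planes₁) (∑-const parameters _))

  -- Each ordered pair of distinct parameters lies in q + 1 planes. `∑-pairs` is used twice, first
  -- for the roots of one plane and at the end for the predicate that always holds, which counts the
  -- pairs of parameters; the factors 1 are there to match its shape.
  moment₂ : ∑ planes (λ c → roots c * (roots c ∸ 1)) ≡ D * (D ∸ 1) * (suc u + 1)
  moment₂ = begin
    ∑ planes (λ c → roots c * (roots c ∸ 1))
      ≡⟨ ∑-ext planes (λ c → sym (∑-pairs U _≟ᵖ_ (Root? c))) ⟩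
    ∑ planes (λ c → ∑ parameters (λ t → 𝟙 (Root? c t) * ∑ parameters (λ s → 𝟙 (s ≢? t) * 𝟙 (Root? c s))))
      ≡⟨ ∑-ext planes (λ c → ∑-ext parameters λ t → trans (sym (∑-*ˡ parameters (𝟙 (Root? c t)) _))
           (∑-ext parameters λ s → solveℕ 3 (λ r a r′ → r :⊗ (a :⊗ r′) :≡ a :⊗ (r :⊗ r′)) refl (𝟙 (Root? c t)) (𝟙 (s ≢? t)) (𝟙 (Root? c s)))) ⟩
    ∑ planes (λ c → ∑ parameters (λ t → ∑ parameters (λ s → 𝟙 (s ≢? t) * (𝟙 (Root? c t) * 𝟙 (Root? c s)))))
      ≡⟨ ∑-swap planes parameters _ ⟩
    ∑ parameters (λ t → ∑ planes (λ c → ∑ parameters (λ s → 𝟙 (s ≢? t) * (𝟙 (Root? c t) * 𝟙 (Root? c s)))))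
      ≡⟨ ∑-ext parameters (λ t → ∑-pull planes parameters (λ s → 𝟙 (s ≢? t)) _) ⟩
    ∑ parameters (λ t → ∑ parameters (λ s → 𝟙 (s ≢? t) * ∑ planes (λ c → 𝟙 (Root? c t) * 𝟙 (Root? c s))))
      ≡⟨ ∑-ext parameters (λ t → trans (∑-ext parameters λ s → trans
           (𝟙*-cong (s ≢? t) {n = 1 * (suc u + 1)} λ s≢t → trans (planes₂ t s (s≢t ∘ sym)) (sym (ℕₚ.*-identityˡ _)))
           (sym (ℕₚ.*-assoc (𝟙 (s ≢? t)) 1 (suc u + 1))))
           (trans (∑-*ʳ parameters (suc u + 1) (λ s → 𝟙 (s ≢? t) * 1)) (cong (_* (suc u + 1)) (sym (ℕₚ.*-identityˡ (∑ parameters (λ s → 𝟙 (s ≢? t) * 1))))))) ⟩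
    ∑ parameters (λ t → 1 * ∑ parameters (λ s → 𝟙 (s ≢? t) * 1) * (suc u + 1))
      ≡⟨ ∑-*ʳ parameters (suc u + 1) _ ⟩
    ∑ parameters (λ t → 1 * ∑ parameters (λ s → 𝟙 (s ≢? t) * 1)) * (suc u + 1)
      ≡⟨ cong (_* (suc u + 1)) (trans (∑-pairs U _≟ᵖ_ (λ _ → yes tt)) (cong (λ n → n * (n ∸ 1)) (∑-one parameters))) ⟩
    D * (D ∸ 1) * (suc u + 1) ∎
    where open ≡-Reasoning

  moment₃ : ∑ planes (λ c → roots c * (roots c ∸ 1) * (roots c ∸ 2)) ≡ D * (D ∸ 1) * (D ∸ 2)
  moment₃ = begin
    ∑ planes (λ c → roots c * (roots c ∸ 1) * (roots c ∸ 2))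
      ≡⟨ ∑-ext planes (λ c → sym (∑-triples U _≟ᵖ_ (Root? c))) ⟩
    ∑ planes (λ c → ∑ parameters (λ t → 𝟙 (Root? c t) * ∑ parameters (λ s → 𝟙 (s ≢? t) * (𝟙 (Root? c s) *
        ∑ parameters (λ w → 𝟙 (w ≢? t) * (𝟙 (w ≢? s) * 𝟙 (Root? c w)))))))
      ≡⟨ ∑-ext planes (λ c → ∑-ext parameters λ t → gather c t) ⟩
    ∑ planes (λ c → ∑ parameters (λ t → ∑ parameters (λ s → 𝟙 (s ≢? t) *
        ∑ parameters (λ w → 𝟙 (w ≢? t) * (𝟙 (w ≢? s) * h c t s w)))))
      ≡⟨ ∑-swap planes parameters _ ⟩
    ∑ parameters (λ t → ∑ planes (λ c → ∑ parameters (λ s → 𝟙 (s ≢? t) *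
        ∑ parameters (λ w → 𝟙 (w ≢? t) * (𝟙 (w ≢? s) * h c t s w)))))
      ≡⟨ ∑-ext parameters (λ t → trans (∑-pull planes parameters (λ s → 𝟙 (s ≢? t)) _)
           (∑-ext parameters λ s → cong (𝟙 (s ≢? t) *_) (trans (∑-pull planes parameters (λ w → 𝟙 (w ≢? t)) _)
             (∑-ext parameters λ w → cong (𝟙 (w ≢? t) *_) (∑-*ˡ planes (𝟙 (w ≢? s)) (λ c → h c t s w)))))) ⟩
    ∑ parameters (λ t → ∑ parameters (λ s → 𝟙 (s ≢? t) *
        ∑ parameters (λ w → 𝟙 (w ≢? t) * (𝟙 (w ≢? s) * ∑ planes (λ c → h c t s w)))))
      ≡⟨ ∑-ext parameters (λ t → trans (∑-ext parameters λ s → 𝟙*-cong (s ≢? t) λ s≢t → trans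
           (∑-ext parameters λ w → 𝟙*-cong (w ≢? t) λ w≢t → 𝟙*-cong (w ≢? s) λ w≢s → planes₃ t s w (s≢t ∘ sym) (w≢t ∘ sym) (w≢s ∘ sym))
           (sym (ℕₚ.*-identityˡ _))) (sym (ℕₚ.*-identityˡ _))) ⟩
    ∑ parameters (λ t → 1 * ∑ parameters (λ s → 𝟙 (s ≢? t) * (1 * ∑ parameters (λ w → 𝟙 (w ≢? t) * (𝟙 (w ≢? s) * 1)))))
      ≡⟨ trans (∑-triples U _≟ᵖ_ (λ _ → yes tt)) (cong (λ n → n * (n ∸ 1) * (n ∸ 2)) (∑-one parameters)) ⟩
    D * (D ∸ 1) * (D ∸ 2) ∎
    where
    open ≡-Reasoning
    h : Vec4 → Parameter → Parameter → Parameter → ℕ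
    h c t s w = 𝟙 (Root? c t) * (𝟙 (Root? c s) * 𝟙 (Root? c w))
    gather : ∀ c t → 𝟙 (Root? c t) * ∑ parameters (λ s → 𝟙 (s ≢? t) * (𝟙 (Root? c s) *
               ∑ parameters (λ w → 𝟙 (w ≢? t) * (𝟙 (w ≢? s) * 𝟙 (Root? c w)))))
             ≡ ∑ parameters (λ s → 𝟙 (s ≢? t) * ∑ parameters (λ w → 𝟙 (w ≢? t) * (𝟙 (w ≢? s) * h c t s w)))
    gather c t = trans (sym (∑-*ˡ parameters (𝟙 (Root? c t)) _)) (∑-ext parameters λ s → trans
      (solveℕ 4 (λ r a r′ z → r :⊗ (a :⊗ (r′ :⊗ z)) :≡ a :⊗ ((r :⊗ r′) :⊗ z)) refl (𝟙 (Root? c t)) (𝟙 (s ≢? t)) (𝟙 (Root? c s)) _)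
      (cong (𝟙 (s ≢? t) *_) (trans (sym (∑-*ˡ parameters (𝟙 (Root? c t) * 𝟙 (Root? c s)) _)) (∑-ext parameters λ w →
        solveℕ 5 (λ r r′ b b′ r″ → (r :⊗ r′) :⊗ (b :⊗ (b′ :⊗ r″)) :≡ b :⊗ (b′ :⊗ (r :⊗ (r′ :⊗ r″)))) refl
          (𝟙 (Root? c t)) (𝟙 (Root? c s)) (𝟙 (w ≢? t)) (𝟙 (w ≢? s)) (𝟙 (Root? c w))))))

  rootClass : ℕ → ℕ
  rootClass k = ∑ planes (λ c → 𝟙 (roots c ℕₚ.≟ k))

  D≡ : D ≡ suc (suc u)
  D≡ = trans length-parameters (cong suc order≡)

  -- No plane has more than three roots, so the falling factorial d(d-1)(d-2) is 6 for d = 3 and 0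
  -- otherwise: the third moment isolates this class. The second and first moments then reach d = 2
  -- and d = 1.
  class₃ : 6 * rootClass 3 ≡ suc (suc u) * suc u * u
  class₃ = trans (sym (∑-*ˡ planes 6 _)) (trans (∑-congᴱ planesᴱ λ c n → small (roots c) (roots≤3 (normalized-≢𝟎 {c} n)))
    (trans moment₃ (cong (λ n → n * (n ∸ 1) * (n ∸ 2)) D≡)))
    where
    small : ∀ d → d ≤ 3 → 6 * 𝟙 (d ℕₚ.≟ 3) ≡ d * (d ∸ 1) * (d ∸ 2)
    small 0 _ = refl
    small 1 _ = refl
    small 2 _ = refl
    small 3 _ = refl
    small (suc (suc (suc (suc _)))) (s≤s (s≤s (s≤s ())))

  class₂ : 2 * rootClass 2 + 6 * rootClass 3 ≡ suc (suc u) * suc u * (suc u + 1)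
  class₂ = trans (cong₂ _+_ (sym (∑-*ˡ planes 2 _)) (sym (∑-*ˡ planes 6 _))) (trans (sym (∑-+ planes _ _))
    (trans (∑-congᴱ planesᴱ λ c n → small (roots c) (roots≤3 (normalized-≢𝟎 {c} n)))
    (trans moment₂ (cong (λ n → n * (n ∸ 1) * (suc u + 1)) D≡))))
    where
    small : ∀ d → d ≤ 3 → 2 * 𝟙 (d ℕₚ.≟ 2) + 6 * 𝟙 (d ℕₚ.≟ 3) ≡ d * (d ∸ 1)
    small 0 _ = refl
    small 1 _ = refl
    small 2 _ = refl
    small 3 _ = refl
    small (suc (suc (suc (suc _)))) (s≤s (s≤s (s≤s ())))

  class₁ : rootClass 1 + 2 * rootClass 2 + 3 * rootClass 3 ≡ suc (suc u) * (suc u * suc u + suc u + 1)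
  class₁ = trans (cong₂ _+_ (trans (cong (rootClass 1 +_) (sym (∑-*ˡ planes 2 _))) (sym (∑-+ planes _ _))) (sym (∑-*ˡ planes 3 _)))
    (trans (sym (∑-+ planes _ _)) (trans (∑-congᴱ planesᴱ λ c n → small (roots c) (roots≤3 (normalized-≢𝟎 {c} n)))
    (trans moment₁ (cong (λ n → n * (suc u * suc u + suc u + 1)) D≡))))
    where
    small : ∀ d → d ≤ 3 → 𝟙 (d ℕₚ.≟ 1) + 2 * 𝟙 (d ℕₚ.≟ 2) + 3 * 𝟙 (d ℕₚ.≟ 3) ≡ d
    small 0 _ = refl
    small 1 _ = refl
    small 2 _ = refl
    small 3 _ = refl
    small (suc (suc (suc (suc _)))) (s≤s (s≤s (s≤s ())))

  one-class : ∀ d → d ≤ 3 → 𝟙 (d ℕₚ.≟ 0) + 𝟙 (d ℕₚ.≟ 1) + 𝟙 (d ℕₚ.≟ 2) + 𝟙 (d ℕₚ.≟ 3) ≡ 1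
  one-class 0 _ = refl
  one-class 1 _ = refl
  one-class 2 _ = refl
  one-class 3 _ = refl
  one-class (suc (suc (suc (suc _)))) (s≤s (s≤s (s≤s ())))

  class₀ : rootClass 0 + rootClass 1 + rootClass 2 + rootClass 3 ≡ suc u * (suc u * suc u) + suc u * suc u + suc u + 1
  class₀ = trans (cong (_+ rootClass 3) (trans (cong (_+ rootClass 2) (sym (∑-+ planes _ _))) (sym (∑-+ planes _ _)))) (trans (sym (∑-+ planes _ _))
    (trans (∑-congᴱ planesᴱ λ c n → one-class (roots c) (roots≤3 (normalized-≢𝟎 {c} n))) (trans (∑-one planes) planes-total)))

  -- Osculating planes

  Normalized-osc : ∀ t → Normalized (osc t)
  Normalized-osc (just t) = zero , (λ _ ()) , refl
  Normalized-osc nothing  = suc (suc (suc zero)) , (λ { zero _ → refl ; (suc zero) _ → refl ; (suc (suc zero)) _ → refl ; (suc (suc (suc zero))) (s≤s (s≤s (s≤s ()))) }) , refl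

  Root-osc : ∀ s t → Root (osc s) t → s ≡ t
  Root-osc s t e = ℓ≡0 s t (cube≡0 (trans (sym (dot-osc s t)) e))

  Root-osc-self : ∀ s → Root (osc s) s
  Root-osc-self s = trans (dot-osc s s) (trans (cong cube (ℓ-self s)) (zeroʳ _))

  roots-osc : ∀ s → roots (osc s) ≡ 1
  roots-osc s = count-one parametersᴱ (Root? (osc s)) s tt (Root-osc-self s) (λ t _ e → sym (Root-osc s t e))

  osc-injective : ∀ {s t} → osc s ≡ osc t → s ≡ t
  osc-injective {s} {t} e = Root-osc s t (trans (cong (λ c → dot c (curvePt t)) e) (Root-osc-self t))

  -- For normalized planes this is `GammaPlane`: the normal form of a plane is unique and `osc t` is
  -- itself normalized, so no scalar is left.
  Osculating : Vec4 → Set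
  Osculating c = ∃[ t ] c ≡ osc t

  Osculating? : Decidable Osculating
  Osculating? c = map′ (λ (t , _ , e) → t , e) (λ (t , e) → t , tt , e) (any-enum parametersᴱ λ t → c ≟ᵛ osc t)

  GammaPlane⇒Osculating : ∀ {c} → Normalized c → GammaPlane c → Osculating c
  GammaPlane⇒Osculating {c} n (t , k , hk , e) =
    t , proj₂ (normalize-unique n (Normalized-osc t) 1≢0 hk (trans (scale-1 c) e))

  Osculating⇒GammaPlane : ∀ {c} → Osculating c → GammaPlane c
  Osculating⇒GammaPlane (t , refl) = t , 1# , 1≢0 , sym (scale-1 (osc t))

  gamma-count : ∑ planes (λ c → 𝟙 (Osculating? c)) ≡ suc (suc u)
  gamma-count = begin
    ∑ planes (λ c → 𝟙 (Osculating? c))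
      ≡⟨ ∑-ext planes (λ c → ℕₚ.≤-antisym
           (𝟙-lower (Osculating? c) λ (t , e) z → ℕₚ.1+n≢0 (trans (sym (𝟙-yes (c ≟ᵛ osc t) e)) (∑-≡0 parameters z t (complete parametersᴱ tt))))
           (𝟙-upper (Osculating? c)
             (λ _ → count≤1 parametersᴱ (λ t → c ≟ᵛ osc t) λ s t _ _ e e′ → osc-injective (trans (sym e) e′))
             (λ h → count-zero parametersᴱ (λ t → c ≟ᵛ osc t) λ t _ e → h (t , e)))) ⟩
    ∑ planes (λ c → ∑ parameters (λ t → 𝟙 (c ≟ᵛ osc t)))
      ≡⟨ ∑-swap planes parameters _ ⟩
    ∑ parameters (λ t → ∑ planes (λ c → 𝟙 (c ≟ᵛ osc t)))
      ≡⟨ ∑-ext parameters (λ t → count-one planesᴱ (_≟ᵛ osc t) (osc t) (Normalized-osc t) refl (λ _ _ e → e)) ⟩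
    ∑ parameters (λ _ → 1)
      ≡⟨ trans (∑-one parameters) D≡ ⟩
    suc (suc u) ∎
    where open ≡-Reasoning

  oneBarClass : ℕ
  oneBarClass = ∑ planes (λ c → 𝟙 (¬? (Osculating? c)) * 𝟙 (roots c ℕₚ.≟ 1))

  -- The q + 1 osculating planes all have exactly one root, a triple one, and what remains of that
  -- class are the 1-bar planes.
  class-one-bar : oneBarClass + suc (suc u) ≡ rootClass 1
  class-one-bar = trans (cong (oneBarClass +_) (sym gamma-count)) (trans (sym (∑-+ planes _ _)) (∑-ext planes λ c →
    𝟙-difference (Osculating? c) (roots c ℕₚ.≟ 1) λ (t , e) → trans (cong roots e) (roots-osc t)))

-- External lines in a plane

module ExternalLines (F : Field) where
  open PlaneCounts F public
  open ℕ-Solver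

  External? : ∀ L → Dec (External L)
  External? L = map′ (λ h t e → h (t , tt , e)) (λ h (t , _ , e) → h t e) (¬? (any-enum parametersᴱ λ t → OnLine? (curvePt t) L))

  CommonRoot : Vec4 → Vec4 → Set
  CommonRoot c x = ∃[ t ] (Root c t × Root x t)

  CommonRoot? : ∀ c x → Dec (CommonRoot c x)
  CommonRoot? c x = map′ (λ (t , _ , e) → t , e) (λ (t , e) → t , tt , e) (any-enum parametersᴱ λ t → Root? c t ×-dec Root? x t)

  external-meet⁺ : ∀ {c x M} → IsLine M → Contains c M → Contains x M → Independent c x → External M → ¬ CommonRoot c x
  external-meet⁺ {c} {x} {M} m cM xM ind ext (t , ec , ex) = ext t (killed⇒OnLine m λ y h →
    let (a , b , e) = perp-span m ind cM xM y h in subst (λ y → Root y t) e (lin-kills a c b x (curvePt t) ec ex))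

  external-meet⁻ : ∀ {c x M} → Contains c M → Contains x M → ¬ CommonRoot c x → External M
  external-meet⁻ {c} {x} {M} cM xM h t on = h (t , OnLine⇒killed M on c cM , OnLine⇒killed M on x xM)

  -- A point lies on the meet exactly when both planes vanish there, so being external becomes a
  -- condition on the zeros of two forms.
  external-meet : ∀ {c x} → Independent c x →
    ∑ lines (λ L → 𝟙 (Contains? c L) * (𝟙 (Contains? x L) * 𝟙 (External? L))) ≡ 𝟙 (¬? (CommonRoot? c x))
  external-meet {c} {x} ind = let (M , m , cM , xM) = line-exists c x in
    trans (meet-sum (λ L → 𝟙 (External? L)) ind m cM xM)
      (𝟙-cong (External? M) (¬? (CommonRoot? c x)) (external-meet⁺ m cM xM ind) (external-meet⁻ {c} {x} {M} cM xM))

  externals : Vec4 → ℕ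
  externals c = ∑ lines (λ L → 𝟙 (Contains? c L) * 𝟙 (External? L))

  private
    -- Coprimality is meant over the points of the cubic defined over F: the two forms may still
    -- share a conjugate pair of zeros in the extension.
    coprimes : Vec4 → ℕ
    coprimes c = ∑ vectors (λ x → 𝟙 (¬? (multiple? c x)) * 𝟙 (¬? (CommonRoot? c x)))

    externals-equation : ∀ {c} → c ≢ 𝟎 → coprimes c + order * externals c ≡ order * order * externals c
    externals-equation {c} hc = trans (cong (_+ order * externals c) (∑-ext vectors λ x →
        𝟙*-cong (¬? (multiple? c x)) λ h → sym (external-meet (non-multiple⇒independent hc h))))
      (lines-in-plane hc (λ L → 𝟙 (External? L)))

    -- The factor u * suc u is q² - q, the number of vectors `x` that cut `c` in one given line.
    externals-value : ∀ {c} → c ≢ 𝟎 → ∀ T → coprimes c ≡ u * (suc u * T) → externals c ≡ T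
    externals-value {c} hc T e = cancel-units (ℕₚ.*-cancelˡ-≡ _ _ (suc u) (ℕₚ.+-cancelʳ-≡ (suc u * externals c) _ _ (begin
      suc u * (u * externals c) + suc u * externals c
        ≡⟨ solveℕ 2 (λ u s → let q = conℕ 1 :⊕ u in q :⊗ (u :⊗ s) :⊕ q :⊗ s :≡ q :⊗ q :⊗ s) refl u (externals c) ⟩
      suc u * suc u * externals c
        ≡⟨ sym (subst (λ q → coprimes c + q * externals c ≡ q * q * externals c) order≡ (externals-equation hc)) ⟩
      coprimes c + suc u * externals c
        ≡⟨ cong (_+ suc u * externals c) (trans e (solveℕ 2 (λ u t → let q = conℕ 1 :⊕ u in u :⊗ (q :⊗ t) :≡ q :⊗ (u :⊗ t)) refl u T)) ⟩
      suc u * (u * T) + suc u * externals c ∎)))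
      where open ≡-Reasoning

  AllNonzero : ∀ {k} → Vec Carrier k → Set
  AllNonzero []      = ⊤
  AllNonzero (x ∷ w) = x ≢ 0# × AllNonzero w

  AllNonzero? : ∀ {k} (w : Vec Carrier k) → Dec (AllNonzero w)
  AllNonzero? []      = yes tt
  AllNonzero? (x ∷ w) = ¬? (x ≟ 0#) ×-dec AllNonzero? w

  count-nonzero : ∀ k → ∑ (allVecs elements k) (λ w → 𝟙 (AllNonzero? w)) ≡ u ^ k
  count-nonzero zero    = refl
  count-nonzero (suc k) = begin
    ∑ (allVecs elements (suc k)) (λ w → 𝟙 (AllNonzero? w))
      ≡⟨ ∑-product _∷_ elements (allVecs elements k) _ ⟩
    ∑ elements (λ x → ∑ (allVecs elements k) (λ w → 𝟙 (¬? (x ≟ 0#) ×-dec AllNonzero? w)))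
      ≡⟨ ∑-ext elements (λ x → trans (∑-ext (allVecs elements k) λ w → 𝟙-× (¬? (x ≟ 0#)) (AllNonzero? w))
           (trans (∑-*ˡ (allVecs elements k) (𝟙 (¬? (x ≟ 0#))) (λ w → 𝟙 (AllNonzero? w))) (cong (𝟙 (¬? (x ≟ 0#)) *_) (count-nonzero k)))) ⟩
    ∑ elements (λ x → 𝟙 (¬? (x ≟ 0#)) * u ^ k)
      ≡⟨ ∑-*ʳ elements (u ^ k) _ ⟩
    ∑ elements (λ x → 𝟙 (¬? (x ≟ 0#))) * u ^ k
      ≡⟨ cong (_* u ^ k) (sym (length-filter (λ x → ¬? (x ≟ 0#)) elements)) ⟩
    u ^ suc k ∎
    where open ≡-Reasoning

  -- Among the q^k value vectors, all attained equally often, (q - 1)^k have no zero entry.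
  count-nonvanishing : ∀ {k} (ps : Vec Vec4 k) → Surjective ps →
                       order ^ k * ∑ vectors (λ x → 𝟙 (AllNonzero? (values ps x))) ≡ u ^ k * order ^ 4
  count-nonvanishing {k} ps surj = begin
    order ^ k * ∑ vectors (λ x → 𝟙 (AllNonzero? (values ps x)))
      ≡⟨ cong (order ^ k *_) (trans (∑-ext vectors λ x → sym (pick x)) (∑-swap vectors W _)) ⟩
    order ^ k * ∑ W (λ w → ∑ vectors (λ x → 𝟙 (values ps x ≟ᵛ w) * 𝟙 (AllNonzero? w)))
      ≡⟨ cong (order ^ k *_) (∑-ext W λ w → ∑-*ʳ vectors (𝟙 (AllNonzero? w)) _) ⟩
    order ^ k * ∑ W (λ w → fibre ps w * 𝟙 (AllNonzero? w))
      ≡⟨ sym (∑-*ˡ W (order ^ k) _) ⟩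
    ∑ W (λ w → order ^ k * (fibre ps w * 𝟙 (AllNonzero? w)))
      ≡⟨ ∑-ext W (λ w → trans (sym (ℕₚ.*-assoc (order ^ k) (fibre ps w) _)) (cong (_* 𝟙 (AllNonzero? w)) (fibre-surjective ps surj w))) ⟩
    ∑ W (λ w → order ^ 4 * 𝟙 (AllNonzero? w))
      ≡⟨ ∑-*ˡ W (order ^ 4) _ ⟩
    order ^ 4 * ∑ W (λ w → 𝟙 (AllNonzero? w))
      ≡⟨ trans (cong (order ^ 4 *_) (count-nonzero k)) (ℕₚ.*-comm (order ^ 4) (u ^ k)) ⟩
    u ^ k * order ^ 4 ∎
    where
    open ≡-Reasoning
    W = allVecs elements k
    pick : ∀ x → ∑ W (λ w → 𝟙 (values ps x ≟ᵛ w) * 𝟙 (AllNonzero? w)) ≡ 𝟙 (AllNonzero? (values ps x))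
    pick x = trans (∑-single (unique (allVecsᴱ elementsᴱ k)) (values ps x) (complete (allVecsᴱ elementsᴱ k) tt)
      (λ w _ ne → cong (_* 𝟙 (AllNonzero? w)) (𝟙-no (values ps x ≟ᵛ w) (ne ∘ sym))))
      (trans (cong (_* 𝟙 (AllNonzero? (values ps x))) (𝟙-yes (values ps x ≟ᵛ values ps x) refl)) (ℕₚ.*-identityˡ _))

  curvePts : ∀ {k} → Vec Parameter k → Vec Vec4 k
  curvePts = Vec.map curvePt

  RootVector : ∀ {k} → Vec4 → Vec Parameter k → Set
  RootVector c ts = (∀ t → Root c t → t ∈ Vec.toList ts) × (∀ t → t ∈ Vec.toList ts → Root c t) × Unique (Vec.toList ts)

  -- A vector of known length lets each of the following cases name its roots by pattern matching.
  root-vector : ∀ c k → roots c ≡ k → Σ (Vec Parameter k) (RootVector c)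
  root-vector c k refl = subst (λ n → Σ (Vec Parameter n) (RootVector c)) (length-filter (Root? c) parameters)
    (Vec.fromList L , subst Lists (sym (Vecₚ.toList∘fromList L)) ((λ t e → complete E (tt , e)) , (λ t m → proj₂ (sound E m)) , unique E))
    where
    L = filter (Root? c) parameters
    E = enum-filter parametersᴱ (Root? c)
    Lists : List Parameter → Set
    Lists ts = (∀ t → Root c t → t ∈ ts) × (∀ t → t ∈ ts → Root c t) × Unique ts

  AllNonzero⇒ : ∀ {k} (ts : Vec Parameter k) x → AllNonzero (values (curvePts ts) x) → ∀ t → t ∈ Vec.toList ts → ¬ Root x t
  AllNonzero⇒ (t ∷ ts) x (h , hs) _ (here refl) e = h e
  AllNonzero⇒ (t ∷ ts) x (h , hs) s (there m)   e = AllNonzero⇒ ts x hs s m e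

  ⇒AllNonzero : ∀ {k} (ts : Vec Parameter k) x → (∀ t → t ∈ Vec.toList ts → ¬ Root x t) → AllNonzero (values (curvePts ts) x)
  ⇒AllNonzero []       x h = tt
  ⇒AllNonzero (t ∷ ts) x h = h t (here refl) , ⇒AllNonzero ts x (λ s m → h s (there m))

  -- As `c` has a root `t₀`, a form without common zero cannot be a multiple of `c`, and only the
  -- nonvanishing at the roots of `c` is left. This needs at least one root, hence `suc k`.
  coprimes-value : ∀ {k c} (ts : Vec Parameter (suc k)) → RootVector c ts → Surjective (curvePts ts) →
                   order ^ suc k * coprimes c ≡ u ^ suc k * order ^ 4
  coprimes-value {k} {c} ts@(t₀ ∷ _) (all , are , _) surj = trans (cong (order ^ suc k *_) (∑-ext vectors λ x →
      trans (sym (𝟙-× (¬? (multiple? c x)) (¬? (CommonRoot? c x))))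
        (𝟙-cong (¬? (multiple? c x) ×-dec ¬? (CommonRoot? c x)) (AllNonzero? (values (curvePts ts) x))
          (λ (_ , h) → ⇒AllNonzero ts x (λ t m e → h (t , are t m , e)))
          (λ h → (λ { (a , refl) → AllNonzero⇒ ts (scale a c) h t₀ (here refl)
                       (trans (dot-scaleˡ a c (curvePt t₀)) (trans (cong (a ⊗_) (are t₀ (here refl))) (zeroʳ a))) })
               , λ (t , ec , ex) → AllNonzero⇒ ts x h t (all t ec) ex))))
    (count-nonvanishing (curvePts ts) surj)

  externals₁ : ∀ {c} → c ≢ 𝟎 → roots c ≡ 1 → externals c ≡ suc u * suc u
  externals₁ {c} hc e with root-vector c 1 e
  ... | ts@(t ∷ []) , rv = externals-value hc _ (ℕₚ.*-cancelˡ-≡ _ _ (suc u ^ 1) {{ℕₚ.m^n≢0 (suc u) 1}}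
    (trans (subst (λ q → q ^ 1 * coprimes c ≡ u ^ 1 * q ^ 4) order≡ (coprimes-value ts rv (surjective₁ t)))
      (solveℕ 1 (λ u → let q = conℕ 1 :⊕ u in u :⊗ conℕ 1 :⊗ (q :⊗ (q :⊗ (q :⊗ (q :⊗ conℕ 1)))) :≡ q :⊗ conℕ 1 :⊗ (u :⊗ (q :⊗ (q :⊗ q)))) refl u)))

  externals₂ : ∀ {c} → c ≢ 𝟎 → roots c ≡ 2 → externals c ≡ suc u * u
  externals₂ {c} hc e with root-vector c 2 e
  ... | ts@(t ∷ s ∷ []) , rv@(_ , _ , (ts≢ All.∷ _) ∷ _) = externals-value hc _ (ℕₚ.*-cancelˡ-≡ _ _ (suc u ^ 2) {{ℕₚ.m^n≢0 (suc u) 2}}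
    (trans (subst (λ q → q ^ 2 * coprimes c ≡ u ^ 2 * q ^ 4) order≡ (coprimes-value ts rv (surjective₂ s t (ts≢ ∘ sym))))
      (solveℕ 1 (λ u → let q = conℕ 1 :⊕ u in u :⊗ (u :⊗ conℕ 1) :⊗ (q :⊗ (q :⊗ (q :⊗ (q :⊗ conℕ 1)))) :≡ q :⊗ (q :⊗ conℕ 1) :⊗ (u :⊗ (q :⊗ (q :⊗ u)))) refl u)))

  externals₃ : ∀ {c} → c ≢ 𝟎 → roots c ≡ 3 → externals c ≡ u * u
  externals₃ {c} hc e with root-vector c 3 e
  ... | ts@(t ∷ s ∷ r ∷ []) , rv@(_ , _ , (ts≢ All.∷ tr≢ All.∷ _) ∷ (sr≢ All.∷ _) ∷ _) = externals-value hc _ (ℕₚ.*-cancelˡ-≡ _ _ (suc u ^ 3) {{ℕₚ.m^n≢0 (suc u) 3}}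
    (trans (subst (λ q → q ^ 3 * coprimes c ≡ u ^ 3 * q ^ 4) order≡ (coprimes-value ts rv (surjective₃ r s t (sr≢ ∘ sym) (tr≢ ∘ sym) (ts≢ ∘ sym))))
      (solveℕ 1 (λ u → let q = conℕ 1 :⊕ u in u :⊗ (u :⊗ (u :⊗ conℕ 1)) :⊗ (q :⊗ (q :⊗ (q :⊗ (q :⊗ conℕ 1)))) :≡ q :⊗ (q :⊗ (q :⊗ conℕ 1)) :⊗ (u :⊗ (q :⊗ (u :⊗ u)))) refl u)))

  -- Without roots the only condition on `x` is not to be a multiple of `c`, which leaves q⁴ - q
  -- vectors: every line of the plane is external.
  externals₀ : ∀ {c} → c ≢ 𝟎 → roots c ≡ 0 → externals c ≡ suc u * suc u + suc u + 1
  externals₀ {c} hc e = externals-value hc _ (ℕₚ.+-cancelʳ-≡ (suc u) _ _ (begin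
    coprimes c + suc u
      ≡⟨ cong₂ _+_ (∑-ext vectors λ x → trans (𝟙*-cong (¬? (multiple? c x)) {n = 1} λ _ → 𝟙-yes (¬? (CommonRoot? c x)) (no-common x)) (ℕₚ.*-identityʳ _))
           (trans (sym order≡) (sym (multiples-count hc))) ⟩
    ∑ vectors (λ x → 𝟙 (¬? (multiple? c x))) + ∑ vectors (λ x → 𝟙 (multiple? c x))
      ≡⟨ sym (∑-+ vectors _ _) ⟩
    ∑ vectors (λ x → 𝟙 (¬? (multiple? c x)) + 𝟙 (multiple? c x))
      ≡⟨ ∑-ext vectors (λ x → trans (ℕₚ.+-comm (𝟙 (¬? (multiple? c x))) _) (𝟙-¬ (multiple? c x))) ⟩
    ∑ vectors (λ _ → 1)
      ≡⟨ trans (∑-one vectors) (trans (length-allVecs elements 4) (cong (_^ 4) order≡)) ⟩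
    suc u ^ 4
      ≡⟨ solveℕ 1 (λ u → let q = conℕ 1 :⊕ u in q :⊗ (q :⊗ (q :⊗ (q :⊗ conℕ 1))) :≡ u :⊗ (q :⊗ (q :⊗ q :⊕ q :⊕ conℕ 1)) :⊕ q) refl u ⟩
    u * (suc u * (suc u * suc u + suc u + 1)) + suc u ∎))
    where
    open ≡-Reasoning
    no-common : ∀ x → ¬ CommonRoot c x
    no-common x (t , ec , _) = ℕₚ.1+n≢0 (trans (sym (𝟙-yes (Root? c t) ec)) (∑-≡0 parameters e t (complete parametersᴱ tt)))

  externalLines : ℕ
  externalLines = ∑ lines (λ L → 𝟙 (External? L))

  ∑-lines-planes : ∀ (g : Line → ℕ) → ∑ planes (λ c → ∑ lines (λ L → 𝟙 (Contains? c L) * g L)) ≡ (order + 1) * ∑ lines g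
  ∑-lines-planes g = trans (∑-swap planes lines _) (trans
    (∑-congᴱ linesᴱ λ L l → trans (∑-*ʳ planes (g L) (λ c → 𝟙 (Contains? c L))) (cong (_* g L) (perp-planes l)))
    (∑-*ˡ lines (order + 1) g))

  external-total : (suc u + 1) * externalLines ≡ rootClass 0 * (suc u * suc u + suc u + 1) + rootClass 1 * (suc u * suc u)
                     + rootClass 2 * (suc u * u) + rootClass 3 * (u * u)
  external-total = begin
    (suc u + 1) * externalLines
      ≡⟨ cong (λ q → (q + 1) * externalLines) (sym order≡) ⟩
    (order + 1) * externalLines
      ≡⟨ sym (∑-lines-planes (λ L → 𝟙 (External? L))) ⟩
    ∑ planes externals
      ≡⟨ ∑-congᴱ planesᴱ (λ c n → classify (roots c) refl (roots≤3 (normalized-≢𝟎 {c} n)) (normalized-≢𝟎 {c} n)) ⟩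
    ∑ planes (λ c → 𝟙 (roots c ℕₚ.≟ 0) * e₀ + 𝟙 (roots c ℕₚ.≟ 1) * e₁ + 𝟙 (roots c ℕₚ.≟ 2) * e₂ + 𝟙 (roots c ℕₚ.≟ 3) * e₃)
      ≡⟨ trans (∑-+ planes _ _) (cong₂ _+_ (trans (∑-+ planes _ _) (cong₂ _+_ (trans (∑-+ planes _ _)
           (cong₂ _+_ (∑-*ʳ planes e₀ _) (∑-*ʳ planes e₁ _))) (∑-*ʳ planes e₂ _))) (∑-*ʳ planes e₃ _)) ⟩
    rootClass 0 * e₀ + rootClass 1 * e₁ + rootClass 2 * e₂ + rootClass 3 * e₃ ∎
    where
    open ≡-Reasoning
    e₀ = suc u * suc u + suc u + 1
    e₁ = suc u * suc u
    e₂ = suc u * u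
    e₃ = u * u
    weight : ℕ → ℕ
    weight d = 𝟙 (d ℕₚ.≟ 0) * e₀ + 𝟙 (d ℕₚ.≟ 1) * e₁ + 𝟙 (d ℕₚ.≟ 2) * e₂ + 𝟙 (d ℕₚ.≟ 3) * e₃
    classify : ∀ {c} d → roots c ≡ d → d ≤ 3 → c ≢ 𝟎 → externals c ≡ weight (roots c)
    classify {c} 0 e _ hc = trans (externals₀ hc e) (trans
      (solveℕ 1 (λ x → x :≡ conℕ 1 :⊗ x :⊕ conℕ 0 :⊕ conℕ 0 :⊕ conℕ 0) refl e₀) (cong weight (sym e)))
    classify {c} 1 e _ hc = trans (externals₁ hc e) (trans
      (solveℕ 1 (λ x → x :≡ conℕ 0 :⊕ conℕ 1 :⊗ x :⊕ conℕ 0 :⊕ conℕ 0) refl e₁) (cong weight (sym e)))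
    classify {c} 2 e _ hc = trans (externals₂ hc e) (trans
      (solveℕ 1 (λ x → x :≡ conℕ 0 :⊕ conℕ 0 :⊕ conℕ 1 :⊗ x :⊕ conℕ 0) refl e₂) (cong weight (sym e)))
    classify {c} 3 e _ hc = trans (externals₃ hc e) (trans
      (solveℕ 1 (λ x → x :≡ conℕ 0 :⊕ conℕ 0 :⊕ conℕ 0 :⊕ conℕ 1 :⊗ x) refl e₃) (cong weight (sym e)))
    classify (suc (suc (suc (suc _)))) _ (s≤s (s≤s (s≤s ()))) _

-- Osculating planes through a line, real axes and EΓ-lines

module RealAxes (F : Field) (three≢0 : Field.three F ≢ Field.0# F) where
  open ExternalLines F public
  open ℕ-Solver

  -- Of the two cubes, one vanishes at the point `t` of the cubic and the other does not.
  osc-independent : ∀ {s t} → s ≢ t → Independent (osc s) (osc t)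
  osc-independent {s} {t} h a b e = coefficient a b s t h e , coefficient b a t s (h ∘ sym)
    (trans (vec-ext λ k → trans (lookup-lin b (osc t) a (osc s) k) (trans (+-comm _ _) (sym (lookup-lin a (osc s) b (osc t) k)))) e)
    where
    coefficient : ∀ a b s t → s ≢ t → lin a (osc s) b (osc t) ≡ 𝟎 → a ≡ 0#
    coefficient a b s t h e = xy≡0⇒y≡0 (cube-≢0 (ℓ≢0 h)) (begin
      cube (ℓ s t) ⊗ a ≡⟨ solve 3 (λ c a b → c :* a := a :* c :+ b :* :0) refl (cube (ℓ s t)) a b ⟩
      a ⊗ cube (ℓ s t) ⊕ b ⊗ 0# ≡⟨ cong₂ (λ x y → a ⊗ x ⊕ b ⊗ y) (sym (dot-osc s t)) (sym (Root-osc-self t)) ⟩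
      a ⊗ dot (osc s) (curvePt t) ⊕ b ⊗ dot (osc t) (curvePt t) ≡⟨ sym (dot-linˡ a (osc s) b (osc t) (curvePt t)) ⟩
      dot (lin a (osc s) b (osc t)) (curvePt t) ≡⟨ cong (λ c → dot c (curvePt t)) e ⟩
      dot 𝟎 (curvePt t) ≡⟨ dot-𝟎ˡ (curvePt t) ⟩
      0# ∎)
      where open ≡-Reasoning

  dot-probe-≢0 : ∀ {v r s t} → v ≢ r → v ≢ s → v ≢ t → dot (osc v) (probe r s t) ≢ 0#
  dot-probe-≢0 {v} {r} {s} {t} hr hs ht e = ⊗-≢0 three≢0 (⊗-≢0 (⊗-≢0 (ℓ≢0 hr) (ℓ≢0 hs)) (ℓ≢0 ht)) (trans (sym (dot-probe v r s t)) e)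

  dot-probe-₁ : ∀ r s t → dot (osc r) (probe r s t) ≡ 0#
  dot-probe-₁ r s t = trans (dot-probe r r s t) (trans (cong (λ z → three ⊗ (z ⊗ ℓ r s ⊗ ℓ r t)) (ℓ-self r))
    (solve 3 (λ k x y → k :* (:0 :* x :* y) := :0) refl three (ℓ r s) (ℓ r t)))

  dot-probe-₂ : ∀ r s t → dot (osc s) (probe r s t) ≡ 0#
  dot-probe-₂ r s t = trans (dot-probe s r s t) (trans (cong (λ z → three ⊗ (ℓ s r ⊗ z ⊗ ℓ s t)) (ℓ-self s))
    (solve 3 (λ k x y → k :* (x :* :0 :* y) := :0) refl three (ℓ s r) (ℓ s t)))

  dot-probe-₃ : ∀ r s t → dot (osc t) (probe r s t) ≡ 0#
  dot-probe-₃ r s t = trans (dot-probe t r s t) (trans (cong (λ z → three ⊗ (ℓ t r ⊗ ℓ t s ⊗ z)) (ℓ-self t))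
    (solve 3 (λ k x y → k :* (x :* y :* :0) := :0) refl three (ℓ t r) (ℓ t s)))

  -- A third osculating plane through the line would lie in the span of the first two. The probe at
  -- `r`, `s`, `s` kills that span, but not a cube with a different zero.
  third-osc : ∀ {L r s t} → IsLine L → r ≢ s → Contains (osc r) L → Contains (osc s) L → Contains (osc t) L → t ≡ r ⊎ t ≡ s
  third-osc {L} {r} {s} {t} l h hr hs ht = go (t ≟ᵖ r) (t ≟ᵖ s)
    where
    impossible : t ≢ r → t ≢ s → ∃[ a ] ∃[ b ] lin a (osc r) b (osc s) ≡ osc t → ⊥
    impossible tr ts (a , b , e) = dot-probe-≢0 {t} {r} {s} {s} tr ts ts (trans (cong (λ c → dot c (probe r s s)) (sym e))
      (lin-kills a (osc r) b (osc s) (probe r s s) (dot-probe-₁ r s s) (dot-probe-₂ r s s)))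
    go : Dec (t ≡ r) → Dec (t ≡ s) → t ≡ r ⊎ t ≡ s
    go (yes e) _       = inj₁ e
    go (no _)  (yes e) = inj₂ e
    go (no tr) (no ts) = ⊥-elim (impossible tr ts (perp-span l (osc-independent h) hr hs (osc t) ht))

  -- The q² vectors of the pencil of the line would all vanish at three points of the cubic, while
  -- only q vectors do.
  three-collinear : ∀ {L r s t} → IsLine L → r ≢ s → r ≢ t → s ≢ t →
                    OnLine (curvePt r) L → OnLine (curvePt s) L → OnLine (curvePt t) L → ⊥
  three-collinear {L} {r} {s} {t} l rs rt st or os ot = ℕₚ.<⇒≱ 1<order (ℕₚ.*-cancelˡ-≤ order
    (subst₂ _≤_ (perp-count l) (trans fibre≡ (sym (ℕₚ.*-identityʳ order)))
      (∑-mono vectors λ c _ → 𝟙-mono (Contains? c L) (values ps c ≟ᵛ zeros 3) λ h →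
        cong₂ _∷_ (OnLine⇒killed L ot c h) (cong₂ _∷_ (OnLine⇒killed L os c h) (cong (_∷ []) (OnLine⇒killed L or c h))))))
    where
    ps = curvePt t ∷ curvePt s ∷ curvePt r ∷ []
    fibre≡ : fibre ps (zeros 3) ≡ order
    fibre≡ = ℕₚ.*-cancelˡ-≡ _ order (order ^ 3) {{ℕₚ.m^n≢0 order 3}} (trans (fibre-surjective ps (surjective₃ r s t rs rt st) (zeros 3))
      (trans (ℕₚ.^-distribˡ-+-* order 3 1) (cong (order ^ 3 *_) (ℕₚ.*-identityʳ order))))

  -- The pencil of the line is contained in the solutions of the two point conditions, and both sets
  -- have q² elements.
  chord-perp : ∀ {L r s} → IsLine L → r ≢ s → OnLine (curvePt r) L → OnLine (curvePt s) L → ∀ c → Root c r → Root c s → Contains c L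
  chord-perp {L} {r} {s} l rs or os c er es = 𝟙≡1 (Contains? c L) (trans
    (∑-tight vectors {f = λ c → 𝟙 (Contains? c L)} {g = λ c → 𝟙 (values ps c ≟ᵛ zeros 2)}
      (λ c _ → 𝟙-mono (Contains? c L) (values ps c ≟ᵛ zeros 2) λ h → cong₂ _∷_ (OnLine⇒killed L os c h) (cong (_∷ []) (OnLine⇒killed L or c h)))
      (ℕₚ.≤-reflexive (trans fibre≡ (sym (perp-count l)))) c (complete vectorsᴱ tt))
    (𝟙-yes (values ps c ≟ᵛ zeros 2) (cong₂ _∷_ es (cong (_∷ []) er))))
    where
    ps = curvePt s ∷ curvePt r ∷ []
    fibre≡ : fibre ps (zeros 2) ≡ order * order
    fibre≡ = ℕₚ.*-cancelˡ-≡ _ (order * order) (order ^ 2) {{ℕₚ.m^n≢0 order 2}} (trans (fibre-surjective ps (surjective₂ r s rs) (zeros 2))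
      (trans (ℕₚ.^-distribˡ-+-* order 2 2) (cong (λ z → order ^ 2 * (order * z)) (ℕₚ.*-identityʳ order))))

  chord-unique : ∀ {L M r s} → IsLine L → IsLine M → r ≢ s → OnLine (curvePt r) L → OnLine (curvePt s) L →
                 OnLine (curvePt r) M → OnLine (curvePt s) M → L ≡ M
  chord-unique {L} {M} l m rs rL sL rM sM = perp-⊆⇒≡ l m λ c h →
    chord-perp m rs rM sM c (OnLine⇒killed L rL c h) (OnLine⇒killed L sL c h)

  -- Osculating planes through a line

  γ : Line → ℕ
  γ L = ∑ parameters (λ t → 𝟙 (Contains? (osc t) L))

  InGammaPlane? : ∀ L → Dec (InGammaPlane L)
  InGammaPlane? L = map′ (λ (t , _ , h) → t , h) (λ (t , h) → t , tt , h) (any-enum parametersᴱ λ t → Contains? (osc t) L)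

  RealAxis? : ∀ L → Dec (RealAxis L)
  RealAxis? L = map′ (λ (s , _ , t , _ , h) → s , t , h) (λ (s , t , h) → s , tt , t , tt , h)
    (any-enum parametersᴱ λ s → any-enum parametersᴱ λ t → ¬? (s ≟ᵖ t) ×-dec (Contains? (osc s) L ×-dec Contains? (osc t) L))

  RealAxis⇒External : ∀ L → RealAxis L → External L
  RealAxis⇒External L (s , t , s≢t , hs , ht) v on = s≢t (trans
    (Root-osc s v (OnLine⇒killed L on (osc s) hs)) (sym (Root-osc t v (OnLine⇒killed L on (osc t) ht))))

  γ-RealAxis : ∀ {L} → IsLine L → RealAxis L → γ L ≡ 2
  γ-RealAxis {L} l (s , t , s≢t , hs , ht) = count-two parametersᴱ (λ t → Contains? (osc t) L) s t tt tt hs ht s≢t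
    (λ v _ h → third-osc l s≢t hs ht h)

  γ-¬RealAxis : ∀ {L} → ¬ RealAxis L → γ L ≡ 𝟙 (InGammaPlane? L)
  γ-¬RealAxis {L} h = ℕₚ.≤-antisym
    (𝟙-upper (InGammaPlane? L) (λ _ → count≤1 parametersᴱ (λ t → Contains? (osc t) L) same)
      (λ no → count-zero parametersᴱ (λ t → Contains? (osc t) L) λ t _ c → no (t , c)))
    (𝟙-lower (InGammaPlane? L) λ (t , c) z → ℕₚ.1+n≢0 (trans (sym (𝟙-yes (Contains? (osc t) L) c)) (∑-≡0 parameters z t (complete parametersᴱ tt))))
    where
    same : ∀ s t → ⊤ → ⊤ → Contains (osc s) L → Contains (osc t) L → s ≡ t
    same s t _ _ hs ht with s ≟ᵖ t
    ... | yes e = e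
    ... | no ne = ⊥-elim (h (s , t , ne , hs , ht))

  EGamma? : ∀ L → Dec (External L × InGammaPlane L × ¬ RealAxis L)
  EGamma? L = External? L ×-dec (InGammaPlane? L ×-dec ¬? (RealAxis? L))

  -- Summing over osculating planes meets an EΓ-line once but a real axis twice, since it lies in
  -- exactly two of them. This is the origin of the factor 2 in the equations below.
  external-γ : ∀ L → IsLine L → 𝟙 (External? L) * γ L ≡ 𝟙 (EGamma? L) + 2 * 𝟙 (RealAxis? L)
  external-γ L l = go (RealAxis? L)
    where
    go : Dec (RealAxis L) → 𝟙 (External? L) * γ L ≡ 𝟙 (EGamma? L) + 2 * 𝟙 (RealAxis? L)
    go (yes ra) = trans (cong₂ _*_ (𝟙-yes (External? L) (RealAxis⇒External L ra)) (γ-RealAxis l ra))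
      (sym (cong₂ (λ x y → x + 2 * y) (𝟙-no (EGamma? L) λ (_ , _ , h) → h ra) (𝟙-yes (RealAxis? L) ra)))
    go (no h) = trans (cong (𝟙 (External? L) *_) (γ-¬RealAxis h)) (trans
      (sym (𝟙-and (EGamma? L) (External? L) (InGammaPlane? L) (λ (a , b , _) → a , b) (λ a b → a , b , h)))
      (trans (sym (ℕₚ.+-identityʳ _)) (cong (λ x → 𝟙 (EGamma? L) + 2 * x) (sym (𝟙-no (RealAxis? L) h)))))

  γ-pairs : ∀ L → IsLine L → γ L * (γ L ∸ 1) ≡ 2 * 𝟙 (RealAxis? L)
  γ-pairs L l = go (RealAxis? L)
    where
    go : Dec (RealAxis L) → γ L * (γ L ∸ 1) ≡ 2 * 𝟙 (RealAxis? L)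
    go (yes ra) = trans (cong (λ g → g * (g ∸ 1)) (γ-RealAxis l ra)) (cong (2 *_) (sym (𝟙-yes (RealAxis? L) ra)))
    go (no h) = trans (cong (λ g → g * (g ∸ 1)) (γ-¬RealAxis h)) (trans (at-most-one (InGammaPlane? L)) (cong (2 *_) (sym (𝟙-no (RealAxis? L) h))))
      where
      at-most-one : ∀ {P : Set} (d : Dec P) → 𝟙 d * (𝟙 d ∸ 1) ≡ 0
      at-most-one (yes _) = refl
      at-most-one (no _)  = refl

  realAxes : ℕ
  realAxes = ∑ lines (λ L → 𝟙 (RealAxis? L))

  -- Ordered pairs of distinct osculating planes, counted by the line in which they meet.
  realAxes-total : 2 * realAxes ≡ suc (suc u) * suc u
  realAxes-total = begin
    2 * realAxes
      ≡⟨ sym (∑-*ˡ lines 2 _) ⟩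
    ∑ lines (λ L → 2 * 𝟙 (RealAxis? L))
      ≡⟨ ∑-congᴱ linesᴱ (λ L l → sym (γ-pairs L l)) ⟩
    ∑ lines (λ L → γ L * (γ L ∸ 1))
      ≡⟨ ∑-ext lines (λ L → sym (∑-pairs U _≟ᵖ_ (λ t → Contains? (osc t) L))) ⟩
    ∑ lines (λ L → ∑ parameters (λ t → 𝟙 (Contains? (osc t) L) * ∑ parameters (λ s → 𝟙 (¬? (s ≟ᵖ t)) * 𝟙 (Contains? (osc s) L))))
      ≡⟨ ∑-ext lines (λ L → ∑-ext parameters λ t → trans (sym (∑-*ˡ parameters (𝟙 (Contains? (osc t) L)) _))
           (∑-ext parameters λ s → solveℕ 3 (λ r a r′ → r :⊗ (a :⊗ r′) :≡ a :⊗ (r :⊗ (r′ :⊗ conℕ 1))) refl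
             (𝟙 (Contains? (osc t) L)) (𝟙 (¬? (s ≟ᵖ t))) (𝟙 (Contains? (osc s) L)))) ⟩
    ∑ lines (λ L → ∑ parameters (λ t → ∑ parameters (λ s → 𝟙 (¬? (s ≟ᵖ t)) * (𝟙 (Contains? (osc t) L) * (𝟙 (Contains? (osc s) L) * 1)))))
      ≡⟨ ∑-swap lines parameters _ ⟩
    ∑ parameters (λ t → ∑ lines (λ L → ∑ parameters (λ s → 𝟙 (¬? (s ≟ᵖ t)) * (𝟙 (Contains? (osc t) L) * (𝟙 (Contains? (osc s) L) * 1)))))
      ≡⟨ ∑-ext parameters (λ t → ∑-pull lines parameters (λ s → 𝟙 (¬? (s ≟ᵖ t))) _) ⟩
    ∑ parameters (λ t → ∑ parameters (λ s → 𝟙 (¬? (s ≟ᵖ t)) * ∑ lines (λ L → 𝟙 (Contains? (osc t) L) * (𝟙 (Contains? (osc s) L) * 1))))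
      ≡⟨ ∑-ext parameters (λ t → trans (∑-ext parameters λ s → 𝟙*-cong (¬? (s ≟ᵖ t)) λ s≢t →
           let (M , m , tM , sM) = line-exists (osc t) (osc s) in meet-sum (λ _ → 1) (osc-independent (s≢t ∘ sym)) m tM sM) (sym (ℕₚ.*-identityˡ _))) ⟩
    ∑ parameters (λ t → 1 * ∑ parameters (λ s → 𝟙 (¬? (s ≟ᵖ t)) * 1))
      ≡⟨ trans (∑-pairs U _≟ᵖ_ (λ _ → yes tt)) (cong (λ n → n * (n ∸ 1)) (trans (∑-one parameters) D≡)) ⟩
    suc (suc u) * suc u ∎
    where
    open ≡-Reasoning
    U = unique parametersᴱ

  eGammaLines : ℕ
  eGammaLines = ∑ lines (λ L → 𝟙 (EGamma? L))

  -- The weight is the constant 1 for the total number of EΓ-lines and the indicator of a plane for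
  -- those inside it.
  ∑-external-γ : ∀ (w : Line → ℕ) → ∑ lines (λ L → w L * (𝟙 (External? L) * γ L))
                 ≡ ∑ lines (λ L → w L * 𝟙 (EGamma? L)) + 2 * ∑ lines (λ L → w L * 𝟙 (RealAxis? L))
  ∑-external-γ w = trans (∑-congᴱ linesᴱ λ L l → trans (cong (w L *_) (external-γ L l))
      (solveℕ 3 (λ w e r → w :⊗ (e :⊕ conℕ 2 :⊗ r) :≡ w :⊗ e :⊕ conℕ 2 :⊗ (w :⊗ r)) refl (w L) (𝟙 (EGamma? L)) (𝟙 (RealAxis? L))))
    (trans (∑-+ lines _ _) (cong (∑ lines (λ L → w L * 𝟙 (EGamma? L)) +_) (∑-*ˡ lines 2 _)))

  ∑-osculating : ∀ (w : Line → ℕ) → ∑ lines (λ L → w L * (𝟙 (External? L) * γ L))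
                 ≡ ∑ parameters (λ t → ∑ lines (λ L → w L * (𝟙 (Contains? (osc t) L) * 𝟙 (External? L))))
  ∑-osculating w = trans (∑-ext lines λ L → trans
      (solveℕ 3 (λ w e g → w :⊗ (e :⊗ g) :≡ (w :⊗ e) :⊗ g) refl (w L) (𝟙 (External? L)) (γ L))
      (trans (sym (∑-*ˡ parameters (w L * 𝟙 (External? L)) _)) (∑-ext parameters λ t →
        solveℕ 3 (λ w e g → (w :⊗ e) :⊗ g :≡ w :⊗ (g :⊗ e)) refl (w L) (𝟙 (External? L)) (𝟙 (Contains? (osc t) L)))))
    (∑-swap lines parameters _)

  eGamma-total : eGammaLines + 2 * realAxes ≡ suc (suc u) * (suc u * suc u)
  eGamma-total = begin
    eGammaLines + 2 * realAxes
      ≡⟨ cong₂ (λ x y → x + 2 * y) (∑-ext lines λ L → sym (ℕₚ.*-identityˡ _)) (∑-ext lines λ L → sym (ℕₚ.*-identityˡ _)) ⟩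
    ∑ lines (λ L → 1 * 𝟙 (EGamma? L)) + 2 * ∑ lines (λ L → 1 * 𝟙 (RealAxis? L))
      ≡⟨ sym (∑-external-γ (λ _ → 1)) ⟩
    ∑ lines (λ L → 1 * (𝟙 (External? L) * γ L))
      ≡⟨ ∑-osculating (λ _ → 1) ⟩
    ∑ parameters (λ t → ∑ lines (λ L → 1 * (𝟙 (Contains? (osc t) L) * 𝟙 (External? L))))
      ≡⟨ ∑-ext parameters (λ t → trans (∑-ext lines λ L → ℕₚ.*-identityˡ _) (externals₁ (normalized-≢𝟎 {osc t} (Normalized-osc t)) (roots-osc t))) ⟩
    ∑ parameters (λ _ → suc u * suc u)
      ≡⟨ trans (∑-const parameters _) (cong (_* (suc u * suc u)) D≡) ⟩
    suc (suc u) * (suc u * suc u) ∎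
    where open ≡-Reasoning

  eGammaIn realAxesIn : Vec4 → ℕ
  eGammaIn c = ∑ lines (λ L → 𝟙 (Contains? c L) * 𝟙 (EGamma? L))
  realAxesIn c = ∑ lines (λ L → 𝟙 (Contains? c L) * 𝟙 (RealAxis? L))

  normalized-independent : ∀ {c d} → Normalized c → Normalized d → c ≢ d → Independent c d
  normalized-independent {c} {d} n n′ c≢d = non-multiple⇒independent (normalized-≢𝟎 {c} n) λ (a , e) → not-multiple a e
    where
    not-multiple : ∀ a → d ≢ scale a c
    not-multiple a e with a ≟ 0#
    ... | yes refl = normalized-≢𝟎 {d} n′ (trans e (scale-0 c))
    ... | no ha = c≢d (sym (proj₂ (normalize-unique n′ n 1≢0 ha (trans (scale-1 d) e))))

  -- Each of the q + 1 osculating planes cuts `c` in one line. As `osc t` meets the cubic in the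
  -- point `t` only, that line is external unless `t` is a root of `c`.
  eGamma-in-plane : ∀ {c} → Normalized c → ¬ Osculating c → eGammaIn c + 2 * realAxesIn c + roots c ≡ suc (suc u)
  eGamma-in-plane {c} n h = begin
    eGammaIn c + 2 * realAxesIn c + roots c
      ≡⟨ cong (_+ roots c) (trans (sym (∑-external-γ (λ L → 𝟙 (Contains? c L)))) (∑-osculating (λ L → 𝟙 (Contains? c L)))) ⟩
    ∑ parameters (λ t → ∑ lines (λ L → 𝟙 (Contains? c L) * (𝟙 (Contains? (osc t) L) * 𝟙 (External? L)))) + roots c
      ≡⟨ cong (_+ roots c) (∑-ext parameters λ t → trans
           (external-meet (normalized-independent n (Normalized-osc t) λ e → h (t , e)))
           (𝟙-cong (¬? (CommonRoot? c (osc t))) (¬? (Root? c t))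
             (λ k e → k (t , e , Root-osc-self t)) (λ k (s , e , e′) → k (subst (Root c) (sym (Root-osc t s e′)) e)))) ⟩
    ∑ parameters (λ t → 𝟙 (¬? (Root? c t))) + roots c
      ≡⟨ sym (∑-+ parameters _ _) ⟩
    ∑ parameters (λ t → 𝟙 (¬? (Root? c t)) + 𝟙 (Root? c t))
      ≡⟨ ∑-ext parameters (λ t → trans (ℕₚ.+-comm (𝟙 (¬? (Root? c t))) _) (𝟙-¬ (Root? c t))) ⟩
    ∑ parameters (λ _ → 1)
      ≡⟨ trans (∑-one parameters) D≡ ⟩
    suc (suc u) ∎
    where open ≡-Reasoning

-- The quadratic extension and conjugation by x ↦ x^q

module Conjugation (F K : Field) (e : Embedding F K) (size≡ : Field.size K ≡ Field.size F * Field.size F) where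
  module 𝔽 = ExternalLines F
  module 𝕂 = ExternalLines K
  open Embedding e
  open 𝕂 using (_⊕_; _⊖_; _⊗_; ⊝_; 0#; 1#; pow; eval; monomial; solve; _:=_; _:+_; _:*_; _:-_; :-_; :0; :1; :3; cube)

  q : ℕ
  q = 𝔽.order

  q≡ : q ≡ suc 𝔽.u
  q≡ = 𝔽.order≡

  ι-0 : ι 𝔽.0# ≡ 0#
  ι-0 = begin
    ι 𝔽.0# ≡⟨ solve 1 (λ x → x := (x :+ x) :- x) refl (ι 𝔽.0#) ⟩
    ι 𝔽.0# ⊕ ι 𝔽.0# ⊖ ι 𝔽.0# ≡⟨ cong (_⊖ ι 𝔽.0#) (trans (sym (ι-+ 𝔽.0# 𝔽.0#)) (cong ι (𝔽.+-identityʳ 𝔽.0#))) ⟩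
    ι 𝔽.0# ⊖ ι 𝔽.0# ≡⟨ 𝕂.-‿inverseʳ _ ⟩
    0# ∎
    where open ≡-Reasoning

  ι-⊝ : ∀ x → ι (𝔽.⊝ x) ≡ ⊝ ι x
  ι-⊝ x = begin
    ι (𝔽.⊝ x) ≡⟨ solve 2 (λ m x → m := (x :+ m) :- x) refl (ι (𝔽.⊝ x)) (ι x) ⟩
    ι x ⊕ ι (𝔽.⊝ x) ⊖ ι x ≡⟨ cong (_⊖ ι x) (trans (sym (ι-+ x (𝔽.⊝ x))) (trans (cong ι (𝔽.-‿inverseʳ x)) ι-0)) ⟩
    0# ⊖ ι x ≡⟨ 𝕂.+-identityˡ _ ⟩
    ⊝ ι x ∎
    where open ≡-Reasoning

  ι-≢0 : ∀ {x} → x ≢ 𝔽.0# → ι x ≢ 0#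
  ι-≢0 {x} h z = 𝕂.1≢0 (begin
    1# ≡⟨ sym ι-1 ⟩
    ι 𝔽.1# ≡⟨ cong ι (sym (𝔽.recipʳ h)) ⟩
    ι (x 𝔽.⊗ 𝔽.recip h) ≡⟨ ι-* x (𝔽.recip h) ⟩
    ι x ⊗ ι (𝔽.recip h) ≡⟨ cong (_⊗ ι (𝔽.recip h)) z ⟩
    0# ⊗ ι (𝔽.recip h) ≡⟨ 𝕂.zeroˡ _ ⟩
    0# ∎)
    where open ≡-Reasoning

  ι≡0 : ∀ {x} → ι x ≡ 0# → x ≡ 𝔽.0#
  ι≡0 {x} z with x 𝔽.≟ 𝔽.0#
  ... | yes h = h
  ... | no h  = ⊥-elim (ι-≢0 h z)

  ι-injective : ∀ {x y} → ι x ≡ ι y → x ≡ y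
  ι-injective {x} {y} h = 𝔽.x-y≡0⇒x≡y (ι≡0 (trans (ι-+ x (𝔽.⊝ y)) (trans (cong (ι x ⊕_) (ι-⊝ y)) (𝕂.x≡y⇒x-y≡0 h))))

  ι-pow : ∀ x n → ι (𝔽.pow x n) ≡ pow (ι x) n
  ι-pow x zero    = ι-1
  ι-pow x (suc n) = trans (ι-* x (𝔽.pow x n)) (cong (ι x ⊗_) (ι-pow x n))

  frob : 𝕂.Carrier → 𝕂.Carrier
  frob s = pow s q

  frob-ι : ∀ a → frob (ι a) ≡ ι a
  frob-ι a = trans (sym (ι-pow a q)) (cong ι (𝔽.pow-order a))

  frob-⊗ : ∀ x y → frob (x ⊗ y) ≡ frob x ⊗ frob y
  frob-⊗ x y = 𝕂.pow-⊗ x y q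

  frob-involutive : ∀ s → frob (frob s) ≡ s
  frob-involutive s = trans (sym (𝕂.pow-* s q q)) (trans (cong (pow s) (sym size≡)) (𝕂.pow-order s))

  -- (x + 1) ^ q - x ^ q - 1 has degree less than q, and vanishes on the subfield.
  private
    _⊞_ : ∀ {n} → Vec 𝕂.Carrier n → Vec 𝕂.Carrier n → Vec 𝕂.Carrier n
    _⊞_ = Vec.zipWith _⊕_

    eval-⊞ : ∀ {n} (p r : Vec 𝕂.Carrier n) x → eval (p ⊞ r) x ≡ eval p x ⊕ eval r x
    eval-⊞ []      []      x = sym (𝕂.+-identityʳ 0#)
    eval-⊞ (a ∷ p) (b ∷ r) x = trans (cong (λ z → a ⊕ b ⊕ x ⊗ z) (eval-⊞ p r x))
      (solve 5 (λ a b x p r → a :+ b :+ x :* (p :+ r) := (a :+ x :* p) :+ (b :+ x :* r)) refl a b x (eval p x) (eval r x))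

    eval-∷ʳ0 : ∀ {n} (p : Vec 𝕂.Carrier n) x → eval (p Vec.∷ʳ 0#) x ≡ eval p x
    eval-∷ʳ0 []      x = solve 1 (λ x → :0 :+ x :* :0 := :0) refl x
    eval-∷ʳ0 (a ∷ p) x = cong (λ z → a ⊕ x ⊗ z) (eval-∷ʳ0 p x)

    -- The polynomial (X + 1)^n - X^n, whose leading terms cancel so that n coefficients suffice. If
    -- d is the one for n, the next is X d + d + X^n.
    difference : ∀ n → Vec 𝕂.Carrier n
    difference zero    = []
    difference (suc n) = ((0# ∷ difference n) ⊞ (difference n Vec.∷ʳ 0#)) ⊞ monomial n

    eval-difference : ∀ n x → eval (difference n) x ≡ pow (x ⊕ 1#) n ⊖ pow x n
    eval-difference zero    x = sym (𝕂.-‿inverseʳ 1#)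
    eval-difference (suc n) x = begin
      eval (((0# ∷ difference n) ⊞ (difference n Vec.∷ʳ 0#)) ⊞ monomial n) x
        ≡⟨ trans (eval-⊞ ((0# ∷ difference n) ⊞ (difference n Vec.∷ʳ 0#)) (monomial n) x) (cong₂ _⊕_ (trans (eval-⊞ (0# ∷ difference n) (difference n Vec.∷ʳ 0#) x)
             (cong (eval (0# ∷ difference n) x ⊕_) (eval-∷ʳ0 (difference n) x))) (𝕂.eval-monomial n x)) ⟩
      0# ⊕ x ⊗ eval (difference n) x ⊕ eval (difference n) x ⊕ pow x n
        ≡⟨ cong (λ z → 0# ⊕ x ⊗ z ⊕ z ⊕ pow x n) (eval-difference n x) ⟩
      0# ⊕ x ⊗ (pow (x ⊕ 1#) n ⊖ pow x n) ⊕ (pow (x ⊕ 1#) n ⊖ pow x n) ⊕ pow x n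
        ≡⟨ solve 3 (λ x p r → :0 :+ x :* (p :- r) :+ (p :- r) :+ r := (x :+ :1) :* p :- x :* r) refl x (pow (x ⊕ 1#) n) (pow x n) ⟩
      (x ⊕ 1#) ⊗ pow (x ⊕ 1#) n ⊖ x ⊗ pow x n ∎
      where open ≡-Reasoning

    subfield : List 𝕂.Carrier
    subfield = map ι 𝔽.elements

    subfield-unique : Unique subfield
    subfield-unique = Uniqueₚ.map⁺ ι-injective (unique 𝔽.elementsᴱ)

    -- With q written as `suc n` the polynomial has a constant coefficient, from which `lower` takes
    -- the 1. Its q coefficients are matched by the q elements of the subfield.
    pow-suc-1 : ∀ n → q ≡ suc n → ∀ x → pow (x ⊕ 1#) (suc n) ≡ pow x (suc n) ⊕ 1#
    pow-suc-1 n qn x = 𝕂.x-y≡0⇒x≡y (trans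
      (solve 2 (λ p r → p :- (r :+ :1) := (p :- r) :- :1) refl (pow (x ⊕ 1#) (suc n)) (pow x (suc n)))
      (trans (sym (eval-minus x)) (𝕂.vanishes minus subfield subfield-unique long roots x)))
      where
      lower : Vec 𝕂.Carrier (suc n) → Vec 𝕂.Carrier (suc n)
      lower (a ∷ p) = a ⊖ 1# ∷ p
      eval-lower : ∀ p x → eval (lower p) x ≡ eval p x ⊖ 1#
      eval-lower (a ∷ p) x = solve 2 (λ a y → a :- :1 :+ y := a :+ y :- :1) refl a (x ⊗ eval p x)
      minus = lower (difference (suc n))
      eval-minus : ∀ x → eval minus x ≡ pow (x ⊕ 1#) (suc n) ⊖ pow x (suc n) ⊖ 1#
      eval-minus x = trans (eval-lower (difference (suc n)) x) (cong (_⊖ 1#) (eval-difference (suc n) x))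
      long : suc n ≤ length subfield
      long = ℕₚ.≤-reflexive (trans (sym qn) (sym (Listₚ.length-map ι 𝔽.elements)))
      roots : ∀ r → r ∈ subfield → eval minus r ≡ 0#
      roots r m with ∈-map⁻ ι m
      ... | a , _ , refl = trans (eval-minus (ι a)) (trans (cong₂ (λ x y → x ⊖ y ⊖ 1#) fixed⁺ fixed)
            (solve 1 (λ x → (x :+ :1) :- x :- :1 := :0) refl (ι a)))
        where
        fixed : pow (ι a) (suc n) ≡ ι a
        fixed = trans (cong (pow (ι a)) (sym qn)) (frob-ι a)
        fixed⁺ : pow (ι a ⊕ 1#) (suc n) ≡ ι a ⊕ 1#
        fixed⁺ = subst (λ x → pow x (suc n) ≡ x) (trans (ι-+ a 𝔽.1#) (cong (ι a ⊕_) ι-1))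
          (trans (cong (pow (ι (a 𝔽.⊕ 𝔽.1#))) (sym qn)) (frob-ι (a 𝔽.⊕ 𝔽.1#)))

  frob-suc : ∀ x → frob (x ⊕ 1#) ≡ frob x ⊕ 1#
  frob-suc x = subst (λ n → pow (x ⊕ 1#) n ≡ pow x n ⊕ 1#) (sym q≡) (pow-suc-1 𝔽.u q≡ x)

  frob-0 : frob 0# ≡ 0#
  frob-0 = trans (cong frob (sym ι-0)) (trans (frob-ι 𝔽.0#) ι-0)

  frob-1 : frob 1# ≡ 1#
  frob-1 = 𝕂.pow-1 q

  -- Since `frob` is multiplicative, x + y = y (x / y + 1) reduces the sum to the case already
  -- settled.
  frob-⊕ : ∀ x y → frob (x ⊕ y) ≡ frob x ⊕ frob y
  frob-⊕ x y with y 𝕂.≟ 0#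
  ... | yes refl = trans (cong frob (𝕂.+-identityʳ x)) (trans (sym (𝕂.+-identityʳ (frob x))) (cong (frob x ⊕_) (sym frob-0)))
  ... | no h = begin
    frob (x ⊕ y) ≡⟨ cong frob (trans (cong (_⊕ y) x≡) (solve 2 (λ y z → y :* z :+ y := y :* (z :+ :1)) refl y z)) ⟩
    frob (y ⊗ (z ⊕ 1#)) ≡⟨ trans (frob-⊗ y (z ⊕ 1#)) (cong (frob y ⊗_) (frob-suc z)) ⟩
    frob y ⊗ (frob z ⊕ 1#) ≡⟨ solve 2 (λ y z → y :* (z :+ :1) := y :* z :+ y) refl (frob y) (frob z) ⟩
    frob y ⊗ frob z ⊕ frob y ≡⟨ cong (_⊕ frob y) (trans (sym (frob-⊗ y z)) (cong frob (sym x≡))) ⟩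
    frob x ⊕ frob y ∎
    where
    open ≡-Reasoning
    z = 𝕂.recip h ⊗ x
    x≡ : x ≡ y ⊗ z
    x≡ = trans (sym (𝕂.*-identityˡ x)) (trans (cong (_⊗ x) (sym (𝕂.recipʳ h))) (𝕂.*-assoc y (𝕂.recip h) x))

  frob-⊝ : ∀ x → frob (⊝ x) ≡ ⊝ frob x
  frob-⊝ x = begin
    frob (⊝ x) ≡⟨ solve 2 (λ m x → m := (x :+ m) :- x) refl (frob (⊝ x)) (frob x) ⟩
    frob x ⊕ frob (⊝ x) ⊖ frob x ≡⟨ cong (_⊖ frob x) (trans (sym (frob-⊕ x (⊝ x))) (trans (cong frob (𝕂.-‿inverseʳ x)) frob-0)) ⟩
    0# ⊖ frob x ≡⟨ 𝕂.+-identityˡ _ ⟩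
    ⊝ frob x ∎
    where open ≡-Reasoning

  InF : 𝕂.Carrier → Set
  InF s = ∃[ a ] ι a ≡ s

  InF? : ∀ s → Dec (InF s)
  InF? s = map′ (λ (a , _ , h) → a , h) (λ (a , h) → a , tt , h) (any-enum 𝔽.elementsᴱ λ a → ι a 𝕂.≟ s)

  -- Otherwise X ^ (q - 1) - 1 would have q roots.
  frob-fixed⇒InF : ∀ s → frob s ≡ s → InF s
  frob-fixed⇒InF s fixed with InF? s
  ... | yes h = h
  ... | no h = ⊥-elim (go 𝔽.u refl)
    where
    s≢0 : s ≢ 0#
    s≢0 z = h (𝔽.0# , trans ι-0 (sym z))
    go : ∀ n → 𝔽.u ≡ n → ⊥
    go zero    un = ℕₚ.<-irrefl refl (subst (1 <_) (trans q≡ (cong suc un)) 𝔽.1<order)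
    go (suc n) un = 𝕂.⊝-≢0 𝕂.1≢0 (trans (solve 1 (λ x → :- :1 := :- :1 :+ :0 :* x) refl (eval (monomial n) 0#))
      (𝕂.vanishes (⊝ 1# ∷ monomial n) (s ∷ map ι 𝔽.units) (All.tabulate s∉ ∷ Uniqueₚ.map⁺ ι-injective (unique 𝔽.unitsᴱ))
        (s≤s (ℕₚ.≤-reflexive (trans (sym un) (sym (Listₚ.length-map ι 𝔽.units))))) roots 0#))
      where
      s∉ : ∀ {x} → x ∈ map ι 𝔽.units → s ≢ x
      s∉ m refl with ∈-map⁻ ι m
      ... | a , _ , e = h (a , sym e)
      root : ∀ r → pow r 𝔽.u ≡ 1# → eval (⊝ 1# ∷ monomial n) r ≡ 0#
      root r p = trans (cong (λ z → ⊝ 1# ⊕ r ⊗ z) (𝕂.eval-monomial n r)) (trans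
        (cong (⊝ 1# ⊕_) (trans (cong (pow r) (sym un)) p)) (solve 0 (:- :1 :+ :1 := :0) refl))
      roots : ∀ r → r ∈ s ∷ map ι 𝔽.units → eval (⊝ 1# ∷ monomial n) r ≡ 0#
      roots r (here refl) = root r (𝕂.cancelˡ s≢0 (trans (cong (pow r) (sym q≡)) (trans fixed (sym (𝕂.*-identityʳ r)))))
      roots r (there m) with ∈-map⁻ ι m
      ... | a , ma , refl = root (ι a) (trans (sym (ι-pow a 𝔽.u)) (trans (cong ι (𝔽.fermat (proj₂ (sound 𝔽.unitsᴱ ma)))) ι-1))

  frob-≢ : ∀ {s} → (∀ a → ι a ≢ s) → s ≢ frob s
  frob-≢ {s} h fixed = let (a , e) = frob-fixed⇒InF s (sym fixed) in h a e

  frob-∉ : ∀ {s} → (∀ a → ι a ≢ s) → ∀ a → ι a ≢ frob s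
  frob-∉ {s} h a e = h a (trans (sym (frob-ι a)) (trans (cong frob e) (frob-involutive s)))

  ι-three : ι 𝔽.three ≡ 𝕂.three
  ι-three = trans (ι-+ (𝔽.1# 𝔽.⊕ 𝔽.1#) 𝔽.1#) (cong₂ _⊕_ (trans (ι-+ 𝔽.1# 𝔽.1#) (cong₂ _⊕_ ι-1 ι-1)) ι-1)

  -- In characteristic 3 the cube roots of unity are trivial, as (ω - 1) ^ 3 = ω ^ 3 - 1.
  three≢0ᴷ : q % 3 ≢ 0 → 𝕂.three ≢ 0#
  three≢0ᴷ hq z = let (ω , ω≢1 , ω³≡1) = 𝕂.primitive-cube-root square%3 in
    ω≢1 (𝕂.x-y≡0⇒x≡y (𝕂.cube≡0 (begin
      cube (ω ⊖ 1#) ≡⟨ solve 1 (λ w → (w :- :1) :* (w :- :1) :* (w :- :1) := w :* w :* w :- :1 :+ :3 :* (w :- w :* w)) refl ω ⟩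
      cube ω ⊖ 1# ⊕ 𝕂.three ⊗ (ω ⊖ ω ⊗ ω) ≡⟨ cong₂ (λ x y → x ⊖ 1# ⊕ y ⊗ (ω ⊖ ω ⊗ ω)) ω³≡1 z ⟩
      1# ⊖ 1# ⊕ 0# ⊗ (ω ⊖ ω ⊗ ω) ≡⟨ solve 1 (λ x → :1 :- :1 :+ :0 :* x := :0) refl (ω ⊖ ω ⊗ ω) ⟩
      0# ∎)))
    where
    open ≡-Reasoning
    residues : ∀ r → r < 3 → r ≢ 0 → (r * r) % 3 ≡ 1
    residues 0 _ h = ⊥-elim (h refl)
    residues 1 _ _ = refl
    residues 2 _ _ = refl
    residues (suc (suc (suc _))) (s≤s (s≤s (s≤s ()))) _
    square%3 : 𝕂.order % 3 ≡ 1
    square%3 = trans (cong (_% 3) size≡) (trans (%-distribˡ-* q q 3) (residues (q % 3) (m%n<n q 3) hq))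

  three≢0ᶠ : q % 3 ≢ 0 → 𝔽.three ≢ 𝔽.0#
  three≢0ᶠ hq z = three≢0ᴷ hq (trans (sym ι-three) (trans (cong ι z) ι-0))

  -- Extension of scalars and conjugation of vectors

  ιᵛ : 𝔽.Vec4 → 𝕂.Vec4
  ιᵛ = Vec.map ι

  ιᵖ : 𝔽.Parameter → 𝕂.Parameter
  ιᵖ (just t) = just (ι t)
  ιᵖ nothing  = nothing

  ιᵖ-injective : ∀ {s t} → ιᵖ s ≡ ιᵖ t → s ≡ t
  ιᵖ-injective {just s}  {just t}  h = cong just (ι-injective (Maybeₚ.just-injective h))
  ιᵖ-injective {nothing} {nothing} h = refl

  ιᵛ-injective : ∀ {u v} → ιᵛ u ≡ ιᵛ v → u ≡ v
  ιᵛ-injective {u} {v} h = 𝔽.vec-ext λ k → ι-injective (trans (sym (Vecₚ.lookup-map k ι u))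
    (trans (cong (λ w → lookup w k) h) (Vecₚ.lookup-map k ι v)))

  ι-dot : ∀ u v → ι (𝔽.dot u v) ≡ 𝕂.dot (ιᵛ u) (ιᵛ v)
  ι-dot (a ∷ b ∷ c ∷ d ∷ []) (x ∷ y ∷ z ∷ w ∷ []) = trans (ι-+ _ _) (cong₂ _⊕_ (trans (ι-+ _ _)
    (cong₂ _⊕_ (trans (ι-+ _ _) (cong₂ _⊕_ (ι-* a x) (ι-* b y))) (ι-* c z))) (ι-* d w))

  ι-curvePt : ∀ t → ιᵛ (𝔽.curvePt t) ≡ 𝕂.curvePt (ιᵖ t)
  ι-curvePt (just t) = 𝕂.vec4-≡ (ι-pow t 3) (ι-pow t 2) refl ι-1
  ι-curvePt nothing  = 𝕂.vec4-≡ ι-1 ι-0 ι-0 ι-0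

  ι-osc : ∀ t → ιᵛ (𝔽.osc t) ≡ 𝕂.osc (ιᵖ t)
  ι-osc (just t) = 𝕂.vec4-≡ ι-1
    (trans (ι-⊝ _) (cong ⊝_ (trans (ι-* 𝔽.three t) (cong (_⊗ ι t) ι-three))))
    (trans (ι-* 𝔽.three (𝔽.pow t 2)) (cong₂ _⊗_ ι-three (ι-pow t 2)))
    (trans (ι-⊝ _) (cong ⊝_ (ι-pow t 3)))
  ι-osc nothing = 𝕂.vec4-≡ ι-0 ι-0 ι-0 ι-1

  conj : 𝕂.Vec4 → 𝕂.Vec4
  conj = Vec.map frob

  conj-ι : ∀ v → conj (ιᵛ v) ≡ ιᵛ v
  conj-ι v = trans (sym (Vecₚ.map-∘ frob ι v)) (Vecₚ.map-cong frob-ι v)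

  conj-lin : ∀ a u b v → conj (𝕂.lin a u b v) ≡ 𝕂.lin (frob a) (conj u) (frob b) (conj v)
  conj-lin a u b v = 𝕂.vec-ext λ k → trans (Vecₚ.lookup-map k frob (𝕂.lin a u b v)) (trans (cong frob (𝕂.lookup-lin a u b v k))
    (trans (frob-⊕ _ _) (trans (cong₂ _⊕_ (frob-⊗ a _) (frob-⊗ b _))
      (sym (trans (𝕂.lookup-lin (frob a) (conj u) (frob b) (conj v) k)
        (cong₂ (λ x y → frob a ⊗ x ⊕ frob b ⊗ y) (Vecₚ.lookup-map k frob u) (Vecₚ.lookup-map k frob v)))))))

  frob-pow : ∀ x n → frob (pow x n) ≡ pow (frob x) n
  frob-pow x zero    = frob-1
  frob-pow x (suc n) = trans (frob-⊗ x (pow x n)) (cong (frob x ⊗_) (frob-pow x n))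

  frob-three : frob 𝕂.three ≡ 𝕂.three
  frob-three = trans (cong frob (sym ι-three)) (trans (frob-ι 𝔽.three) ι-three)

  conj-osc : ∀ s → conj (𝕂.osc (just s)) ≡ 𝕂.osc (just (frob s))
  conj-osc s = 𝕂.vec4-≡ frob-1
    (trans (frob-⊝ _) (cong ⊝_ (trans (frob-⊗ 𝕂.three s) (cong (_⊗ frob s) frob-three))))
    (trans (frob-⊗ 𝕂.three (pow s 2)) (cong₂ _⊗_ frob-three (frob-pow s 2)))
    (trans (frob-⊝ _) (cong ⊝_ (frob-pow s 3)))

-- Imaginary chords and imaginary axes

module ImaginaryLines (F K : Field) (e : Embedding F K) (size≡ : Field.size K ≡ Field.size F * Field.size F)
                      (q%3≢0 : Field.size F % 3 ≢ 0) where
  open Conjugation F K e size≡ public hiding (module 𝔽; module 𝕂)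
  open Embedding e public
  module 𝔽 = RealAxes F (Conjugation.three≢0ᶠ F K e size≡ q%3≢0)
  module 𝕂 = RealAxes K (Conjugation.three≢0ᴷ F K e size≡ q%3≢0)
  open PG3 F K e using (NotInF; ImaginaryChord; ImaginaryAxis) public
  open 𝕂 using (_⊕_; _⊖_; _⊗_; ⊝_; 0#; 1#; pow; solve; _:=_; _:+_; _:*_; _:-_; :-_; :0; :1; :3; cube)

  ιᴸ : 𝔽.Line → 𝕂.Line
  ιᴸ (r₁ , r₂) = ιᵛ r₁ , ιᵛ r₂

  ιᴸ-injective : ∀ {L M} → ιᴸ L ≡ ιᴸ M → L ≡ M
  ιᴸ-injective h = cong₂ _,_ (ιᵛ-injective (cong proj₁ h)) (ιᵛ-injective (cong proj₂ h))

  ι-zero-at : ∀ v k → lookup v k ≡ 𝔽.0# → lookup (ιᵛ v) k ≡ 0#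
  ι-zero-at v k h = trans (Vecₚ.lookup-map k ι v) (trans (cong ι h) ι-0)

  ι-one-at : ∀ v k → lookup v k ≡ 𝔽.1# → lookup (ιᵛ v) k ≡ 1#
  ι-one-at v k h = trans (Vecₚ.lookup-map k ι v) (trans (cong ι h) ι-1)

  -- The pivots survive extension of scalars, so what is proved about lines over any field applies
  -- over `K` to the lines of PG(3,q).
  ι-IsLine : ∀ L → 𝔽.IsLine L → 𝕂.IsLine (ιᴸ L)
  ι-IsLine (r₁ , r₂) (i , j , lt , z₁ , o₁ , z₁ⱼ , z₂ , o₂) = i , j , lt
    , (λ k h → ι-zero-at r₁ k (z₁ k h)) , ι-one-at r₁ i o₁ , ι-zero-at r₁ j z₁ⱼ , (λ k h → ι-zero-at r₂ k (z₂ k h)) , ι-one-at r₂ j o₂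

  ι-Normalized : ∀ {c} → 𝔽.Normalized c → 𝕂.Normalized (ιᵛ c)
  ι-Normalized {c} (i , z , o) = i , (λ k h → ι-zero-at c k (z k h)) , ι-one-at c i o

  ι-Contains : ∀ c L → 𝔽.Contains c L → 𝕂.Contains (ιᵛ c) (ιᴸ L)
  ι-Contains c (r₁ , r₂) (h₁ , h₂) = trans (sym (ι-dot c r₁)) (trans (cong ι h₁) ι-0) , trans (sym (ι-dot c r₂)) (trans (cong ι h₂) ι-0)

  ι-Contains-osc : ∀ t L → 𝔽.Contains (𝔽.osc t) L → 𝕂.Contains (𝕂.osc (ιᵖ t)) (ιᴸ L)
  ι-Contains-osc t L h = subst (λ c → 𝕂.Contains c (ιᴸ L)) (ι-osc t) (ι-Contains (𝔽.osc t) L h)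

  ι-Root : ∀ c t → 𝔽.Root c t → 𝕂.Root (ιᵛ c) (ιᵖ t)
  ι-Root c t h = trans (cong (𝕂.dot (ιᵛ c)) (sym (ι-curvePt t))) (trans (sym (ι-dot c (𝔽.curvePt t))) (trans (cong ι h) ι-0))

  ι-Root⁻ : ∀ c t → 𝕂.Root (ιᵛ c) (ιᵖ t) → 𝔽.Root c t
  ι-Root⁻ c t h = ι≡0 (trans (ι-dot c (𝔽.curvePt t)) (trans (cong (𝕂.dot (ιᵛ c)) (ι-curvePt t)) h))

  ι-OnLine : ∀ t L → 𝔽.OnLine (𝔽.curvePt t) L → 𝕂.OnLine (𝕂.curvePt (ιᵖ t)) (ιᴸ L)
  ι-OnLine t (r₁ , r₂) (a , b , h) = ι a , ι b , trans (sym (ι-curvePt t)) (trans (cong ιᵛ h) (𝕂.vec-ext λ k →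
    trans (Vecₚ.lookup-map k ι (𝔽.lin a r₁ b r₂)) (trans (cong ι (𝔽.lookup-lin a r₁ b r₂ k)) (trans (ι-+ _ _)
      (trans (cong₂ _⊕_ (trans (ι-* a _) (cong (ι a ⊗_) (sym (Vecₚ.lookup-map k ι r₁)))) (trans (ι-* b _) (cong (ι b ⊗_) (sym (Vecₚ.lookup-map k ι r₂)))))
        (sym (𝕂.lookup-lin (ι a) (ιᵛ r₁) (ι b) (ιᵛ r₂) k)))))))

  just-≢ : ∀ {s} → NotInF s → _≢_ {A = 𝕂.Parameter} (just s) (just (frob s))
  just-≢ h p = frob-≢ h (Maybeₚ.just-injective p)

  ιᵖ-≢ : ∀ {s} t → NotInF s → ιᵖ t ≢ just s
  ιᵖ-≢ (just t) h p = h t (Maybeₚ.just-injective p)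

  NotInF? : ∀ s → Dec (NotInF s)
  NotInF? s = map′ (λ h a p → h (a , p)) (λ h (a , p) → h a p) (¬? (InF? s))

  ι-≢𝟎 : ∀ {c} → 𝔽.Normalized c → ιᵛ c ≢ 𝕂.𝟎
  ι-≢𝟎 {c} n = 𝕂.normalized-≢𝟎 {ιᵛ c} (ι-Normalized {c} n)

  -- Conjugation exchanges `s` and `frob s`, so it fixes their sum and, in `norm`, their product.
  trace : ∀ s → ∃[ T ] ι T ≡ s ⊕ frob s
  trace s = frob-fixed⇒InF (s ⊕ frob s) (trans (frob-⊕ s (frob s)) (trans (cong (frob s ⊕_) (frob-involutive s)) (𝕂.+-comm _ _)))

  norm : ∀ s → ∃[ N ] ι N ≡ s ⊗ frob s
  norm s = frob-fixed⇒InF (s ⊗ frob s) (trans (frob-⊗ s (frob s)) (trans (cong (frob s ⊗_) (frob-involutive s)) (𝕂.*-comm _ _)))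

  -- Lines attached to conjugate pairs

  module ConjugatePairs (R : 𝕂.Carrier → 𝔽.Line → Set) (R? : ∀ s L → Dec (R s L))
    (R⇒NotInF : ∀ {s L} → R s L → NotInF s) (R-frob : ∀ {s L} → R s L → R (frob s) L)
    (R-third : ∀ {s t L} → 𝔽.IsLine L → R s L → R t L → t ≡ s ⊎ t ≡ frob s)
    (R-exists : ∀ s → NotInF s → ∃[ L ] (𝔽.IsLine L × R s L))
    (R-unique : ∀ {s L M} → 𝔽.IsLine L → 𝔽.IsLine M → R s L → R s M → L ≡ M) where

    Some : 𝔽.Line → Set
    Some L = ∃[ s ] R s L

    Some? : ∀ L → Dec (Some L)
    Some? L = map′ (λ (s , _ , h) → s , h) (λ (s , h) → s , tt , h) (any-enum 𝕂.elementsᴱ λ s → R? s L)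

    -- Pairs of an element and a line: each of the q² - q elements outside F belongs to one line,
    -- and each line that occurs belongs to an element and its conjugate.
    count-some : 2 * ∑ 𝔽.lines (λ L → 𝟙 (Some? L)) + q ≡ q * q
    count-some = begin
      2 * ∑ 𝔽.lines (λ L → 𝟙 (Some? L)) + q
        ≡⟨ cong₂ _+_ (trans (sym (∑-*ˡ 𝔽.lines 2 _)) (∑-congᴱ 𝔽.linesᴱ λ L l → sym (two L l))) (sym count-InF) ⟩
      ∑ 𝔽.lines (λ L → ∑ 𝕂.elements (λ s → 𝟙 (R? s L))) + ∑ 𝕂.elements (λ s → 𝟙 (InF? s))
        ≡⟨ cong (_+ ∑ 𝕂.elements (λ s → 𝟙 (InF? s))) (trans (∑-swap 𝔽.lines 𝕂.elements _) (∑-ext 𝕂.elements one)) ⟩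
      ∑ 𝕂.elements (λ s → 𝟙 (¬? (InF? s))) + ∑ 𝕂.elements (λ s → 𝟙 (InF? s))
        ≡⟨ sym (∑-+ 𝕂.elements _ _) ⟩
      ∑ 𝕂.elements (λ s → 𝟙 (¬? (InF? s)) + 𝟙 (InF? s))
        ≡⟨ ∑-ext 𝕂.elements (λ s → trans (ℕₚ.+-comm (𝟙 (¬? (InF? s))) _) (𝟙-¬ (InF? s))) ⟩
      ∑ 𝕂.elements (λ _ → 1)
        ≡⟨ trans (∑-one 𝕂.elements) size≡ ⟩
      q * q ∎
      where
      open ≡-Reasoning
      two : ∀ L → 𝔽.IsLine L → ∑ 𝕂.elements (λ s → 𝟙 (R? s L)) ≡ 2 * 𝟙 (Some? L)
      two L l = go (Some? L)
        where
        go : Dec (Some L) → ∑ 𝕂.elements (λ s → 𝟙 (R? s L)) ≡ 2 * 𝟙 (Some? L)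
        go (yes (s , h)) = trans (count-two 𝕂.elementsᴱ (λ s → R? s L) s (frob s) tt tt h (R-frob h) (frob-≢ (R⇒NotInF h)) (λ t _ h′ → R-third l h h′))
          (cong (2 *_) (sym (𝟙-yes (Some? L) (s , h))))
        go (no h) = trans (count-zero 𝕂.elementsᴱ (λ s → R? s L) (λ s _ r → h (s , r))) (cong (2 *_) (sym (𝟙-no (Some? L) h)))
      one : ∀ s → ∑ 𝔽.lines (λ L → 𝟙 (R? s L)) ≡ 𝟙 (¬? (InF? s))
      one s = go (InF? s)
        where
        go : Dec (InF s) → ∑ 𝔽.lines (λ L → 𝟙 (R? s L)) ≡ 𝟙 (¬? (InF? s))
        go (yes (a , p)) = trans (count-zero 𝔽.linesᴱ (R? s) (λ L _ r → R⇒NotInF r a p)) (sym (𝟙-no (¬? (InF? s)) (λ h → h (a , p))))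
        go (no h) = let (L , l , r) = R-exists s (λ a p → h (a , p)) in
          trans (count-one 𝔽.linesᴱ (R? s) L l r (λ M m r′ → R-unique m l r′ r)) (sym (𝟙-yes (¬? (InF? s)) h))
      count-InF : ∑ 𝕂.elements (λ s → 𝟙 (InF? s)) ≡ q
      count-InF = begin
        ∑ 𝕂.elements (λ s → 𝟙 (InF? s))
          ≡⟨ ∑-ext 𝕂.elements (λ s → ℕₚ.≤-antisym
               (𝟙-lower (InF? s) λ (a , p) z → ℕₚ.1+n≢0 (trans (sym (𝟙-yes (ι a 𝕂.≟ s) p)) (∑-≡0 𝔽.elements z a (complete 𝔽.elementsᴱ tt))))
               (𝟙-upper (InF? s) (λ _ → count≤1 𝔽.elementsᴱ (λ a → ι a 𝕂.≟ s) λ a b _ _ p p′ → ι-injective (trans p (sym p′)))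
                 (λ h → count-zero 𝔽.elementsᴱ (λ a → ι a 𝕂.≟ s) λ a _ p → h (a , p)))) ⟩
        ∑ 𝕂.elements (λ s → ∑ 𝔽.elements (λ a → 𝟙 (ι a 𝕂.≟ s)))
          ≡⟨ ∑-swap 𝕂.elements 𝔽.elements _ ⟩
        ∑ 𝔽.elements (λ a → ∑ 𝕂.elements (λ s → 𝟙 (ι a 𝕂.≟ s)))
          ≡⟨ ∑-ext 𝔽.elements (λ a → count-one 𝕂.elementsᴱ (ι a 𝕂.≟_) (ι a) tt refl (λ _ _ → sym)) ⟩
        ∑ 𝔽.elements (λ _ → 1)
          ≡⟨ ∑-one 𝔽.elements ⟩
        q ∎

  -- `ImaginaryChord` hides `s` under a quantifier, whereas the count runs over pairs of `s` and a
  -- line. As a record with both as parameters it also lets them be inferred.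
  record Chord (s : 𝕂.Carrier) (L : 𝔽.Line) : Set where
    constructor chord
    field
      outside    : NotInF s
      point      : 𝕂.OnLine (𝕂.curvePt (just s)) (ιᴸ L)
      conjugate  : 𝕂.OnLine (𝕂.curvePt (just (frob s))) (ιᴸ L)

  record Axis (s : 𝕂.Carrier) (L : 𝔽.Line) : Set where
    constructor axis
    field
      outside    : NotInF s
      plane      : 𝕂.Contains (𝕂.osc (just s)) (ιᴸ L)
      conjugate  : 𝕂.Contains (𝕂.osc (just (frob s))) (ιᴸ L)

  Chord? : ∀ s L → Dec (Chord s L)
  Chord? s L = map′ (λ (h , o , o′) → chord h o o′) (λ (chord h o o′) → h , o , o′) $ NotInF? s ×-dec (𝕂.OnLine? (𝕂.curvePt (just s)) (ιᴸ L) ×-dec 𝕂.OnLine? (𝕂.curvePt (just (frob s))) (ιᴸ L))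

  Axis? : ∀ s L → Dec (Axis s L)
  Axis? s L = map′ (λ (h , o , o′) → axis h o o′) (λ (axis h o o′) → h , o , o′) $ NotInF? s ×-dec (𝕂.Contains? (𝕂.osc (just s)) (ιᴸ L) ×-dec 𝕂.Contains? (𝕂.osc (just (frob s))) (ιᴸ L))

  Chord-frob : ∀ {s L} → Chord s L → Chord (frob s) L
  Chord-frob {s} {L} (chord h o o′) = chord (frob-∉ h) o′ (subst (λ t → 𝕂.OnLine (𝕂.curvePt (just t)) (ιᴸ L)) (sym (frob-involutive s)) o)

  Axis-frob : ∀ {s L} → Axis s L → Axis (frob s) L
  Axis-frob {s} {L} (axis h o o′) = axis (frob-∉ h) o′ (subst (λ t → 𝕂.Contains (𝕂.osc (just t)) (ιᴸ L)) (sym (frob-involutive s)) o)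

  Chord-third : ∀ {s t L} → 𝔽.IsLine L → Chord s L → Chord t L → t ≡ s ⊎ t ≡ frob s
  Chord-third {s} {t} {L} l (chord h o o′) (chord _ p _) = go (t 𝕂.≟ s) (t 𝕂.≟ frob s)
    where
    go : Dec (t ≡ s) → Dec (t ≡ frob s) → t ≡ s ⊎ t ≡ frob s
    go (yes p) _       = inj₁ p
    go (no _)  (yes p) = inj₂ p
    go (no n)  (no n′) = ⊥-elim (𝕂.three-collinear (ι-IsLine L l) (just-≢ h)
      (λ z → n (sym (Maybeₚ.just-injective z))) (λ z → n′ (sym (Maybeₚ.just-injective z))) o o′ p)

  Axis-third : ∀ {s t L} → 𝔽.IsLine L → Axis s L → Axis t L → t ≡ s ⊎ t ≡ frob s
  Axis-third {L = L} l (axis h o o′) (axis _ p _) = Sum.map Maybeₚ.just-injective Maybeₚ.just-injective (𝕂.third-osc {ιᴸ L} (ι-IsLine L l) (just-≢ h) o o′ p)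

  Chord-unique : ∀ {s L M} → 𝔽.IsLine L → 𝔽.IsLine M → Chord s L → Chord s M → L ≡ M
  Chord-unique {L = L} {M} l m (chord h o o′) (chord _ p p′) = ιᴸ-injective (𝕂.chord-unique (ι-IsLine L l) (ι-IsLine M m) (just-≢ h) o o′ p p′)

  Axis-unique : ∀ {s L M} → 𝔽.IsLine L → 𝔽.IsLine M → Axis s L → Axis s M → L ≡ M
  Axis-unique {L = L} {M} l m (axis h o o′) (axis _ p p′) = ιᴸ-injective (𝕂.line-unique (𝕂.osc-independent (just-≢ h)) (ι-IsLine L l) (ι-IsLine M m) o o′ p p′)

  -- x² - T x + N is the minimal polynomial of s; it spans with its multiple by x the planes through P(s).
  Chord-exists : ∀ s → NotInF s → ∃[ L ] (𝔽.IsLine L × Chord s L)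
  Chord-exists s h = through (trace s) (norm s)
    where
    through : ∃[ T ] ι T ≡ s ⊕ frob s → ∃[ N ] ι N ≡ s ⊗ frob s → ∃[ L ] (𝔽.IsLine L × Chord s L)
    through (T , T≡) (N , N≡) = let (L , l , h₁ , h₂) = 𝔽.line-exists G₁ G₂ in L , l
        , chord h (on L l h₁ h₂ s (root₁ s (frob s)) (root₂ s (frob s))) (on L l h₁ h₂ (frob s) (root₁′ s (frob s)) (root₂′ s (frob s)))
      where
      G₁ G₂ : 𝔽.Vec4
      G₁ = 𝔽.1# ∷ 𝔽.⊝ T ∷ N ∷ 𝔽.0# ∷ []
      G₂ = 𝔽.0# ∷ 𝔽.1# ∷ 𝔽.⊝ T ∷ N ∷ []
      T̂ = s ⊕ frob s
      N̂ = s ⊗ frob s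
      g₁ g₂ : 𝕂.Vec4
      g₁ = 1# ∷ ⊝ T̂ ∷ N̂ ∷ 0# ∷ []
      g₂ = 0# ∷ 1# ∷ ⊝ T̂ ∷ N̂ ∷ []
      g₁≡ : ιᵛ G₁ ≡ g₁
      g₁≡ = 𝕂.vec4-≡ ι-1 (trans (ι-⊝ T) (cong ⊝_ T≡)) N≡ ι-0
      g₂≡ : ιᵛ G₂ ≡ g₂
      g₂≡ = 𝕂.vec4-≡ ι-0 ι-1 (trans (ι-⊝ T) (cong ⊝_ T≡)) N≡
      root₁ : ∀ s s′ → 𝕂.Root (1# ∷ ⊝ (s ⊕ s′) ∷ s ⊗ s′ ∷ 0# ∷ []) (just s)
      root₁ = solve 2 (λ s s′ → :1 :* (s :* (s :* (s :* :1))) :+ (:- (s :+ s′)) :* (s :* (s :* :1)) :+ s :* s′ :* s :+ :0 :* :1 := :0) refl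
      root₁′ : ∀ s s′ → 𝕂.Root (1# ∷ ⊝ (s ⊕ s′) ∷ s ⊗ s′ ∷ 0# ∷ []) (just s′)
      root₁′ = solve 2 (λ s s′ → :1 :* (s′ :* (s′ :* (s′ :* :1))) :+ (:- (s :+ s′)) :* (s′ :* (s′ :* :1)) :+ s :* s′ :* s′ :+ :0 :* :1 := :0) refl
      root₂′ : ∀ s s′ → 𝕂.Root (0# ∷ 1# ∷ ⊝ (s ⊕ s′) ∷ s ⊗ s′ ∷ []) (just s′)
      root₂′ = solve 2 (λ s s′ → :0 :* (s′ :* (s′ :* (s′ :* :1))) :+ :1 :* (s′ :* (s′ :* :1)) :+ (:- (s :+ s′)) :* s′ :+ s :* s′ :* :1 := :0) refl
      root₂ : ∀ s s′ → 𝕂.Root (0# ∷ 1# ∷ ⊝ (s ⊕ s′) ∷ s ⊗ s′ ∷ []) (just s)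
      root₂ = solve 2 (λ s s′ → :0 :* (s :* (s :* (s :* :1))) :+ :1 :* (s :* (s :* :1)) :+ (:- (s :+ s′)) :* s :+ s :* s′ :* :1 := :0) refl
      independent : 𝕂.Independent g₁ g₂
      independent a b z = a≡0 , trans (solve 3 (λ a b t → b := (a :* (:- t) :+ b :* :1) :+ a :* t) refl a b T̂)
        (trans (cong₂ _⊕_ (cong (λ v → lookup v (suc zero)) z) (trans (cong (_⊗ T̂) a≡0) (𝕂.zeroˡ T̂))) (𝕂.+-identityˡ 0#))
        where
        a≡0 : a ≡ 0#
        a≡0 = trans (solve 2 (λ a b → a := a :* :1 :+ b :* :0) refl a b) (cong (λ v → lookup v zero) z)
      on : ∀ L → 𝔽.IsLine L → 𝔽.Contains G₁ L → 𝔽.Contains G₂ L → ∀ x → 𝕂.Root g₁ (just x) → 𝕂.Root g₂ (just x) →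
           𝕂.OnLine (𝕂.curvePt (just x)) (ιᴸ L)
      on L l h₁ h₂ x e₁ e₂ = 𝕂.killed⇒OnLine (ι-IsLine L l) λ c hc → combine c (𝕂.perp-span (ι-IsLine L l) independent
          (subst (λ g → 𝕂.Contains g (ιᴸ L)) g₁≡ (ι-Contains G₁ L h₁)) (subst (λ g → 𝕂.Contains g (ιᴸ L)) g₂≡ (ι-Contains G₂ L h₂)) c hc)
        where
        combine : ∀ c → ∃[ a ] ∃[ b ] 𝕂.lin a g₁ b g₂ ≡ c → 𝕂.Root c (just x)
        combine c (a , b , p) = subst (λ c → 𝕂.Root c (just x)) p (𝕂.lin-kills a g₁ b g₂ (𝕂.curvePt (just x)) e₁ e₂)

  -- The osculating planes at s and its conjugate span over K the same planes as
  -- (0, 3, -3T, T² - N) and (1, 0, -3N, N T), where T and N are the trace and the norm of s.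
  Axis-exists : ∀ s → NotInF s → ∃[ L ] (𝔽.IsLine L × Axis s L)
  Axis-exists s h = through (trace s) (norm s)
    where
    through : ∃[ T ] ι T ≡ s ⊕ frob s → ∃[ N ] ι N ≡ s ⊗ frob s → ∃[ L ] (𝔽.IsLine L × Axis s L)
    through (T , T≡) (N , N≡) = let (L , l , h₁ , h₂) = 𝔽.line-exists G₁ G₂ in L , l
        , axis h (contains L h₁ h₂ s (osc-s s (frob s))) (contains L h₁ h₂ (frob s) (osc-s′ s (frob s)))
      where
      -- Reducing the entries of the osculating plane at `s` by s² = T s - N, hence s³ = (T² - N) s
      -- - N T, gives G₁ - s G₂ with both vectors defined over F.
      G₁ G₂ : 𝔽.Vec4
      G₁ = 𝔽.1# ∷ 𝔽.0# ∷ 𝔽.⊝ (𝔽.three 𝔽.⊗ N) ∷ N 𝔽.⊗ T ∷ []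
      G₂ = 𝔽.0# ∷ 𝔽.three ∷ 𝔽.⊝ (𝔽.three 𝔽.⊗ T) ∷ T 𝔽.⊗ T 𝔽.⊕ 𝔽.⊝ N ∷ []
      g₁ g₂ : 𝕂.Carrier → 𝕂.Carrier → 𝕂.Vec4
      g₁ T N = 1# ∷ 0# ∷ ⊝ (𝕂.three ⊗ N) ∷ N ⊗ T ∷ []
      g₂ T N = 0# ∷ 𝕂.three ∷ ⊝ (𝕂.three ⊗ T) ∷ T ⊗ T ⊖ N ∷ []
      g₁≡ : ιᵛ G₁ ≡ g₁ (s ⊕ frob s) (s ⊗ frob s)
      g₁≡ = 𝕂.vec4-≡ ι-1 ι-0 (trans (ι-⊝ _) (cong ⊝_ (trans (ι-* 𝔽.three N) (cong₂ _⊗_ ι-three N≡)))) (trans (ι-* N T) (cong₂ _⊗_ N≡ T≡))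
      g₂≡ : ιᵛ G₂ ≡ g₂ (s ⊕ frob s) (s ⊗ frob s)
      g₂≡ = 𝕂.vec4-≡ ι-0 ι-three (trans (ι-⊝ _) (cong ⊝_ (trans (ι-* 𝔽.three T) (cong₂ _⊗_ ι-three T≡))))
        (trans (ι-+ _ _) (cong₂ _⊕_ (trans (ι-* T T) (cong₂ _⊗_ T≡ T≡)) (trans (ι-⊝ N) (cong ⊝_ N≡))))
      osc-s : ∀ s s′ → 𝕂.lin 1# (g₁ (s ⊕ s′) (s ⊗ s′)) (⊝ s) (g₂ (s ⊕ s′) (s ⊗ s′)) ≡ 𝕂.osc (just s)
      osc-s s s′ = 𝕂.vec4-≡
        (solve 1 (λ s → :1 :* :1 :+ (:- s) :* :0 := :1) refl s)
        (solve 1 (λ s → :1 :* :0 :+ (:- s) :* :3 := :- (:3 :* s)) refl s)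
        (solve 2 (λ s s′ → :1 :* :- (:3 :* (s :* s′)) :+ (:- s) :* :- (:3 :* (s :+ s′)) := :3 :* (s :* (s :* :1))) refl s s′)
        (solve 2 (λ s s′ → :1 :* (s :* s′ :* (s :+ s′)) :+ (:- s) :* ((s :+ s′) :* (s :+ s′) :- s :* s′) := :- (s :* (s :* (s :* :1)))) refl s s′)
      osc-s′ : ∀ s s′ → 𝕂.lin 1# (g₁ (s ⊕ s′) (s ⊗ s′)) (⊝ s′) (g₂ (s ⊕ s′) (s ⊗ s′)) ≡ 𝕂.osc (just s′)
      osc-s′ s s′ = trans (cong₂ (λ t n → 𝕂.lin 1# (g₁ t n) (⊝ s′) (g₂ t n)) (𝕂.+-comm s s′) (𝕂.*-comm s s′)) (osc-s s′ s)
      contains : ∀ L → 𝔽.Contains G₁ L → 𝔽.Contains G₂ L → ∀ x →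
                 𝕂.lin 1# (g₁ (s ⊕ frob s) (s ⊗ frob s)) (⊝ x) (g₂ (s ⊕ frob s) (s ⊗ frob s)) ≡ 𝕂.osc (just x) → 𝕂.Contains (𝕂.osc (just x)) (ιᴸ L)
      contains L h₁ h₂ x p = subst (λ c → 𝕂.Contains c (ιᴸ L)) p (𝕂.Contains-lin 1# (g₁ _ _) (⊝ x) (g₂ _ _) (ιᴸ L)
        (subst (λ c → 𝕂.Contains c (ιᴸ L)) g₁≡ (ι-Contains G₁ L h₁)) (subst (λ c → 𝕂.Contains c (ιᴸ L)) g₂≡ (ι-Contains G₂ L h₂)))

  module Chords = ConjugatePairs Chord Chord? Chord.outside Chord-frob Chord-third Chord-exists Chord-unique
  module Axes = ConjugatePairs Axis Axis? Axis.outside Axis-frob Axis-third Axis-exists Axis-unique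

  -- Planes through an imaginary chord

  Chord-roots : ∀ {c s L} → Chord s L → 𝔽.Contains c L → 𝕂.Root (ιᵛ c) (just s) × 𝕂.Root (ιᵛ c) (just (frob s))
  Chord-roots {c} {s} {L} (chord _ o o′) h = 𝕂.OnLine⇒killed (ιᴸ L) o (ιᵛ c) (ι-Contains c L h) , 𝕂.OnLine⇒killed (ιᴸ L) o′ (ιᵛ c) (ι-Contains c L h)

  -- The form of a plane through the chord vanishes at `s` outside F, but the cube at a parameter
  -- `t` of F vanishes at `t` only, over K as well.
  Chord-¬Osculating : ∀ {c s L} → Chord s L → 𝔽.Contains c L → ¬ 𝔽.Osculating c
  Chord-¬Osculating {c} {s} {L} ch@(chord h _ _) cL (t , refl) = ιᵖ-≢ t h (𝕂.Root-osc (ιᵖ t) (just s)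
    (subst (λ c → 𝕂.Root c (just s)) (ι-osc t) (proj₁ (Chord-roots {𝔽.osc t} ch cL))))

  -- Dividing the cubic form of c by x² - T x y + N y² leaves a linear form and no remainder.
  Chord-root : ∀ {c s} → NotInF s → 𝕂.Root (ιᵛ c) (just s) → ∃[ t ] 𝔽.Root c t
  Chord-root {c₀ ∷ c₁ ∷ c₂ ∷ c₃ ∷ []} {s} h r = divide (trace s) (norm s)
    where
    divide : ∃[ T ] ι T ≡ s ⊕ frob s → ∃[ N ] ι N ≡ s ⊗ frob s → ∃[ t ] 𝔽.Root (c₀ ∷ c₁ ∷ c₂ ∷ c₃ ∷ []) t
    divide (T , T≡) (N , N≡) = t , trans (cong (𝔽.dot c) (𝔽.curvePt≡ t)) (trans (factorization c₀ c₁ c₂ c₃ T N (𝔽.X t) (𝔽.Y t))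
        (trans (cong₂ 𝔽._⊕_ (trans (cong (quadratic T N (𝔽.X t) (𝔽.Y t) 𝔽.⊗_) t-root) (𝔽.zeroʳ _))
          (trans (cong₂ (λ p r → 𝔽.Y t 𝔽.⊗ 𝔽.Y t 𝔽.⊗ (p 𝔽.⊗ 𝔽.X t 𝔽.⊕ r 𝔽.⊗ 𝔽.Y t)) P≡0 R≡0)
            (𝔽.solve 2 (λ x y → y 𝔽.:* y 𝔽.:* (𝔽.:0 𝔽.:* x 𝔽.:+ 𝔽.:0 𝔽.:* y) 𝔽.:= 𝔽.:0) refl (𝔽.X t) (𝔽.Y t)))) (𝔽.+-identityʳ 𝔽.0#)))
      where
      c = c₀ ∷ c₁ ∷ c₂ ∷ c₃ ∷ []
      B = c₁ 𝔽.⊕ T 𝔽.⊗ c₀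
      P = c₂ 𝔽.⊖ N 𝔽.⊗ c₀ 𝔽.⊕ T 𝔽.⊗ (c₁ 𝔽.⊕ T 𝔽.⊗ c₀)
      R = c₃ 𝔽.⊖ N 𝔽.⊗ (c₁ 𝔽.⊕ T 𝔽.⊗ c₀)
      t = proj₁ (𝔽.form-zero c₀ B)
      t-root : c₀ 𝔽.⊗ 𝔽.X t 𝔽.⊕ B 𝔽.⊗ 𝔽.Y t ≡ 𝔽.0#
      t-root = proj₂ (𝔽.form-zero c₀ B)
      quadratic : ∀ T N x y → 𝔽.Carrier
      quadratic T N x y = x 𝔽.⊗ x 𝔽.⊖ T 𝔽.⊗ x 𝔽.⊗ y 𝔽.⊕ N 𝔽.⊗ y 𝔽.⊗ y
      factorization : ∀ c₀ c₁ c₂ c₃ T N x y → 𝔽.dot (c₀ ∷ c₁ ∷ c₂ ∷ c₃ ∷ []) (𝔽.cubics x y) ≡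
        quadratic T N x y 𝔽.⊗ (c₀ 𝔽.⊗ x 𝔽.⊕ (c₁ 𝔽.⊕ T 𝔽.⊗ c₀) 𝔽.⊗ y)
          𝔽.⊕ y 𝔽.⊗ y 𝔽.⊗ ((c₂ 𝔽.⊖ N 𝔽.⊗ c₀ 𝔽.⊕ T 𝔽.⊗ (c₁ 𝔽.⊕ T 𝔽.⊗ c₀)) 𝔽.⊗ x 𝔽.⊕ (c₃ 𝔽.⊖ N 𝔽.⊗ (c₁ 𝔽.⊕ T 𝔽.⊗ c₀)) 𝔽.⊗ y)
      factorization = 𝔽.solve 8 (λ c₀ c₁ c₂ c₃ T N x y →
        c₀ 𝔽.:* (x 𝔽.:* x 𝔽.:* x) 𝔽.:+ c₁ 𝔽.:* (x 𝔽.:* x 𝔽.:* y) 𝔽.:+ c₂ 𝔽.:* (x 𝔽.:* y 𝔽.:* y) 𝔽.:+ c₃ 𝔽.:* (y 𝔽.:* y 𝔽.:* y)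
        𝔽.:= (x 𝔽.:* x 𝔽.:- T 𝔽.:* x 𝔽.:* y 𝔽.:+ N 𝔽.:* y 𝔽.:* y) 𝔽.:* (c₀ 𝔽.:* x 𝔽.:+ (c₁ 𝔽.:+ T 𝔽.:* c₀) 𝔽.:* y)
          𝔽.:+ y 𝔽.:* y 𝔽.:* ((c₂ 𝔽.:- N 𝔽.:* c₀ 𝔽.:+ T 𝔽.:* (c₁ 𝔽.:+ T 𝔽.:* c₀)) 𝔽.:* x 𝔽.:+ (c₃ 𝔽.:- N 𝔽.:* (c₁ 𝔽.:+ T 𝔽.:* c₀)) 𝔽.:* y)) refl
      ιP : ι P ≡ ι c₂ ⊖ s ⊗ frob s ⊗ ι c₀ ⊕ (s ⊕ frob s) ⊗ (ι c₁ ⊕ (s ⊕ frob s) ⊗ ι c₀)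
      ιP = trans (ι-+ _ _) (cong₂ _⊕_ (trans (ι-+ _ _) (cong (ι c₂ ⊕_) (trans (ι-⊝ _) (cong ⊝_ (trans (ι-* N c₀) (cong (_⊗ ι c₀) N≡))))))
        (trans (ι-* T _) (cong₂ _⊗_ T≡ (trans (ι-+ c₁ _) (cong (ι c₁ ⊕_) (trans (ι-* T c₀) (cong (_⊗ ι c₀) T≡)))))))
      ιR : ι R ≡ ι c₃ ⊖ s ⊗ frob s ⊗ (ι c₁ ⊕ (s ⊕ frob s) ⊗ ι c₀)
      ιR = trans (ι-+ _ _) (cong (ι c₃ ⊕_) (trans (ι-⊝ _) (cong ⊝_ (trans (ι-* N _)
        (cong₂ _⊗_ N≡ (trans (ι-+ c₁ _) (cong (ι c₁ ⊕_) (trans (ι-* T c₀) (cong (_⊗ ι c₀) T≡)))))))))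
      remainder : ι P ⊗ s ⊕ ι R ≡ 0#
      remainder = trans (cong₂ (λ p r → p ⊗ s ⊕ r) ιP ιR) (trans (solve 6 (λ a b c d s s′ →
        (c :- s :* s′ :* a :+ (s :+ s′) :* (b :+ (s :+ s′) :* a)) :* s :+ (d :- s :* s′ :* (b :+ (s :+ s′) :* a))
        := a :* (s :* (s :* (s :* :1))) :+ b :* (s :* (s :* :1)) :+ c :* s :+ d :* :1) refl (ι c₀) (ι c₁) (ι c₂) (ι c₃) s (frob s)) r)
      -- If `P` were nonzero, P s + R = 0 would give s = -R / P in F.
      P≡0 : P ≡ 𝔽.0#
      P≡0 = go (P 𝔽.≟ 𝔽.0#)
        where
        go : Dec (P ≡ 𝔽.0#) → P ≡ 𝔽.0#
        go (yes p) = p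
        go (no p) = ⊥-elim (h (𝔽.⊝ (𝔽.recip p 𝔽.⊗ R)) (𝕂.cancelˡ (ι-≢0 p) (trans (sym (ι-* P _))
          (trans (cong ι (trans (𝔽.solve 3 (λ p i r → p 𝔽.:* 𝔽.:- (i 𝔽.:* r) 𝔽.:= 𝔽.:- (p 𝔽.:* i 𝔽.:* r)) refl P (𝔽.recip p) R)
            (cong 𝔽.⊝_ (trans (cong (𝔽._⊗ R) (𝔽.recipʳ p)) (𝔽.*-identityˡ R)))))
          (trans (ι-⊝ R) (sym (𝕂.x-y≡0⇒x≡y (trans (solve 2 (λ a b → a :- :- b := a :+ b) refl (ι P ⊗ s) (ι R)) remainder))))))))
      R≡0 : R ≡ 𝔽.0#
      R≡0 = ι≡0 (trans (solve 2 (λ s r → r := :0 :* s :+ r) refl s (ι R)) (trans (cong (λ z → z ⊗ s ⊕ ι R) (sym (trans (cong ι P≡0) ι-0))) remainder))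

  -- Dividing out the conjugate pair leaves a zero in F; a second one would make four zeros over K.
  Chord-plane : ∀ {c s L} → 𝔽.Normalized c → Chord s L → 𝔽.Contains c L → 𝔽.roots c ≡ 1
  Chord-plane {c} {s} {L} n ch@(chord h _ _) cL = one (Chord-roots {c} ch cL)
    where
    same : 𝕂.Root (ιᵛ c) (just s) → 𝕂.Root (ιᵛ c) (just (frob s)) → ∀ t v → 𝔽.Root c t → 𝔽.Root c v → Dec (v ≡ t) → v ≡ t
    same r r′ t v ct cv (yes p) = p
    same r r′ t v ct cv (no p) = ⊥-elim (ι-≢𝟎 {c} n (𝕂.four-roots (just-≢ h) (ιᵖ-≢ t h ∘ sym) (ιᵖ-≢ t (frob-∉ h) ∘ sym)
      (ιᵖ-≢ v h ∘ sym) (ιᵖ-≢ v (frob-∉ h) ∘ sym) (λ z → p (ιᵖ-injective (sym z))) r r′ (ι-Root c t ct) (ι-Root c v cv)))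
    one : 𝕂.Root (ιᵛ c) (just s) × 𝕂.Root (ιᵛ c) (just (frob s)) → 𝔽.roots c ≡ 1
    one (r , r′) = let (t , ct) = Chord-root {c} h r in
      count-one 𝔽.parametersᴱ (𝔽.Root? c) t tt ct (λ v _ cv → same r r′ t v ct cv (v 𝔽.≟ᵖ t))

  -- Two different conjugate pairs would be four zeros of the form of `c`.
  Chord-unique-in-plane : ∀ {c s t L M} → 𝔽.Normalized c → 𝔽.IsLine L → 𝔽.IsLine M → Chord s L → Chord t M →
                          𝔽.Contains c L → 𝔽.Contains c M → L ≡ M
  Chord-unique-in-plane {c} {s} {t} {L} {M} n l m ch ch′ cL cM = go (t 𝕂.≟ s) (t 𝕂.≟ frob s)
    where
    go : Dec (t ≡ s) → Dec (t ≡ frob s) → L ≡ M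
    go (yes p) _ = Chord-unique l m ch (subst (λ t → Chord t M) p ch′)
    go (no _) (yes p) = Chord-unique l m ch (subst (λ t → Chord t M) (frob-involutive s) (Chord-frob (subst (λ t → Chord t M) p ch′)))
    go (no p) (no p′) = ⊥-elim (ι-≢𝟎 {c} n (𝕂.four-roots (just-≢ (Chord.outside ch)) (λ z → p (sym (Maybeₚ.just-injective z))) (λ z → p′ (sym (Maybeₚ.just-injective z)))
      (λ z → p′ (trans (sym (frob-involutive t)) (cong frob (sym (Maybeₚ.just-injective z)))))
      (λ z → p (trans (sym (frob-involutive t)) (trans (cong frob (sym (Maybeₚ.just-injective z))) (frob-involutive s))))
      (just-≢ (Chord.outside ch′)) (proj₁ (Chord-roots {c} ch cL)) (proj₂ (Chord-roots {c} ch cL)) (proj₁ (Chord-roots {c} ch′ cM)) (proj₂ (Chord-roots {c} ch′ cM))))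

  -- Over `K` both kinds of axis are the meet of two distinct osculating planes, and the uniqueness
  -- argument need not distinguish them.
  AxisAt : 𝕂.Parameter → 𝕂.Parameter → 𝔽.Line → Set
  AxisAt v w L = v ≢ w × 𝕂.Contains (𝕂.osc v) (ιᴸ L) × 𝕂.Contains (𝕂.osc w) (ιᴸ L)

  RealAxis⇒AxisAt : ∀ {L} → 𝔽.RealAxis L → ∃[ s ] ∃[ t ] AxisAt (ιᵖ s) (ιᵖ t) L
  RealAxis⇒AxisAt {L} (s , t , h , hs , ht) = s , t , (λ p → h (ιᵖ-injective p)) , ι-Contains-osc s L hs , ι-Contains-osc t L ht

  Axis⇒AxisAt : ∀ {s L} → Axis s L → AxisAt (just s) (just (frob s)) L
  Axis⇒AxisAt (axis h o o′) = just-≢ h , o , o′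

  -- Extension creates no new osculating planes over F: if `c` were the cube at `s`, conjugation
  -- would fix `c` and move the cube to that at `frob s`, so `s` would lie in F.
  ι-¬Osculating : ∀ {c} → 𝔽.Normalized c → ¬ 𝔽.Osculating c → ∀ v b → ιᵛ c ≢ 𝕂.scale b (𝕂.osc v)
  ι-¬Osculating {c} n h v b p = go (b 𝕂.≟ 0#)
    where
    normalized : ∀ v → b ≢ 0# → ιᵛ c ≡ 𝕂.scale b (𝕂.osc v) → ιᵛ c ≡ 𝕂.osc v
    normalized v hb p = proj₂ (𝕂.normalize-unique (ι-Normalized {c} n) (𝕂.Normalized-osc v) 𝕂.1≢0 hb (trans (𝕂.scale-1 (ιᵛ c)) p))
    at : ∀ v → ιᵛ c ≡ 𝕂.osc v → ⊥
    at nothing p = h (nothing , ιᵛ-injective (trans p (sym (ι-osc nothing))))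
    at (just s) p = in-subfield (frob-fixed⇒InF s (Maybeₚ.just-injective (𝕂.osc-injective {just (frob s)} {just s}
        (trans (sym (conj-osc s)) (trans (cong conj (sym p)) (trans (conj-ι c) p))))))
      where
      in-subfield : InF s → ⊥
      in-subfield (a , q) = h (just a , ιᵛ-injective (trans p (trans (cong (λ s → 𝕂.osc (just s)) (sym q)) (sym (ι-osc (just a))))))
    go : Dec (b ≡ 0#) → ⊥
    go (yes z) = ι-≢𝟎 {c} n (trans p (trans (cong (λ b → 𝕂.scale b (𝕂.osc v)) z) (𝕂.scale-0 (𝕂.osc v))))
    go (no hb) = at v (normalized v hb p)

  -- A vanishing coefficient would make `c` a multiple of one of the two osculating planes, so both
  -- are units. This makes a U³ + b V³ an honest equation for the ratio V / U.
  AxisAt-span : ∀ {c v w L} → 𝔽.Normalized c → ¬ 𝔽.Osculating c → 𝔽.IsLine L → AxisAt v w L → 𝔽.Contains c L →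
                ∃[ a ] ∃[ b ] (a ≢ 0# × b ≢ 0# × 𝕂.lin a (𝕂.osc v) b (𝕂.osc w) ≡ ιᵛ c)
  AxisAt-span {c} {v} {w} {L} n h l (v≢w , hv , hw) cL =
    let (a , b , p) = 𝕂.perp-span (ι-IsLine L l) (𝕂.osc-independent v≢w) hv hw (ιᵛ c) (ι-Contains c L cL) in
    a , b , (λ z → ι-¬Osculating {c} n h w b (trans (sym p) (first a b z))) , (λ z → ι-¬Osculating {c} n h v a (trans (sym p) (second a b z))) , p
    where
    first : ∀ a b → a ≡ 0# → 𝕂.lin a (𝕂.osc v) b (𝕂.osc w) ≡ 𝕂.scale b (𝕂.osc w)
    first a b z = 𝕂.vec-ext λ k → trans (𝕂.lookup-lin a (𝕂.osc v) b (𝕂.osc w) k) (trans (cong (λ a → a ⊗ lookup (𝕂.osc v) k ⊕ b ⊗ lookup (𝕂.osc w) k) z)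
      (trans (solve 2 (λ x y → :0 :* x :+ y := y) refl (lookup (𝕂.osc v) k) (b ⊗ lookup (𝕂.osc w) k)) (sym (𝕂.lookup-scale b (𝕂.osc w) k))))
    second : ∀ a b → b ≡ 0# → 𝕂.lin a (𝕂.osc v) b (𝕂.osc w) ≡ 𝕂.scale a (𝕂.osc v)
    second a b z = 𝕂.vec-ext λ k → trans (𝕂.lookup-lin a (𝕂.osc v) b (𝕂.osc w) k) (trans (cong (λ b → a ⊗ lookup (𝕂.osc v) k ⊕ b ⊗ lookup (𝕂.osc w) k) z)
      (trans (solve 2 (λ x y → y :+ :0 :* x := y) refl (lookup (𝕂.osc w) k) (a ⊗ lookup (𝕂.osc v) k)) (sym (𝕂.lookup-scale a (𝕂.osc v) k))))

  -- Probing both expressions for c at a point on the osculating planes at w, v′ and w′ shows that v is v′ or w′.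
  AxisAt-unique-in-plane : ∀ {c v w v′ w′ L M} → 𝔽.Normalized c → ¬ 𝔽.Osculating c → 𝔽.IsLine L → 𝔽.IsLine M →
                           AxisAt v w L → AxisAt v′ w′ M → 𝔽.Contains c L → 𝔽.Contains c M → L ≡ M
  AxisAt-unique-in-plane {c} {v} {w} {v′} {w′} {L} {M} n h l m ax@(v≢w , hv , hw) ax′@(_ , hv′ , hw′) cL cM =
    let (a , b , ha , hb , p) = AxisAt-span {c} n h l ax cL
        (a′ , b′ , _ , _ , p′) = AxisAt-span {c} n h m ax′ cM
    -- Both osculating planes through `L` thus contain `M`, and being independent they determine the
    -- line.
    in ιᴸ-injective (𝕂.line-unique (𝕂.osc-independent v≢w) (ι-IsLine L l) (ι-IsLine M m) hv hw
         (on-M (among v w a b a′ b′ ha v≢w (trans p (sym p′))))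
         (on-M (among w v b a a′ b′ hb (v≢w ∘ sym) (trans (swap a b) (trans p (sym p′))))))
    where
    swap : ∀ a b → 𝕂.lin b (𝕂.osc w) a (𝕂.osc v) ≡ 𝕂.lin a (𝕂.osc v) b (𝕂.osc w)
    swap a b = 𝕂.vec-ext λ k → trans (𝕂.lookup-lin b (𝕂.osc w) a (𝕂.osc v) k) (trans (𝕂.+-comm _ _) (sym (𝕂.lookup-lin a (𝕂.osc v) b (𝕂.osc w) k)))
    on-M : ∀ {x} → x ≡ v′ ⊎ x ≡ w′ → 𝕂.Contains (𝕂.osc x) (ιᴸ M)
    on-M (inj₁ p) = subst (λ x → 𝕂.Contains (𝕂.osc x) (ιᴸ M)) (sym p) hv′
    on-M (inj₂ p) = subst (λ x → 𝕂.Contains (𝕂.osc x) (ιᴸ M)) (sym p) hw′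
    among : ∀ v w a b a′ b′ → a ≢ 0# → v ≢ w → 𝕂.lin a (𝕂.osc v) b (𝕂.osc w) ≡ 𝕂.lin a′ (𝕂.osc v′) b′ (𝕂.osc w′) → v ≡ v′ ⊎ v ≡ w′
    among v w a b a′ b′ ha v≢w p = go (v 𝕂.≟ᵖ v′) (v 𝕂.≟ᵖ w′)
      where
      x = 𝕂.probe w v′ w′
      impossible : v ≢ v′ → v ≢ w′ → ⊥
      impossible n₁ n₂ = 𝕂.⊗-≢0 ha (𝕂.dot-probe-≢0 {v} {w} {v′} {w′} v≢w n₁ n₂) (begin
        a ⊗ 𝕂.dot (𝕂.osc v) x ≡⟨ solve 2 (λ y b → y := y :+ b :* :0) refl (a ⊗ 𝕂.dot (𝕂.osc v) x) b ⟩
        a ⊗ 𝕂.dot (𝕂.osc v) x ⊕ b ⊗ 0# ≡⟨ cong (λ z → a ⊗ 𝕂.dot (𝕂.osc v) x ⊕ b ⊗ z) (sym (𝕂.dot-probe-₁ w v′ w′)) ⟩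
        a ⊗ 𝕂.dot (𝕂.osc v) x ⊕ b ⊗ 𝕂.dot (𝕂.osc w) x ≡⟨ sym (𝕂.dot-linˡ a (𝕂.osc v) b (𝕂.osc w) x) ⟩
        𝕂.dot (𝕂.lin a (𝕂.osc v) b (𝕂.osc w)) x ≡⟨ cong (λ c → 𝕂.dot c x) p ⟩
        𝕂.dot (𝕂.lin a′ (𝕂.osc v′) b′ (𝕂.osc w′)) x ≡⟨ 𝕂.lin-kills a′ (𝕂.osc v′) b′ (𝕂.osc w′) x (𝕂.dot-probe-₂ w v′ w′) (𝕂.dot-probe-₃ w v′ w′) ⟩
        0# ∎)
        where open ≡-Reasoning
      go : Dec (v ≡ v′) → Dec (v ≡ w′) → v ≡ v′ ⊎ v ≡ w′
      go (yes q) _       = inj₁ q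
      go (no _)  (yes q) = inj₂ q
      go (no q)  (no q′) = ⊥-elim (impossible q q′)

-- The zeros of a U³ + b V³

module AxisRoots (F K : Field) (e : Embedding F K) (size≡ : Field.size K ≡ Field.size F * Field.size F)
                 (q%3≢0 : Field.size F % 3 ≢ 0) where
  open ImaginaryLines F K e size≡ q%3≢0 public
  open 𝕂 using (_⊕_; _⊖_; _⊗_; ⊝_; 0#; 1#; pow; solve; _:=_; _:+_; _:*_; _:-_; :-_; :0; :1; :3; cube; ℓ; α; β; X; Y)

  conjᵖ : 𝕂.Parameter → 𝕂.Parameter
  conjᵖ (just s) = just (frob s)
  conjᵖ nothing  = nothing

  frob-ℓ : ∀ s t → frob (ℓ s t) ≡ ℓ (conjᵖ s) (conjᵖ t)
  frob-ℓ s t = trans (frob-⊕ _ _) (cong₂ _⊕_ (trans (frob-⊗ (α s) (X t)) (cong₂ _⊗_ (frob-α s) (frob-X t)))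
                                             (trans (frob-⊗ (β s) (Y t)) (cong₂ _⊗_ (frob-β s) (frob-Y t))))
    where
    frob-α : ∀ s → frob (α s) ≡ α (conjᵖ s)
    frob-α (just _) = frob-1
    frob-α nothing  = frob-0
    frob-β : ∀ s → frob (β s) ≡ β (conjᵖ s)
    frob-β (just s) = frob-⊝ s
    frob-β nothing  = frob-1
    frob-X : ∀ t → frob (X t) ≡ X (conjᵖ t)
    frob-X (just _) = refl
    frob-X nothing  = frob-1
    frob-Y : ∀ t → frob (Y t) ≡ Y (conjᵖ t)
    frob-Y (just _) = frob-1
    frob-Y nothing  = frob-0

  conjᵖ-ι : ∀ t → conjᵖ (ιᵖ t) ≡ ιᵖ t
  conjᵖ-ι (just t) = cong just (frob-ι t)
  conjᵖ-ι nothing  = refl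

  conjᵖ-fixed : ∀ p → conjᵖ p ≡ p → ∃[ t ] ιᵖ t ≡ p
  conjᵖ-fixed (just s) h = let (a , h′) = frob-fixed⇒InF s (Maybeₚ.just-injective h) in just a , cong just h′
  conjᵖ-fixed nothing  h = nothing , refl

  -- c has the cubic form a ℓ(v,t)³ + b ℓ(w,t)³, so that t is a root when the ratio y = ℓ(w,t) / ℓ(v,t) satisfies a + b y³ = 0.
  module Ratio (c : 𝔽.Vec4) (v w : 𝕂.Parameter) (v≢w : v ≢ w) (a b : 𝕂.Carrier) (ha : a ≢ 0#) (hb : b ≢ 0#)
               (span : 𝕂.lin a (𝕂.osc v) b (𝕂.osc w) ≡ ιᵛ c) where

    A B : 𝔽.Parameter → 𝕂.Carrier
    A t = ℓ v (ιᵖ t)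
    B t = ℓ w (ιᵖ t)

    value : ∀ t → 𝕂.dot (ιᵛ c) (𝕂.curvePt (ιᵖ t)) ≡ a ⊗ cube (A t) ⊕ b ⊗ cube (B t)
    value t = trans (cong (λ c → 𝕂.dot c (𝕂.curvePt (ιᵖ t))) (sym span))
      (trans (𝕂.dot-linˡ a (𝕂.osc v) b (𝕂.osc w) (𝕂.curvePt (ιᵖ t)))
        (cong₂ (λ x y → a ⊗ x ⊕ b ⊗ y) (𝕂.dot-osc v (ιᵖ t)) (𝕂.dot-osc w (ιᵖ t))))

    -- If one linear form vanished at a root, so would the other because `b` is nonzero, and then
    -- both `v` and `w` would be the point itself.
    root⇒A≢0 : ∀ {t} → 𝔽.Root c t → A t ≢ 0#
    root⇒A≢0 {t} r z = v≢w (trans (𝕂.ℓ≡0 v (ιᵖ t) z) (sym (𝕂.ℓ≡0 w (ιᵖ t) (𝕂.cube≡0 (𝕂.xy≡0⇒y≡0 hb (begin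
      b ⊗ cube (B t) ≡⟨ solve 3 (λ a b y → b :* y := a :* (:0 :* :0 :* :0) :+ b :* y) refl a b (cube (B t)) ⟩
      a ⊗ cube 0# ⊕ b ⊗ cube (B t) ≡⟨ cong (λ z → a ⊗ cube z ⊕ b ⊗ cube (B t)) (sym z) ⟩
      a ⊗ cube (A t) ⊕ b ⊗ cube (B t) ≡⟨ sym (value t) ⟩
      𝕂.dot (ιᵛ c) (𝕂.curvePt (ιᵖ t)) ≡⟨ ι-Root c t r ⟩
      0# ∎))))))
      where open ≡-Reasoning

    ratio-value : ∀ {t y} → B t ≡ y ⊗ A t → 𝕂.dot (ιᵛ c) (𝕂.curvePt (ιᵖ t)) ≡ cube (A t) ⊗ (a ⊕ b ⊗ cube y)
    ratio-value {t} {y} h = trans (value t) (trans (cong (λ z → a ⊗ cube (A t) ⊕ b ⊗ cube z) h)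
      (solve 4 (λ a b y x → a :* (x :* x :* x) :+ b :* ((y :* x) :* (y :* x) :* (y :* x)) := x :* x :* x :* (a :+ b :* (y :* y :* y))) refl a b y (A t)))

    ratio⇒root : ∀ {t y} → B t ≡ y ⊗ A t → a ⊕ b ⊗ cube y ≡ 0# → 𝔽.Root c t
    ratio⇒root {t} {y} h z = ι-Root⁻ c t (trans (ratio-value h) (trans (cong (cube (A t) ⊗_) z) (𝕂.zeroʳ _)))

    root⇒ratio : ∀ {t} → 𝔽.Root c t → ∃[ y ] (B t ≡ y ⊗ A t × a ⊕ b ⊗ cube y ≡ 0#)
    root⇒ratio {t} r = B t ⊗ 𝕂.recip A≢0 , h , 𝕂.xy≡0⇒y≡0 (𝕂.cube-≢0 A≢0) (trans (sym (ratio-value h)) (ι-Root c t r))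
      where
      A≢0 = root⇒A≢0 r
      h : B t ≡ B t ⊗ 𝕂.recip A≢0 ⊗ A t
      h = sym (trans (𝕂.*-assoc _ _ _) (trans (cong (B t ⊗_) (𝕂.recipˡ A≢0)) (𝕂.*-identityʳ _)))

    y≢0 : ∀ {y} → a ⊕ b ⊗ cube y ≡ 0# → y ≢ 0#
    y≢0 {y} h z = ha (trans (solve 2 (λ a b → a := a :+ b :* (:0 :* :0 :* :0)) refl a b) (trans (cong (λ y → a ⊕ b ⊗ cube y) (sym z)) h))

    -- Since v ≠ w, the ratio of the two linear forms is a projective coordinate: with
    -- `point-unique` each `y` is the ratio at exactly one point, the zero of a linear form.
    point-exists : ∀ y → ∃[ p ] ℓ w p ≡ y ⊗ ℓ v p
    point-exists y = let (p , h) = 𝕂.form-zero (α w ⊖ y ⊗ α v) (β w ⊖ y ⊗ β v) in p , 𝕂.x-y≡0⇒x≡y (trans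
      (solve 7 (λ aw av bw bv y x z → aw :* x :+ bw :* z :- y :* (av :* x :+ bv :* z) := (aw :- y :* av) :* x :+ (bw :- y :* bv) :* z)
        refl (α w) (α v) (β w) (β v) y (X p) (Y p)) h)

    point-unique : ∀ y {p r} → ℓ w p ≡ y ⊗ ℓ v p → ℓ w r ≡ y ⊗ ℓ v r → p ≡ r
    point-unique y {p} {r} hp hr = go (p 𝕂.≟ᵖ r)
      where
      form : ∀ p → ℓ w p ≡ y ⊗ ℓ v p → (α w ⊖ y ⊗ α v) ⊗ X p ⊕ (β w ⊖ y ⊗ β v) ⊗ Y p ≡ 0#
      form p h = trans (solve 7 (λ aw av bw bv y x z → (aw :- y :* av) :* x :+ (bw :- y :* bv) :* z := aw :* x :+ bw :* z :- y :* (av :* x :+ bv :* z))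
        refl (α w) (α v) (β w) (β v) y (X p) (Y p)) (𝕂.x≡y⇒x-y≡0 h)
      equal : α w ⊖ y ⊗ α v ≡ 0# × β w ⊖ y ⊗ β v ≡ 0# → v ≡ w
      equal (h₁ , h₂) = sym (𝕂.ℓ≡0 w v (trans (cong₂ (λ p r → p ⊗ X v ⊕ r ⊗ Y v) (𝕂.x-y≡0⇒x≡y h₁) (𝕂.x-y≡0⇒x≡y h₂))
        (trans (solve 5 (λ y a b x z → y :* a :* x :+ y :* b :* z := y :* (a :* x :+ b :* z)) refl y (α v) (β v) (X v) (Y v))
          (trans (cong (y ⊗_) (𝕂.ℓ-self v)) (𝕂.zeroʳ y)))))
      go : Dec (p ≡ r) → p ≡ r
      go (yes h) = h
      go (no h)  = ⊥-elim (v≢w (equal (𝕂.form-zero-unique _ _ h (form p hp) (form r hr))))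

    -- `S` is to be the set of ratios at points defined over F. `S-ratio` gives one inclusion; for
    -- the other, `S-conj` says that the conjugate of a point with ratio `y` has ratio `y` too, so
    -- by uniqueness the point is its own conjugate.
    module Descent (S : 𝕂.Carrier → Set)
      (S-ratio : ∀ t y → A t ≢ 0# → B t ≡ y ⊗ A t → S y)
      (S-conj : ∀ y → S y → ∀ p → ℓ w p ≡ y ⊗ ℓ v p → ℓ w (conjᵖ p) ≡ y ⊗ ℓ v (conjᵖ p)) where

      solution : ∀ y → S y → ∃[ t ] B t ≡ y ⊗ A t
      solution y Sy = let (p , h) = point-exists y
                          (t , h′) = conjᵖ-fixed p (point-unique y (S-conj y Sy p h) h)
                      in t , subst (λ p → ℓ w p ≡ y ⊗ ℓ v p) (sym h′) h

      -- The ratios of all roots have the same cube -a / b. Injectivity of cubing is asked on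
      -- nonzero elements only, as `S` contains 0 in the real case.
      one-root : ∀ y₀ → S y₀ → a ⊕ b ⊗ cube y₀ ≡ 0# → (∀ y y′ → S y → S y′ → y ≢ 0# → y′ ≢ 0# → cube y ≡ cube y′ → y ≡ y′) → 𝔽.roots c ≡ 1
      one-root y₀ S₀ e₀ inj = let (t , h) = solution y₀ S₀ in
          count-one 𝔽.parametersᴱ (𝔽.Root? c) t tt (ratio⇒root h e₀) (λ s _ r → same t h s r (root⇒ratio r))
        where
        same : ∀ t → B t ≡ y₀ ⊗ A t → ∀ s → 𝔽.Root c s → ∃[ y ] (B s ≡ y ⊗ A s × a ⊕ b ⊗ cube y ≡ 0#) → s ≡ t
        same t h s r (y , hy , ey) = ιᵖ-injective (point-unique y₀ (subst (λ y → B s ≡ y ⊗ A s) y≡ hy) h)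
          where
          y≡ : y ≡ y₀
          y≡ = inj y y₀ (S-ratio s y (root⇒A≢0 r) hy) S₀ (y≢0 ey) (y≢0 e₀) (𝕂.cancelˡ hb (𝕂.x-y≡0⇒x≡y (trans
            (solve 4 (λ a b x z → b :* x :- b :* z := (a :+ b :* x) :- (a :+ b :* z)) refl a b (cube y) (cube y₀)) (𝕂.x≡y⇒x-y≡0 (trans ey (sym e₀))))))

      -- Multiplying a ratio by `ω` does not change its cube and moves the root, so a single root
      -- produces three distinct ones.
      not-few-roots : ∀ ω → ω ≢ 1# → cube ω ≡ 1# → (∀ y → S y → S (ω ⊗ y)) → 𝔽.roots c ≢ 1 × 𝔽.roots c ≢ 2
      not-few-roots ω ω≢1 ω³ closed = not-one , not-two
        where
        rotated : ∀ {y} → a ⊕ b ⊗ cube y ≡ 0# → a ⊕ b ⊗ cube (ω ⊗ y) ≡ 0#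
        rotated {y} h = trans (cong (λ z → a ⊕ b ⊗ z) (trans (𝕂.cube-⊗ ω y) (trans (cong (_⊗ cube y) ω³) (𝕂.*-identityˡ _)))) h
        apart : ∀ {s t y y′} → y ≢ y′ → 𝔽.Root c s → B s ≡ y ⊗ A s → B t ≡ y′ ⊗ A t → s ≢ t
        apart {s} {y = y} {y′} ne r h h′ refl = ne (𝕂.cancelˡ (root⇒A≢0 r) (trans (𝕂.*-comm _ y) (trans (sym h) (trans h′ (𝕂.*-comm y′ _)))))
        ω-cancel : ∀ {y} → y ≢ 0# → ω ⊗ y ≢ y
        ω-cancel {y} hy h = ω≢1 (𝕂.cancelˡ hy (trans (𝕂.*-comm y ω) (trans h (sym (𝕂.*-identityʳ y)))))
        ω²-cancel : ∀ {y} → y ≢ 0# → ω ⊗ (ω ⊗ y) ≢ y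
        ω²-cancel {y} hy h = ω-cancel hy (sym (trans (sym (𝕂.*-identityˡ y)) (trans (cong (_⊗ y) (sym ω³))
          (trans (solve 2 (λ w y → w :* w :* w :* y := w :* (w :* (w :* y))) refl ω y) (cong (ω ⊗_) h)))))
        three-roots : ∀ t → 𝔽.Root c t → ∃[ s ] ∃[ r ] (𝔽.Root c s × 𝔽.Root c r × t ≢ s × t ≢ r × s ≢ r)
        three-roots t rt = from-ratio (root⇒ratio rt)
          where
          from-ratio : ∃[ y ] (B t ≡ y ⊗ A t × a ⊕ b ⊗ cube y ≡ 0#) → ∃[ s ] ∃[ r ] (𝔽.Root c s × 𝔽.Root c r × t ≢ s × t ≢ r × s ≢ r)
          from-ratio (y , h , ey) = from-points (solution (ω ⊗ y) S₁) (solution (ω ⊗ (ω ⊗ y)) (closed (ω ⊗ y) S₁))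
            where
            S₁ = closed y (S-ratio t y (root⇒A≢0 rt) h)
            from-points : ∃[ s ] B s ≡ ω ⊗ y ⊗ A s → ∃[ r ] B r ≡ ω ⊗ (ω ⊗ y) ⊗ A r → ∃[ s ] ∃[ r ] (𝔽.Root c s × 𝔽.Root c r × t ≢ s × t ≢ r × s ≢ r)
            from-points (s , hs) (r , hr) = s , r , rs , ratio⇒root hr (rotated (rotated ey))
              , apart (ω-cancel (y≢0 ey) ∘ sym) rt h hs , apart (ω²-cancel (y≢0 ey) ∘ sym) rt h hr
              , apart (λ p → ω-cancel (y≢0 (rotated ey)) (sym p)) rs hs hr
              where
              rs : 𝔽.Root c s
              rs = ratio⇒root hs (rotated ey)
        not-one : 𝔽.roots c ≢ 1
        not-one h = impossible (𝔽.root-vector c 1 h)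
          where
          contradict : ∀ t → (∀ s → 𝔽.Root c s → s ∈ t ∷ []) → ∃[ s ] ∃[ r ] (𝔽.Root c s × 𝔽.Root c r × t ≢ s × t ≢ r × s ≢ r) → ⊥
          contradict t all (s , _ , rs , _ , t≢s , _) with all s rs
          ... | here p = t≢s (sym p)
          impossible : Σ (Vec 𝔽.Parameter 1) (𝔽.RootVector c) → ⊥
          impossible (t ∷ [] , all , are , _) = contradict t all (three-roots t (are t (here refl)))
        not-two : 𝔽.roots c ≢ 2
        not-two h = impossible (𝔽.root-vector c 2 h)
          where
          contradict : ∀ t t′ → (∀ s → 𝔽.Root c s → s ∈ t ∷ t′ ∷ []) → ∃[ s ] ∃[ r ] (𝔽.Root c s × 𝔽.Root c r × t ≢ s × t ≢ r × s ≢ r) → ⊥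
          contradict t t′ all (s , r , rs , rr , t≢s , t≢r , s≢r) with all s rs | all r rr
          ... | here p         | _               = t≢s (sym p)
          ... | there (here p) | here p′         = t≢r (sym p′)
          ... | there (here p) | there (here p′) = s≢r (trans p (sym p′))
          impossible : Σ (Vec 𝔽.Parameter 2) (𝔽.RootVector c) → ⊥
          impossible (t ∷ t′ ∷ [] , all , are , _) = contradict t t′ all (three-roots t (are t (here refl)))

  cube-pow : ∀ g m → cube (pow g m) ≡ pow (cube g) m
  cube-pow g m = sym (trans (𝕂.pow-⊗ (g ⊗ g) g m) (cong (_⊗ pow g m) (𝕂.pow-⊗ g g m)))

  -- The unique cube root of y is a power of y when the exponent m inverts 3.
  module CubeRoot (S : 𝕂.Carrier → Set) (S-pow : ∀ y m → S y → S (pow y m)) (m : ℕ) (root : ∀ y → S y → y ≢ 0# → pow (cube y) m ≡ y) where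
    cube-injective : ∀ y y′ → S y → S y′ → y ≢ 0# → y′ ≢ 0# → cube y ≡ cube y′ → y ≡ y′
    cube-injective y y′ Sy Sy′ hy hy′ h = trans (sym (root y Sy hy)) (trans (cong (λ z → pow z m) h) (root y′ Sy′ hy′))

    -- The element g = -a / b lies in `S`, and (g^m)³ = (g³)^m = g.
    cube-root : ∀ {a b} → a ≢ 0# → b ≢ 0# → (∀ g → b ⊗ g ≡ ⊝ a → S g) → ∃[ y ] (S y × a ⊕ b ⊗ cube y ≡ 0#)
    cube-root {a} {b} ha hb Sg = pow g m , S-pow g m (Sg g bg) , trans (cong (λ z → a ⊕ b ⊗ z) (trans (cube-pow g m) (root g (Sg g bg) g≢0)))
        (trans (cong (a ⊕_) bg) (𝕂.-‿inverseʳ a))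
      where
      g = 𝕂.recip hb ⊗ ⊝ a
      bg : b ⊗ g ≡ ⊝ a
      bg = trans (sym (𝕂.*-assoc b _ _)) (trans (cong (_⊗ ⊝ a) (𝕂.recipʳ hb)) (𝕂.*-identityˡ _))
      g≢0 : g ≢ 0#
      g≢0 = 𝕂.⊗-≢0 (𝕂.recip≢0 hb) (𝕂.⊝-≢0 ha)

  pow-cube : ∀ y m → pow (cube y) m ≡ pow y (m * 3)
  pow-cube y m = trans (cong (λ z → pow z m) (sym (𝕂.pow-3 y))) (sym (𝕂.pow-* y m 3))

  -- The plane is fixed by conjugation, so its two expressions can be compared, which determines the
  -- conjugates of `a` and `b`.
  conj-span : ∀ {a b c v w} → 𝕂.lin a (𝕂.osc v) b (𝕂.osc w) ≡ ιᵛ c → 𝕂.lin (frob a) (conj (𝕂.osc v)) (frob b) (conj (𝕂.osc w)) ≡ ιᵛ c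
  conj-span {a} {b} {c} {v} {w} h = trans (sym (conj-lin a (𝕂.osc v) b (𝕂.osc w))) (trans (cong conj h) (conj-ι c))

  module Real where
    -- The elements of F, that is, 0 and the group of order q - 1.
    S : 𝕂.Carrier → Set
    S y = frob y ≡ y

    S-pow : ∀ y m → S y → S (pow y m)
    S-pow y m h = trans (frob-pow y m) (cong (λ z → pow z m) h)

    exponent : q % 3 ≡ 2 → ∃[ m ] (∀ y → S y → y ≢ 0# → pow (cube y) m ≡ y)
    -- For q = 3k + 2 one has 3(2k + 1) = 2(q - 1) + 1, and y^(q-1) = 1.
    exponent h = 2 * k + 1 , root
      where
      open ℕ-Solver
      k = q / 3
      u≡ : 𝔽.u ≡ 1 + k * 3
      u≡ = ℕₚ.suc-injective (trans (sym q≡) (trans (m≡m%n+[m/n]*n q 3) (cong (_+ k * 3) h)))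
      root : ∀ y → S y → y ≢ 0# → pow (cube y) (2 * k + 1) ≡ y
      root y Sy hy = begin
        pow (cube y) (2 * k + 1) ≡⟨ pow-cube y (2 * k + 1) ⟩
        pow y ((2 * k + 1) * 3) ≡⟨ cong (pow y) (solveℕ 1 (λ k → (conℕ 2 :⊗ k :⊕ conℕ 1) :⊗ conℕ 3 :≡ conℕ 1 :⊕ conℕ 2 :⊗ (conℕ 1 :⊕ k :⊗ conℕ 3)) refl k) ⟩
        y ⊗ pow y (2 * (1 + k * 3)) ≡⟨ cong (λ n → y ⊗ pow y (2 * n)) (sym u≡) ⟩
        y ⊗ pow y (2 * 𝔽.u) ≡⟨ cong (y ⊗_) (trans (𝕂.pow-* y 2 𝔽.u) (trans (cong (λ z → pow z 2) y^u) (𝕂.pow-1 2))) ⟩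
        y ⊗ 1# ≡⟨ 𝕂.*-identityʳ y ⟩
        y ∎
        where
        open ≡-Reasoning
        y^u : pow y 𝔽.u ≡ 1#
        y^u = 𝕂.cancelˡ hy (trans (cong (pow y) (sym q≡)) (trans Sy (sym (𝕂.*-identityʳ y))))

    module At {c v w a b} (ha : a ≢ 0#) (hb : b ≢ 0#) (v≢w : v ≢ w) (span : 𝕂.lin a (𝕂.osc (ιᵖ v)) b (𝕂.osc (ιᵖ w)) ≡ ιᵛ c) where
      v≢w′ : ιᵖ v ≢ ιᵖ w
      v≢w′ h = v≢w (ιᵖ-injective h)

      open Ratio c (ιᵖ v) (ιᵖ w) v≢w′ a b ha hb span

      frob-ℓ-ι : ∀ v p → frob (ℓ (ιᵖ v) p) ≡ ℓ (ιᵖ v) (conjᵖ p)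
      frob-ℓ-ι v p = trans (frob-ℓ (ιᵖ v) p) (cong (λ v → ℓ v (conjᵖ p)) (conjᵖ-ι v))

      S-conj : ∀ y → S y → ∀ p → ℓ (ιᵖ w) p ≡ y ⊗ ℓ (ιᵖ v) p → ℓ (ιᵖ w) (conjᵖ p) ≡ y ⊗ ℓ (ιᵖ v) (conjᵖ p)
      S-conj y Sy p h = trans (sym (frob-ℓ-ι w p)) (trans (cong frob h) (trans (frob-⊗ y _) (cong₂ _⊗_ Sy (frob-ℓ-ι v p))))

      S-ratio : ∀ t y → A t ≢ 0# → B t ≡ y ⊗ A t → S y
      S-ratio t y hA h = 𝕂.cancelˡ hA (begin
        A t ⊗ frob y ≡⟨ 𝕂.*-comm (A t) (frob y) ⟩
        frob y ⊗ A t ≡⟨ cong (frob y ⊗_) (sym (fixed v)) ⟩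
        frob y ⊗ frob (A t) ≡⟨ trans (sym (frob-⊗ y (A t))) (cong frob (sym h)) ⟩
        frob (B t) ≡⟨ fixed w ⟩
        B t ≡⟨ trans h (𝕂.*-comm y (A t)) ⟩
        A t ⊗ y ∎)
        where
        open ≡-Reasoning
        fixed : ∀ v → frob (ℓ (ιᵖ v) (ιᵖ t)) ≡ ℓ (ιᵖ v) (ιᵖ t)
        fixed v = trans (frob-ℓ-ι v (ιᵖ t)) (cong (ℓ (ιᵖ v)) (conjᵖ-ι t))

      open Descent S S-ratio S-conj public

      conj-osc-ι : ∀ v → conj (𝕂.osc (ιᵖ v)) ≡ 𝕂.osc (ιᵖ v)
      conj-osc-ι v = trans (cong conj (sym (ι-osc v))) (trans (conj-ι (𝔽.osc v)) (ι-osc v))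

      -- Both osculating planes are defined over F, so conjugation fixes each of the coefficients
      -- `a` and `b`.
      S-quotient : ∀ g → b ⊗ g ≡ ⊝ a → S g
      S-quotient g h = 𝕂.cancelˡ hb (begin
        b ⊗ frob g ≡⟨ cong (_⊗ frob g) (sym (proj₂ fixed)) ⟩
        frob b ⊗ frob g ≡⟨ trans (sym (frob-⊗ b g)) (cong frob h) ⟩
        frob (⊝ a) ≡⟨ trans (frob-⊝ a) (cong ⊝_ (proj₁ fixed)) ⟩
        ⊝ a ≡⟨ sym h ⟩
        b ⊗ g ∎)
        where
        open ≡-Reasoning
        fixed : frob a ≡ a × frob b ≡ b
        fixed = 𝕂.independent-injective (𝕂.osc-independent v≢w′) (trans
          (cong₂ (λ x y → 𝕂.lin (frob a) x (frob b) y) (sym (conj-osc-ι v)) (sym (conj-osc-ι w))) (trans (conj-span {c = c} {ιᵖ v} {ιᵖ w} span) (sym span)))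

  module Imaginary where
    -- The elements of norm 1, the group y^(q+1) = 1.
    S : 𝕂.Carrier → Set
    S y = frob y ⊗ y ≡ 1#

    S-⊗ : ∀ {x y} → S x → S y → S (x ⊗ y)
    S-⊗ {x} {y} hx hy = trans (cong (_⊗ (x ⊗ y)) (frob-⊗ x y)) (trans
      (solve 4 (λ a b x y → a :* b :* (x :* y) := a :* x :* (b :* y)) refl (frob x) (frob y) x y)
      (trans (cong₂ _⊗_ hx hy) (𝕂.*-identityʳ 1#)))

    S-pow : ∀ y m → S y → S (pow y m)
    S-pow y zero    h = trans (cong (_⊗ 1#) frob-1) (𝕂.*-identityʳ 1#)
    S-pow y (suc m) h = S-⊗ h (S-pow y m h)

    exponent : q % 3 ≡ 1 → ∃[ m ] (∀ y → S y → y ≢ 0# → pow (cube y) m ≡ y)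
    -- For q = 3k + 1 one has 3(k + 1) = (q + 1) + 1, and y^(q+1) = 1.
    exponent h = k + 1 , root
      where
      open ℕ-Solver
      k = q / 3
      q≡′ : q ≡ 1 + k * 3
      q≡′ = trans (m≡m%n+[m/n]*n q 3) (cong (_+ k * 3) h)
      root : ∀ y → S y → y ≢ 0# → pow (cube y) (k + 1) ≡ y
      root y Sy _ = begin
        pow (cube y) (k + 1) ≡⟨ pow-cube y (k + 1) ⟩
        pow y ((k + 1) * 3) ≡⟨ cong (pow y) (solveℕ 1 (λ k → (k :⊕ conℕ 1) :⊗ conℕ 3 :≡ conℕ 2 :⊕ (conℕ 1 :⊕ k :⊗ conℕ 3)) refl k) ⟩
        y ⊗ (y ⊗ pow y (1 + k * 3)) ≡⟨ cong (λ n → y ⊗ (y ⊗ pow y n)) (sym q≡′) ⟩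
        y ⊗ (y ⊗ frob y) ≡⟨ cong (y ⊗_) (trans (𝕂.*-comm y (frob y)) Sy) ⟩
        y ⊗ 1# ≡⟨ 𝕂.*-identityʳ y ⟩
        y ∎
        where open ≡-Reasoning

    module At {c s a b} (ha : a ≢ 0#) (hb : b ≢ 0#) (h : NotInF s) (span : 𝕂.lin a (𝕂.osc (just s)) b (𝕂.osc (just (frob s))) ≡ ιᵛ c) where
      open Ratio c (just s) (just (frob s)) (just-≢ h) a b ha hb span

      frob-ℓ₁ : ∀ p → frob (ℓ (just s) p) ≡ ℓ (just (frob s)) (conjᵖ p)
      frob-ℓ₁ p = frob-ℓ (just s) p

      frob-ℓ₂ : ∀ p → frob (ℓ (just (frob s)) p) ≡ ℓ (just s) (conjᵖ p)
      frob-ℓ₂ p = trans (frob-ℓ (just (frob s)) p) (cong (λ s → ℓ (just s) (conjᵖ p)) (frob-involutive s))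

      S-conj : ∀ y → S y → ∀ p → ℓ (just (frob s)) p ≡ y ⊗ ℓ (just s) p → ℓ (just (frob s)) (conjᵖ p) ≡ y ⊗ ℓ (just s) (conjᵖ p)
      S-conj y Sy p h = sym (begin
        y ⊗ ℓ (just s) (conjᵖ p) ≡⟨ cong (y ⊗_) (trans (sym (frob-ℓ₂ p)) (trans (cong frob h) (frob-⊗ y _))) ⟩
        y ⊗ (frob y ⊗ frob (ℓ (just s) p)) ≡⟨ solve 3 (λ y z l → y :* (z :* l) := z :* y :* l) refl y (frob y) _ ⟩
        frob y ⊗ y ⊗ frob (ℓ (just s) p) ≡⟨ trans (cong₂ _⊗_ Sy (frob-ℓ₁ p)) (𝕂.*-identityˡ _) ⟩
        ℓ (just (frob s)) (conjᵖ p) ∎)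
        where open ≡-Reasoning

      -- Conjugation exchanges the two linear forms; at a point over F it therefore exchanges `A t`
      -- and `B t` and inverts their ratio.
      S-ratio : ∀ t y → A t ≢ 0# → B t ≡ y ⊗ A t → S y
      S-ratio t y hA h = 𝕂.cancelˡ hA (begin
        A t ⊗ (frob y ⊗ y) ≡⟨ solve 3 (λ x z y → x :* (z :* y) := z :* (y :* x)) refl (A t) (frob y) y ⟩
        frob y ⊗ (y ⊗ A t) ≡⟨ cong (frob y ⊗_) (trans (sym h) (trans (cong (ℓ (just (frob s))) (sym (conjᵖ-ι t))) (sym (frob-ℓ₁ (ιᵖ t))))) ⟩
        frob y ⊗ frob (A t) ≡⟨ trans (sym (frob-⊗ y (A t))) (cong frob (sym h)) ⟩
        frob (B t) ≡⟨ trans (frob-ℓ₂ (ιᵖ t)) (cong (ℓ (just s)) (conjᵖ-ι t)) ⟩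
        A t ≡⟨ sym (𝕂.*-identityʳ (A t)) ⟩
        A t ⊗ 1# ∎)
        where open ≡-Reasoning

      open Descent S S-ratio S-conj public

      -- Conjugation exchanges the two osculating planes, hence also `a` and `b`, so -a / b is sent
      -- to its inverse.
      S-quotient : ∀ g → b ⊗ g ≡ ⊝ a → S g
      S-quotient g hg = 𝕂.cancelˡ hb (begin
        b ⊗ (frob g ⊗ g) ≡⟨ solve 3 (λ b z g → b :* (z :* g) := z :* (b :* g)) refl b (frob g) g ⟩
        frob g ⊗ (b ⊗ g) ≡⟨ trans (cong (frob g ⊗_) hg) (solve 2 (λ z a → z :* :- a := :- (a :* z)) refl (frob g) a) ⟩
        ⊝ (a ⊗ frob g) ≡⟨ cong (λ x → ⊝ (x ⊗ frob g)) (sym (proj₁ swapped)) ⟩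
        ⊝ (frob b ⊗ frob g) ≡⟨ cong ⊝_ (trans (sym (frob-⊗ b g)) (trans (cong frob hg) (trans (frob-⊝ a) (cong ⊝_ (proj₂ swapped))))) ⟩
        ⊝ (⊝ b) ≡⟨ solve 1 (λ b → :- (:- b) := b :* :1) refl b ⟩
        b ⊗ 1# ∎)
        where
        open ≡-Reasoning
        swapped : frob b ≡ a × frob a ≡ b
        swapped = 𝕂.independent-injective (𝕂.osc-independent (just-≢ h)) (trans (𝕂.vec-ext λ k → trans (𝕂.lookup-lin (frob b) (𝕂.osc (just s)) (frob a) (𝕂.osc (just (frob s))) k)
            (trans (𝕂.+-comm _ _) (sym (𝕂.lookup-lin (frob a) (𝕂.osc (just (frob s))) (frob b) (𝕂.osc (just s)) k))))
          (trans (cong₂ (λ x y → 𝕂.lin (frob a) x (frob b) y) (sym (conj-osc s)) (trans (cong (λ s → 𝕂.osc (just s)) (sym (frob-involutive s))) (sym (conj-osc (frob s)))))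
            (trans (conj-span {c = c} {just s} {just (frob s)} span) (sym span))))

  module _ {c : 𝔽.Vec4} (n : 𝔽.Normalized c) (h : ¬ 𝔽.Osculating c) {L : 𝔽.Line} (l : 𝔽.IsLine L) (cL : 𝔽.Contains c L) where

    real-few-roots : q % 3 ≡ 1 → 𝔽.RealAxis L → 𝔽.roots c ≢ 1 × 𝔽.roots c ≢ 2
    real-few-roots hq (v , w , v≢w , hv , hw) =
      let (ω , ω≢1 , ω³) = 𝔽.primitive-cube-root hq
          (a , b , ha , hb , span) = AxisAt-span {c} {ιᵖ v} {ιᵖ w} {L} n h l ((λ p → v≢w (ιᵖ-injective p)) , ι-Contains-osc v L hv , ι-Contains-osc w L hw) cL
      in Real.At.not-few-roots {c} {v} {w} ha hb v≢w span (ι ω) (λ p → ω≢1 (ι-injective (trans p (sym ι-1))))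
           (trans (sym (trans (ι-* _ _) (cong (_⊗ ι ω) (ι-* ω ω)))) (trans (cong ι ω³) ι-1))
           (λ y Sy → trans (frob-⊗ (ι ω) y) (cong₂ _⊗_ (frob-ι ω) Sy))

    real-one-root : q % 3 ≡ 2 → 𝔽.RealAxis L → 𝔽.roots c ≡ 1
    real-one-root hq (v , w , v≢w , hv , hw) =
      let (m , root) = Real.exponent hq
          (a , b , ha , hb , span) = AxisAt-span {c} {ιᵖ v} {ιᵖ w} {L} n h l ((λ p → v≢w (ιᵖ-injective p)) , ι-Contains-osc v L hv , ι-Contains-osc w L hw) cL
          (y , Sy , ey) = CubeRoot.cube-root Real.S Real.S-pow m root ha hb (Real.At.S-quotient {c} {v} {w} ha hb v≢w span)
      in Real.At.one-root {c} {v} {w} ha hb v≢w span y Sy ey (CubeRoot.cube-injective Real.S Real.S-pow m root)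

    imaginary-one-root : q % 3 ≡ 1 → ∀ {s} → Axis s L → 𝔽.roots c ≡ 1
    imaginary-one-root hq {s} ax@(axis hs _ _) =
      let (m , root) = Imaginary.exponent hq
          (a , b , ha , hb , span) = AxisAt-span {c} {just s} {just (frob s)} {L} n h l (Axis⇒AxisAt ax) cL
          (y , Sy , ey) = CubeRoot.cube-root Imaginary.S Imaginary.S-pow m root ha hb (Imaginary.At.S-quotient {c} {s} ha hb hs span)
      in Imaginary.At.one-root {c} {s} ha hb hs span y Sy ey (CubeRoot.cube-injective Imaginary.S Imaginary.S-pow m root)

    imaginary-few-roots : q % 3 ≡ 2 → ∀ {s} → Axis s L → 𝔽.roots c ≢ 1 × 𝔽.roots c ≢ 2
    imaginary-few-roots hq {s} ax@(axis hs _ _) =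
      let (ω , ω≢1 , ω³) = 𝕂.primitive-cube-root square%3
          (a , b , ha , hb , span) = AxisAt-span {c} {just s} {just (frob s)} {L} n h l (Axis⇒AxisAt ax) cL
      in Imaginary.At.not-few-roots {c} {s} ha hb hs span ω ω≢1 ω³ (λ y Sy → Imaginary.S-⊗ (norm-one ω ω³) Sy)
      where
      square%3 : 𝕂.order % 3 ≡ 1
      square%3 = trans (cong (_% 3) size≡) (trans (%-distribˡ-* q q 3) (cong (λ r → (r * r) % 3) hq))
      -- Here 3 divides q + 1, so a cube root of unity satisfies ω^(q+1) = 1.
      norm-one : ∀ ω → cube ω ≡ 1# → Imaginary.S ω
      norm-one ω ω³ = begin
        frob ω ⊗ ω ≡⟨ 𝕂.*-comm (frob ω) ω ⟩
        pow ω (suc q) ≡⟨ cong (λ n → pow ω (suc n)) (trans (m≡m%n+[m/n]*n q 3) (cong (_+ q / 3 * 3) hq)) ⟩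
        pow ω ((1 + q / 3) * 3) ≡⟨ trans (sym (pow-cube ω (1 + q / 3))) (trans (cong (λ z → pow z (1 + q / 3)) ω³) (𝕂.pow-1 (1 + q / 3))) ⟩
        1# ∎
        where open ≡-Reasoning

-- Totals of lines and planes, and the chords and axes in one plane

module LineCounts (F K : Field) (e : Embedding F K) (size≡ : Field.size K ≡ Field.size F * Field.size F)
                  (q%3≢0 : Field.size F % 3 ≢ 0) where
  open AxisRoots F K e size≡ q%3≢0 public
  open ℕ-Solver
  open 𝔽 using (u; lines; planes; linesᴱ; planesᴱ; Contains?; roots)

  -- The five classes of external lines

  Chord-External : ∀ {s L} → 𝔽.IsLine L → Chord s L → 𝔽.External L
  Chord-External {s} {L} l (chord h o o′) t on = 𝕂.three-collinear (ι-IsLine L l) (just-≢ h)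
    (ιᵖ-≢ t h ∘ sym) (ιᵖ-≢ t (frob-∉ h) ∘ sym) o o′ (ι-OnLine t L on)

  Chord-¬InGammaPlane : ∀ {s L} → Chord s L → ¬ 𝔽.InGammaPlane L
  Chord-¬InGammaPlane {s} {L} ch (t , h) = Chord-¬Osculating {𝔽.osc t} ch h (t , refl)

  -- An osculating plane through the chord would vanish at both `s` and `frob s`, yet it has a
  -- single zero over K.
  Chord-¬Axis : ∀ {s s′ L} → Chord s L → Axis s′ L → ⊥
  Chord-¬Axis {s} {s′} {L} (chord h o o′) (axis _ p _) = just-≢ h (trans
    (sym (𝕂.Root-osc (just s′) (just s) (𝕂.OnLine⇒killed (ιᴸ L) o (𝕂.osc (just s′)) p)))
    (𝕂.Root-osc (just s′) (just (frob s)) (𝕂.OnLine⇒killed (ιᴸ L) o′ (𝕂.osc (just s′)) p)))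

  Axis-External : ∀ {s L} → Axis s L → 𝔽.External L
  Axis-External {s} {L} (axis h p _) t on = ιᵖ-≢ t h (sym (𝕂.Root-osc (just s) (ιᵖ t) (𝕂.OnLine⇒killed (ιᴸ L) (ι-OnLine t L on) (𝕂.osc (just s)) p)))

  Axis-¬InGammaPlane : ∀ {s L} → 𝔽.IsLine L → Axis s L → ¬ 𝔽.InGammaPlane L
  Axis-¬InGammaPlane {s} {L} l (axis h p p′) (t , hp) = excluded (𝕂.third-osc {ιᴸ L} (ι-IsLine L l) (just-≢ h) p p′ (ι-Contains-osc t L hp))
    where
    excluded : ¬ (ιᵖ t ≡ just s ⊎ ιᵖ t ≡ just (frob s))
    excluded (inj₁ z) = ιᵖ-≢ t h z
    excluded (inj₂ z) = ιᵖ-≢ t (frob-∉ h) z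

  -- The EnΓ-lines, with chords and axes given by the records above, for which decidability is at
  -- hand.
  EnGamma : 𝔽.Line → Set
  EnGamma L = 𝔽.External L × ¬ 𝔽.InGammaPlane L × ¬ Chords.Some L × ¬ Axes.Some L

  EnGamma? : ∀ L → Dec (EnGamma L)
  EnGamma? L = 𝔽.External? L ×-dec (¬? (𝔽.InGammaPlane? L) ×-dec (¬? (Chords.Some? L) ×-dec ¬? (Axes.Some? L)))

  external-classes : ∀ L → 𝔽.IsLine L →
    𝟙 (𝔽.External? L) ≡ 𝟙 (𝔽.EGamma? L) + 𝟙 (𝔽.RealAxis? L) + 𝟙 (Chords.Some? L) + 𝟙 (Axes.Some? L) + 𝟙 (EnGamma? L)
  external-classes L l = go (𝔽.External? L) (𝔽.InGammaPlane? L) (𝔽.RealAxis? L) (Chords.Some? L) (Axes.Some? L)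
    where
    sum₅ : ∀ {x a b c d f a′ b′ c′ d′ f′ : ℕ} → x ≡ a′ + b′ + c′ + d′ + f′ → a ≡ a′ → b ≡ b′ → c ≡ c′ → d ≡ d′ → f ≡ f′ → x ≡ a + b + c + d + f
    sum₅ h refl refl refl refl refl = h
    go : Dec (𝔽.External L) → Dec (𝔽.InGammaPlane L) → Dec (𝔽.RealAxis L) → Dec (Chords.Some L) → Dec (Axes.Some L) →
      𝟙 (𝔽.External? L) ≡ 𝟙 (𝔽.EGamma? L) + 𝟙 (𝔽.RealAxis? L) + 𝟙 (Chords.Some? L) + 𝟙 (Axes.Some? L) + 𝟙 (EnGamma? L)
    go (no x) _ _ _ _ = sum₅ (𝟙-no (𝔽.External? L) x) (𝟙-no (𝔽.EGamma? L) (x ∘ proj₁)) (𝟙-no (𝔽.RealAxis? L) (x ∘ 𝔽.RealAxis⇒External L))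
      (𝟙-no (Chords.Some? L) (λ (_ , ch) → x (Chord-External l ch))) (𝟙-no (Axes.Some? L) (λ (_ , ax) → x (Axis-External ax))) (𝟙-no (EnGamma? L) (x ∘ proj₁))
    go (yes x) (yes g) (yes ra) _ _ = sum₅ (𝟙-yes (𝔽.External? L) x) (𝟙-no (𝔽.EGamma? L) (λ (_ , _ , h) → h ra)) (𝟙-yes (𝔽.RealAxis? L) ra)
      (𝟙-no (Chords.Some? L) (λ (_ , ch) → Chord-¬InGammaPlane ch g)) (𝟙-no (Axes.Some? L) (λ (_ , ax) → Axis-¬InGammaPlane l ax g)) (𝟙-no (EnGamma? L) (λ (_ , h , _) → h g))
    go (yes x) (yes g) (no h) _ _ = sum₅ (𝟙-yes (𝔽.External? L) x) (𝟙-yes (𝔽.EGamma? L) (x , g , h)) (𝟙-no (𝔽.RealAxis? L) h)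
      (𝟙-no (Chords.Some? L) (λ (_ , ch) → Chord-¬InGammaPlane ch g)) (𝟙-no (Axes.Some? L) (λ (_ , ax) → Axis-¬InGammaPlane l ax g)) (𝟙-no (EnGamma? L) (λ (_ , h , _) → h g))
    go (yes x) (no g) _ (yes ch) _ = sum₅ (𝟙-yes (𝔽.External? L) x) (𝟙-no (𝔽.EGamma? L) (λ (_ , h , _) → g h)) (𝟙-no (𝔽.RealAxis? L) (λ (s , _ , _ , h , _) → g (s , h)))
      (𝟙-yes (Chords.Some? L) ch) (𝟙-no (Axes.Some? L) (λ (_ , ax) → Chord-¬Axis (proj₂ ch) ax)) (𝟙-no (EnGamma? L) (λ (_ , _ , h , _) → h ch))
    go (yes x) (no g) _ (no ch) (yes ax) = sum₅ (𝟙-yes (𝔽.External? L) x) (𝟙-no (𝔽.EGamma? L) (λ (_ , h , _) → g h)) (𝟙-no (𝔽.RealAxis? L) (λ (s , _ , _ , h , _) → g (s , h)))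
      (𝟙-no (Chords.Some? L) ch) (𝟙-yes (Axes.Some? L) ax) (𝟙-no (EnGamma? L) (λ (_ , _ , _ , h) → h ax))
    go (yes x) (no g) _ (no ch) (no ax) = sum₅ (𝟙-yes (𝔽.External? L) x) (𝟙-no (𝔽.EGamma? L) (λ (_ , h , _) → g h)) (𝟙-no (𝔽.RealAxis? L) (λ (s , _ , _ , h , _) → g (s , h)))
      (𝟙-no (Chords.Some? L) ch) (𝟙-no (Axes.Some? L) ax) (𝟙-yes (EnGamma? L) (x , g , ch , ax))

  -- Applied with weight 1 for the total number of EnΓ-lines, and with the indicator of a plane for
  -- the number inside it.
  weighted-classes : ∀ (w : 𝔽.Line → ℕ) → ∑ lines (λ L → w L * 𝟙 (𝔽.External? L)) ≡
    ∑ lines (λ L → w L * 𝟙 (𝔽.EGamma? L)) + ∑ lines (λ L → w L * 𝟙 (𝔽.RealAxis? L)) + ∑ lines (λ L → w L * 𝟙 (Chords.Some? L))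
      + ∑ lines (λ L → w L * 𝟙 (Axes.Some? L)) + ∑ lines (λ L → w L * 𝟙 (EnGamma? L))
  weighted-classes w = trans (∑-congᴱ linesᴱ λ L l → trans (cong (w L *_) (external-classes L l))
      (solveℕ 6 (λ w a b c d f → w :⊗ (a :⊕ b :⊕ c :⊕ d :⊕ f) :≡ w :⊗ a :⊕ w :⊗ b :⊕ w :⊗ c :⊕ w :⊗ d :⊕ w :⊗ f) refl
        (w L) (𝟙 (𝔽.EGamma? L)) (𝟙 (𝔽.RealAxis? L)) (𝟙 (Chords.Some? L)) (𝟙 (Axes.Some? L)) (𝟙 (EnGamma? L))))
    (trans (∑-+ lines _ _) (cong (_+ ∑ lines (λ L → w L * 𝟙 (EnGamma? L))) (trans (∑-+ lines _ _) (cong (_+ ∑ lines (λ L → w L * 𝟙 (Axes.Some? L)))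
      (trans (∑-+ lines _ _) (cong (_+ ∑ lines (λ L → w L * 𝟙 (Chords.Some? L))) (∑-+ lines _ _)))))))

  -- This is q³ - q, the order of PGL(2, q), which acts on the cubic. The counts below are expressed
  -- through it: 1/3, 1/2 and 1/6 of it for the three types of planes, once for EΓ-lines and q - 1
  -- times for EnΓ-lines.
  groupOrder : ℕ
  groupOrder = suc (suc u) * suc u * u

  halve : ∀ {m n} → 2 * m ≡ 2 * n → m ≡ n
  halve {m} {n} = ℕₚ.*-cancelˡ-≡ m n 2

  n₀ n₁ n₂ n₃ : ℕ
  n₀ = 𝔽.rootClass 0
  n₁ = 𝔽.oneBarClass
  n₂ = 𝔽.rootClass 2
  n₃ = 𝔽.rootClass 3

  n₃-value : 6 * n₃ ≡ groupOrder
  n₃-value = 𝔽.class₃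

  n₂-value : n₂ ≡ suc (suc u) * suc u
  n₂-value = halve (ℕₚ.+-cancelʳ-≡ (6 * n₃) _ _ (trans 𝔽.class₂ (trans
    (solveℕ 1 (λ u → let q = conℕ 1 :⊕ u in (conℕ 1 :⊕ q) :⊗ q :⊗ (q :⊕ conℕ 1) :≡ conℕ 2 :⊗ ((conℕ 1 :⊕ q) :⊗ q) :⊕ (conℕ 1 :⊕ q) :⊗ q :⊗ u) refl u)
    (cong (2 * (suc (suc u) * suc u) +_) (sym n₃-value)))))

  -- Twice the first moment, with the known classes and the osculating planes added on both sides
  -- instead of being subtracted.
  n₁-value : 2 * n₁ ≡ groupOrder
  n₁-value = ℕₚ.+-cancelʳ-≡ (2 * suc (suc u) + 4 * n₂ + 6 * n₃) _ _ (begin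
    2 * n₁ + (2 * suc (suc u) + 4 * n₂ + 6 * n₃)
      ≡⟨ solveℕ 4 (λ a b c d → conℕ 2 :⊗ a :⊕ (conℕ 2 :⊗ b :⊕ conℕ 4 :⊗ c :⊕ conℕ 6 :⊗ d) :≡ conℕ 2 :⊗ ((a :⊕ b) :⊕ conℕ 2 :⊗ c :⊕ conℕ 3 :⊗ d)) refl n₁ (suc (suc u)) n₂ n₃ ⟩
    2 * (n₁ + suc (suc u) + 2 * n₂ + 3 * n₃)
      ≡⟨ cong (2 *_) (trans (cong (λ n → n + 2 * n₂ + 3 * n₃) 𝔽.class-one-bar) 𝔽.class₁) ⟩
    2 * (suc (suc u) * (suc u * suc u + suc u + 1))
      ≡⟨ solveℕ 1 (λ u → let q = conℕ 1 :⊕ u; p = conℕ 1 :⊕ q in conℕ 2 :⊗ (p :⊗ (q :⊗ q :⊕ q :⊕ conℕ 1)) :≡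
           p :⊗ q :⊗ u :⊕ (conℕ 2 :⊗ p :⊕ conℕ 4 :⊗ (p :⊗ q) :⊕ p :⊗ q :⊗ u)) refl u ⟩
    groupOrder + (2 * suc (suc u) + 4 * (suc (suc u) * suc u) + groupOrder)
      ≡⟨ cong₂ (λ x y → groupOrder + (2 * suc (suc u) + 4 * x + y)) (sym n₂-value) (sym n₃-value) ⟩
    groupOrder + (2 * suc (suc u) + 4 * n₂ + 6 * n₃) ∎)
    where open ≡-Reasoning

  n₀-value : 3 * n₀ ≡ groupOrder
  n₀-value = halve (ℕₚ.+-cancelʳ-≡ (3 * (2 * n₁) + 6 * suc (suc u) + 6 * n₂ + 6 * n₃) _ _ (begin
    2 * (3 * n₀) + (3 * (2 * n₁) + 6 * suc (suc u) + 6 * n₂ + 6 * n₃)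
      ≡⟨ solveℕ 5 (λ z a b c d → conℕ 2 :⊗ (conℕ 3 :⊗ z) :⊕ (conℕ 3 :⊗ (conℕ 2 :⊗ a) :⊕ conℕ 6 :⊗ b :⊕ conℕ 6 :⊗ c :⊕ conℕ 6 :⊗ d) :≡
           conℕ 6 :⊗ (z :⊕ (a :⊕ b) :⊕ c :⊕ d)) refl n₀ n₁ (suc (suc u)) n₂ n₃ ⟩
    6 * (n₀ + (n₁ + suc (suc u)) + n₂ + n₃)
      ≡⟨ cong (6 *_) (trans (cong (λ n → n₀ + n + n₂ + n₃) 𝔽.class-one-bar) 𝔽.class₀) ⟩
    6 * (suc u * (suc u * suc u) + suc u * suc u + suc u + 1)
      ≡⟨ solveℕ 1 (λ u → let q = conℕ 1 :⊕ u; p = conℕ 1 :⊕ q; v = p :⊗ q :⊗ u in conℕ 6 :⊗ (q :⊗ (q :⊗ q) :⊕ q :⊗ q :⊕ q :⊕ conℕ 1) :≡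
           conℕ 2 :⊗ v :⊕ (conℕ 3 :⊗ v :⊕ conℕ 6 :⊗ p :⊕ conℕ 6 :⊗ (p :⊗ q) :⊕ v)) refl u ⟩
    2 * groupOrder + (3 * groupOrder + 6 * suc (suc u) + 6 * (suc (suc u) * suc u) + groupOrder)
      ≡⟨ cong₂ (λ x y → 2 * groupOrder + (3 * x + 6 * suc (suc u) + 6 * (suc (suc u) * suc u) + y)) (sym n₁-value) (sym n₃-value) ⟩
    2 * groupOrder + (3 * (2 * n₁) + 6 * suc (suc u) + 6 * (suc (suc u) * suc u) + 6 * n₃)
      ≡⟨ cong (λ x → 2 * groupOrder + (3 * (2 * n₁) + 6 * suc (suc u) + 6 * x + 6 * n₃)) (sym n₂-value) ⟩
    2 * groupOrder + (3 * (2 * n₁) + 6 * suc (suc u) + 6 * n₂ + 6 * n₃) ∎))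
    where open ≡-Reasoning

  eGamma-value : 𝔽.eGammaLines ≡ groupOrder
  eGamma-value = ℕₚ.+-cancelʳ-≡ (2 * 𝔽.realAxes) _ _ (trans 𝔽.eGamma-total (trans
    (solveℕ 1 (λ u → let q = conℕ 1 :⊕ u; p = conℕ 1 :⊕ q in p :⊗ (q :⊗ q) :≡ p :⊗ q :⊗ u :⊕ p :⊗ q) refl u)
    (cong (groupOrder +_) (sym 𝔽.realAxes-total))))

  chordLines axisLines enGammaLines : ℕ
  chordLines   = ∑ lines (λ L → 𝟙 (Chords.Some? L))
  axisLines    = ∑ lines (λ L → 𝟙 (Axes.Some? L))
  enGammaLines = ∑ lines (λ L → 𝟙 (EnGamma? L))

  private
    pairs-value : ∀ m → 2 * m + q ≡ q * q → 2 * m ≡ suc u * u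
    pairs-value m h = ℕₚ.+-cancelʳ-≡ (suc u) _ _ (trans (subst (λ q → 2 * m + q ≡ q * q) q≡ h)
      (solveℕ 1 (λ u → let q = conℕ 1 :⊕ u in q :⊗ q :≡ q :⊗ u :⊕ q) refl u))

  chord-value : 2 * chordLines ≡ suc u * u
  chord-value = pairs-value chordLines Chords.count-some

  axis-value : 2 * axisLines ≡ suc u * u
  axis-value = pairs-value axisLines Axes.count-some

  -- The factor 6 clears the denominators of the three plane counts; the factor q + 1, the number of
  -- planes through a line, is then cancelled.
  external-value : 6 * 𝔽.externalLines ≡ 6 * (groupOrder * u) + 6 * groupOrder + 3 * (suc (suc u) * suc u) + 6 * (suc u * u)
  external-value = ℕₚ.*-cancelˡ-≡ _ _ (suc u + 1) {{ℕ.≢-nonZero (λ z → ℕₚ.1+n≢0 z)}} (begin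
    (suc u + 1) * (6 * 𝔽.externalLines)
      ≡⟨ solveℕ 2 (λ q x → q :⊗ (conℕ 6 :⊗ x) :≡ conℕ 6 :⊗ (q :⊗ x)) refl (suc u + 1) 𝔽.externalLines ⟩
    6 * ((suc u + 1) * 𝔽.externalLines)
      ≡⟨ cong (6 *_) (trans 𝔽.external-total (cong (λ n → n₀ * e₀ + n * e₁ + n₂ * e₂ + n₃ * e₃) (sym 𝔽.class-one-bar))) ⟩
    6 * (n₀ * e₀ + (n₁ + suc (suc u)) * e₁ + n₂ * e₂ + n₃ * e₃)
      ≡⟨ solveℕ 9 (λ z a p c d e₀ e₁ e₂ e₃ → conℕ 6 :⊗ (z :⊗ e₀ :⊕ (a :⊕ p) :⊗ e₁ :⊕ c :⊗ e₂ :⊕ d :⊗ e₃) :≡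
           conℕ 2 :⊗ (conℕ 3 :⊗ z) :⊗ e₀ :⊕ (conℕ 3 :⊗ (conℕ 2 :⊗ a) :⊕ conℕ 6 :⊗ p) :⊗ e₁ :⊕ conℕ 6 :⊗ c :⊗ e₂ :⊕ conℕ 6 :⊗ d :⊗ e₃) refl
           n₀ n₁ (suc (suc u)) n₂ n₃ e₀ e₁ e₂ e₃ ⟩
    2 * (3 * n₀) * e₀ + (3 * (2 * n₁) + 6 * suc (suc u)) * e₁ + 6 * n₂ * e₂ + 6 * n₃ * e₃
      ≡⟨ cong₂ _+_ (cong₂ _+_ (cong₂ _+_ (cong (λ x → 2 * x * e₀) n₀-value) (cong (λ x → (3 * x + 6 * suc (suc u)) * e₁) n₁-value))
           (cong (λ x → 6 * x * e₂) n₂-value)) (cong (_* e₃) n₃-value) ⟩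
    2 * groupOrder * e₀ + (3 * groupOrder + 6 * suc (suc u)) * e₁ + 6 * (suc (suc u) * suc u) * e₂ + groupOrder * e₃
      ≡⟨ solveℕ 1 (λ u → let q = conℕ 1 :⊕ u; p = conℕ 1 :⊕ q; v = p :⊗ q :⊗ u in
           conℕ 2 :⊗ v :⊗ (q :⊗ q :⊕ q :⊕ conℕ 1) :⊕ (conℕ 3 :⊗ v :⊕ conℕ 6 :⊗ p) :⊗ (q :⊗ q) :⊕ conℕ 6 :⊗ (p :⊗ q) :⊗ (q :⊗ u) :⊕ v :⊗ (u :⊗ u) :≡
           (q :⊕ conℕ 1) :⊗ (conℕ 6 :⊗ (v :⊗ u) :⊕ conℕ 6 :⊗ v :⊕ conℕ 3 :⊗ (p :⊗ q) :⊕ conℕ 6 :⊗ (q :⊗ u))) refl u ⟩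
    (suc u + 1) * (6 * (groupOrder * u) + 6 * groupOrder + 3 * (suc (suc u) * suc u) + 6 * (suc u * u)) ∎)
    where
    open ≡-Reasoning
    e₀ = suc u * suc u + suc u + 1
    e₁ = suc u * suc u
    e₂ = suc u * u
    e₃ = u * u

  enGamma-value : enGammaLines ≡ groupOrder * u
  enGamma-value = ℕₚ.*-cancelˡ-≡ _ _ 6 (ℕₚ.+-cancelʳ-≡ (6 * groupOrder + 3 * (suc (suc u) * suc u) + 6 * (suc u * u)) _ _ (begin
    6 * enGammaLines + (6 * groupOrder + 3 * (suc (suc u) * suc u) + 6 * (suc u * u))
      ≡⟨ solveℕ 4 (λ n v h m → conℕ 6 :⊗ n :⊕ (conℕ 6 :⊗ v :⊕ conℕ 3 :⊗ h :⊕ conℕ 6 :⊗ m) :≡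
           conℕ 6 :⊗ v :⊕ conℕ 3 :⊗ h :⊕ conℕ 3 :⊗ m :⊕ conℕ 3 :⊗ m :⊕ conℕ 6 :⊗ n) refl enGammaLines groupOrder (suc (suc u) * suc u) (suc u * u) ⟩
    6 * groupOrder + 3 * (suc (suc u) * suc u) + 3 * (suc u * u) + 3 * (suc u * u) + 6 * enGammaLines
      ≡⟨ cong (_+ 6 * enGammaLines) (cong₂ _+_ (cong₂ _+_ (cong₂ (λ x y → 6 * x + 3 * y) (sym eGamma-value) (sym 𝔽.realAxes-total))
           (cong (3 *_) (sym chord-value))) (cong (3 *_) (sym axis-value))) ⟩
    6 * 𝔽.eGammaLines + 3 * (2 * 𝔽.realAxes) + 3 * (2 * chordLines) + 3 * (2 * axisLines) + 6 * enGammaLines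
      ≡⟨ solveℕ 5 (λ a b c d f → conℕ 6 :⊗ a :⊕ conℕ 3 :⊗ (conℕ 2 :⊗ b) :⊕ conℕ 3 :⊗ (conℕ 2 :⊗ c) :⊕ conℕ 3 :⊗ (conℕ 2 :⊗ d) :⊕ conℕ 6 :⊗ f :≡
           conℕ 6 :⊗ (a :⊕ b :⊕ c :⊕ d :⊕ f)) refl 𝔽.eGammaLines 𝔽.realAxes chordLines axisLines enGammaLines ⟩
    6 * (𝔽.eGammaLines + 𝔽.realAxes + chordLines + axisLines + enGammaLines)
      ≡⟨ cong (6 *_) (sym unweighted) ⟩
    6 * 𝔽.externalLines
      ≡⟨ external-value ⟩
    6 * (groupOrder * u) + 6 * groupOrder + 3 * (suc (suc u) * suc u) + 6 * (suc u * u)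
      ≡⟨ solveℕ 4 (λ a b c d → a :⊕ b :⊕ c :⊕ d :≡ a :⊕ (b :⊕ c :⊕ d)) refl (6 * (groupOrder * u)) (6 * groupOrder) (3 * (suc (suc u) * suc u)) (6 * (suc u * u)) ⟩
    6 * (groupOrder * u) + (6 * groupOrder + 3 * (suc (suc u) * suc u) + 6 * (suc u * u)) ∎))
    where
    open ≡-Reasoning
    unit-weight : ∀ {P : 𝔽.Line → Set} (P? : ∀ L → Dec (P L)) → ∑ lines (λ L → 1 * 𝟙 (P? L)) ≡ ∑ lines (λ L → 𝟙 (P? L))
    unit-weight P? = ∑-ext lines λ L → ℕₚ.*-identityˡ _
    unweighted : 𝔽.externalLines ≡ 𝔽.eGammaLines + 𝔽.realAxes + chordLines + axisLines + enGammaLines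
    unweighted = trans (sym (unit-weight 𝔽.External?)) (trans (weighted-classes (λ _ → 1))
      (cong₂ _+_ (cong₂ _+_ (cong₂ _+_ (cong₂ _+_ (unit-weight 𝔽.EGamma?) (unit-weight 𝔽.RealAxis?)) (unit-weight Chords.Some?)) (unit-weight Axes.Some?)) (unit-weight EnGamma?)))

  -- Imaginary chords and axes in a plane

  chordsIn axesIn : 𝔽.Vec4 → ℕ
  chordsIn c  = ∑ lines (λ L → 𝟙 (Contains? c L) * 𝟙 (Chords.Some? L))
  axesIn c    = ∑ lines (λ L → 𝟙 (Contains? c L) * 𝟙 (Axes.Some? L))

  OneBar : 𝔽.Vec4 → Set
  OneBar c = ¬ 𝔽.Osculating c × roots c ≡ 1

  OneBar? : ∀ c → Dec (OneBar c)
  OneBar? c = ¬? (𝔽.Osculating? c) ×-dec (roots c ℕₚ.≟ 1)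

  count-OneBar : ∑ planes (λ c → 𝟙 (OneBar? c)) ≡ n₁
  count-OneBar = ∑-ext planes λ c → 𝟙-× (¬? (𝔽.Osculating? c)) (roots c ℕₚ.≟ 1)

  -- Both sides have the same sum over all planes.
  chordsIn-value : ∀ {c} → 𝔽.Normalized c → chordsIn c ≡ 𝟙 (OneBar? c)
  chordsIn-value {c} n = ∑-tight planes (λ c m → bound c (sound planesᴱ m)) (ℕₚ.≤-reflexive totals) c (complete planesᴱ n)
    where
    In? : ∀ c L → Dec (𝔽.Contains c L × Chords.Some L)
    In? c L = Contains? c L ×-dec Chords.Some? L
    chordsIn≡ : ∀ c → chordsIn c ≡ ∑ lines (λ L → 𝟙 (In? c L))
    chordsIn≡ c = ∑-ext lines λ L → sym (𝟙-× (Contains? c L) (Chords.Some? L))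
    bound : ∀ c → 𝔽.Normalized c → chordsIn c ≤ 𝟙 (OneBar? c)
    bound c n = 𝟙-upper (OneBar? c)
      (λ _ → subst (_≤ 1) (sym (chordsIn≡ c)) (count≤1 linesᴱ (In? c)
        (λ L M l m (cL , (_ , ch)) (cM , (_ , ch′)) → Chord-unique-in-plane {c} n l m ch ch′ cL cM)))
      (λ h → trans (chordsIn≡ c) (count-zero linesᴱ (In? c) (λ L l (cL , (_ , ch)) → h (Chord-¬Osculating {c} ch cL , Chord-plane {c} n ch cL))))
    -- There are q(q-1)/2 chords with q + 1 planes through each, which is half of `groupOrder`.
    totals : ∑ planes (λ c → 𝟙 (OneBar? c)) ≡ ∑ planes chordsIn
    totals = halve (begin
      2 * ∑ planes (λ c → 𝟙 (OneBar? c))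
        ≡⟨ trans (cong (2 *_) count-OneBar) n₁-value ⟩
      suc (suc u) * suc u * u
        ≡⟨ solveℕ 1 (λ u → let q = conℕ 1 :⊕ u in (conℕ 1 :⊕ q) :⊗ q :⊗ u :≡ (q :⊕ conℕ 1) :⊗ (q :⊗ u)) refl u ⟩
      (suc u + 1) * (suc u * u)
        ≡⟨ cong₂ (λ x y → (x + 1) * y) (sym q≡) (sym chord-value) ⟩
      (q + 1) * (2 * chordLines)
        ≡⟨ solveℕ 2 (λ x y → x :⊗ (conℕ 2 :⊗ y) :≡ conℕ 2 :⊗ (x :⊗ y)) refl (q + 1) chordLines ⟩
      2 * ((q + 1) * chordLines)
        ≡⟨ cong (2 *_) (sym (𝔽.∑-lines-planes (λ L → 𝟙 (Chords.Some? L)))) ⟩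
      2 * ∑ planes chordsIn ∎)
      where open ≡-Reasoning

  Good : 𝔽.Vec4 → Set
  Good c = ¬ 𝔽.Osculating c × roots c ≢ 2

  Good? : ∀ c → Dec (Good c)
  Good? c = ¬? (𝔽.Osculating? c) ×-dec ¬? (roots c ℕₚ.≟ 2)

  AnyAxis : 𝔽.Line → Set
  AnyAxis L = 𝔽.RealAxis L ⊎ Axes.Some L

  AnyAxis? : ∀ L → Dec (AnyAxis L)
  AnyAxis? L = 𝔽.RealAxis? L ⊎-dec Axes.Some? L

  count-AnyAxis : ∀ L → 𝔽.IsLine L → 𝟙 (AnyAxis? L) ≡ 𝟙 (𝔽.RealAxis? L) + 𝟙 (Axes.Some? L)
  count-AnyAxis L l = disjoint (𝔽.RealAxis? L) (Axes.Some? L) λ (s , _ , _ , h , _) (_ , ax) → Axis-¬InGammaPlane l ax (s , h)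
    where
    disjoint : ∀ {P Q : Set} (d : Dec P) (f : Dec Q) → (P → Q → ⊥) → 𝟙 (d ⊎-dec f) ≡ 𝟙 d + 𝟙 f
    disjoint (yes p) (yes r) h = ⊥-elim (h p r)
    disjoint (yes _) (no _)  h = refl
    disjoint (no _)  (yes _) h = refl
    disjoint (no _)  (no _)  h = refl

  AnyAxis-unique-in-plane : ∀ {c L M} → 𝔽.Normalized c → ¬ 𝔽.Osculating c → 𝔽.IsLine L → 𝔽.IsLine M →
                            AnyAxis L → AnyAxis M → 𝔽.Contains c L → 𝔽.Contains c M → L ≡ M
  AnyAxis-unique-in-plane {c} {L} {M} n h l m x y cL cM =
    let (v , w , ax) = at L x
        (v′ , w′ , ax′) = at M y
    in AxisAt-unique-in-plane {c} {v} {w} {v′} {w′} {L} {M} n h l m ax ax′ cL cM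
    where
    at : ∀ L → AnyAxis L → ∃[ v ] ∃[ w ] AxisAt v w L
    at L (inj₁ ra)       = let (s , t , ax) = RealAxis⇒AxisAt {L} ra in ιᵖ s , ιᵖ t , ax
    at L (inj₂ (s , ax)) = just s , just (frob s) , Axis⇒AxisAt ax

  -- All that the comparison of totals needs from the ratios: for either residue of q and along
  -- either kind of axis, two roots do not occur.
  AnyAxis-roots : ∀ {c L} → 𝔽.Normalized c → ¬ 𝔽.Osculating c → 𝔽.IsLine L → AnyAxis L → 𝔽.Contains c L → roots c ≢ 2
  AnyAxis-roots {c} {L} n h l x cL = go (q % 3) refl (m%n<n q 3) x
    where
    one≢two : roots c ≡ 1 → roots c ≢ 2
    one≢two p p′ = ℕₚ.1+n≢0 (ℕₚ.suc-injective (trans (sym p′) p))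
    go : ∀ r → q % 3 ≡ r → r < 3 → AnyAxis L → roots c ≢ 2
    go 0 hq _ _ = ⊥-elim (q%3≢0 hq)
    go 1 hq _ (inj₁ ra)       = proj₂ (real-few-roots {c} n h {L} l cL hq ra)
    go 1 hq _ (inj₂ (_ , ax)) = one≢two (imaginary-one-root {c} n h {L} l cL hq ax)
    go 2 hq _ (inj₁ ra)       = one≢two (real-one-root {c} n h {L} l cL hq ra)
    go 2 hq _ (inj₂ (_ , ax)) = proj₂ (imaginary-few-roots {c} n h {L} l cL hq ax)
    go (suc (suc (suc _))) _ (s≤s (s≤s (s≤s ()))) _

  ∑-Osculating : ∀ (f : 𝔽.Vec4 → ℕ) → ∑ planes (λ c → 𝟙 (𝔽.Osculating? c) * f c) ≡ ∑ 𝔽.parameters (λ t → f (𝔽.osc t))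
  ∑-Osculating f = trans (sym (∑-filter 𝔽.Osculating? planes f)) (sym (∑-bij 𝔽.parametersᴱ (enum-filter planesᴱ 𝔽.Osculating?) 𝔽._≟ᵛ_ 𝔽.osc
    (λ t _ → 𝔽.Normalized-osc t , (t , refl)) (λ c (_ , (t , p)) → t , tt , sym p) (λ s t _ _ p → 𝔽.osc-injective p) f))

  private
    realOff axesOff : ℕ
    realOff = ∑ planes (λ c → 𝟙 (¬? (𝔽.Osculating? c)) * 𝔽.realAxesIn c)
    axesOff = ∑ planes (λ c → 𝟙 (¬? (𝔽.Osculating? c)) * axesIn c)

    off-on : ∀ (f : 𝔽.Vec4 → ℕ) → ∑ planes (λ c → 𝟙 (¬? (𝔽.Osculating? c)) * f c) + ∑ 𝔽.parameters (λ t → f (𝔽.osc t)) ≡ ∑ planes f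
    off-on f = trans (cong (∑ planes (λ c → 𝟙 (¬? (𝔽.Osculating? c)) * f c) +_) (sym (∑-Osculating f))) (trans (sym (∑-+ planes _ _))
      (∑-ext planes λ c → trans (sym (ℕₚ.*-distribʳ-+ (f c) (𝟙 (¬? (𝔽.Osculating? c))) _))
        (trans (cong (_* f c) (trans (ℕₚ.+-comm (𝟙 (¬? (𝔽.Osculating? c))) _) (𝟙-¬ (𝔽.Osculating? c)))) (ℕₚ.*-identityˡ (f c)))))

    -- Of the q + 1 planes through a real axis exactly two are osculating. The other q - 1, for
    -- q(q+1)/2 axes, make half of `groupOrder`.
    realOff-value : 2 * realOff ≡ groupOrder
    realOff-value = ℕₚ.+-cancelʳ-≡ (2 * (2 * 𝔽.realAxes)) _ _ (begin
      2 * realOff + 2 * (2 * 𝔽.realAxes)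
        ≡⟨ trans (sym (ℕₚ.*-distribˡ-+ 2 realOff _)) (cong (λ x → 2 * (realOff + x)) (sym on)) ⟩
      2 * (realOff + ∑ 𝔽.parameters (λ t → 𝔽.realAxesIn (𝔽.osc t)))
        ≡⟨ cong (2 *_) (trans (off-on 𝔽.realAxesIn) (𝔽.∑-lines-planes (λ L → 𝟙 (𝔽.RealAxis? L)))) ⟩
      2 * ((q + 1) * 𝔽.realAxes)
        ≡⟨ trans (solveℕ 2 (λ x y → conℕ 2 :⊗ (x :⊗ y) :≡ x :⊗ (conℕ 2 :⊗ y)) refl (q + 1) 𝔽.realAxes) (cong₂ (λ x y → (x + 1) * y) q≡ 𝔽.realAxes-total) ⟩
      (suc u + 1) * (suc (suc u) * suc u)
        ≡⟨ solveℕ 1 (λ u → let q = conℕ 1 :⊕ u; p = conℕ 1 :⊕ q in (q :⊕ conℕ 1) :⊗ (p :⊗ q) :≡ p :⊗ q :⊗ u :⊕ conℕ 2 :⊗ (p :⊗ q)) refl u ⟩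
      groupOrder + 2 * (suc (suc u) * suc u)
        ≡⟨ cong (λ x → groupOrder + 2 * x) (sym 𝔽.realAxes-total) ⟩
      groupOrder + 2 * (2 * 𝔽.realAxes) ∎)
      where
      open ≡-Reasoning
      on : ∑ 𝔽.parameters (λ t → 𝔽.realAxesIn (𝔽.osc t)) ≡ 2 * 𝔽.realAxes
      on = trans (∑-swap 𝔽.parameters lines _) (trans (∑-congᴱ linesᴱ λ L l → trans (∑-*ʳ 𝔽.parameters (𝟙 (𝔽.RealAxis? L)) _) (on-line L l)) (∑-*ˡ lines 2 _))
        where
        on-line : ∀ L → 𝔽.IsLine L → 𝔽.γ L * 𝟙 (𝔽.RealAxis? L) ≡ 2 * 𝟙 (𝔽.RealAxis? L)
        on-line L l = trans (ℕₚ.*-comm (𝔽.γ L) _) (trans (𝟙*-cong (𝔽.RealAxis? L) (λ ra → 𝔽.γ-RealAxis {L} l ra)) (ℕₚ.*-comm (𝟙 (𝔽.RealAxis? L)) 2))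

    -- An imaginary axis lies in no osculating plane, so all q + 1 planes through each of the
    -- q(q-1)/2 axes count.
    axesOff-value : 2 * axesOff ≡ groupOrder
    axesOff-value = begin
      2 * axesOff
        ≡⟨ cong (2 *_) (trans (sym (ℕₚ.+-identityʳ axesOff)) (trans (cong (axesOff +_) (sym on)) (trans (off-on axesIn) (𝔽.∑-lines-planes (λ L → 𝟙 (Axes.Some? L)))))) ⟩
      2 * ((q + 1) * axisLines)
        ≡⟨ trans (solveℕ 2 (λ x y → conℕ 2 :⊗ (x :⊗ y) :≡ x :⊗ (conℕ 2 :⊗ y)) refl (q + 1) axisLines) (cong₂ (λ x y → (x + 1) * y) q≡ axis-value) ⟩
      (suc u + 1) * (suc u * u)
        ≡⟨ solveℕ 1 (λ u → let q = conℕ 1 :⊕ u in (q :⊕ conℕ 1) :⊗ (q :⊗ u) :≡ (conℕ 1 :⊕ q) :⊗ q :⊗ u) refl u ⟩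
      groupOrder ∎
      where
      open ≡-Reasoning
      on : ∑ 𝔽.parameters (λ t → axesIn (𝔽.osc t)) ≡ 0
      on = ∑-zero 𝔽.parameters λ t _ → ∑-zero lines λ L m → 𝟙*-zero (Contains? (𝔽.osc t) L) λ h →
        𝟙-no (Axes.Some? L) λ (_ , ax) → Axis-¬InGammaPlane (sound linesᴱ m) ax (t , h)

    -- The fractions 1/3, 1/2 and 1/6 of `groupOrder` add up to the whole of it; the factor 6 keeps
    -- them integral.
    count-Good : 6 * ∑ planes (λ c → 𝟙 (Good? c)) ≡ 6 * groupOrder
    count-Good = begin
      6 * ∑ planes (λ c → 𝟙 (Good? c))
        ≡⟨ cong (6 *_) (∑-congᴱ planesᴱ λ c n → trans (split c n) refl) ⟩
      6 * ∑ planes (λ c → 𝟙 (roots c ℕₚ.≟ 0) + 𝟙 (OneBar? c) + 𝟙 (roots c ℕₚ.≟ 3))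
        ≡⟨ cong (6 *_) (trans (∑-+ planes _ _) (cong (_+ n₃) (trans (∑-+ planes _ _) (cong (n₀ +_) count-OneBar)))) ⟩
      6 * (n₀ + n₁ + n₃)
        ≡⟨ solveℕ 3 (λ a b c → conℕ 6 :⊗ (a :⊕ b :⊕ c) :≡ conℕ 2 :⊗ (conℕ 3 :⊗ a) :⊕ conℕ 3 :⊗ (conℕ 2 :⊗ b) :⊕ conℕ 6 :⊗ c) refl n₀ n₁ n₃ ⟩
      2 * (3 * n₀) + 3 * (2 * n₁) + 6 * n₃
        ≡⟨ cong₂ _+_ (cong₂ (λ x y → 2 * x + 3 * y) n₀-value n₁-value) n₃-value ⟩
      2 * groupOrder + 3 * groupOrder + groupOrder
        ≡⟨ solveℕ 1 (λ v → conℕ 2 :⊗ v :⊕ conℕ 3 :⊗ v :⊕ v :≡ conℕ 6 :⊗ v) refl groupOrder ⟩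
      6 * groupOrder ∎
      where
      open ≡-Reasoning
      split : ∀ c → 𝔽.Normalized c → 𝟙 (Good? c) ≡ 𝟙 (roots c ℕₚ.≟ 0) + 𝟙 (OneBar? c) + 𝟙 (roots c ℕₚ.≟ 3)
      split c n = trans (𝟙-× (¬? (𝔽.Osculating? c)) (¬? (roots c ℕₚ.≟ 2))) (trans
        (cases (𝔽.Osculating? c) (roots c) (λ (t , p) → trans (cong roots p) (𝔽.roots-osc t)) (𝔽.roots≤3 (𝔽.normalized-≢𝟎 {c} n)))
        (cong (λ x → 𝟙 (roots c ℕₚ.≟ 0) + x + 𝟙 (roots c ℕₚ.≟ 3)) (sym (𝟙-× (¬? (𝔽.Osculating? c)) (roots c ℕₚ.≟ 1)))))
        where
        cases : ∀ {P : Set} (p : Dec P) d → (P → d ≡ 1) → d ≤ 3 →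
                𝟙 (¬? p) * 𝟙 (¬? (d ℕₚ.≟ 2)) ≡ 𝟙 (d ℕₚ.≟ 0) + 𝟙 (¬? p) * 𝟙 (d ℕₚ.≟ 1) + 𝟙 (d ℕₚ.≟ 3)
        cases (yes p) d h _ with refl ← h p = refl
        cases (no _) 0 _ _ = refl
        cases (no _) 1 _ _ = refl
        cases (no _) 2 _ _ = refl
        cases (no _) 3 _ _ = refl
        cases (no _) (suc (suc (suc (suc _)))) _ (s≤s (s≤s (s≤s ())))

  -- Again both sides have the same sum over all planes.
  axesIn-value : ∀ {c} → 𝔽.Normalized c → Good c → 𝔽.realAxesIn c + axesIn c ≡ 1
  axesIn-value {c} n good = begin
    𝔽.realAxesIn c + axesIn c ≡⟨ sym (ℕₚ.*-identityˡ _) ⟩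
    1 * (𝔽.realAxesIn c + axesIn c) ≡⟨ cong (_* (𝔽.realAxesIn c + axesIn c)) (sym (𝟙-yes (¬? (𝔽.Osculating? c)) (proj₁ good))) ⟩
    𝟙 (¬? (𝔽.Osculating? c)) * (𝔽.realAxesIn c + axesIn c) ≡⟨ ∑-tight planes {f = off} {g = λ c → 𝟙 (Good? c)} (λ c m → bound c (sound planesᴱ m)) (ℕₚ.≤-reflexive totals) c (complete planesᴱ n) ⟩
    𝟙 (Good? c) ≡⟨ 𝟙-yes (Good? c) good ⟩
    1 ∎
    where
    open ≡-Reasoning
    off : 𝔽.Vec4 → ℕ
    off c = 𝟙 (¬? (𝔽.Osculating? c)) * (𝔽.realAxesIn c + axesIn c)
    In? : ∀ c L → Dec (𝔽.Contains c L × AnyAxis L)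
    In? c L = Contains? c L ×-dec AnyAxis? L
    both≡ : ∀ c → 𝔽.realAxesIn c + axesIn c ≡ ∑ lines (λ L → 𝟙 (In? c L))
    both≡ c = trans (sym (∑-+ lines _ _)) (∑-congᴱ linesᴱ λ L l → trans (sym (ℕₚ.*-distribˡ-+ (𝟙 (Contains? c L)) _ _))
      (trans (cong (𝟙 (Contains? c L) *_) (sym (count-AnyAxis L l))) (sym (𝟙-× (Contains? c L) (AnyAxis? L)))))
    bound : ∀ c → 𝔽.Normalized c → off c ≤ 𝟙 (Good? c)
    bound c n = 𝟙-upper (Good? c)
      (λ (h , _) → subst (_≤ 1) (sym (trans (cong (_* (𝔽.realAxesIn c + axesIn c)) (𝟙-yes (¬? (𝔽.Osculating? c)) h)) (trans (ℕₚ.*-identityˡ _) (both≡ c))))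
        (count≤1 linesᴱ (In? c) (λ L M l m (cL , x) (cM , y) → AnyAxis-unique-in-plane {c} n h l m x y cL cM)))
      (λ bad → 𝟙*-zero (¬? (𝔽.Osculating? c)) λ h → trans (both≡ c)
        (count-zero linesᴱ (In? c) (λ L l (cL , x) → bad (h , AnyAxis-roots {c} {L} n h l x cL))))
    -- Each kind of axis contributes one half of `groupOrder`.
    totals : ∑ planes (λ c → 𝟙 (Good? c)) ≡ ∑ planes off
    totals = ℕₚ.*-cancelˡ-≡ _ _ 6 (begin
      6 * ∑ planes (λ c → 𝟙 (Good? c)) ≡⟨ count-Good ⟩
      6 * groupOrder ≡⟨ solveℕ 1 (λ v → conℕ 6 :⊗ v :≡ conℕ 3 :⊗ v :⊕ conℕ 3 :⊗ v) refl groupOrder ⟩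
      3 * groupOrder + 3 * groupOrder ≡⟨ cong₂ (λ x y → 3 * x + 3 * y) (sym realOff-value) (sym axesOff-value) ⟩
      3 * (2 * realOff) + 3 * (2 * axesOff) ≡⟨ solveℕ 2 (λ x y → conℕ 3 :⊗ (conℕ 2 :⊗ x) :⊕ conℕ 3 :⊗ (conℕ 2 :⊗ y) :≡ conℕ 6 :⊗ (x :⊕ y)) refl realOff axesOff ⟩
      6 * (realOff + axesOff) ≡⟨ cong (6 *_) (trans (sym (∑-+ planes _ _)) (∑-ext planes λ c → sym (ℕₚ.*-distribˡ-+ (𝟙 (¬? (𝔽.Osculating? c))) _ _))) ⟩
      6 * ∑ planes off ∎)

-- `fromℚᵘ` unfolds to division of an integer by a positive natural number, so cross-multiplication
-- of unnormalised fractions suffices. The two nonzero hypotheses keep away from the default values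
-- of `average` and `frac`.
frac-average : ∀ ns num d → d ≢ 0 → length ns ≢ 0 → sum ns * d ≡ num * length ns → average ns ≡ frac num d
frac-average []       num d       _  hl _ = ⊥-elim (hl refl)
frac-average (n ∷ ns) num zero    hd _  _ = ⊥-elim (hd refl)
frac-average (n ∷ ns) num (suc d) _  _  h = ℚₚ.fromℚᵘ-cong {ℚᵘ.mkℚᵘ (ℤ.+ sum (n ∷ ns)) (length ns)} {ℚᵘ.mkℚᵘ (ℤ.+ num) d}
  (ℚᵘ.*≡* (trans (sym (ℤₚ.pos-* (sum (n ∷ ns)) (suc d))) (trans (cong ℤ.+_ h) (ℤₚ.pos-* num (suc (length ns))))))

sum-map : ∀ {A : Set} (f : A → ℕ) xs → sum (map f xs) ≡ ∑ xs f
sum-map f []       = refl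
sum-map f (x ∷ xs) = cong (f x +_) (sum-map f xs)

pointwise-map : ∀ {A : Set} {R : A → ℕ → Set} (f : A → ℕ) → (∀ x → R x (f x)) → ∀ xs → Pointwise R xs (map f xs)
pointwise-map f h []       = []
pointwise-map f h (x ∷ xs) = h x ∷ pointwise-map f h xs

minus : ∀ {m n} k → m + k ≡ n → m ≡ n ∸ k
minus {m} k h = trans (sym (ℕₚ.m+n∸n≡m m k)) (cong (_∸ k) h)

-- The numbers Λ and the averages Π

module Incidences (F K : Field) (e : Embedding F K) (size≡ : Field.size K ≡ Field.size F * Field.size F)
                  (q%3≢0 : Field.size F % 3 ≢ 0) where
  open LineCounts F K e size≡ q%3≢0 public
  open PG3 F K e using (HasPlaneType; HasLineType; LambdaIs; PiIs)
  open 𝔽 using (u; lines; planes; linesᴱ; planesᴱ; Contains?; roots)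
  open ℕ-Solver

  OfPlaneType : PlaneType → 𝔽.Vec4 → Set
  OfPlaneType threeC   c = roots c ≡ 3
  OfPlaneType oneBarC  c = OneBar c
  OfPlaneType zeroC    c = roots c ≡ 0

  OfPlaneType? : ∀ π c → Dec (OfPlaneType π c)
  OfPlaneType? threeC  c = roots c ℕₚ.≟ 3
  OfPlaneType? oneBarC c = OneBar? c
  OfPlaneType? zeroC   c = roots c ℕₚ.≟ 0

  curve-points⁺ : ∀ c {k} → 𝔽.CurvePointsIn c k → roots c ≡ k
  curve-points⁺ c = card-count 𝔽.parametersᴱ 𝔽._≟ᵖ_ (𝔽.Root? c) (λ _ r → tt , r) (λ _ _ r → r)

  curve-points⁻ : ∀ c {k} → roots c ≡ k → 𝔽.CurvePointsIn c k
  curve-points⁻ c h = card-map (λ _ → proj₂) (λ _ r → tt , r) (card-filter 𝔽.parametersᴱ (𝔽.Root? c) h)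

  plane-type⁺ : ∀ π {c} → 𝔽.Normalized c → HasPlaneType π c → OfPlaneType π c
  plane-type⁺ threeC  {c} n h       = curve-points⁺ c h
  plane-type⁺ oneBarC {c} n (g , h) = (λ o → g (𝔽.Osculating⇒GammaPlane {c} o)) , curve-points⁺ c h
  plane-type⁺ zeroC   {c} n h       = curve-points⁺ c h

  plane-type⁻ : ∀ π {c} → 𝔽.Normalized c → OfPlaneType π c → HasPlaneType π c
  plane-type⁻ threeC  {c} n h       = curve-points⁻ c h
  plane-type⁻ oneBarC {c} n (g , h) = (λ o → g (𝔽.GammaPlane⇒Osculating {c} n o)) , curve-points⁻ c h
  plane-type⁻ zeroC   {c} n h       = curve-points⁻ c h

  OfLineType : LineType → 𝔽.Line → Set
  OfLineType EΓ  L = 𝔽.External L × 𝔽.InGammaPlane L × ¬ 𝔽.RealAxis L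
  OfLineType EnΓ L = EnGamma L

  OfLineType? : ∀ λt L → Dec (OfLineType λt L)
  OfLineType? EΓ  L = 𝔽.EGamma? L
  OfLineType? EnΓ L = EnGamma? L

  line-type⁺ : ∀ λt {L} → HasLineType λt L → OfLineType λt L
  line-type⁺ EΓ  h = h
  line-type⁺ EnΓ (x , g , c , a) = x , g , (λ (s , chord h o o′) → c (s , h , o , o′)) , (λ (s , axis h p p′) → a (s , h , p , p′))

  line-type⁻ : ∀ λt {L} → OfLineType λt L → HasLineType λt L
  line-type⁻ EΓ  h = h
  line-type⁻ EnΓ (x , g , c , a) = x , g , (λ (s , h , o , o′) → c (s , chord h o o′)) , (λ (s , h , p , p′) → a (s , axis h p p′))

  linesIn : LineType → 𝔽.Vec4 → ℕ
  linesIn λt c = ∑ lines (λ L → 𝟙 (Contains? c L) * 𝟙 (OfLineType? λt L))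

  planeCount : PlaneType → ℕ
  planeCount π = ∑ planes (λ c → 𝟙 (OfPlaneType? π c))

  lineCount : LineType → ℕ
  lineCount λt = ∑ lines (λ L → 𝟙 (OfLineType? λt L))

  Λ-Value : LineType → PlaneType → ℕ → Set
  Λ-Value λt π n = ∀ c → 𝔽.Normalized c → OfPlaneType π c → linesIn λt c ≡ n

  lambda : ∀ λt π {n} → Λ-Value λt π n → LambdaIs λt π n
  lambda λt π h c nc hp = card-map (λ L (l , cL , t) → l , line-type⁻ λt {L} t , cL) (λ L (l , t , cL) → l , cL , line-type⁺ λt {L} t)
    (card-filter linesᴱ (λ L → Contains? c L ×-dec OfLineType? λt L)
      (trans (∑-ext lines λ L → 𝟙-× (Contains? c L) (OfLineType? λt L)) (h c nc (plane-type⁺ π {c} nc hp))))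

  -- Counting incident pairs of a line and a plane in two ways.
  average-planes : ∀ λt π {n} num d → Λ-Value λt π n → lineCount λt ≢ 0 → d ≢ 0 → planeCount π * n * d ≡ num * lineCount λt →
                   PiIs π λt (frac num d)
  average-planes λt π {n} num d h hM hd ratio =
      ls , enum-map (λ L (l , t) → l , line-type⁻ λt {L} t) (λ L (l , t) → l , line-type⁺ λt {L} t) (enum-filter linesᴱ (OfLineType? λt))
    , map f ls , pointwise-map f card ls
    , frac-average (map f ls) num d hd (λ z → hM (trans (sym length≡) z)) (trans (cong (_* d) sum≡) (trans ratio (cong (num *_) (sym length≡))))
    where
    ls = filter (OfLineType? λt) lines
    f : 𝔽.Line → ℕ
    f L = ∑ planes (λ c → 𝟙 (OfPlaneType? π c ×-dec Contains? c L))
    card : ∀ L → Card (λ c → 𝔽.Normalized c × HasPlaneType π c × 𝔽.Contains c L) (f L)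
    card L = card-map (λ c (n , t , cL) → n , plane-type⁻ π {c} n t , cL) (λ c (n , t , cL) → n , plane-type⁺ π {c} n t , cL)
      (card-filter planesᴱ (λ c → OfPlaneType? π c ×-dec Contains? c L) refl)
    length≡ : length (map f ls) ≡ lineCount λt
    length≡ = trans (Listₚ.length-map f ls) (length-filter (OfLineType? λt) lines)
    sum≡ : sum (map f ls) ≡ planeCount π * n
    sum≡ = begin
      sum (map f ls)
        ≡⟨ trans (sum-map f ls) (∑-filter (OfLineType? λt) lines f) ⟩
      ∑ lines (λ L → 𝟙 (OfLineType? λt L) * f L)
        ≡⟨ ∑-ext lines (λ L → sym (∑-*ˡ planes (𝟙 (OfLineType? λt L)) (λ c → 𝟙 (OfPlaneType? π c ×-dec Contains? c L)))) ⟩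
      ∑ lines (λ L → ∑ planes (λ c → 𝟙 (OfLineType? λt L) * 𝟙 (OfPlaneType? π c ×-dec Contains? c L)))
        ≡⟨ ∑-ext lines (λ L → ∑-ext planes λ c → trans (cong (𝟙 (OfLineType? λt L) *_) (𝟙-× (OfPlaneType? π c) (Contains? c L)))
             (solveℕ 3 (λ t p c → t :⊗ (p :⊗ c) :≡ p :⊗ (c :⊗ t)) refl (𝟙 (OfLineType? λt L)) (𝟙 (OfPlaneType? π c)) (𝟙 (Contains? c L)))) ⟩
      ∑ lines (λ L → ∑ planes (λ c → 𝟙 (OfPlaneType? π c) * (𝟙 (Contains? c L) * 𝟙 (OfLineType? λt L))))
        ≡⟨ 𝔽.∑-pull lines planes (λ c → 𝟙 (OfPlaneType? π c)) (λ L c → 𝟙 (Contains? c L) * 𝟙 (OfLineType? λt L)) ⟩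
      ∑ planes (λ c → 𝟙 (OfPlaneType? π c) * linesIn λt c)
        ≡⟨ ∑-congᴱ planesᴱ (λ c nc → 𝟙*-cong (OfPlaneType? π c) (λ t → h c nc t)) ⟩
      ∑ planes (λ c → 𝟙 (OfPlaneType? π c) * n)
        ≡⟨ ∑-*ʳ planes n _ ⟩
      planeCount π * n ∎
      where open ≡-Reasoning

  -- The average is n times the number of planes over the number of lines, so `d` is the ratio of
  -- lines to planes: 6, 2 or 3 for EΓ-lines and q - 1 times as much for EnΓ-lines.
  average-ratio : ∀ λt π {n} d → Λ-Value λt π n → lineCount λt ≢ 0 → d * planeCount π ≡ lineCount λt → PiIs π λt (frac n d)
  average-ratio λt π {n} d h hM ratio = average-planes λt π n d h hM (λ z → hM (trans (sym ratio) (cong (_* planeCount π) z)))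
    (trans (solveℕ 3 (λ p n d → p :⊗ n :⊗ d :≡ n :⊗ (d :⊗ p)) refl (planeCount π) n d) (cong (n *_) ratio))

  private
    product≢0 : ∀ {m n} → m ≢ 0 → n ≢ 0 → m * n ≢ 0
    product≢0 {zero}          hm _  _ = hm refl
    product≢0 {suc _} {zero}  _  hn _ = hn refl
    product≢0 {suc _} {suc _} _  _  ()

    u≢0 : u ≢ 0
    u≢0 = ℕ.≢-nonZero⁻¹ u {{𝔽.units-nonZero}}

    groupOrder≢0 : groupOrder ≢ 0
    groupOrder≢0 = product≢0 {suc (suc u) * suc u} (λ ()) u≢0

  eGamma≢0 : lineCount EΓ ≢ 0
  eGamma≢0 z = groupOrder≢0 (trans (sym eGamma-value) z)

  enGamma≢0 : lineCount EnΓ ≢ 0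
  enGamma≢0 z = product≢0 groupOrder≢0 u≢0 (trans (sym enGamma-value) z)

  planes-3 : 6 * planeCount threeC ≡ groupOrder
  planes-3 = n₃-value

  planes-1 : 2 * planeCount oneBarC ≡ groupOrder
  planes-1 = trans (cong (2 *_) count-OneBar) n₁-value

  planes-0 : 3 * planeCount zeroC ≡ groupOrder
  planes-0 = n₀-value

  -- The numbers of lines of each class in a plane

  few⇒¬Osculating : ∀ {c} → roots c ≢ 1 → ¬ 𝔽.Osculating c
  few⇒¬Osculating h (t , p) = h (trans (cong roots p) (𝔽.roots-osc t))

  no-real : ∀ {c} → (∀ {L} → 𝔽.IsLine L → 𝔽.Contains c L → ¬ 𝔽.RealAxis L) → 𝔽.realAxesIn c ≡ 0
  no-real {c} h = ∑-zero lines λ L m → 𝟙*-zero (Contains? c L) λ cL → 𝟙-no (𝔽.RealAxis? L) (h {L} (sound linesᴱ m) cL)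

  no-axes : ∀ {c} → (∀ {L s} → 𝔽.IsLine L → 𝔽.Contains c L → ¬ Axis s L) → axesIn c ≡ 0
  no-axes {c} h = ∑-zero lines λ L m → 𝟙*-zero (Contains? c L) λ cL → 𝟙-no (Axes.Some? L) (λ (s , ax) → h {L} (sound linesᴱ m) cL ax)

  -- In order, the numbers of points of the cubic, real axes, imaginary axes and imaginary chords in
  -- the plane. They determine both Λ through the two equations that follow.
  record PlaneNumbers (c : 𝔽.Vec4) (d r i j : ℕ) : Set where
    field
      not-osculating : ¬ 𝔽.Osculating c
      root-count     : roots c ≡ d
      real           : 𝔽.realAxesIn c ≡ r
      imaginary      : axesIn c ≡ i
      chords         : chordsIn c ≡ j

  eGamma-equation : ∀ {c d r i j} → 𝔽.Normalized c → PlaneNumbers c d r i j → linesIn EΓ c + 2 * r + d ≡ suc (suc u)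
  eGamma-equation {c} n N = subst₂ (λ r d → linesIn EΓ c + 2 * r + d ≡ suc (suc u)) real root-count (𝔽.eGamma-in-plane {c} n not-osculating)
    where open PlaneNumbers N

  -- The external lines in `c` are known from d alone, and all classes but the last have been
  -- counted.
  enGamma-equation : ∀ {c d r i j} → PlaneNumbers c d r i j → 𝔽.externals c ≡ linesIn EΓ c + r + j + i + linesIn EnΓ c
  enGamma-equation {c} N = trans (weighted-classes (λ L → 𝟙 (Contains? c L)))
    (cong (_+ linesIn EnΓ c) (cong₂ _+_ (cong₂ (λ r j → linesIn EΓ c + r + j) real chords) imaginary))
    where open PlaneNumbers N

  module _ {c : 𝔽.Vec4} (n : 𝔽.Normalized c) where
    private
      no-chords : roots c ≢ 1 → chordsIn c ≡ 0
      no-chords h = trans (chordsIn-value {c} n) (𝟙-no (OneBar? c) (λ (_ , p) → h p))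

      one-chord : OneBar c → chordsIn c ≡ 1
      one-chord h = trans (chordsIn-value {c} n) (𝟙-yes (OneBar? c) h)

      real-by-axes : Good c → axesIn c ≡ 0 → 𝔽.realAxesIn c ≡ 1
      real-by-axes g z = trans (sym (ℕₚ.+-identityʳ _)) (trans (cong (𝔽.realAxesIn c +_) (sym z)) (axesIn-value {c} n g))

      axes-by-real : Good c → 𝔽.realAxesIn c ≡ 0 → axesIn c ≡ 1
      axes-by-real g z = trans (cong (_+ axesIn c) (sym z)) (axesIn-value {c} n g)

    -- The index is q modulo 3. For this residue an imaginary axis would force d = 1, so the one
    -- axis in `c` is real.
    numbers₁-split : q % 3 ≡ 1 → ∀ {d} → roots c ≡ d → d ≢ 1 → d ≢ 2 → PlaneNumbers c d 1 0 0
    numbers₁-split hq {d} refl h₁ h₂ = record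
      { not-osculating = few⇒¬Osculating {c} h₁ ; root-count = refl ; real = real-by-axes (few⇒¬Osculating {c} h₁ , h₂) none ; imaginary = none ; chords = no-chords h₁ }
      where
      none : axesIn c ≡ 0
      none = no-axes {c} λ {L} l cL ax → h₁ (imaginary-one-root {c} n (few⇒¬Osculating {c} h₁) {L} l cL hq ax)

    numbers₁-one : q % 3 ≡ 1 → OneBar c → PlaneNumbers c 1 0 1 1
    numbers₁-one hq ob@(o , h) = record
      { not-osculating = o ; root-count = h ; real = none ; imaginary = axes-by-real (o , λ p → ℕₚ.1+n≢0 (ℕₚ.suc-injective (trans (sym p) h))) none ; chords = one-chord ob }
      where
      none : 𝔽.realAxesIn c ≡ 0
      none = no-real {c} λ {L} l cL ra → proj₁ (real-few-roots {c} n o {L} l cL hq ra) h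

    -- The two kinds of axis have changed roles: now a real axis would force d = 1.
    numbers₂-split : q % 3 ≡ 2 → ∀ {d} → roots c ≡ d → d ≢ 1 → d ≢ 2 → PlaneNumbers c d 0 1 0
    numbers₂-split hq {d} refl h₁ h₂ = record
      { not-osculating = few⇒¬Osculating {c} h₁ ; root-count = refl ; real = none ; imaginary = axes-by-real (few⇒¬Osculating {c} h₁ , h₂) none ; chords = no-chords h₁ }
      where
      none : 𝔽.realAxesIn c ≡ 0
      none = no-real {c} λ {L} l cL ra → h₁ (real-one-root {c} n (few⇒¬Osculating {c} h₁) {L} l cL hq ra)

    numbers₂-one : q % 3 ≡ 2 → OneBar c → PlaneNumbers c 1 1 0 1
    numbers₂-one hq ob@(o , h) = record
      { not-osculating = o ; root-count = h ; real = real-by-axes (o , λ p → ℕₚ.1+n≢0 (ℕₚ.suc-injective (trans (sym p) h))) none ; imaginary = none ; chords = one-chord ob }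
      where
      none : axesIn c ≡ 0
      none = no-axes {c} λ {L} l cL ax → proj₁ (imaginary-few-roots {c} n o {L} l cL hq ax) h

  private
    3≢1 : 3 ≢ 1
    3≢1 ()
    3≢2 : 3 ≢ 2
    3≢2 ()
    0≢₁ : 0 ≢ 1
    0≢₁ ()
    0≢₂ : 0 ≢ 2
    0≢₂ ()

    at-q : ∀ (f : ℕ → ℕ) {x} → x ≡ f (suc u) → x ≡ f q
    at-q f h = trans h (cong f (sym q≡))

    nz : ∀ {c} → 𝔽.Normalized c → c ≢ 𝔽.𝟎
    nz {c} n = 𝔽.normalized-≢𝟎 {c} n

    -- In these names the first index is q modulo 3 and the second is d; `g` is the number of
    -- EΓ-lines in the plane and `n` that of EnΓ-lines. Expressing `u` through `g` where possible
    -- makes the truncated differences exact.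
    eΓ₁₃ : ∀ u g → g + 2 * 1 + 3 ≡ suc (suc u) → g + 3 ≡ u
    eΓ₁₃ u g h = ℕₚ.suc-injective (ℕₚ.suc-injective (trans (solveℕ 1 (λ g → conℕ 2 :⊕ (g :⊕ conℕ 3) :≡ g :⊕ conℕ 2 :⊕ conℕ 3) refl g) h))

    enΓ₁₃ : ∀ u g n → g + 3 ≡ u → u * u ≡ g + 1 + 0 + 0 + n → n ≡ suc u * suc u ∸ 3 * suc u + 4
    enΓ₁₃ _ g n refl h = trans (ℕₚ.+-cancelˡ-≡ (g + 1) _ _ (trans
        (trans (solveℕ 2 (λ g n → (g :⊕ conℕ 1) :⊕ n :≡ g :⊕ conℕ 1 :⊕ conℕ 0 :⊕ conℕ 0 :⊕ n) refl g n) (sym h))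
        (solveℕ 1 (λ g → (g :⊕ conℕ 3) :⊗ (g :⊕ conℕ 3) :≡ (g :⊕ conℕ 1) :⊕ ((conℕ 1 :⊕ (g :⊕ conℕ 3)) :⊗ (g :⊕ conℕ 1) :⊕ conℕ 4)) refl g)))
      -- With q = g + 4 the difference q² - 3q is q(g + 1).
      (cong (_+ 4) (minus {suc (g + 3) * (g + 1)} (3 * suc (g + 3))
        (solveℕ 1 (λ g → let q = conℕ 1 :⊕ (g :⊕ conℕ 3) in q :⊗ (g :⊕ conℕ 1) :⊕ conℕ 3 :⊗ q :≡ q :⊗ q) refl g)))

    eΓ₁₁ : ∀ u g → g + 2 * 0 + 1 ≡ suc (suc u) → g ≡ suc u
    eΓ₁₁ u g h = ℕₚ.suc-injective (trans (solveℕ 1 (λ g → conℕ 1 :⊕ g :≡ g :⊕ conℕ 0 :⊕ conℕ 1) refl g) h)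

    enΓ₁₁ : ∀ u g n → g ≡ suc u → suc u * suc u ≡ g + 0 + 1 + 1 + n → n ≡ suc u * suc u ∸ suc u ∸ 2
    enΓ₁₁ u _ n refl h = trans (minus (suc u + 2) (trans
        (solveℕ 2 (λ q n → n :⊕ (q :⊕ conℕ 2) :≡ q :⊕ conℕ 0 :⊕ conℕ 1 :⊕ conℕ 1 :⊕ n) refl (suc u) n) (sym h)))
      (sym (ℕₚ.∸-+-assoc (suc u * suc u) (suc u) 2))

    eΓ₁₀ : ∀ u g → g + 2 * 1 + 0 ≡ suc (suc u) → g ≡ u
    eΓ₁₀ u g h = ℕₚ.suc-injective (ℕₚ.suc-injective (trans (solveℕ 1 (λ g → conℕ 2 :⊕ g :≡ g :⊕ conℕ 2 :⊕ conℕ 0) refl g) h))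

    enΓ₁₀ : ∀ u g n → g ≡ u → suc u * suc u + suc u + 1 ≡ g + 1 + 0 + 0 + n → n ≡ suc u * suc u + 1
    enΓ₁₀ u _ n refl h = ℕₚ.+-cancelˡ-≡ (u + 1) _ _ (trans
      (trans (solveℕ 2 (λ g n → (g :⊕ conℕ 1) :⊕ n :≡ g :⊕ conℕ 1 :⊕ conℕ 0 :⊕ conℕ 0 :⊕ n) refl u n) (sym h))
      (solveℕ 1 (λ u → let q = conℕ 1 :⊕ u in q :⊗ q :⊕ q :⊕ conℕ 1 :≡ (u :⊕ conℕ 1) :⊕ (q :⊗ q :⊕ conℕ 1)) refl u))

    eΓ₂₃ : ∀ u g → g + 2 * 0 + 3 ≡ suc (suc u) → suc g ≡ u
    eΓ₂₃ u g h = ℕₚ.suc-injective (ℕₚ.suc-injective (trans (solveℕ 1 (λ g → conℕ 3 :⊕ g :≡ g :⊕ conℕ 0 :⊕ conℕ 3) refl g) h))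

    enΓ₂₃ : ∀ u g n → suc g ≡ u → u * u ≡ g + 0 + 0 + 1 + n → n ≡ (suc u ∸ 1) * (suc u ∸ 2)
    enΓ₂₃ _ g n refl h = ℕₚ.+-cancelˡ-≡ (g + 1) _ _ (trans
      (trans (solveℕ 2 (λ g n → (g :⊕ conℕ 1) :⊕ n :≡ g :⊕ conℕ 0 :⊕ conℕ 0 :⊕ conℕ 1 :⊕ n) refl g n) (sym h))
      (solveℕ 1 (λ g → (conℕ 1 :⊕ g) :⊗ (conℕ 1 :⊕ g) :≡ (g :⊕ conℕ 1) :⊕ (conℕ 1 :⊕ g) :⊗ g) refl g))

    eΓ₂₁ : ∀ u g → g + 2 * 1 + 1 ≡ suc (suc u) → suc g ≡ u
    eΓ₂₁ u g h = ℕₚ.suc-injective (ℕₚ.suc-injective (trans (solveℕ 1 (λ g → conℕ 3 :⊕ g :≡ g :⊕ conℕ 2 :⊕ conℕ 1) refl g) h))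

    enΓ₂₁ : ∀ u g n → suc g ≡ u → suc u * suc u ≡ g + 1 + 1 + 0 + n → n ≡ suc u * suc u ∸ suc u
    enΓ₂₁ _ g n refl h = minus (suc (suc g)) (trans
      (solveℕ 2 (λ g n → n :⊕ (conℕ 2 :⊕ g) :≡ g :⊕ conℕ 1 :⊕ conℕ 1 :⊕ conℕ 0 :⊕ n) refl g n) (sym h))

    eΓ₂₀ : ∀ u g → g + 2 * 0 + 0 ≡ suc (suc u) → g ≡ suc u + 1
    eΓ₂₀ u g h = trans (solveℕ 1 (λ g → g :≡ g :⊕ conℕ 0 :⊕ conℕ 0) refl g) (trans h (ℕₚ.+-comm 1 (suc u)))

    enΓ₂₀ : ∀ u g n → g ≡ suc u + 1 → suc u * suc u + suc u + 1 ≡ g + 0 + 0 + 1 + n → n ≡ suc u * suc u ∸ 1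
    enΓ₂₀ u _ n refl h = minus 1 (ℕₚ.+-cancelʳ-≡ (suc u + 1) (n + 1) (suc u * suc u) (trans
      (trans (solveℕ 2 (λ q n → n :⊕ conℕ 1 :⊕ (q :⊕ conℕ 1) :≡ (q :⊕ conℕ 1) :⊕ conℕ 0 :⊕ conℕ 0 :⊕ conℕ 1 :⊕ n) refl (suc u) n) (sym h))
      (ℕₚ.+-assoc (suc u * suc u) (suc u) 1)))

  module One (hq : q % 3 ≡ 1) where
    eΓ-3 : Λ-Value EΓ threeC (q ∸ 4)
    eΓ-3 c n t = at-q (_∸ 4) (minus 3 (eΓ₁₃ u _ (eGamma-equation {c} n (numbers₁-split {c} n hq t 3≢1 3≢2))))

    eΓ-1 : Λ-Value EΓ oneBarC q
    eΓ-1 c n t = at-q id (eΓ₁₁ u _ (eGamma-equation {c} n (numbers₁-one {c} n hq t)))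

    eΓ-0 : Λ-Value EΓ zeroC (q ∸ 1)
    eΓ-0 c n t = at-q (_∸ 1) (eΓ₁₀ u _ (eGamma-equation {c} n (numbers₁-split {c} n hq t 0≢₁ 0≢₂)))

    enΓ-3 : Λ-Value EnΓ threeC (q * q ∸ 3 * q + 4)
    enΓ-3 c n t = let N = numbers₁-split {c} n hq t 3≢1 3≢2 in at-q (λ q → q * q ∸ 3 * q + 4)
      (enΓ₁₃ u _ _ (eΓ₁₃ u _ (eGamma-equation {c} n N)) (trans (sym (𝔽.externals₃ {c} (nz {c} n) t)) (enGamma-equation {c} N)))

    enΓ-1 : Λ-Value EnΓ oneBarC (q * q ∸ q ∸ 2)
    enΓ-1 c n t = let N = numbers₁-one {c} n hq t in at-q (λ q → q * q ∸ q ∸ 2)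
      (enΓ₁₁ u _ _ (eΓ₁₁ u _ (eGamma-equation {c} n N)) (trans (sym (𝔽.externals₁ {c} (nz {c} n) (proj₂ t))) (enGamma-equation {c} N)))

    enΓ-0 : Λ-Value EnΓ zeroC (q * q + 1)
    enΓ-0 c n t = let N = numbers₁-split {c} n hq t 0≢₁ 0≢₂ in at-q (λ q → q * q + 1)
      (enΓ₁₀ u _ _ (eΓ₁₀ u _ (eGamma-equation {c} n N)) (trans (sym (𝔽.externals₀ {c} (nz {c} n) t)) (enGamma-equation {c} N)))

  module Two (hq : q % 3 ≡ 2) where
    eΓ-3 : Λ-Value EΓ threeC (q ∸ 2)
    eΓ-3 c n t = at-q (_∸ 2) (cong (_∸ 1) (eΓ₂₃ u _ (eGamma-equation {c} n (numbers₂-split {c} n hq t 3≢1 3≢2))))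

    eΓ-1 : Λ-Value EΓ oneBarC (q ∸ 2)
    eΓ-1 c n t = at-q (_∸ 2) (cong (_∸ 1) (eΓ₂₁ u _ (eGamma-equation {c} n (numbers₂-one {c} n hq t))))

    eΓ-0 : Λ-Value EΓ zeroC (q + 1)
    eΓ-0 c n t = at-q (_+ 1) (eΓ₂₀ u _ (eGamma-equation {c} n (numbers₂-split {c} n hq t 0≢₁ 0≢₂)))

    enΓ-3 : Λ-Value EnΓ threeC ((q ∸ 1) * (q ∸ 2))
    enΓ-3 c n t = let N = numbers₂-split {c} n hq t 3≢1 3≢2 in at-q (λ q → (q ∸ 1) * (q ∸ 2))
      (enΓ₂₃ u _ _ (eΓ₂₃ u _ (eGamma-equation {c} n N)) (trans (sym (𝔽.externals₃ {c} (nz {c} n) t)) (enGamma-equation {c} N)))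

    enΓ-1 : Λ-Value EnΓ oneBarC (q * q ∸ q)
    enΓ-1 c n t = let N = numbers₂-one {c} n hq t in at-q (λ q → q * q ∸ q)
      (enΓ₂₁ u _ _ (eΓ₂₁ u _ (eGamma-equation {c} n N)) (trans (sym (𝔽.externals₁ {c} (nz {c} n) (proj₂ t))) (enGamma-equation {c} N)))

    enΓ-0 : Λ-Value EnΓ zeroC (q * q ∸ 1)
    enΓ-0 c n t = let N = numbers₂-split {c} n hq t 0≢₁ 0≢₂ in at-q (λ q → q * q ∸ 1)
      (enΓ₂₀ u _ _ (eΓ₂₀ u _ (eGamma-equation {c} n N)) (trans (sym (𝔽.externals₀ {c} (nz {c} n) t)) (enGamma-equation {c} N)))

  -- For q ≡ 2 modulo 3 the number of EnΓ-lines in a plane is itself a multiple of q - 1, which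
  -- cancels against the same factor in their total.
  average-cancel : ∀ π {n} num d → Λ-Value EnΓ π n → n ≡ num * u → d ≢ 0 → d * planeCount π ≡ groupOrder → PiIs π EnΓ (frac num d)
  average-cancel π {n} num d h hn hd ratio = average-planes EnΓ π num d h enGamma≢0 hd (begin
    planeCount π * n * d
      ≡⟨ cong (λ n → planeCount π * n * d) hn ⟩
    planeCount π * (num * u) * d
      ≡⟨ solveℕ 4 (λ p n u d → p :⊗ (n :⊗ u) :⊗ d :≡ n :⊗ (d :⊗ p :⊗ u)) refl (planeCount π) num u d ⟩
    num * (d * planeCount π * u)
      ≡⟨ cong (num *_) (trans (cong (_* u) ratio) (sym enGamma-value)) ⟩
    num * lineCount EnΓ ∎)
    where open ≡-Reasoning

  ratioᴱ : ∀ π d → d * planeCount π ≡ groupOrder → d * planeCount π ≡ lineCount EΓ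
  ratioᴱ π d h = trans h (sym eGamma-value)

  ratioᴱⁿ : ∀ π d → d * planeCount π ≡ groupOrder → d * (q ∸ 1) * planeCount π ≡ lineCount EnΓ
  ratioᴱⁿ π d h = begin
    d * (q ∸ 1) * planeCount π ≡⟨ cong (λ n → d * (n ∸ 1) * planeCount π) q≡ ⟩
    d * u * planeCount π ≡⟨ solveℕ 3 (λ d u p → d :⊗ u :⊗ p :≡ d :⊗ p :⊗ u) refl d u (planeCount π) ⟩
    d * planeCount π * u ≡⟨ trans (cong (_* u) h) (sym enGamma-value) ⟩
    lineCount EnΓ ∎
    where open ≡-Reasoning

  case-one : q % 3 ≡ 1 →
      LambdaIs EΓ threeC (q ∸ 4) × LambdaIs EΓ oneBarC q × LambdaIs EΓ zeroC (q ∸ 1)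
    × PiIs threeC EΓ (frac (q ∸ 4) 6) × PiIs oneBarC EΓ (frac q 2) × PiIs zeroC EΓ (frac (q ∸ 1) 3)
    × LambdaIs EnΓ threeC (q * q ∸ 3 * q + 4) × LambdaIs EnΓ oneBarC (q * q ∸ q ∸ 2) × LambdaIs EnΓ zeroC (q * q + 1)
    × PiIs threeC EnΓ (frac (q * q ∸ 3 * q + 4) (6 * (q ∸ 1))) × PiIs oneBarC EnΓ (frac (q * q ∸ q ∸ 2) (2 * (q ∸ 1)))
    × PiIs zeroC EnΓ (frac (q * q + 1) (3 * (q ∸ 1)))
  case-one hq =
      lambda EΓ threeC eΓ-3 , lambda EΓ oneBarC eΓ-1 , lambda EΓ zeroC eΓ-0
    , average-ratio EΓ threeC 6 eΓ-3 eGamma≢0 (ratioᴱ threeC 6 planes-3)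
    , average-ratio EΓ oneBarC 2 eΓ-1 eGamma≢0 (ratioᴱ oneBarC 2 planes-1)
    , average-ratio EΓ zeroC 3 eΓ-0 eGamma≢0 (ratioᴱ zeroC 3 planes-0)
    , lambda EnΓ threeC enΓ-3 , lambda EnΓ oneBarC enΓ-1 , lambda EnΓ zeroC enΓ-0
    , average-ratio EnΓ threeC (6 * (q ∸ 1)) enΓ-3 enGamma≢0 (ratioᴱⁿ threeC 6 planes-3)
    , average-ratio EnΓ oneBarC (2 * (q ∸ 1)) enΓ-1 enGamma≢0 (ratioᴱⁿ oneBarC 2 planes-1)
    , average-ratio EnΓ zeroC (3 * (q ∸ 1)) enΓ-0 enGamma≢0 (ratioᴱⁿ zeroC 3 planes-0)
    where open One hq

  case-two : q % 3 ≡ 2 →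
      LambdaIs EΓ threeC (q ∸ 2) × LambdaIs EΓ oneBarC (q ∸ 2) × LambdaIs EΓ zeroC (q + 1)
    × PiIs threeC EΓ (frac (q ∸ 2) 6) × PiIs oneBarC EΓ (frac (q ∸ 2) 2) × PiIs zeroC EΓ (frac (q + 1) 3)
    × LambdaIs EnΓ threeC ((q ∸ 1) * (q ∸ 2)) × LambdaIs EnΓ oneBarC (q * q ∸ q) × LambdaIs EnΓ zeroC (q * q ∸ 1)
    × PiIs threeC EnΓ (frac (q ∸ 2) 6) × PiIs oneBarC EnΓ (frac q 2) × PiIs zeroC EnΓ (frac (q + 1) 3)
  case-two hq =
      lambda EΓ threeC eΓ-3 , lambda EΓ oneBarC eΓ-1 , lambda EΓ zeroC eΓ-0
    , average-ratio EΓ threeC 6 eΓ-3 eGamma≢0 (ratioᴱ threeC 6 planes-3)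
    , average-ratio EΓ oneBarC 2 eΓ-1 eGamma≢0 (ratioᴱ oneBarC 2 planes-1)
    , average-ratio EΓ zeroC 3 eΓ-0 eGamma≢0 (ratioᴱ zeroC 3 planes-0)
    , lambda EnΓ threeC enΓ-3 , lambda EnΓ oneBarC enΓ-1 , lambda EnΓ zeroC enΓ-0
    , average-cancel threeC (q ∸ 2) 6 enΓ-3 (trans (ℕₚ.*-comm (q ∸ 1) (q ∸ 2)) (cong (λ n → (q ∸ 2) * (n ∸ 1)) q≡)) (λ ()) planes-3
    , average-cancel oneBarC q 2 enΓ-1 (trans (cong (λ n → n * n ∸ n) q≡) (trans (sym (minus (suc u)
        (solveℕ 1 (λ u → let q = conℕ 1 :⊕ u in q :⊗ u :⊕ q :≡ q :⊗ q) refl u))) (cong (_* u) (sym q≡)))) (λ ()) planes-1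
    , average-cancel zeroC (q + 1) 3 enΓ-0 (trans (cong (λ n → n * n ∸ 1) q≡) (trans (sym (minus 1
        (solveℕ 1 (λ u → let q = conℕ 1 :⊕ u in (q :⊕ conℕ 1) :⊗ u :⊕ conℕ 1 :≡ q :⊗ q) refl u))) (cong (λ n → (n + 1) * u) (sym q≡)))) (λ ()) planes-0
    where open Two hq

theorem5p10 : (F K : Field) (e : Embedding F K) →
    Field.size K ≡ Field.size F * Field.size F →
    5 ≤ Field.size F → Field.size F % 3 ≢ 0 →
    (Field.size F % 3 ≡ 1 →
    PG3.LambdaIs F K e EΓ threeC (Field.size F ∸ 4)
    × PG3.LambdaIs F K e EΓ oneBarC (Field.size F)
    × PG3.LambdaIs F K e EΓ zeroC (Field.size F ∸ 1)
    × PG3.PiIs F K e threeC EΓ (frac (Field.size F ∸ 4) 6)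
    × PG3.PiIs F K e oneBarC EΓ (frac (Field.size F) 2)
    × PG3.PiIs F K e zeroC EΓ (frac (Field.size F ∸ 1) 3)
    × PG3.LambdaIs F K e EnΓ threeC (Field.size F * Field.size F ∸ 3 * Field.size F + 4)
    × PG3.LambdaIs F K e EnΓ oneBarC (Field.size F * Field.size F ∸ Field.size F ∸ 2)
    × PG3.LambdaIs F K e EnΓ zeroC (Field.size F * Field.size F + 1)
    × PG3.PiIs F K e threeC EnΓ
    (frac (Field.size F * Field.size F ∸ 3 * Field.size F + 4) (6 * (Field.size F ∸ 1)))
    × PG3.PiIs F K e oneBarC EnΓ
    (frac (Field.size F * Field.size F ∸ Field.size F ∸ 2) (2 * (Field.size F ∸ 1)))
    × PG3.PiIs F K e zeroC EnΓ
    (frac (Field.size F * Field.size F + 1) (3 * (Field.size F ∸ 1))))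
    × (Field.size F % 3 ≡ 2 →
    PG3.LambdaIs F K e EΓ threeC (Field.size F ∸ 2)
    × PG3.LambdaIs F K e EΓ oneBarC (Field.size F ∸ 2)
    × PG3.LambdaIs F K e EΓ zeroC (Field.size F + 1)
    × PG3.PiIs F K e threeC EΓ (frac (Field.size F ∸ 2) 6)
    × PG3.PiIs F K e oneBarC EΓ (frac (Field.size F ∸ 2) 2)
    × PG3.PiIs F K e zeroC EΓ (frac (Field.size F + 1) 3)
    × PG3.LambdaIs F K e EnΓ threeC ((Field.size F ∸ 1) * (Field.size F ∸ 2))
    × PG3.LambdaIs F K e EnΓ oneBarC (Field.size F * Field.size F ∸ Field.size F)
    × PG3.LambdaIs F K e EnΓ zeroC (Field.size F * Field.size F ∸ 1)
    × PG3.PiIs F K e threeC EnΓ (frac (Field.size F ∸ 2) 6)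
    × PG3.PiIs F K e oneBarC EnΓ (frac (Field.size F) 2)
    × PG3.PiIs F K e zeroC EnΓ (frac (Field.size F + 1) 3))
theorem5p10 F K e size≡ _ q%3≢0 = case-one , case-two
  where open Incidences F K e size≡ q%3≢0
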